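{- Let $q$ be an odd prime power with $q \notin \{3,5,7,9,11,13,31,41\}$. Then for every $\alpha \in \mathbb{F}_{q^2}^*$ and every $\theta \in \mathbb{F}_{q^2}\setminus \mathbb{F}_q$ there exists $x \in \mathbb{F}_q$ such that $\alpha(\theta+x)$ is $2$-primitive. In particular, the least integer $L$ such that $\mathbb{F}_{q^2}/\mathbb{F}_q$ possesses the line property for $2$-primitive elements for every odd prime power $q > L$ is $L = 41$.
   Context: For a prime power $q$ and integers $n,r$ with $r \mid q^n-1$, an element of $\mathbb{F}_{q^n}^*$ is called $r$-primitive if its multiplicative order is $(q^n-1)/r$. The extension $\mathbb{F}_{q^n}/\mathbb{F}_q$ possesses the line property for $r$-primitive elements if for every $\alpha \in \mathbb{F}_{q^n}^*$ and every $\theta$ with $\mathbb{F}_{q^n} = \mathbb{F}_q(\theta)$, the set $\{\alpha(\theta+x) : x \in \mathbb{F}_q\}$ contains an $r$-primitive element. -}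

module Defs where

open import Data.Nat as ℕ using (ℕ; zero; suc; _<_; _≤_; _∸_; _%_)
open import Data.Nat.Primality using (Prime)
open import Data.Fin using (Fin)
open import Data.Product using (Σ; _×_; ∃; ∃-syntax)
open import Relation.Nullary using (¬_)
open import Relation.Binary.PropositionalEquality using (_≡_; _≢_)
open import Function.Bundles using (_↔_)
import Algebra.Structures as AS

IsPrimePower : ℕ → Set
IsPrimePower q = ∃[ p ] ∃[ k ] (Prime p × 1 ≤ k × q ≡ p ℕ.^ k)

IsOddPrimePower : ℕ → Set
IsOddPrimePower q = IsPrimePower q × q % 2 ≡ 1

record FiniteField (size : ℕ) : Set₁ where
  field
    Carrier : Set
    _+_ _*_ : Carrier → Carrier → Carrier
    -_      : Carrier → Carrier
    0# 1#   : Carrier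
    isCommutativeRing : AS.IsCommutativeRing {A = Carrier} _≡_ _+_ _*_ -_ 0# 1#
    0≢1     : 0# ≢ 1#
    inverse : ∀ x → x ≢ 0# → ∃[ y ] (x * y ≡ 1#)
    enum    : Carrier ↔ Fin size

  infixl 7 _*_
  infixl 6 _+_

  _^_ : Carrier → ℕ → Carrier
  a ^ zero  = 1#
  a ^ suc k = a * (a ^ k)

  HasOrder : Carrier → ℕ → Set
  HasOrder a k = 0 < k × a ^ k ≡ 1# × (∀ j → 0 < j → j < k → a ^ j ≢ 1#)

record QuadExt (q : ℕ) : Set₁ where
  field
    F  : FiniteField (q ℕ.* q)
    K  : FiniteField q
  open FiniteField F public
  private module K = FiniteField K
  field
    ι   : K.Carrier → Carrier
    ι-+ : ∀ x y → ι (x K.+ y) ≡ ι x + ι y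
    ι-* : ∀ x y → ι (x K.* y) ≡ ι x * ι y
    ι-1 : ι K.1# ≡ 1#

  Kcar : Set
  Kcar = K.Carrier

  TwoPrimitive : Carrier → Set
  TwoPrimitive a = a ≢ 0# × HasOrder a ((q ℕ.* q ∸ 1) ℕ./ 2)

  -- θ lies in F_{q^2} \ F_q  (equivalently, F_{q^2} = F_q(θ), since the degree is 2)
  NotInBase : Carrier → Set
  NotInBase θ = ∀ x → ι x ≢ θ

LineProperty2 : ∀ {q} → QuadExt q → Set
LineProperty2 E = ∀ α θ → α ≢ 0# → NotInBase θ → ∃[ x ] TwoPrimitive (α * (θ + ι x))
  where open QuadExt E

-- F_{q^2}/F_q has the line property for 2-primitive elements
-- (stated for every model of the extension; all models are isomorphic)
HasLineProperty2 : ℕ → Set₁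
HasLineProperty2 q = (E : QuadExt q) → LineProperty2 E

-- Let N = q² − 1, fix a generator of F_{q²}^*, and let T ⊆ ℤ/N be the set of logarithms of the q points of the
-- line α(θ + F_q). A point is 2-primitive as soon as its logarithm t satisfies t ≡ 2 (mod 4) and l ∤ t for every odd
-- prime l ∣ N. If w ∉ F_q then w(θ + y) = θ + x has exactly one solution, so T is a relative difference set with
-- forbidden subgroup (q + 1)ℤ/N. Grouping characters by their order, this bounds every sum over T of a product of
-- Ramanujan sums of degree φ by φ √q, using integers only: such a product is a convolution idempotent, and
-- Cauchy–Schwarz applies. (For characters trivial on F_q^* the bound is φ, since T is injective modulo q + 1.)
-- A sieve over the prime divisors of N then settles q ≥ 37249; below that its integer criteria are evaluated for each
-- q, using also that T is at most two-to-one modulo q − 1. For the 42 prime powers left over, q ∉ {3, …, 41}, let γ be a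
-- root of X² − tr X − c. Every line not through 0 is β(γ + F_q), so the logarithms of one line, obtained from a linear
-- recurrence, are shifted by all residues and searched. For q = 41 the line 3(θ + F₄₁) with θ² = 3 contains no
-- element of order 840.

module Submission where

-- The theorem speaks of every model of the extension, while character values and √q are not
-- integers; both facts shape the proof. A Ramanujan sum is an integer that already collects all
-- characters of one order, and the bound φ√q for such a group is what the triangle inequality would
-- give for its φ members, so grouping costs nothing. √q itself enters only through pairs of
-- integers with s²q ≤ R². No isomorphism between models is built: computations for a particular q
-- are made with codes of elements, and what is used is that codes evaluate compatibly with sums and
-- products in whichever model is given. Refuting the property at q = 41, by contrast, takes a
-- single model. The sieve knows odd primes below 29 individually and larger ones only by their
-- number t. This leaves 2⁸ sets D of small primes, and t is controlled by 4·∏D·29^t ≤ N. The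
-- threshold for q is 37249 = 193²: the requirement on √q is checked either against 193 or against
-- the fourth root of 4·∏D·29^t.

open import Defs

-- Finite integer sums, periodic functions and indicators of divisibility

module IntegerSums where

  open import Data.Nat as ℕ using (ℕ; zero; suc; s≤s; z≤n; NonZero)
  import Data.Nat.Properties as ℕP
  open import Data.Nat.Divisibility using (_∣_; _∣?_; divides; ∣m+n∣m⇒∣n; ∣m∣n⇒∣m+n; >⇒∤; _∣0)
  open import Data.Integer hiding (suc; NonZero)
  open import Data.Integer.Properties
  open import Data.Integer.Tactic.RingSolver using (solve-∀)
  open import Data.Product using (_×_; _,_; ∃-syntax)
  open import Data.Sum using (_⊎_; inj₁; inj₂)
  open import Data.Empty using (⊥-elim)
  open import Function using (_∘_)
  open import Relation.Nullary using (¬_; Dec; yes; no)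
  open import Relation.Binary.PropositionalEquality

  ∑ : ℕ → (ℕ → ℤ) → ℤ
  ∑ zero    f = 0ℤ
  ∑ (suc n) f = ∑ n f + f n

  ∑-cong< : ∀ n {f g : ℕ → ℤ} → (∀ i → i ℕ.< n → f i ≡ g i) → ∑ n f ≡ ∑ n g
  ∑-cong< zero    e = refl
  ∑-cong< (suc n) e = cong₂ _+_ (∑-cong< n λ i p → e i (ℕP.m≤n⇒m≤1+n p)) (e n ℕP.≤-refl)

  ∑-cong : ∀ n {f g : ℕ → ℤ} → (∀ i → f i ≡ g i) → ∑ n f ≡ ∑ n g
  ∑-cong n e = ∑-cong< n λ i _ → e i

  ∑-const : ∀ n c → ∑ n (λ _ → c) ≡ + n * c
  ∑-const zero    c = sym (*-zeroˡ c)
  ∑-const (suc n) c = begin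
    ∑ n (λ _ → c) + c ≡⟨ cong (_+ c) (∑-const n c) ⟩
    + n * c + c       ≡⟨ (λ a b → lem a b) (+ n) c ⟩
    (1ℤ + + n) * c    ∎
    where open ≡-Reasoning
          lem : ∀ a b → a * b + b ≡ (1ℤ + a) * b
          lem = solve-∀

  ∑-0 : ∀ n → ∑ n (λ _ → 0ℤ) ≡ 0ℤ
  ∑-0 n = trans (∑-const n 0ℤ) (*-zeroʳ (+ n))

  ∑-+ : ∀ n (f g : ℕ → ℤ) → ∑ n (λ i → f i + g i) ≡ ∑ n f + ∑ n g
  ∑-+ zero    f g = refl
  ∑-+ (suc n) f g rewrite ∑-+ n f g = lem (∑ n f) (∑ n g) (f n) (g n)
    where lem : ∀ a b c d → a + b + (c + d) ≡ a + c + (b + d)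
          lem = solve-∀

  ∑-*ˡ : ∀ n c (f : ℕ → ℤ) → ∑ n (λ i → c * f i) ≡ c * ∑ n f
  ∑-*ˡ zero    c f = sym (*-zeroʳ c)
  ∑-*ˡ (suc n) c f rewrite ∑-*ˡ n c f = sym (*-distribˡ-+ c (∑ n f) (f n))

  ∑-*ʳ : ∀ n c (f : ℕ → ℤ) → ∑ n (λ i → f i * c) ≡ ∑ n f * c
  ∑-*ʳ n c f = trans (∑-cong n λ i → *-comm (f i) c) (trans (∑-*ˡ n c f) (*-comm c (∑ n f)))

  ∑-- : ∀ n (f g : ℕ → ℤ) → ∑ n (λ i → f i - g i) ≡ ∑ n f - ∑ n g
  ∑-- zero    f g = refl
  ∑-- (suc n) f g rewrite ∑-- n f g = lem (∑ n f) (∑ n g) (f n) (g n)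
    where lem : ∀ a b c d → (a - b) + (c - d) ≡ (a + c) - (b + d)
          lem = solve-∀

  ∑-swap : ∀ m n (f : ℕ → ℕ → ℤ) → ∑ m (λ i → ∑ n (f i)) ≡ ∑ n (λ j → ∑ m (λ i → f i j))
  ∑-swap zero    n f = sym (∑-0 n)
  ∑-swap (suc m) n f rewrite ∑-swap m n f = sym (∑-+ n (λ j → ∑ m (λ i → f i j)) (f m))

  ∑-mono : ∀ n {f g : ℕ → ℤ} → (∀ i → i ℕ.< n → f i ≤ g i) → ∑ n f ≤ ∑ n g
  ∑-mono zero    e = ≤-refl
  ∑-mono (suc n) e = +-mono-≤ (∑-mono n λ i p → e i (ℕP.m≤n⇒m≤1+n p)) (e n ℕP.≤-refl)

  ∑-nonneg : ∀ n {f : ℕ → ℤ} → (∀ i → i ℕ.< n → 0ℤ ≤ f i) → 0ℤ ≤ ∑ n f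
  ∑-nonneg n {f} e = subst (_≤ ∑ n f) (∑-0 n) (∑-mono n e)

  ∑-suc : ∀ n f → ∑ (suc n) f ≡ f 0 + ∑ n (f ∘ suc)
  ∑-suc zero    f = trans (+-identityˡ (f 0)) (sym (+-identityʳ (f 0)))
  ∑-suc (suc n) f rewrite ∑-suc n f = +-assoc (f 0) (∑ n (f ∘ suc)) (f (suc n))

  ∑-split : ∀ m n f → ∑ (m ℕ.+ n) f ≡ ∑ m f + ∑ n (λ i → f (m ℕ.+ i))
  ∑-split m zero    f rewrite ℕP.+-identityʳ m = sym (+-identityʳ (∑ m f))
  ∑-split m (suc n) f rewrite ℕP.+-suc m n | ∑-split m n f =
    +-assoc (∑ m f) (∑ n (λ i → f (m ℕ.+ i))) (f (m ℕ.+ n))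

  Periodic : ℕ → (ℕ → ℤ) → Set
  Periodic p f = ∀ b → f (b ℕ.+ p) ≡ f b

  periodic-* : ∀ {p f} k → Periodic p f → ∀ b → f (b ℕ.+ k ℕ.* p) ≡ f b
  periodic-* {p} {f} zero    per b = cong f (ℕP.+-identityʳ b)
  periodic-* {p} {f} (suc k) per b = trans
    (cong f (trans (cong (b ℕ.+_) (ℕP.+-comm p (k ℕ.* p))) (sym (ℕP.+-assoc b (k ℕ.* p) p))))
    (trans (per (b ℕ.+ k ℕ.* p)) (periodic-* k per b))

  periodic-∣ : ∀ {p n f} → p ∣ n → Periodic p f → Periodic n f
  periodic-∣ (divides k refl) per = periodic-* k per

  periodic-shift : ∀ {p f} a → Periodic p f → Periodic p (λ b → f (b ℕ.+ a))
  periodic-shift {p} {f} a per b = trans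
    (cong f (trans (ℕP.+-assoc b p a) (trans (cong (b ℕ.+_) (ℕP.+-comm p a)) (sym (ℕP.+-assoc b a p)))))
    (per (b ℕ.+ a))

  periodic-product : ∀ {p f g} → Periodic p f → Periodic p g → Periodic p (λ b → f b * g b)
  periodic-product perf perg b = cong₂ _*_ (perf b) (perg b)

  ∑-shift₁ : ∀ n {f} → Periodic n f → ∑ n (f ∘ suc) ≡ ∑ n f
  ∑-shift₁ n {f} per = begin
    ∑ n (f ∘ suc)                     ≡⟨ lem (f 0) (∑ n (f ∘ suc)) ⟩
    (f 0 + ∑ n (f ∘ suc)) - f 0       ≡⟨ cong (_- f 0) (sym (∑-suc n f)) ⟩
    (∑ n f + f n) - f 0               ≡⟨ cong (λ z → (∑ n f + z) - f 0) (per 0) ⟩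
    (∑ n f + f 0) - f 0               ≡⟨ lem′ (f 0) (∑ n f) ⟩
    ∑ n f                             ∎
    where open ≡-Reasoning
          lem : ∀ a b → b ≡ (a + b) - a
          lem = solve-∀
          lem′ : ∀ a b → (b + a) - a ≡ b
          lem′ = solve-∀

  ∑-shift : ∀ n {f} → Periodic n f → ∀ a → ∑ n (λ b → f (b ℕ.+ a)) ≡ ∑ n f
  ∑-shift n {f} per zero    = ∑-cong n λ b → cong f (ℕP.+-identityʳ b)
  ∑-shift n {f} per (suc a) = trans (∑-cong n λ b → cong f (ℕP.+-suc b a))
    (trans (∑-shift₁ n (periodic-shift a per)) (∑-shift n per a))

  ∑-blocks : ∀ k d {f} → Periodic d f → ∑ (k ℕ.* d) f ≡ + k * ∑ d f
  ∑-blocks zero    d {f} per = sym (*-zeroˡ (∑ d f))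
  ∑-blocks (suc k) d {f} per = begin
    ∑ (d ℕ.+ k ℕ.* d) f                              ≡⟨ ∑-split d (k ℕ.* d) f ⟩
    ∑ d f + ∑ (k ℕ.* d) (λ i → f (d ℕ.+ i))
      ≡⟨ cong (λ z → ∑ d f + z) (∑-cong (k ℕ.* d) λ i → trans (cong f (ℕP.+-comm d i)) (per i)) ⟩
    ∑ d f + ∑ (k ℕ.* d) f                            ≡⟨ cong (λ z → ∑ d f + z) (∑-blocks k d per) ⟩
    ∑ d f + + k * ∑ d f                              ≡⟨ lem (∑ d f) (+ k) ⟩
    (1ℤ + + k) * ∑ d f                               ∎
    where open ≡-Reasoning
          lem : ∀ a b → a + b * a ≡ (1ℤ + b) * a
          lem = solve-∀

  ∑-product : ∀ m n (f g : ℕ → ℤ) → ∑ m (λ i → ∑ n (λ j → f i * g j)) ≡ ∑ m f * ∑ n g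
  ∑-product m n f g = trans (∑-cong m λ i → ∑-*ˡ n (f i) g) (∑-*ʳ m (∑ n g) f)

  square-nonneg : ∀ a → 0ℤ ≤ a * a
  square-nonneg (+ n)     = subst (0ℤ ≤_) (pos-* n n) (+≤+ z≤n)
  square-nonneg (-[1+ n ]) = +≤+ z≤n

  -- Twice the difference of the two sides is Σᵢⱼ (fᵢgⱼ − gᵢfⱼ)².
  cauchy-schwarz : ∀ n (f g : ℕ → ℤ) → ∑ n (λ i → f i * g i) * ∑ n (λ i → f i * g i)
                           ≤ ∑ n (λ i → f i * f i) * ∑ n (λ i → g i * g i)
  cauchy-schwarz n f g = 0≤i-j⇒j≤i {∑ n ff * ∑ n gg} {∑ n fg * ∑ n fg} (*-cancelˡ-≤-pos 0ℤ (∑ n ff * ∑ n gg - ∑ n fg * ∑ n fg) (+ 2) (begin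
    0ℤ                                      ≤⟨ ∑-nonneg n {λ i → ∑ n (sq i)} (λ i _ → ∑-nonneg n {sq i} λ j _ → square-nonneg (d i j)) ⟩
    ∑ n (λ i → ∑ n (sq i))                  ≡⟨ ∑-cong n (λ i → ∑-cong n λ j → expand (f i) (g i) (f j) (g j)) ⟩
    ∑ n (λ i → ∑ n λ j → s i j - t i j)     ≡⟨ ∑-cong n (λ i → ∑-- n (s i) (t i)) ⟩
    ∑ n (λ i → ∑ n (s i) - ∑ n (t i))       ≡⟨ ∑-- n (λ i → ∑ n (s i)) (λ i → ∑ n (t i)) ⟩
    ∑ n (λ i → ∑ n (s i)) - ∑ n (λ i → ∑ n (t i)) ≡⟨ cong₂ _-_ ∑s ∑t ⟩
    (∑ n ff * ∑ n gg + ∑ n gg * ∑ n ff) - + 2 * (∑ n fg * ∑ n fg) ≡⟨ collect (∑ n ff) (∑ n gg) (∑ n fg) ⟩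
    + 2 * (∑ n ff * ∑ n gg - ∑ n fg * ∑ n fg) ∎))
    where
    open ≤-Reasoning
    d sq s t : ℕ → ℕ → ℤ
    ff gg fg : ℕ → ℤ
    ff i = f i * f i
    gg i = g i * g i
    fg i = f i * g i
    d i j = f i * g j - g i * f j
    sq i j = d i j * d i j
    s i j = ff i * gg j + gg i * ff j
    t i j = + 2 * (fg i * fg j)
    ∑s : ∑ n (λ i → ∑ n (s i)) ≡ ∑ n ff * ∑ n gg + ∑ n gg * ∑ n ff
    ∑s = trans (∑-cong n λ i → ∑-+ n (λ j → ff i * gg j) (λ j → gg i * ff j))
        (trans (∑-+ n (λ i → ∑ n λ j → ff i * gg j) (λ i → ∑ n λ j → gg i * ff j))
               (cong₂ _+_ (∑-product n n ff gg) (∑-product n n gg ff)))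
    ∑t : ∑ n (λ i → ∑ n (t i)) ≡ + 2 * (∑ n fg * ∑ n fg)
    ∑t = trans (∑-cong n λ i → ∑-*ˡ n (+ 2) (λ j → fg i * fg j))
        (trans (∑-*ˡ n (+ 2) (λ i → ∑ n λ j → fg i * fg j)) (cong (+ 2 *_) (∑-product n n fg fg)))
    expand : ∀ a b c e → (a * e - b * c) * (a * e - b * c) ≡ (a * a * (e * e) + b * b * (c * c)) - + 2 * (a * b * (c * e))
    expand = solve-∀
    collect : ∀ a b c → (a * b + b * a) - + 2 * (c * c) ≡ + 2 * (a * b - c * c)
    collect = solve-∀

  ⟦_⟧ : {P : Set} → Dec P → ℤ
  ⟦ yes _ ⟧ = 1ℤ
  ⟦ no _ ⟧  = 0ℤ

  ⟦⟧-yes : {P : Set} (d : Dec P) → P → ⟦ d ⟧ ≡ 1ℤ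
  ⟦⟧-yes (yes _) p = refl
  ⟦⟧-yes (no ¬p) p = ⊥-elim (¬p p)

  ⟦⟧-no : {P : Set} (d : Dec P) → ¬ P → ⟦ d ⟧ ≡ 0ℤ
  ⟦⟧-no (yes p) ¬p = ⊥-elim (¬p p)
  ⟦⟧-no (no _)  ¬p = refl

  ⟦⟧-cong : {P Q : Set} (d : Dec P) (e : Dec Q) → (P → Q) → (Q → P) → ⟦ d ⟧ ≡ ⟦ e ⟧
  ⟦⟧-cong (yes p) e f g = sym (⟦⟧-yes e (f p))
  ⟦⟧-cong (no ¬p) e f g = sym (⟦⟧-no e (¬p ∘ g))

  ⟦⟧-≥0 : {P : Set} (d : Dec P) → 0ℤ ≤ ⟦ d ⟧
  ⟦⟧-≥0 (yes _) = +≤+ z≤n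
  ⟦⟧-≥0 (no _)  = +≤+ z≤n

  ⟦⟧-≤1 : {P : Set} (d : Dec P) → ⟦ d ⟧ ≤ 1ℤ
  ⟦⟧-≤1 (yes _) = ≤-refl
  ⟦⟧-≤1 (no _)  = +≤+ z≤n

  ⟦⟧≢0 : {P : Set} (d : Dec P) → ⟦ d ⟧ ≢ 0ℤ → P
  ⟦⟧≢0 (yes p) _ = p
  ⟦⟧≢0 (no _)  n = ⊥-elim (n refl)

  δ : ℕ → ℕ → ℤ
  δ i j = ⟦ i ℕ.≟ j ⟧

  ∑-zero : ∀ n {f : ℕ → ℤ} → (∀ i → i ℕ.< n → f i ≡ 0ℤ) → ∑ n f ≡ 0ℤ
  ∑-zero n e = trans (∑-cong< n e) (∑-0 n)

  ∑-δ : ∀ n a (h : ℕ → ℤ) → a ℕ.< n → ∑ n (λ s → δ s a * h s) ≡ h a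
  ∑-δ (suc n) a h a<1+n with n ℕ.≟ a
  ... | yes refl = begin
    ∑ n (λ s → δ s n * h s) + 1ℤ * h n
      ≡⟨ cong (_+ 1ℤ * h n) (∑-zero n λ i i<n → cong (_* h i) (⟦⟧-no (i ℕ.≟ n) (ℕP.<⇒≢ i<n))) ⟩
    0ℤ + 1ℤ * h n ≡⟨ trans (+-identityˡ _) (*-identityˡ _) ⟩
    h n ∎
    where open ≡-Reasoning
  ... | no n≢a = trans (+-identityʳ _) (∑-δ n a h (ℕP.≤∧≢⇒< (ℕP.≤-pred a<1+n) (n≢a ∘ sym)))

  ∑-nonzero : ∀ n f → ∑ n f ≢ 0ℤ → ∃[ i ] (i ℕ.< n × f i ≢ 0ℤ)
  ∑-nonzero zero    f ne = ⊥-elim (ne refl)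
  ∑-nonzero (suc n) f ne with f n ≟ 0ℤ
  ... | no fn≢0 = n , ℕP.≤-refl , fn≢0
  ... | yes fn≡0 with ∑-nonzero n f (λ e → ne (cong₂ _+_ e fn≡0))
  ...   | i , i<n , fi≢0 = i , ℕP.m≤n⇒m≤1+n i<n , fi≢0

  ∑-atMostOne : ∀ n f → (∀ i → i ℕ.< n → f i ≤ 1ℤ) →
    (∀ i j → i ℕ.< n → j ℕ.< n → f i ≢ 0ℤ → f j ≢ 0ℤ → i ≡ j) → ∑ n f ≤ 1ℤ
  ∑-atMostOne zero    f le u = +≤+ z≤n
  ∑-atMostOne (suc n) f le u with f n ≟ 0ℤ
  ... | yes fn≡0 rewrite fn≡0 | +-identityʳ (∑ n f) =
    ∑-atMostOne n f (λ i p → le i (ℕP.m≤n⇒m≤1+n p)) (λ i j p r → u i j (ℕP.m≤n⇒m≤1+n p) (ℕP.m≤n⇒m≤1+n r))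
  ... | no fn≢0 = subst (_≤ 1ℤ) (sym (trans (cong (_+ f n) (∑-zero n z)) (+-identityˡ (f n)))) (le n ℕP.≤-refl)
    where z : ∀ i → i ℕ.< n → f i ≡ 0ℤ
          z i i<n with f i ≟ 0ℤ
          ... | yes e = e
          ... | no ne = ⊥-elim (ℕP.<⇒≢ i<n (u i n (ℕP.m≤n⇒m≤1+n i<n) ℕP.≤-refl ne fn≢0))

  ∑-atMostTwo : ∀ n f → (∀ i → i ℕ.< n → f i ≤ 1ℤ) →
    (∀ i j k → i ℕ.< n → j ℕ.< n → k ℕ.< n → f i ≢ 0ℤ → f j ≢ 0ℤ → f k ≢ 0ℤ → i ≡ j ⊎ j ≡ k ⊎ i ≡ k) →
    ∑ n f ≤ + 2
  ∑-atMostTwo zero    f le u = +≤+ z≤n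
  ∑-atMostTwo (suc n) f le u with f n ≟ 0ℤ
  ... | yes fn≡0 rewrite fn≡0 | +-identityʳ (∑ n f) =
    ∑-atMostTwo n f (λ i p → le i (ℕP.m≤n⇒m≤1+n p))
      (λ i j k p r t → u i j k (ℕP.m≤n⇒m≤1+n p) (ℕP.m≤n⇒m≤1+n r) (ℕP.m≤n⇒m≤1+n t))
  ... | no fn≢0 = +-mono-≤ (∑-atMostOne n f (λ i p → le i (ℕP.m≤n⇒m≤1+n p)) v) (le n ℕP.≤-refl)
    where v : ∀ i j → i ℕ.< n → j ℕ.< n → f i ≢ 0ℤ → f j ≢ 0ℤ → i ≡ j
          v i j p r fi fj with u i j n (ℕP.m≤n⇒m≤1+n p) (ℕP.m≤n⇒m≤1+n r) ℕP.≤-refl fi fj fn≢0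
          ... | inj₁ e        = e
          ... | inj₂ (inj₁ e) = ⊥-elim (ℕP.<⇒≢ r e)
          ... | inj₂ (inj₂ e) = ⊥-elim (ℕP.<⇒≢ p e)

  -- A pointwise bound whose totals agree leaves no slack anywhere. Counting pairs of points then
  -- determines how often each single difference of logarithms occurs.
  ∑-squeeze : ∀ n {f g : ℕ → ℤ} → (∀ i → i ℕ.< n → f i ≤ g i) → ∑ n f ≡ ∑ n g → ∀ i → i ℕ.< n → f i ≡ g i
  ∑-squeeze (suc n) {f} {g} le e i i<1+n = go
    where
    le′ : ∑ n f ≤ ∑ n g
    le′ = ∑-mono n λ j p → le j (ℕP.m≤n⇒m≤1+n p)
    last-eq : f n ≡ g n
    last-eq = ≤-antisym (le n ℕP.≤-refl)
      (+-cancelˡ-≤′ (∑ n f) (subst (∑ n f + g n ≤_) (sym e) (+-monoˡ-≤ (g n) le′)))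
      where
      +-cancelˡ-≤′ : ∀ a {b c} → a + b ≤ a + c → b ≤ c
      +-cancelˡ-≤′ a {b} {c} p = subst₂ _≤_ (lem a b) (lem a c) (+-monoʳ-≤ (- a) p)
        where lem : ∀ a b → - a + (a + b) ≡ b
              lem = solve-∀
    rest-eq : ∑ n f ≡ ∑ n g
    rest-eq = +-cancelʳ (f n) (∑ n f) (∑ n g) (trans e (cong (λ z → ∑ n g + z) (sym last-eq)))
      where
      +-cancelʳ : ∀ c a b → a + c ≡ b + c → a ≡ b
      +-cancelʳ c a b p = trans (lem a c) (trans (cong (_- c) p) (sym (lem b c)))
        where lem : ∀ a c → a ≡ (a + c) - c
              lem = solve-∀
    go : f i ≡ g i
    go with i ℕ.≟ n
    ... | yes refl = last-eq
    ... | no i≢n = ∑-squeeze n (λ j p → le j (ℕP.m≤n⇒m≤1+n p)) rest-eq i (ℕP.≤∧≢⇒< (ℕP.≤-pred i<1+n) i≢n)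

  𝟙 : ℕ → ℕ → ℤ
  𝟙 m e = ⟦ m ∣? e ⟧

  𝟙-periodic : ∀ m → Periodic m (𝟙 m)
  𝟙-periodic m b = ⟦⟧-cong (m ∣? (b ℕ.+ m)) (m ∣? b)
    (λ d → ∣m+n∣m⇒∣n (subst (m ∣_) (ℕP.+-comm b m) d) (divides 1 (sym (ℕP.+-identityʳ m))))
    (λ d → ∣m∣n⇒∣m+n d (divides 1 (sym (ℕP.+-identityʳ m))))

  ∑-𝟙₁ : ∀ m .{{_ : NonZero m}} → ∑ m (𝟙 m) ≡ 1ℤ
  ∑-𝟙₁ (suc m) = begin
    ∑ (suc m) (𝟙 (suc m))            ≡⟨ ∑-suc m (𝟙 (suc m)) ⟩
    𝟙 (suc m) 0 + ∑ m (𝟙 (suc m) ∘ suc) ≡⟨ cong₂ _+_ (⟦⟧-yes (suc m ∣? 0) (suc m ∣0)) (∑-zero m λ i i<m → ⟦⟧-no (suc m ∣? suc i) (>⇒∤ (s≤s i<m))) ⟩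
    1ℤ ∎
    where open ≡-Reasoning

  ∑-𝟙 : ∀ k m .{{_ : NonZero m}} → ∑ (k ℕ.* m) (𝟙 m) ≡ + k
  ∑-𝟙 k m = trans (∑-blocks k m (𝟙-periodic m)) (trans (cong (+ k *_) (∑-𝟙₁ m)) (*-identityʳ (+ k)))

-- Ramanujan sums as convolution idempotents on ℤ/N

module Kernels where

  open import Data.Nat as ℕ using (ℕ; zero; suc; z≤n; NonZero)
  import Data.Nat.Properties as ℕP
  open import Data.Nat.Divisibility using (_∣_; _∣?_; divides; ∣m+n∣m⇒∣n; ∣m∣n⇒∣m+n; ∣-trans; quotient)
  open import Data.Nat.Coprimality using (Coprime; coprime-Bézout)
  open import Data.Nat.GCD using (module Bézout)
  open import Data.Integer hiding (suc; NonZero)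
  open import Data.Integer.Properties
  open import Data.Integer.Tactic.RingSolver using (solve-∀)
  open import Data.Empty using (⊥-elim)
  open import Relation.Nullary using (yes; no)
  open import Relation.Binary.PropositionalEquality
  open IntegerSums

  cancelˡ : ∀ n {a b} .{{_ : NonZero n}} → + n * a ≡ + n * b → a ≡ b
  cancelˡ (suc n) {a} {b} e = *-cancelˡ-≡ (+ suc n) a b e

  -- On ℤ/N, B(a) = Σ_b u(b)v(b+a) is invariant under a ↦ a+P and a ↦ a+m, hence constant.
  ∑-coprime : ∀ N {P m} {u v : ℕ → ℤ} → Coprime P m → Periodic P u → Periodic N u → Periodic m v → Periodic N v →
    + N * ∑ N (λ b → u b * v b) ≡ ∑ N u * ∑ N v
  ∑-coprime N {P} {m} {u} {v} cop uP uN vm vN = begin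
    + N * ∑ N (λ b → u b * v b)                ≡⟨ cong (+ N *_) (∑-cong N λ b → cong (λ z → u b * v z) (sym (ℕP.+-identityʳ b))) ⟩
    + N * B 0                                  ≡⟨ sym (∑-const N (B 0)) ⟩
    ∑ N (λ a → B 0)                            ≡⟨ ∑-cong N (λ a → sym (const a)) ⟩
    ∑ N B                                      ≡⟨ ∑-swap N N (λ a b → u b * v (b ℕ.+ a)) ⟩
    ∑ N (λ b → ∑ N λ a → u b * v (b ℕ.+ a))    ≡⟨ ∑-cong N (λ b → trans (∑-*ˡ N (u b) (λ a → v (b ℕ.+ a)))
        (cong (u b *_) (trans (∑-cong N λ a → cong v (ℕP.+-comm b a)) (∑-shift N vN b)))) ⟩
    ∑ N (λ b → u b * ∑ N v)                    ≡⟨ ∑-*ʳ N (∑ N v) u ⟩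
    ∑ N u * ∑ N v                              ∎
    where
    open ≡-Reasoning
    B : ℕ → ℤ
    B a = ∑ N (λ b → u b * v (b ℕ.+ a))
    B-m : Periodic m B
    B-m a = ∑-cong N λ b → cong (u b *_) (trans (cong v (sym (ℕP.+-assoc b a m))) (vm (b ℕ.+ a)))
    B-P : Periodic P B
    -- Replace u(b) by u(b + P), so that both factors are translated by P, and undo the translation
    -- in the summation variable.
    B-P a = trans
      (∑-cong N λ b → cong₂ _*_ (sym (uP b)) (cong v (trans (cong (b ℕ.+_) (ℕP.+-comm a P)) (sym (ℕP.+-assoc b P a)))))
      (∑-shift N {λ b → u b * v (b ℕ.+ a)} (periodic-product uN (periodic-shift a vN)) P)
    step : ∀ a → B (suc a) ≡ B a
    -- Bézout writes 1 as a combination of the two periods, with the negative term moved to the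
    -- other side; hence B has period 1.
    step a with coprime-Bézout cop
    ... | Bézout.+- x y e = begin
      B (suc a)                 ≡⟨ sym (periodic-* y B-m (suc a)) ⟩
      B (suc a ℕ.+ y ℕ.* m)     ≡⟨ cong B (sym (ℕP.+-suc a (y ℕ.* m))) ⟩
      B (a ℕ.+ (1 ℕ.+ y ℕ.* m)) ≡⟨ cong (λ z → B (a ℕ.+ z)) e ⟩
      B (a ℕ.+ x ℕ.* P)         ≡⟨ periodic-* x B-P a ⟩
      B a                       ∎
    ... | Bézout.-+ x y e = begin
      B (suc a)                 ≡⟨ sym (periodic-* x B-P (suc a)) ⟩
      B (suc a ℕ.+ x ℕ.* P)     ≡⟨ cong B (sym (ℕP.+-suc a (x ℕ.* P))) ⟩
      B (a ℕ.+ (1 ℕ.+ x ℕ.* P)) ≡⟨ cong (λ z → B (a ℕ.+ z)) e ⟩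
      B (a ℕ.+ y ℕ.* m)         ≡⟨ periodic-* y B-m a ⟩
      B a                       ∎
    const : ∀ a → B a ≡ B 0
    const zero    = refl
    const (suc a) = trans (step a) (const a)

  -- The characteristic properties of a sum, over the characters of one given exact order, of the
  -- values at e: k is the convolution idempotent of the span of these φ characters.
  record Kernel (N P φ : ℕ) (k : ℕ → ℤ) : Set where
    field
      period  : Periodic P k
      periodN : Periodic N k
      sum≡0   : ∑ N k ≡ 0ℤ
      auto    : ∀ s → ∑ N (λ b → k b * k (b ℕ.+ s)) ≡ + N * k s
      at0     : k 0 ≡ + φ
      bound   : ∀ e → ∣ k e ∣ ℕ.≤ φ

  -- A character of order Pm is uniquely a product of characters of the coprime orders P and m, so
  -- the product of the two sums is the sum for order Pm. `∑-coprime` factors the averages, which is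
  -- why each identity is obtained multiplied by N and cancelled afterwards.
  kernel-* : ∀ {N P m φ φ′ k k′} .{{_ : NonZero N}} → Coprime P m → Kernel N P φ k → Kernel N m φ′ k′ →
    Kernel N (P ℕ.* m) (φ ℕ.* φ′) (λ e → k e * k′ e)
  kernel-* {N} {P} {m} {φ} {φ′} {k} {k′} cop K K′ = record
    { period  = periodic-product (periodic-∣ (divides m (ℕP.*-comm P m)) K.period) (periodic-∣ (divides P refl) K′.period)
    ; periodN = periodic-product K.periodN K′.periodN
    ; sum≡0   = cancelˡ N (trans (∑-coprime N cop K.period K.periodN K′.period K′.periodN)
                  (trans (cong (_* ∑ N k′) K.sum≡0) (trans (*-zeroˡ (∑ N k′)) (sym (*-zeroʳ (+ N))))))
    ; auto    = λ s → cancelˡ N (auto s)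
    ; at0     = trans (cong₂ _*_ K.at0 K′.at0) (sym (pos-* φ φ′))
    ; bound   = λ e → ℕP.≤-trans (ℕP.≤-reflexive (abs-* (k e) (k′ e))) (ℕP.*-mono-≤ (K.bound e) (K′.bound e))
    }
    where
    module K = Kernel K
    module K′ = Kernel K′
    open ≡-Reasoning
    mid : ∀ a b c d → a * b * (c * d) ≡ a * c * (b * d)
    mid = solve-∀
    mid′ : ∀ n a b → n * a * (n * b) ≡ n * (n * (a * b))
    mid′ = solve-∀
    auto : ∀ s → + N * ∑ N (λ b → k b * k′ b * (k (b ℕ.+ s) * k′ (b ℕ.+ s))) ≡ + N * (+ N * (k s * k′ s))
    auto s = begin
      + N * ∑ N (λ b → k b * k′ b * (k (b ℕ.+ s) * k′ (b ℕ.+ s)))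
        ≡⟨ cong (+ N *_) (∑-cong N λ b → mid (k b) (k′ b) (k (b ℕ.+ s)) (k′ (b ℕ.+ s))) ⟩
      + N * ∑ N (λ b → k b * k (b ℕ.+ s) * (k′ b * k′ (b ℕ.+ s)))
        ≡⟨ ∑-coprime N {u = λ b → k b * k (b ℕ.+ s)} {v = λ b → k′ b * k′ (b ℕ.+ s)} cop
             (periodic-product K.period (periodic-shift s K.period)) (periodic-product K.periodN (periodic-shift s K.periodN))
             (periodic-product K′.period (periodic-shift s K′.period)) (periodic-product K′.periodN (periodic-shift s K′.periodN)) ⟩
      ∑ N (λ b → k b * k (b ℕ.+ s)) * ∑ N (λ b → k′ b * k′ (b ℕ.+ s)) ≡⟨ cong₂ _*_ (K.auto s) (K′.auto s) ⟩
      + N * k s * (+ N * k′ s)       ≡⟨ mid′ (+ N) (k s) (k′ s) ⟩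
      + N * (+ N * (k s * k′ s))     ∎

  -- For m a prime power and m′ the next lower power this is the Ramanujan sum of modulus m.
  ramanujan : ℕ → ℕ → ℕ → ℤ
  ramanujan m m′ e = + m * 𝟙 m e - + m′ * 𝟙 m′ e

  𝟙-absorbˡ : ∀ {m m′} b s → m′ ∣ m → 𝟙 m b * 𝟙 m′ (b ℕ.+ s) ≡ 𝟙 m b * 𝟙 m′ s
  𝟙-absorbˡ {m} {m′} b s m′∣m with m ∣? b
  ... | no _ = refl
  ... | yes m∣b = cong (1ℤ *_) (⟦⟧-cong (m′ ∣? (b ℕ.+ s)) (m′ ∣? s)
    (λ d → ∣m+n∣m⇒∣n d (∣-trans m′∣m m∣b)) (λ d → ∣m∣n⇒∣m+n (∣-trans m′∣m m∣b) d))

  𝟙-absorbʳ : ∀ {m m′} b s → m′ ∣ m → 𝟙 m′ b * 𝟙 m (b ℕ.+ s) ≡ 𝟙 m (b ℕ.+ s) * 𝟙 m′ s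
  𝟙-absorbʳ {m} {m′} b s m′∣m with m ∣? (b ℕ.+ s)
  ... | no _ = *-zeroʳ (𝟙 m′ b)
  ... | yes m∣b+s = trans (*-identityʳ (𝟙 m′ b)) (trans (⟦⟧-cong (m′ ∣? b) (m′ ∣? s)
    (λ d → ∣m+n∣m⇒∣n (∣-trans m′∣m m∣b+s) d)
    (λ d → ∣m+n∣m⇒∣n (subst (m′ ∣_) (ℕP.+-comm b s) (∣-trans m′∣m m∣b+s)) d)) (sym (*-identityˡ (𝟙 m′ s))))

  ∑-𝟙-shift : ∀ {N} m (d : m ∣ N) .{{_ : NonZero m}} s → ∑ N (λ b → 𝟙 m (b ℕ.+ s)) ≡ + quotient d
  ∑-𝟙-shift m (divides k refl) s = trans (∑-shift (k ℕ.* m) (periodic-∣ (divides k refl) (𝟙-periodic m)) s) (∑-𝟙 k m)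

  ∑-𝟙-∣ : ∀ {N} m (d : m ∣ N) .{{_ : NonZero m}} → ∑ N (𝟙 m) ≡ + quotient d
  ∑-𝟙-∣ m (divides k refl) = ∑-𝟙 k m

  +m*quotient : ∀ {m N} (d : m ∣ N) → + m * + quotient d ≡ + N
  +m*quotient {m} (divides k refl) = trans (sym (pos-* m k)) (cong +_ (ℕP.*-comm m k))

  -- The values are m - m′, -m′ and 0. The hypothesis 2m′ ≤ m says m′ ≤ m - m′, so the value at 0 is
  -- the largest in absolute value.
  ramanujan-kernel : ∀ {N} m m′ .{{_ : NonZero m}} .{{_ : NonZero m′}} → m ∣ N → m′ ∣ m → m′ ℕ.+ m′ ℕ.≤ m →
    Kernel N m (m ℕ.∸ m′) (ramanujan m m′)
  ramanujan-kernel {N} m m′ m∣N m′∣m 2m′≤m = record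
    { period  = period
    ; periodN = periodic-∣ m∣N period
    ; sum≡0   = begin
        ∑ N (ramanujan m m′) ≡⟨ ∑-- N (λ e → + m * 𝟙 m e) (λ e → + m′ * 𝟙 m′ e) ⟩
        ∑ N (λ e → + m * 𝟙 m e) - ∑ N (λ e → + m′ * 𝟙 m′ e)
          ≡⟨ cong₂ _-_ (trans (∑-*ˡ N (+ m) (𝟙 m)) (trans (cong (+ m *_) (∑-𝟙-∣ m m∣N)) (+m*quotient m∣N)))
                       (trans (∑-*ˡ N (+ m′) (𝟙 m′)) (trans (cong (+ m′ *_) (∑-𝟙-∣ m′ m′∣N)) (+m*quotient m′∣N))) ⟩
        + N - + N ≡⟨ +-inverseʳ (+ N) ⟩
        0ℤ ∎
    ; auto    = auto
    ; at0     = trans (cong₂ (λ x y → + m * x - + m′ * y) (⟦⟧-yes (m ∣? 0) (divides 0 refl)) (⟦⟧-yes (m′ ∣? 0) (divides 0 refl)))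
                  (trans (cong₂ _-_ (*-identityʳ (+ m)) (*-identityʳ (+ m′))) (trans (m-n≡m⊖n m m′) (⊖-≥ (ℕP.≤-trans (ℕP.m≤m+n m′ m′) 2m′≤m))))
    ; bound   = bound
    }
    where
    open ≡-Reasoning
    m′∣N = ∣-trans m′∣m m∣N
    period : Periodic m (ramanujan m m′)
    period b = cong₂ (λ x y → + m * x - + m′ * y) (𝟙-periodic m b) (periodic-∣ m′∣m (𝟙-periodic m′) b)
    m′≤m∸m′ : m′ ℕ.≤ m ℕ.∸ m′
    m′≤m∸m′ = subst (ℕ._≤ m ℕ.∸ m′) (ℕP.m+n∸n≡m m′ m′) (ℕP.∸-monoˡ-≤ m′ 2m′≤m)
    bound : ∀ e → ∣ ramanujan m m′ e ∣ ℕ.≤ m ℕ.∸ m′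
    bound e with m ∣? e | m′ ∣? e
    ... | yes _ | yes _ = ℕP.≤-reflexive (cong ∣_∣ (trans (cong₂ _-_ (*-identityʳ (+ m)) (*-identityʳ (+ m′)))
                            (trans (m-n≡m⊖n m m′) (⊖-≥ (ℕP.≤-trans (ℕP.m≤m+n m′ m′) 2m′≤m)))))
    ... | yes p | no ¬p = ⊥-elim (¬p (∣-trans m′∣m p))
    ... | no _ | yes _ = ℕP.≤-trans (ℕP.≤-reflexive (trans (cong ∣_∣ (trans (cong₂ _-_ (*-zeroʳ (+ m)) (*-identityʳ (+ m′))) (+-identityˡ (- + m′)))) (∣-i∣≡∣i∣ (+ m′)))) m′≤m∸m′
    ... | no _ | no _ = ℕP.≤-trans (ℕP.≤-reflexive (cong ∣_∣ (cong₂ _-_ (*-zeroʳ (+ m)) (*-zeroʳ (+ m′))))) z≤n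
    auto : ∀ s → ∑ N (λ b → ramanujan m m′ b * ramanujan m m′ (b ℕ.+ s)) ≡ + N * ramanujan m m′ s
    auto s = begin
      ∑ N (λ b → ramanujan m m′ b * ramanujan m m′ (b ℕ.+ s)) ≡⟨ ∑-cong N (λ b → summand b) ⟩
      ∑ N (λ b → (A * 𝟙 m b - B * 𝟙 m (b ℕ.+ s)) + C * 𝟙 m′ b)
        ≡⟨ trans (∑-+ N (λ b → A * 𝟙 m b - B * 𝟙 m (b ℕ.+ s)) (λ b → C * 𝟙 m′ b))
                 (cong (λ z → z + ∑ N (λ b → C * 𝟙 m′ b)) (∑-- N (λ b → A * 𝟙 m b) (λ b → B * 𝟙 m (b ℕ.+ s)))) ⟩
      (∑ N (λ b → A * 𝟙 m b) - ∑ N (λ b → B * 𝟙 m (b ℕ.+ s))) + ∑ N (λ b → C * 𝟙 m′ b)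
        ≡⟨ cong₂ _+_ (cong₂ _-_ (trans (∑-*ˡ N A (𝟙 m)) (cong (A *_) (∑-𝟙-∣ m m∣N)))
                                (trans (∑-*ˡ N B (λ b → 𝟙 m (b ℕ.+ s))) (cong (B *_) (∑-𝟙-shift m m∣N s))))
                     (trans (∑-*ˡ N C (𝟙 m′)) (cong (C *_) (∑-𝟙-∣ m′ m′∣N))) ⟩
      (A * + quotient m∣N - B * + quotient m∣N) + C * + quotient m′∣N
        ≡⟨ collect (+ m) (+ m′) (𝟙 m s) (𝟙 m′ s) (+ quotient m∣N) (+ quotient m′∣N) ⟩
      (+ m * + quotient m∣N) * ((+ m * 𝟙 m s - + m′ * 𝟙 m′ s) - + m′ * 𝟙 m′ s) + (+ m′ * + quotient m′∣N) * (+ m′ * 𝟙 m′ s)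
        ≡⟨ cong₂ (λ x y → x * ((+ m * 𝟙 m s - + m′ * 𝟙 m′ s) - + m′ * 𝟙 m′ s) + y * (+ m′ * 𝟙 m′ s)) (+m*quotient m∣N) (+m*quotient m′∣N) ⟩
      + N * ((+ m * 𝟙 m s - + m′ * 𝟙 m′ s) - + m′ * 𝟙 m′ s) + + N * (+ m′ * 𝟙 m′ s)
        ≡⟨ finish (+ N) (+ m * 𝟙 m s - + m′ * 𝟙 m′ s) (+ m′ * 𝟙 m′ s) ⟩
      + N * ramanujan m m′ s ∎
      where
      A B C : ℤ
      A = + m * + m * 𝟙 m s - + m * + m′ * 𝟙 m′ s
      B = + m * + m′ * 𝟙 m′ s
      C = + m′ * + m′ * 𝟙 m′ s
      expand : ∀ m m′ a b c d → (m * a - m′ * b) * (m * c - m′ * d) ≡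
        (m * m * (a * c) - m * m′ * (a * d)) - m * m′ * (b * c) + m′ * m′ * (b * d)
      expand = solve-∀
      regroup : ∀ m m′ a a′ b c d → (m * m * (a * c) - m * m′ * (a * d)) - m * m′ * (a′ * d) + m′ * m′ * (b * d) ≡
        (((m * m * c - m * m′ * d) * a) - (m * m′ * d) * a′) + (m′ * m′ * d) * b
      regroup = solve-∀
      summand : ∀ b → ramanujan m m′ b * ramanujan m m′ (b ℕ.+ s) ≡ (A * 𝟙 m b - B * 𝟙 m (b ℕ.+ s)) + C * 𝟙 m′ b
      summand b = trans (expand (+ m) (+ m′) (𝟙 m b) (𝟙 m′ b) (𝟙 m (b ℕ.+ s)) (𝟙 m′ (b ℕ.+ s)))
        (trans (cong₂ _+_ (cong₂ _-_ (cong₂ _-_ (cong (+ m * + m *_) (𝟙-absorbˡ b s (divides 1 (sym (ℕP.*-identityˡ m)))))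
                                                (cong (+ m * + m′ *_) (𝟙-absorbˡ b s m′∣m)))
                                     (cong (+ m * + m′ *_) (𝟙-absorbʳ b s m′∣m)))
                          (cong (+ m′ * + m′ *_) (𝟙-absorbˡ b s (divides 1 (sym (ℕP.*-identityˡ m′))))))
               (regroup (+ m) (+ m′) (𝟙 m b) (𝟙 m (b ℕ.+ s)) (𝟙 m′ b) (𝟙 m s) (𝟙 m′ s)))
      collect : ∀ m m′ c d x y → ((m * m * c - m * m′ * d) * x - (m * m′ * d) * x) + (m′ * m′ * d) * y ≡
        (m * x) * ((m * c - m′ * d) - m′ * d) + (m′ * y) * (m′ * d)
      collect = solve-∀
      finish : ∀ n a b → n * (a - b) + n * b ≡ n * a
      finish = solve-∀

-- Kernel sums over the logarithms of a line

module PointSums where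

  open import Data.Nat as ℕ using (ℕ; zero; suc; z≤n; NonZero)
  import Data.Nat.Properties as ℕP
  open import Data.Nat.Divisibility using (_∣_; _∣?_; divides)
  import Data.Nat.Tactic.RingSolver as ℕR
  open import Data.Integer hiding (suc; NonZero)
  open import Data.Integer.Properties
  open import Data.Integer.Tactic.RingSolver using (solve-∀)
  open import Function using (_∘_)
  open import Relation.Nullary using (yes; no)
  open import Relation.Binary.PropositionalEquality
  open IntegerSums
  open Kernels

  -- `pred n * u` is -u modulo n without subtraction, and only the u ≡ -t contributes. Summed over
  -- T, this expresses a sum by the sizes of the residue classes of T, which is where bounds on
  -- those sizes enter.
  ∑-unfold : ∀ n .{{_ : NonZero n}} {k : ℕ → ℤ} → Periodic n k → ∀ t →
    k t ≡ ∑ n (λ u → 𝟙 n (t ℕ.+ u) * k (ℕ.pred n ℕ.* u))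
  ∑-unfold n@(suc n-1) {k} per t = begin
    k t                                     ≡⟨ sym (*-identityˡ (k t)) ⟩
    1ℤ * k t                                ≡⟨ cong (_* k t) (sym ones) ⟩
    ∑ n (λ u → 𝟙 n (t ℕ.+ u)) * k t         ≡⟨ sym (∑-*ʳ n (k t) (λ u → 𝟙 n (t ℕ.+ u))) ⟩
    ∑ n (λ u → 𝟙 n (t ℕ.+ u) * k t)         ≡⟨ ∑-cong n replace ⟩
    ∑ n (λ u → 𝟙 n (t ℕ.+ u) * k (n-1 ℕ.* u)) ∎
    where
    open ≡-Reasoning
    ones : ∑ n (λ u → 𝟙 n (t ℕ.+ u)) ≡ 1ℤ
    ones = trans (∑-cong n λ u → cong (𝟙 n) (ℕP.+-comm t u)) (trans (∑-shift n (𝟙-periodic n) t) (∑-𝟙₁ n))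
    rearrange : ∀ t u m → t ℕ.+ u ℕ.* suc m ≡ m ℕ.* u ℕ.+ (t ℕ.+ u)
    rearrange = ℕR.solve-∀
    replace : ∀ u → 𝟙 n (t ℕ.+ u) * k t ≡ 𝟙 n (t ℕ.+ u) * k (n-1 ℕ.* u)
    replace u with n ∣? (t ℕ.+ u)
    ... | no _ = refl
    ... | yes (divides c e) = cong (1ℤ *_) (begin
      k t                        ≡⟨ sym (periodic-* u per t) ⟩
      k (t ℕ.+ u ℕ.* n)          ≡⟨ cong k (rearrange t u n-1) ⟩
      k (n-1 ℕ.* u ℕ.+ (t ℕ.+ u)) ≡⟨ cong (λ z → k (n-1 ℕ.* u ℕ.+ z)) e ⟩
      k (n-1 ℕ.* u ℕ.+ c ℕ.* n)  ≡⟨ periodic-* c per (n-1 ℕ.* u) ⟩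
      k (n-1 ℕ.* u)              ∎)

  ∑-negate : ∀ n .{{_ : NonZero n}} {k : ℕ → ℤ} → Periodic n k → ∑ n (λ u → k (ℕ.pred n ℕ.* u)) ≡ ∑ n k
  ∑-negate n {k} per = sym (begin
    ∑ n k                                                          ≡⟨ ∑-cong n (∑-unfold n per) ⟩
    ∑ n (λ t → ∑ n (λ u → 𝟙 n (t ℕ.+ u) * k (ℕ.pred n ℕ.* u)))     ≡⟨ ∑-swap n n (λ t u → 𝟙 n (t ℕ.+ u) * k (ℕ.pred n ℕ.* u)) ⟩
    ∑ n (λ u → ∑ n (λ t → 𝟙 n (t ℕ.+ u) * k (ℕ.pred n ℕ.* u)))     ≡⟨ ∑-cong n (λ u → trans (∑-*ʳ n (k (ℕ.pred n ℕ.* u)) (λ t → 𝟙 n (t ℕ.+ u)))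
       (trans (cong (_* k (ℕ.pred n ℕ.* u)) (trans (∑-shift n (𝟙-periodic n) u) (∑-𝟙₁ n))) (*-identityˡ (k (ℕ.pred n ℕ.* u))))) ⟩
    ∑ n (λ u → k (ℕ.pred n ℕ.* u))                                 ∎)
    where open ≡-Reasoning

  ∣∑∣≤ : ∀ n (f : ℕ → ℤ) (g : ℕ → ℤ) → (∀ i → i ℕ.< n → + ∣ f i ∣ ≤ g i) → + ∣ ∑ n f ∣ ≤ ∑ n g
  ∣∑∣≤ zero    f g le = ≤-refl
  ∣∑∣≤ (suc n) f g le = ≤-trans (+≤+ (∣i+j∣≤∣i∣+∣j∣ (∑ n f) (f n)))
    (+-mono-≤ (∣∑∣≤ n f g λ i p → le i (ℕP.m≤n⇒m≤1+n p)) (le n ℕP.≤-refl))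

  -- The logarithms T(0), …, T(q−1) (with q = r+1) of the points of an affine line not through the origin:
  -- a relative difference set in ℤ/(q²−1) with forbidden subgroup generated by q+1.
  record LineLogs (r : ℕ) (T : ℕ → ℕ) : Set where
    q : ℕ
    q = suc r
    q+1 : ℕ
    q+1 = suc q
    N : ℕ
    N = r ℕ.* q+1
    field
      T<N         : ∀ i → T i ℕ.< N
      differences : ∀ h → Periodic N h →
        ∑ q (λ i → ∑ q λ j → (1ℤ - δ i j) * h (T i ℕ.+ (N ℕ.∸ T j))) ≡ ∑ N h - ∑ r (λ j → h (j ℕ.* q+1))
      hits₊       : ∀ u → ∑ q (λ i → 𝟙 q+1 (T i ℕ.+ u)) ≤ 1ℤ
      hits₋       : ∀ u → ∑ q (λ i → 𝟙 r (T i ℕ.+ u)) ≤ + 2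

  module _ {r : ℕ} {T : ℕ → ℕ} .{{_ : NonZero r}} (L : LineLogs r T) where
    open LineLogs L

    private instance
      N≢0 : NonZero N
      N≢0 = ℕP.m*n≢0 r q+1

    ∑T-unfold : ∀ n .{{_ : NonZero n}} {k : ℕ → ℤ} → Periodic n k →
      ∑ q (k ∘ T) ≡ ∑ n (λ u → ∑ q (λ i → 𝟙 n (T i ℕ.+ u)) * k (ℕ.pred n ℕ.* u))
    ∑T-unfold n {k} per = trans (∑-cong q λ i → ∑-unfold n per (T i))
      (trans (∑-swap q n (λ i u → 𝟙 n (T i ℕ.+ u) * k (ℕ.pred n ℕ.* u)))
             (∑-cong n λ u → ∑-*ʳ q (k (ℕ.pred n ℕ.* u)) (λ i → 𝟙 n (T i ℕ.+ u))))

    -- As k is nonnegative, each residue class may be counted with the maximal multiplicity m. No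
    -- character sum is involved, hence no √q.
    ∑T-count : ∀ n .{{_ : NonZero n}} m {k : ℕ → ℤ} → (∀ u → ∑ q (λ i → 𝟙 n (T i ℕ.+ u)) ≤ + m) →
      Periodic n k → (∀ e → 0ℤ ≤ k e) → ∑ q (k ∘ T) ≤ + m * ∑ n k
    ∑T-count n m {k} le per k≥0 = begin
      ∑ q (k ∘ T)                                                        ≡⟨ ∑T-unfold n per ⟩
      ∑ n (λ u → ∑ q (λ i → 𝟙 n (T i ℕ.+ u)) * k (ℕ.pred n ℕ.* u))
        ≤⟨ ∑-mono n (λ u _ → *-monoʳ-≤-nonNeg (k (ℕ.pred n ℕ.* u)) {{nonNegative (k≥0 (ℕ.pred n ℕ.* u))}} (le u)) ⟩
      ∑ n (λ u → + m * k (ℕ.pred n ℕ.* u))                               ≡⟨ ∑-*ˡ n (+ m) (λ u → k (ℕ.pred n ℕ.* u)) ⟩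
      + m * ∑ n (λ u → k (ℕ.pred n ℕ.* u))                               ≡⟨ cong (+ m *_) (∑-negate n per) ⟩
      + m * ∑ n k                                                        ∎
      where open ≤-Reasoning

    module _ {P φ : ℕ} {k : ℕ → ℤ} (K : Kernel N P φ k) where
      open Kernel K

      -- The q logarithms occupy q of the q + 1 classes modulo q + 1, once each. Since k sums to 0
      -- over all classes, the sum over T is -k at the one missing class. The proof keeps that class
      -- as the nonnegative weight 1 - ρ of total mass 1.
      directional-bound : Periodic q+1 k → ∣ ∑ q (k ∘ T) ∣ ℕ.≤ φ
      directional-bound per = drop‿+≤+ (begin
        + ∣ ∑ q (k ∘ T) ∣                ≡⟨ cong (λ z → + ∣ z ∣) rewritten ⟩
        + ∣ - ∑ q+1 (λ u → k̃ u * (1ℤ - ρ u)) ∣ ≡⟨ cong +_ (∣-i∣≡∣i∣ (∑ q+1 (λ u → k̃ u * (1ℤ - ρ u)))) ⟩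
        + ∣ ∑ q+1 (λ u → k̃ u * (1ℤ - ρ u)) ∣   ≤⟨ ∣∑∣≤ q+1 (λ u → k̃ u * (1ℤ - ρ u)) (λ u → + φ * (1ℤ - ρ u)) (λ u _ → term u) ⟩
        ∑ q+1 (λ u → + φ * (1ℤ - ρ u))   ≡⟨ ∑-*ˡ q+1 (+ φ) (λ u → 1ℤ - ρ u) ⟩
        + φ * ∑ q+1 (λ u → 1ℤ - ρ u)     ≡⟨ cong (+ φ *_) one ⟩
        + φ * 1ℤ                         ≡⟨ *-identityʳ (+ φ) ⟩
        + φ                              ∎)
        where
        open ≤-Reasoning
        k̃ ρ : ℕ → ℤ
        k̃ u = k (q ℕ.* u)
        ρ u = ∑ q (λ i → 𝟙 q+1 (T i ℕ.+ u))
        ∑k : ∑ q+1 k ≡ 0ℤ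
        ∑k = cancelˡ r (trans (sym (∑-blocks r q+1 per)) (trans sum≡0 (sym (*-zeroʳ (+ r)))))
        ∑ρ : ∑ q+1 ρ ≡ + q
        ∑ρ = trans (∑-swap q+1 q (λ u i → 𝟙 q+1 (T i ℕ.+ u)))
          (trans (∑-cong q λ i → trans (∑-cong q+1 λ u → cong (𝟙 q+1) (ℕP.+-comm (T i) u))
                                       (trans (∑-shift q+1 (𝟙-periodic q+1) (T i)) (∑-𝟙₁ q+1)))
                 (trans (∑-const q 1ℤ) (*-identityʳ (+ q))))
        one : ∑ q+1 (λ u → 1ℤ - ρ u) ≡ 1ℤ
        one = trans (∑-- q+1 (λ _ → 1ℤ) ρ) (trans (cong₂ _-_ (trans (∑-const q+1 1ℤ) (*-identityʳ (+ q+1))) ∑ρ) (lem (+ q)))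
          where lem : ∀ a → (1ℤ + a) - a ≡ 1ℤ
                lem = solve-∀
        rewritten : ∑ q (k ∘ T) ≡ - ∑ q+1 (λ u → k̃ u * (1ℤ - ρ u))
        rewritten = trans (∑T-unfold q+1 per) (sym (trans (cong -_ split) (neg-involutive (∑ q+1 (λ u → ρ u * k̃ u)))))
          where
          lem : ∀ a b → a * (1ℤ - b) ≡ a - b * a
          lem = solve-∀
          split : ∑ q+1 (λ u → k̃ u * (1ℤ - ρ u)) ≡ - ∑ q+1 (λ u → ρ u * k̃ u)
          split = trans (∑-cong q+1 λ u → lem (k̃ u) (ρ u)) (trans (∑-- q+1 k̃ (λ u → ρ u * k̃ u))
            (trans (cong (_- ∑ q+1 (λ u → ρ u * k̃ u)) (trans (∑-negate q+1 per) ∑k)) (+-identityˡ (- ∑ q+1 (λ u → ρ u * k̃ u)))))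
        term : ∀ u → + ∣ k̃ u * (1ℤ - ρ u) ∣ ≤ + φ * (1ℤ - ρ u)
        term u = begin
          + ∣ k̃ u * (1ℤ - ρ u) ∣         ≡⟨ cong +_ (abs-* (k̃ u) (1ℤ - ρ u)) ⟩
          + (∣ k̃ u ∣ ℕ.* ∣ 1ℤ - ρ u ∣)   ≡⟨ pos-* ∣ k̃ u ∣ ∣ 1ℤ - ρ u ∣ ⟩
          + ∣ k̃ u ∣ * + ∣ 1ℤ - ρ u ∣     ≤⟨ *-monoʳ-≤-nonNeg (+ ∣ 1ℤ - ρ u ∣) (+≤+ (bound (q ℕ.* u))) ⟩
          + φ * + ∣ 1ℤ - ρ u ∣           ≡⟨ cong (+ φ *_) (0≤i⇒+∣i∣≡i (i≤j⇒0≤j-i (hits₊ u))) ⟩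
          + φ * (1ℤ - ρ u)               ∎

      private
        F : ℕ → ℤ
        F b = ∑ q (λ i → k (T i ℕ.+ b))

        -- Translate b by T j and use idempotence; `N ∸ T j` stands for -T j modulo N.
        correlation : ∀ i j → ∑ N (λ b → k (T i ℕ.+ b) * k (T j ℕ.+ b)) ≡ + N * k (T i ℕ.+ (N ℕ.∸ T j))
        correlation i j = sym (begin
          + N * k s                                          ≡⟨ sym (auto s) ⟩
          ∑ N (λ b → k b * k (b ℕ.+ s))                      ≡⟨ sym (∑-shift N (periodic-product periodN (periodic-shift s periodN)) (T j)) ⟩
          ∑ N (λ b → k (b ℕ.+ T j) * k (b ℕ.+ T j ℕ.+ s))    ≡⟨ ∑-cong N (λ b → trans (cong₂ _*_ (cong k (ℕP.+-comm b (T j))) (trans (cong k (index b)) (periodN (T i ℕ.+ b))))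
                                                                                      (*-comm (k (T j ℕ.+ b)) (k (T i ℕ.+ b)))) ⟩
          ∑ N (λ b → k (T i ℕ.+ b) * k (T j ℕ.+ b))          ∎)
          where
          open ≡-Reasoning
          s = T i ℕ.+ (N ℕ.∸ T j)
          re : ∀ b t t′ d → b ℕ.+ t ℕ.+ (t′ ℕ.+ d) ≡ t′ ℕ.+ b ℕ.+ (t ℕ.+ d)
          re = ℕR.solve-∀
          index : ∀ b → b ℕ.+ T j ℕ.+ s ≡ T i ℕ.+ b ℕ.+ N
          index b = trans (re b (T j) (T i) (N ℕ.∸ T j)) (cong (T i ℕ.+ b ℕ.+_) (ℕP.m+[n∸m]≡n (ℕP.<⇒≤ (T<N j))))

        -- r N Σⱼ k(j(q+1)) is a sum of squares
        forbidden≥0 : 0ℤ ≤ + N * ∑ r (λ j → k (j ℕ.* q+1))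
        forbidden≥0 = *-cancelˡ-≤-pos 0ℤ (+ N * ∑ r (λ j → k (j ℕ.* q+1))) (+ r) {{positive-r}} (begin
          + r * 0ℤ                                ≡⟨ *-zeroʳ (+ r) ⟩
          0ℤ                                      ≤⟨ ∑-nonneg N {λ b → κ b * κ b} (λ b _ → square-nonneg (κ b)) ⟩
          ∑ N (λ b → κ b * κ b)                   ≡⟨ sym twist ⟩
          + r * ∑ N (λ b → k b * κ b)             ≡⟨ cong (+ r *_) (sym average) ⟩
          + r * (+ N * ∑ r (λ j → k (j ℕ.* q+1))) ∎)
          where
          open ≤-Reasoning
          positive-r : Positive (+ r)
          positive-r = positive (+<+ (ℕP.n≢0⇒n>0 (ℕ.≢-nonZero⁻¹ r)))
          κ : ℕ → ℤ
          κ b = ∑ r (λ j → k (b ℕ.+ j ℕ.* q+1))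
          average : + N * ∑ r (λ j → k (j ℕ.* q+1)) ≡ ∑ N (λ b → k b * κ b)
          average = trans (sym (∑-*ˡ r (+ N) (λ j → k (j ℕ.* q+1))))
            (trans (∑-cong r λ j → sym (auto (j ℕ.* q+1)))
            (trans (∑-swap r N (λ j b → k b * k (b ℕ.+ j ℕ.* q+1)))
                   (∑-cong N λ b → ∑-*ˡ r (k b) (λ j → k (b ℕ.+ j ℕ.* q+1)))))
          κ-inv : Periodic q+1 κ
          κ-inv b = trans (∑-cong r λ j → cong k (trans (ℕP.+-assoc b q+1 (j ℕ.* q+1)) refl))
            (∑-shift₁ r {λ j → k (b ℕ.+ j ℕ.* q+1)} λ j → trans (cong k (re b j r q+1)) (periodN (b ℕ.+ j ℕ.* q+1)))
            where re : ∀ b j r m → b ℕ.+ (j ℕ.+ r) ℕ.* m ≡ b ℕ.+ j ℕ.* m ℕ.+ r ℕ.* m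
                  re = ℕR.solve-∀
          κN : Periodic N κ
          κN = periodic-* r κ-inv
          -- κ is the sum of k over a coset of the forbidden subgroup and is constant on cosets.
          -- Averaging k over each coset therefore turns k κ into κ² / r.
          twist : + r * ∑ N (λ b → k b * κ b) ≡ ∑ N (λ b → κ b * κ b)
          twist = begin-equality
            + r * ∑ N (λ b → k b * κ b)           ≡⟨ sym (∑-const r (∑ N (λ b → k b * κ b))) ⟩
            ∑ r (λ i → ∑ N (λ b → k b * κ b))     ≡⟨ ∑-cong r (λ i → sym (∑-shift N (periodic-product periodN κN) (i ℕ.* q+1))) ⟩
            ∑ r (λ i → ∑ N (λ b → k (b ℕ.+ i ℕ.* q+1) * κ (b ℕ.+ i ℕ.* q+1)))
              ≡⟨ ∑-cong r (λ i → ∑-cong N λ b → cong (k (b ℕ.+ i ℕ.* q+1) *_) (periodic-* i κ-inv b)) ⟩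
            ∑ r (λ i → ∑ N (λ b → k (b ℕ.+ i ℕ.* q+1) * κ b)) ≡⟨ ∑-swap r N (λ i b → k (b ℕ.+ i ℕ.* q+1) * κ b) ⟩
            ∑ N (λ b → ∑ r (λ i → k (b ℕ.+ i ℕ.* q+1) * κ b)) ≡⟨ ∑-cong N (λ b → ∑-*ʳ r (κ b) (λ i → k (b ℕ.+ i ℕ.* q+1))) ⟩
            ∑ N (λ b → κ b * κ b)                 ∎

        -- Expanding the square leaves N k(T i - T j). The diagonal gives q N φ. The off-diagonal
        -- differences run once through everything outside the forbidden subgroup; as k has total 0,
        -- they contribute minus its sum over the subgroup, which is at most 0.
        energy : ∑ N (λ b → F b * F b) ≤ + q * (+ N * + φ)
        energy = begin
          ∑ N (λ b → F b * F b)   ≡⟨ ∑-cong N (λ b → sym (∑-product q q (λ i → k (T i ℕ.+ b)) (λ j → k (T j ℕ.+ b)))) ⟩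
          ∑ N (λ b → ∑ q λ i → ∑ q λ j → k (T i ℕ.+ b) * k (T j ℕ.+ b))
            ≡⟨ trans (∑-swap N q (λ b i → ∑ q λ j → k (T i ℕ.+ b) * k (T j ℕ.+ b)))
                     (∑-cong q λ i → ∑-swap N q (λ b j → k (T i ℕ.+ b) * k (T j ℕ.+ b))) ⟩
          ∑ q (λ i → ∑ q λ j → ∑ N λ b → k (T i ℕ.+ b) * k (T j ℕ.+ b)) ≡⟨ ∑-cong q (λ i → ∑-cong q λ j → trans (correlation i j) (split i j)) ⟩
          ∑ q (λ i → ∑ q λ j → δ j i * h i j + (1ℤ - δ i j) * h i j)
            ≡⟨ trans (∑-cong q λ i → ∑-+ q (λ j → δ j i * h i j) (λ j → (1ℤ - δ i j) * h i j))
                     (∑-+ q (λ i → ∑ q λ j → δ j i * h i j) (λ i → ∑ q λ j → (1ℤ - δ i j) * h i j)) ⟩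
          ∑ q (λ i → ∑ q λ j → δ j i * h i j) + ∑ q (λ i → ∑ q λ j → (1ℤ - δ i j) * h i j) ≡⟨ cong₂ _+_ diagonal off-diagonal ⟩
          + q * (+ N * + φ) + - (+ N * ∑ r (λ j → k (j ℕ.* q+1))) ≤⟨ +-monoʳ-≤ (+ q * (+ N * + φ)) (neg-mono-≤ forbidden≥0) ⟩
          + q * (+ N * + φ) + - 0ℤ ≡⟨ +-identityʳ (+ q * (+ N * + φ)) ⟩
          + q * (+ N * + φ)        ∎
          where
          open ≤-Reasoning
          h : ℕ → ℕ → ℤ
          h i j = + N * k (T i ℕ.+ (N ℕ.∸ T j))
          split : ∀ i j → h i j ≡ δ j i * h i j + (1ℤ - δ i j) * h i j
          split i j = trans (lem (δ i j) (h i j)) (cong (λ z → z * h i j + (1ℤ - δ i j) * h i j) (⟦⟧-cong (i ℕ.≟ j) (j ℕ.≟ i) sym sym))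
            where lem : ∀ d x → x ≡ d * x + (1ℤ - d) * x
                  lem = solve-∀
          diagonal : ∑ q (λ i → ∑ q λ j → δ j i * h i j) ≡ + q * (+ N * + φ)
          diagonal = trans (∑-cong< q λ i i<q → trans (∑-δ q i (h i) i<q)
              (cong (+ N *_) (trans (cong k (ℕP.m+[n∸m]≡n (ℕP.<⇒≤ (T<N i)))) (trans (periodN 0) at0))))
            (∑-const q (+ N * + φ))
          off-diagonal : ∑ q (λ i → ∑ q λ j → (1ℤ - δ i j) * h i j) ≡ - (+ N * ∑ r (λ j → k (j ℕ.* q+1)))
          off-diagonal = trans (differences (λ s → + N * k s) (λ b → cong (+ N *_) (periodN b)))
            (trans (cong₂ _-_ (trans (∑-*ˡ N (+ N) k) (trans (cong (+ N *_) sum≡0) (*-zeroʳ (+ N)))) (∑-*ˡ r (+ N) (λ j → k (j ℕ.* q+1))))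
                   (+-identityˡ (- (+ N * ∑ r (λ j → k (j ℕ.* q+1))))))

      -- k is a convolution idempotent, so N F = k ⋆ F, and Cauchy–Schwarz turns the energy bound into a pointwise one
      square-bound : ∑ q (k ∘ T) * ∑ q (k ∘ T) ≤ + φ * + φ * + q
      square-bound = *-cancelˡ-≤-pos (S * S) (+ φ * + φ * + q) (+ N * + N) {{positive-N²}} (begin
        + N * + N * (S * S)                                ≡⟨ lem (+ N) S ⟩
        (+ N * S) * (+ N * S)                              ≡⟨ cong₂ _*_ reproduce reproduce ⟩
        ∑ N (λ c → k c * F c) * ∑ N (λ c → k c * F c)      ≤⟨ cauchy-schwarz N k F ⟩
        ∑ N (λ c → k c * k c) * ∑ N (λ c → F c * F c)      ≡⟨ cong (_* ∑ N (λ c → F c * F c)) selfcorr ⟩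
        (+ N * + φ) * ∑ N (λ c → F c * F c)                ≤⟨ *-monoˡ-≤-nonNeg (+ N * + φ) {{nonNegative (subst (0ℤ ≤_) (pos-* N φ) (+≤+ z≤n))}} energy ⟩
        (+ N * + φ) * (+ q * (+ N * + φ))                  ≡⟨ lem′ (+ N) (+ φ) (+ q) ⟩
        + N * + N * (+ φ * + φ * + q)                      ∎)
        where
        open ≤-Reasoning
        S = ∑ q (k ∘ T)
        positive-N² : Positive (+ N * + N)
        positive-N² = positive (subst (0ℤ <_) (pos-* N N) (+<+ (ℕP.n≢0⇒n>0 (ℕ.≢-nonZero⁻¹ (N ℕ.* N) {{ℕP.m*n≢0 N N}}))))
        lem : ∀ n s → n * n * (s * s) ≡ (n * s) * (n * s)
        lem = solve-∀
        lem′ : ∀ n p q → (n * p) * (q * (n * p)) ≡ n * n * (p * p * q)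
        lem′ = solve-∀
        selfcorr : ∑ N (λ c → k c * k c) ≡ + N * + φ
        selfcorr = trans (∑-cong N λ c → cong (λ z → k c * k z) (sym (ℕP.+-identityʳ c))) (trans (auto 0) (cong (+ N *_) at0))
        reproduce : + N * S ≡ ∑ N (λ c → k c * F c)
        reproduce = begin-equality
          + N * S                                          ≡⟨ sym (∑-*ˡ q (+ N) (k ∘ T)) ⟩
          ∑ q (λ i → + N * k (T i))                        ≡⟨ ∑-cong q (λ i → sym (auto (T i))) ⟩
          ∑ q (λ i → ∑ N (λ c → k c * k (c ℕ.+ T i)))      ≡⟨ ∑-swap q N (λ i c → k c * k (c ℕ.+ T i)) ⟩
          ∑ N (λ c → ∑ q (λ i → k c * k (c ℕ.+ T i)))      ≡⟨ ∑-cong N (λ c → trans (∑-*ˡ q (k c) (λ i → k (c ℕ.+ T i)))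
                                                                (cong (k c *_) (∑-cong q λ i → cong k (ℕP.+-comm c (T i))))) ⟩
          ∑ N (λ c → k c * F c)                            ∎

      -- The rational R / s is an upper bound for √q, so this is |S| ≤ φ√q with the square root
      -- replaced by integers.
      root-bound : ∀ {s R} → s ℕ.* s ℕ.* q ℕ.≤ R ℕ.* R → s ℕ.* ∣ ∑ q (k ∘ T) ∣ ℕ.≤ φ ℕ.* R
      root-bound {s} {R} s²q≤R² = ℕP.≮⇒≥ λ lt → ℕP.<⇒≱ (ℕP.*-mono-< lt lt) (begin
        s ℕ.* x ℕ.* (s ℕ.* x)       ≡⟨ lem s x ⟩
        s ℕ.* s ℕ.* (x ℕ.* x)       ≤⟨ ℕP.*-monoʳ-≤ (s ℕ.* s) x²≤ ⟩
        s ℕ.* s ℕ.* (φ ℕ.* φ ℕ.* q) ≡⟨ lem′ s φ q ⟩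
        φ ℕ.* φ ℕ.* (s ℕ.* s ℕ.* q) ≤⟨ ℕP.*-monoʳ-≤ (φ ℕ.* φ) s²q≤R² ⟩
        φ ℕ.* φ ℕ.* (R ℕ.* R)       ≡⟨ sym (lem φ R) ⟩
        φ ℕ.* R ℕ.* (φ ℕ.* R)       ∎)
        where
        open ℕP.≤-Reasoning
        S = ∑ q (k ∘ T)
        x = ∣ S ∣
        lem : ∀ s x → s ℕ.* x ℕ.* (s ℕ.* x) ≡ s ℕ.* s ℕ.* (x ℕ.* x)
        lem = ℕR.solve-∀
        lem′ : ∀ s p q → s ℕ.* s ℕ.* (p ℕ.* p ℕ.* q) ≡ p ℕ.* p ℕ.* (s ℕ.* s ℕ.* q)
        lem′ = ℕR.solve-∀
        x²≤ : x ℕ.* x ℕ.≤ φ ℕ.* φ ℕ.* q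
        x²≤ = drop‿+≤+ (subst₂ _≤_ (trans (sym (0≤i⇒+∣i∣≡i (square-nonneg S))) (cong +_ (abs-* S S)))
          (trans (cong (_* + q) (sym (pos-* φ φ))) (sym (pos-* (φ ℕ.* φ) q))) square-bound)

-- Products of local weights: main terms and error terms

module SieveBounds where

  open import Data.Nat as ℕ using (ℕ; zero; suc; z≤n; NonZero)
  import Data.Nat.Properties as ℕP
  open import Data.Nat.Divisibility using (_∣_; _∣?_; divides; ∣-trans; m∣m*n; n∣m*n; 1∣_; m%n≡0⇒n∣m; n∣m⇒m%n≡0)
  open import Data.Nat.Coprimality using (Coprime; coprime-divisor) renaming (sym to coprime-sym)
  import Data.Nat.Tactic.RingSolver as ℕR
  open import Data.Integer hiding (suc; NonZero)
  open import Data.Integer.Properties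
  open import Data.Integer.Tactic.RingSolver using (solve-∀)
  open import Data.Bool using (Bool; true; false; _∧_; if_then_else_)
  open import Data.List using (List; []; _∷_)
  open import Data.List.Relation.Unary.All using (All; []; _∷_)
  open import Data.Product using (_×_; _,_)
  open import Data.Unit using (⊤; tt)
  open import Data.Empty using (⊥-elim)
  open import Function using (_∘_)
  open import Relation.Nullary using (yes; no)
  open import Relation.Binary.PropositionalEquality
  open IntegerSums
  open Kernels
  open PointSums

  coprime-*ˡ : ∀ {a b c} → Coprime a c → Coprime b c → Coprime (a ℕ.* b) c
  coprime-*ˡ {a} {b} {c} ac bc {d} (d∣ab , d∣c) =
    bc (coprime-divisor (λ { (e∣d , e∣a) → ac (e∣a , ∣-trans e∣d d∣c) }) d∣ab , d∣c)

  coprime-∣ˡ : ∀ {a b c} → a ∣ b → Coprime b c → Coprime a c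
  coprime-∣ˡ a∣b bc (d∣a , d∣c) = bc (∣-trans d∣a a∣b , d∣c)

  -- A divisibility test made for evaluation. The value at d = 0 is a default, so the completeness
  -- direction asks for d ≠ 0.
  _∣ᵇ_ : ℕ → ℕ → Bool
  zero  ∣ᵇ n = false
  suc d ∣ᵇ n = (n ℕ.% suc d) ℕ.≡ᵇ 0

  ∣ᵇ⇒∣ : ∀ d n → (d ∣ᵇ n) ≡ true → d ∣ n
  ∣ᵇ⇒∣ (suc d) n e = m%n≡0⇒n∣m n (suc d) (ℕP.≡ᵇ⇒≡ (n ℕ.% suc d) 0 (subst Data.Bool.T (sym e) tt))

  ∣⇒∣ᵇ : ∀ d n .{{_ : NonZero d}} → d ∣ n → (d ∣ᵇ n) ≡ true
  ∣⇒∣ᵇ (suc d) n d∣n rewrite n∣m⇒m%n≡0 n (suc d) d∣n = refl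

  ∧-true : ∀ {a b} → a ∧ b ≡ true → a ≡ true × b ≡ true
  ∧-true {true} {true} refl = refl , refl

  -- Local weights, each 0 or the modulus: `two` is supported on e ≡ 2 (mod 4), `cop l` on l ∤ e and `div l` on l ∣ e.
  data Local : Set where
    two : Local
    cop div : ℕ → Local

  val : Local → ℕ → ℤ
  val two     e = 1ℤ + (ramanujan 2 1 e - ramanujan 4 2 e)
  val (cop l) e = + (l ℕ.∸ 1) - ramanujan l 1 e
  val (div l) e = 1ℤ + ramanujan l 1 e

  -- `lead` is the coefficient of the trivial character in the expansion of the weight, that is, its
  -- mean value.
  modulus lead : Local → ℕ
  modulus two     = 4
  modulus (cop l) = l
  modulus (div l) = l
  lead two     = 1
  lead (cop l) = l ℕ.∸ 1
  lead (div l) = 1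

  vals : List Local → ℕ → ℤ
  vals []       e = 1ℤ
  vals (L ∷ Ls) e = val L e * vals Ls e

  moduli leads : List Local → ℕ
  moduli []       = 1
  moduli (L ∷ Ls) = modulus L ℕ.* moduli Ls
  leads []        = 1
  leads (L ∷ Ls)  = lead L ℕ.* leads Ls

  𝟙₁ : ∀ e → 𝟙 1 e ≡ 1ℤ
  𝟙₁ e = ⟦⟧-yes (1 ∣? e) (1∣ e)

  +∸1 : ∀ l → 1 ℕ.≤ l → + (l ℕ.∸ 1) ≡ + l - 1ℤ
  +∸1 l 1≤l = trans (sym (⊖-≥ 1≤l)) (sym (m-n≡m⊖n l 1))

  -- Each weight is used in two shapes: the expansion into Ramanujan sums gives estimates, while
  -- closed forms like this one give sign and support.
  val-two : ∀ e → val two e ≡ + 4 * (𝟙 2 e - 𝟙 4 e)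
  val-two e rewrite 𝟙₁ e = lem (𝟙 2 e) (𝟙 4 e)
    where lem : ∀ a b → 1ℤ + ((+ 2 * a - 1ℤ * 1ℤ) - (+ 4 * b - + 2 * a)) ≡ + 4 * (a - b)
          lem = solve-∀

  val-cop : ∀ l → 1 ℕ.≤ l → ∀ e → val (cop l) e ≡ + l * (1ℤ - 𝟙 l e)
  val-cop l 1≤l e rewrite 𝟙₁ e | +∸1 l 1≤l = lem (+ l) (𝟙 l e)
    where lem : ∀ l a → (l - 1ℤ) - (l * a - 1ℤ * 1ℤ) ≡ l * (1ℤ - a)
          lem = solve-∀

  val-div : ∀ l e → val (div l) e ≡ + l * 𝟙 l e
  val-div l e rewrite 𝟙₁ e = lem (+ l) (𝟙 l e)
    where lem : ∀ l a → 1ℤ + (l * a - 1ℤ * 1ℤ) ≡ l * a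
          lem = solve-∀

  4∣⇒2∣ : ∀ {e} → 4 ∣ e → 2 ∣ e
  4∣⇒2∣ = ∣-trans (divides 2 refl)

  0≤𝟙2-𝟙4 : ∀ e → 0ℤ ≤ 𝟙 2 e - 𝟙 4 e
  0≤𝟙2-𝟙4 e with 2 ∣? e | 4 ∣? e
  ... | yes _ | yes _ = ≤-refl
  ... | yes _ | no _  = +≤+ z≤n
  ... | no ¬2 | yes p = ⊥-elim (¬2 (4∣⇒2∣ p))
  ... | no _  | no _  = ≤-refl

  0≤1-𝟙 : ∀ l e → 0ℤ ≤ 1ℤ - 𝟙 l e
  0≤1-𝟙 l e = i≤j⇒0≤j-i (⟦⟧-≤1 (l ∣? e))

  Positive≥ : Local → Set
  Positive≥ two     = ⊤
  Positive≥ (cop l) = 1 ℕ.≤ l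
  Positive≥ (div l) = ⊤

  val≥0 : ∀ L → Positive≥ L → ∀ e → 0ℤ ≤ val L e
  val≥0 two     _ e = subst (0ℤ ≤_) (sym (val-two e)) (*-monoˡ-≤-nonNeg (+ 4) (0≤𝟙2-𝟙4 e))
  val≥0 (cop l) p e = subst₂ _≤_ (*-zeroʳ (+ l)) (sym (val-cop l p e)) (*-monoˡ-≤-nonNeg (+ l) (0≤1-𝟙 l e))
  val≥0 (div l) _ e = subst₂ _≤_ (*-zeroʳ (+ l)) (sym (val-div l e)) (*-monoˡ-≤-nonNeg (+ l) (⟦⟧-≥0 (l ∣? e)))

  0≤* : ∀ {a b} → 0ℤ ≤ a → 0ℤ ≤ b → 0ℤ ≤ a * b
  0≤* {a} {b} p r = subst (_≤ a * b) (*-zeroʳ a) (*-monoˡ-≤-nonNeg a {{nonNegative p}} r)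

  *-mono : ∀ {a b c d} → 0ℤ ≤ a → 0ℤ ≤ d → a ≤ b → c ≤ d → a * c ≤ b * d
  *-mono {a} {b} {c} {d} 0≤a 0≤d a≤b c≤d =
    ≤-trans (*-monoˡ-≤-nonNeg a {{nonNegative 0≤a}} c≤d) (*-monoʳ-≤-nonNeg d {{nonNegative 0≤d}} a≤b)

  vals≥0 : ∀ {Ls} → All Positive≥ Ls → ∀ e → 0ℤ ≤ vals Ls e
  vals≥0 []       e = +≤+ z≤n
  vals≥0 (p ∷ ps) e = 0≤* (val≥0 _ p e) (vals≥0 ps e)

  ≥2 : Local → Set
  ≥2 two     = ⊤
  ≥2 (cop l) = 2 ℕ.≤ l
  ≥2 (div l) = 2 ℕ.≤ l

  -- The conditions under which the product of the weights expands into kernels: every modulus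
  -- divides N and is coprime to the product of those after it.
  data Admissible (N : ℕ) : List Local → Set where
    []  : Admissible N []
    adm : ∀ {L Ls} → ≥2 L → modulus L ∣ N → Coprime (modulus L) (moduli Ls) → Admissible N Ls → Admissible N (L ∷ Ls)

  kernel-coarsen : ∀ {N P P′ φ k} → P ∣ P′ → Kernel N P φ k → Kernel N P′ φ k
  kernel-coarsen P∣P′ K = record { Kernel K ; period = periodic-∣ P∣P′ (Kernel.period K) }

  ram₁ : ∀ {N l} → 2 ℕ.≤ l → l ∣ N → Kernel N l (l ℕ.∸ 1) (ramanujan l 1)
  ram₁ {l = suc l} 2≤l l∣N = ramanujan-kernel (suc l) 1 l∣N (1∣ suc l) 2≤l

  -- The sum of modulus 2 is declared with period 4, so that both sums inside `two` share the
  -- modulus 4 against which coprimality is recorded.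
  ram₂ : ∀ {N} → 4 ∣ N → Kernel N 4 1 (ramanujan 2 1)
  ram₂ 4∣N = kernel-coarsen (divides 2 refl) (ramanujan-kernel 2 1 (4∣⇒2∣ 4∣N) (1∣ 2) ℕP.≤-refl)

  ram₄ : ∀ {N} → 4 ∣ N → Kernel N 4 2 (ramanujan 4 2)
  ram₄ 4∣N = ramanujan-kernel 4 2 4∣N (divides 2 refl) ℕP.≤-refl

  ramanujan-periodic : ∀ m m′ → m′ ∣ m → Periodic m (ramanujan m m′)
  ramanujan-periodic m m′ m′∣m b = cong₂ (λ x y → + m * x - + m′ * y) (𝟙-periodic m b) (periodic-∣ m′∣m (𝟙-periodic m′) b)

  val-periodic : ∀ L → Periodic (modulus L) (val L)
  val-periodic two b = cong₂ (λ x y → 1ℤ + (x - y))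
    (periodic-∣ (divides 2 refl) (ramanujan-periodic 2 1 (1∣ 2)) b) (ramanujan-periodic 4 2 (divides 2 refl) b)
  val-periodic (cop l) b = cong (λ x → + (l ℕ.∸ 1) - x) (ramanujan-periodic l 1 (1∣ l) b)
  val-periodic (div l) b = cong (λ z → 1ℤ + z) (ramanujan-periodic l 1 (1∣ l) b)

  vals-periodic : ∀ Ls → Periodic (moduli Ls) (vals Ls)
  vals-periodic []       b = refl
  vals-periodic (L ∷ Ls) = periodic-product (periodic-∣ (m∣m*n (moduli Ls)) (val-periodic L))
                                            (periodic-∣ (n∣m*n (modulus L)) (vals-periodic Ls))

  vals-periodic-adm : ∀ {n Ls} → Admissible n Ls → Periodic n (vals Ls)
  vals-periodic-adm []                        b = refl
  vals-periodic-adm (adm {L} _ m∣n _ A) = periodic-product (periodic-∣ m∣n (val-periodic L)) (vals-periodic-adm A)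

  ∑-val : ∀ {n} L → ≥2 L → modulus L ∣ n → ∑ n (val L) ≡ + n * + lead L
  ∑-val {n} two _ 4∣n = begin
    ∑ n (val two) ≡⟨ ∑-+ n (λ _ → 1ℤ) (λ e → ramanujan 2 1 e - ramanujan 4 2 e) ⟩
    ∑ n (λ _ → 1ℤ) + ∑ n (λ e → ramanujan 2 1 e - ramanujan 4 2 e)
      ≡⟨ cong₂ _+_ (∑-const n 1ℤ) (trans (∑-- n (ramanujan 2 1) (ramanujan 4 2)) (cong₂ _-_ (Kernel.sum≡0 (ram₂ 4∣n)) (Kernel.sum≡0 (ram₄ 4∣n)))) ⟩
    + n * 1ℤ + 0ℤ ≡⟨ +-identityʳ (+ n * 1ℤ) ⟩
    + n * 1ℤ ∎
    where open ≡-Reasoning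
  ∑-val {n} (cop l) 2≤l l∣n = trans (∑-- n (λ _ → + (l ℕ.∸ 1)) (ramanujan l 1))
    (trans (cong₂ _-_ (∑-const n (+ (l ℕ.∸ 1))) (Kernel.sum≡0 (ram₁ 2≤l l∣n))) (+-identityʳ (+ n * + (l ℕ.∸ 1))))
  ∑-val {n} (div l) 2≤l l∣n = trans (∑-+ n (λ _ → 1ℤ) (ramanujan l 1))
    (trans (cong₂ _+_ (∑-const n 1ℤ) (Kernel.sum≡0 (ram₁ 2≤l l∣n))) (+-identityʳ (+ n * 1ℤ)))

  -- For coprime moduli the mean of a product is the product of the means, and each mean is the
  -- leading coefficient.
  ∑-vals : ∀ {n Ls} .{{_ : NonZero n}} → Admissible n Ls → ∑ n (vals Ls) ≡ + n * + leads Ls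
  ∑-vals {n} [] = ∑-const n 1ℤ
  ∑-vals {n} {L ∷ Ls} (adm 2≤ m∣n ⊥Ls A) = cancelˡ n (begin
    + n * ∑ n (vals (L ∷ Ls))              ≡⟨ ∑-coprime n ⊥Ls (val-periodic L) (periodic-∣ m∣n (val-periodic L)) (vals-periodic Ls) (vals-periodic-adm A) ⟩
    ∑ n (val L) * ∑ n (vals Ls)            ≡⟨ cong₂ _*_ (∑-val L 2≤ m∣n) (∑-vals A) ⟩
    (+ n * + lead L) * (+ n * + leads Ls)  ≡⟨ lem (+ n) (+ lead L) (+ leads Ls) ⟩
    + n * (+ n * (+ lead L * + leads Ls))  ≡⟨ cong (λ z → + n * (+ n * z)) (sym (pos-* (lead L) (leads Ls))) ⟩
    + n * (+ n * + leads (L ∷ Ls))         ∎)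
    where
    open ≡-Reasoning
    lem : ∀ n a b → (n * a) * (n * b) ≡ n * (n * (a * b))
    lem = solve-∀

  -- Expanding a product of local weights into kernels, err and err₀ add up the bounds for the non-constant terms,
  -- scaled by s: φ s for a kernel of period q+1, and φ R ≥ s φ √q for the others.
  module Error (q+1 s R : ℕ) where

    err : Bool → ℕ → List Local → ℕ
    err dir φ []           = φ ℕ.* (if dir then s else R)
    err dir φ (two   ∷ Ls) = err dir φ Ls ℕ.+ (err (dir ∧ (2 ∣ᵇ q+1)) (φ ℕ.* 1) Ls ℕ.+ err (dir ∧ (4 ∣ᵇ q+1)) (φ ℕ.* 2) Ls)
    err dir φ (cop l ∷ Ls) = (l ℕ.∸ 1) ℕ.* err dir φ Ls ℕ.+ err (dir ∧ (l ∣ᵇ q+1)) (φ ℕ.* (l ℕ.∸ 1)) Ls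
    err dir φ (div l ∷ Ls) = err dir φ Ls ℕ.+ err (dir ∧ (l ∣ᵇ q+1)) (φ ℕ.* (l ℕ.∸ 1)) Ls

    err₀ : List Local → ℕ
    err₀ []           = 0
    err₀ (two   ∷ Ls) = err₀ Ls ℕ.+ (err (2 ∣ᵇ q+1) 1 Ls ℕ.+ err (4 ∣ᵇ q+1) 2 Ls)
    err₀ (cop l ∷ Ls) = (l ℕ.∸ 1) ℕ.* err₀ Ls ℕ.+ err (l ∣ᵇ q+1) (l ℕ.∸ 1) Ls
    err₀ (div l ∷ Ls) = err₀ Ls ℕ.+ err (l ∣ᵇ q+1) (l ℕ.∸ 1) Ls

    -- Absolute coefficients times degrees, added up over the characters in the weight: 1 + 1 + 2
    -- for `two`, (l - 1) + (l - 1) for `cop l`, 1 + (l - 1) for `div l`. This is what the error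
    -- becomes when the better bound for period q + 1 is given up.
    weight : Local → ℕ
    weight two     = 4
    weight (cop l) = 2 ℕ.* (l ℕ.∸ 1)
    weight (div l) = suc (l ℕ.∸ 1)

    weights : List Local → ℕ
    weights []       = 1
    weights (L ∷ Ls) = weight L ℕ.* weights Ls

    err≤ : s ℕ.≤ R → ∀ dir φ Ls → err dir φ Ls ℕ.≤ φ ℕ.* (R ℕ.* weights Ls)
    err≤ s≤R true  φ [] = ℕP.*-monoʳ-≤ φ (ℕP.≤-trans s≤R (ℕP.≤-reflexive (sym (ℕP.*-identityʳ R))))
    err≤ s≤R false φ [] = ℕP.*-monoʳ-≤ φ (ℕP.≤-reflexive (sym (ℕP.*-identityʳ R)))
    err≤ s≤R dir φ (two ∷ Ls) = ℕP.≤-trans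
      (ℕP.+-mono-≤ (err≤ s≤R dir φ Ls) (ℕP.+-mono-≤ (err≤ s≤R _ (φ ℕ.* 1) Ls) (err≤ s≤R _ (φ ℕ.* 2) Ls)))
      (ℕP.≤-reflexive (lem φ R (weights Ls)))
      where lem : ∀ p r w → p ℕ.* (r ℕ.* w) ℕ.+ (p ℕ.* 1 ℕ.* (r ℕ.* w) ℕ.+ p ℕ.* 2 ℕ.* (r ℕ.* w)) ≡ p ℕ.* (r ℕ.* (4 ℕ.* w))
            lem = ℕR.solve-∀
    err≤ s≤R dir φ (cop l ∷ Ls) = ℕP.≤-trans
      (ℕP.+-mono-≤ (ℕP.*-monoʳ-≤ (l ℕ.∸ 1) (err≤ s≤R dir φ Ls)) (err≤ s≤R _ (φ ℕ.* (l ℕ.∸ 1)) Ls))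
      (ℕP.≤-reflexive (lem φ R (weights Ls) (l ℕ.∸ 1)))
      where lem : ∀ p r w a → a ℕ.* (p ℕ.* (r ℕ.* w)) ℕ.+ p ℕ.* a ℕ.* (r ℕ.* w) ≡ p ℕ.* (r ℕ.* (2 ℕ.* a ℕ.* w))
            lem = ℕR.solve-∀
    err≤ s≤R dir φ (div l ∷ Ls) = ℕP.≤-trans
      (ℕP.+-mono-≤ (err≤ s≤R dir φ Ls) (err≤ s≤R _ (φ ℕ.* (l ℕ.∸ 1)) Ls))
      (ℕP.≤-reflexive (lem φ R (weights Ls) (l ℕ.∸ 1)))
      where lem : ∀ p r w a → p ℕ.* (r ℕ.* w) ℕ.+ p ℕ.* a ℕ.* (r ℕ.* w) ≡ p ℕ.* (r ℕ.* (suc a ℕ.* w))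
            lem = ℕR.solve-∀

    err₀≤ : s ℕ.≤ R → ∀ Ls → err₀ Ls ℕ.≤ R ℕ.* weights Ls
    err₀≤ s≤R [] = z≤n
    err₀≤ s≤R (two ∷ Ls) = ℕP.≤-trans
      (ℕP.+-mono-≤ (err₀≤ s≤R Ls) (ℕP.+-mono-≤ (err≤ s≤R _ 1 Ls) (err≤ s≤R _ 2 Ls)))
      (ℕP.≤-reflexive (lem R (weights Ls)))
      where lem : ∀ r w → r ℕ.* w ℕ.+ (1 ℕ.* (r ℕ.* w) ℕ.+ 2 ℕ.* (r ℕ.* w)) ≡ r ℕ.* (4 ℕ.* w)
            lem = ℕR.solve-∀
    err₀≤ s≤R (cop l ∷ Ls) = ℕP.≤-trans
      (ℕP.+-mono-≤ (ℕP.*-monoʳ-≤ (l ℕ.∸ 1) (err₀≤ s≤R Ls)) (err≤ s≤R _ (l ℕ.∸ 1) Ls))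
      (ℕP.≤-reflexive (lem R (weights Ls) (l ℕ.∸ 1)))
      where lem : ∀ r w a → a ℕ.* (r ℕ.* w) ℕ.+ a ℕ.* (r ℕ.* w) ≡ r ℕ.* (2 ℕ.* a ℕ.* w)
            lem = ℕR.solve-∀
    err₀≤ s≤R (div l ∷ Ls) = ℕP.≤-trans
      (ℕP.+-mono-≤ (err₀≤ s≤R Ls) (err≤ s≤R _ (l ℕ.∸ 1) Ls))
      (ℕP.≤-reflexive (lem R (weights Ls) (l ℕ.∸ 1)))
      where lem : ∀ r w a → r ℕ.* w ℕ.+ a ℕ.* (r ℕ.* w) ≡ r ℕ.* (suc a ℕ.* w)
            lem = ℕR.solve-∀

  module _ {r : ℕ} {T : ℕ → ℕ} .{{_ : NonZero r}} (L : LineLogs r T) {s R : ℕ}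
           (s²q≤R² : s ℕ.* s ℕ.* suc r ℕ.≤ R ℕ.* R) where
    open LineLogs L
    open Error q+1 s R

    private instance
      N≢0 : NonZero N
      N≢0 = ℕP.m*n≢0 r q+1

    ∥_∥ : (ℕ → ℤ) → ℕ
    ∥ f ∥ = s ℕ.* ∣ ∑ q (f ∘ T) ∣

    ∥∥-cong : ∀ {f g : ℕ → ℤ} → (∀ e → f e ≡ g e) → ∥ f ∥ ≡ ∥ g ∥
    ∥∥-cong e = cong (λ z → s ℕ.* ∣ z ∣) (∑-cong q λ i → e (T i))

    ∥+∥ : ∀ f g → ∥ (λ e → f e + g e) ∥ ℕ.≤ ∥ f ∥ ℕ.+ ∥ g ∥
    ∥+∥ f g = ℕP.≤-trans (ℕP.*-monoʳ-≤ s (ℕP.≤-trans (ℕP.≤-reflexive (cong ∣_∣ (∑-+ q (f ∘ T) (g ∘ T)))) (∣i+j∣≤∣i∣+∣j∣ (∑ q (f ∘ T)) (∑ q (g ∘ T)))))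
      (ℕP.≤-reflexive (ℕP.*-distribˡ-+ s ∣ ∑ q (f ∘ T) ∣ ∣ ∑ q (g ∘ T) ∣))

    ∥-∥ : ∀ f g → ∥ (λ e → f e - g e) ∥ ℕ.≤ ∥ f ∥ ℕ.+ ∥ g ∥
    ∥-∥ f g = ℕP.≤-trans (ℕP.*-monoʳ-≤ s (ℕP.≤-trans (ℕP.≤-reflexive (cong ∣_∣ (∑-- q (f ∘ T) (g ∘ T)))) (∣i-j∣≤∣i∣+∣j∣ (∑ q (f ∘ T)) (∑ q (g ∘ T)))))
      (ℕP.≤-reflexive (ℕP.*-distribˡ-+ s ∣ ∑ q (f ∘ T) ∣ ∣ ∑ q (g ∘ T) ∣))

    ∥*∥ : ∀ c f → ∥ (λ e → + c * f e) ∥ ≡ c ℕ.* ∥ f ∥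
    ∥*∥ c f = trans (cong (s ℕ.*_) (trans (cong ∣_∣ (∑-*ˡ q (+ c) (f ∘ T))) (abs-* (+ c) (∑ q (f ∘ T))))) (lem s c ∣ ∑ q (f ∘ T) ∣)
      where lem : ∀ s c x → s ℕ.* (c ℕ.* x) ≡ c ℕ.* (s ℕ.* x)
            lem = ℕR.solve-∀

    -- The flag `dir` of the error recursion promises that the kernel multiplied up so far has
    -- period q + 1; the value false promises nothing. Every further factor must have a modulus
    -- dividing q + 1 for the flag to survive.
    Directional : Bool → (ℕ → ℤ) → Set
    Directional dir k = dir ≡ true → Periodic q+1 k

    dir-* : ∀ {dir k m k′} → Directional dir k → Periodic m k′ → Directional (dir ∧ (m ∣ᵇ q+1)) (λ e → k e * k′ e)
    dir-* {dir} {k} {m} {k′} D per e with ∧-true {dir} e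
    ... | d , m∣ = periodic-product (D d) (periodic-∣ (∣ᵇ⇒∣ m q+1 m∣) per)

    dir₁ : ∀ {m k′} → Periodic m k′ → Directional (m ∣ᵇ q+1) k′
    dir₁ {m} per m∣ = periodic-∣ (∣ᵇ⇒∣ m q+1 m∣) per

    -- Expand the first weight: its constant part leaves the kernel k as it is, and each Ramanujan
    -- sum multiplies k into a kernel of larger modulus. At the end of the list the accumulated
    -- kernel is estimated by the directional bound or by the root bound, according to the flag.
    err-bound : ∀ {P φ k dir} Ls → Kernel N P φ k → Directional dir k → Coprime P (moduli Ls) → Admissible N Ls →
      ∥ (λ e → k e * vals Ls e) ∥ ℕ.≤ err dir φ Ls
    err-bound {k = k} {dir = true} [] K D c A = ℕP.≤-trans
      (ℕP.≤-reflexive (∥∥-cong λ e → *-identityʳ (k e)))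
      (ℕP.≤-trans (ℕP.*-monoʳ-≤ s (directional-bound L K (D refl))) (ℕP.≤-reflexive (ℕP.*-comm s _)))
    err-bound {k = k} {dir = false} [] K D c A = ℕP.≤-trans
      (ℕP.≤-reflexive (∥∥-cong λ e → *-identityʳ (k e))) (root-bound L K {s} {R} s²q≤R²)
    err-bound {P} {φ} {k} {dir} (Lo ∷ Ls) K D c (adm 2≤ m∣N cL A) = go Lo 2≤ m∣N refl
      where
      m = modulus Lo
      P⊥m : Coprime P m
      P⊥m = coprime-sym (coprime-∣ˡ (m∣m*n (moduli Ls)) (coprime-sym c))
      Pm⊥ : Coprime (P ℕ.* m) (moduli Ls)
      Pm⊥ = coprime-*ˡ (coprime-sym (coprime-∣ˡ (n∣m*n m) (coprime-sym c))) cL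
      same : ∥ (λ e → k e * vals Ls e) ∥ ℕ.≤ err dir φ Ls
      same = err-bound Ls (kernel-coarsen (m∣m*n m) K) D Pm⊥ A
      times : ∀ {φ′ k′ m′} → Kernel N m φ′ k′ → Periodic m′ k′ →
        ∥ (λ e → k e * k′ e * vals Ls e) ∥ ℕ.≤ err (dir ∧ (m′ ∣ᵇ q+1)) (φ ℕ.* φ′) Ls
      times {m′ = m′} K′ per = err-bound Ls (kernel-* P⊥m K K′) (dir-* {m = m′} D per) Pm⊥ A
      go : ∀ Lo′ → ≥2 Lo′ → modulus Lo′ ∣ N → Lo′ ≡ Lo → ∥ (λ e → k e * (val Lo′ e * vals Ls e)) ∥ ℕ.≤ err dir φ (Lo′ ∷ Ls)
      go two _ 4∣N refl = begin
        ∥ (λ e → k e * (val two e * vals Ls e)) ∥ ≡⟨ ∥∥-cong (λ e → lem (k e) (ramanujan 2 1 e) (ramanujan 4 2 e) (vals Ls e)) ⟩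
        ∥ (λ e → a e + (b e - d e)) ∥             ≤⟨ ∥+∥ a (λ e → b e - d e) ⟩
        ∥ a ∥ ℕ.+ ∥ (λ e → b e - d e) ∥           ≤⟨ ℕP.+-monoʳ-≤ ∥ a ∥ (∥-∥ b d) ⟩
        ∥ a ∥ ℕ.+ (∥ b ∥ ℕ.+ ∥ d ∥)
          ≤⟨ ℕP.+-mono-≤ same (ℕP.+-mono-≤ (times {m′ = 2} (ram₂ 4∣N) (ramanujan-periodic 2 1 (1∣ 2))) (times {m′ = 4} (ram₄ 4∣N) (ramanujan-periodic 4 2 (divides 2 refl)))) ⟩
        err dir φ (two ∷ Ls)                      ∎
        where
        open ℕP.≤-Reasoning
        a b d : ℕ → ℤ
        a e = k e * vals Ls e
        b e = k e * ramanujan 2 1 e * vals Ls e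
        d e = k e * ramanujan 4 2 e * vals Ls e
        lem : ∀ k x y v → k * ((1ℤ + (x - y)) * v) ≡ k * v + (k * x * v - k * y * v)
        lem = solve-∀
      go (cop l) 2≤l l∣N refl = begin
        ∥ (λ e → k e * (val (cop l) e * vals Ls e)) ∥ ≡⟨ ∥∥-cong (λ e → lem (k e) (+ (l ℕ.∸ 1)) (ramanujan l 1 e) (vals Ls e)) ⟩
        ∥ (λ e → + (l ℕ.∸ 1) * a e - b e) ∥           ≤⟨ ∥-∥ (λ e → + (l ℕ.∸ 1) * a e) b ⟩
        ∥ (λ e → + (l ℕ.∸ 1) * a e) ∥ ℕ.+ ∥ b ∥       ≡⟨ cong (ℕ._+ ∥ b ∥) (∥*∥ (l ℕ.∸ 1) a) ⟩
        (l ℕ.∸ 1) ℕ.* ∥ a ∥ ℕ.+ ∥ b ∥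
          ≤⟨ ℕP.+-mono-≤ (ℕP.*-monoʳ-≤ (l ℕ.∸ 1) same) (times {m′ = l} (ram₁ 2≤l l∣N) (ramanujan-periodic l 1 (1∣ l))) ⟩
        err dir φ (cop l ∷ Ls)                        ∎
        where
        open ℕP.≤-Reasoning
        a b : ℕ → ℤ
        a e = k e * vals Ls e
        b e = k e * ramanujan l 1 e * vals Ls e
        lem : ∀ k l x v → k * ((l - x) * v) ≡ l * (k * v) - k * x * v
        lem = solve-∀
      go (div l) 2≤l l∣N refl = begin
        ∥ (λ e → k e * (val (div l) e * vals Ls e)) ∥ ≡⟨ ∥∥-cong (λ e → lem (k e) (ramanujan l 1 e) (vals Ls e)) ⟩
        ∥ (λ e → a e + b e) ∥                         ≤⟨ ∥+∥ a b ⟩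
        ∥ a ∥ ℕ.+ ∥ b ∥
          ≤⟨ ℕP.+-mono-≤ same (times {m′ = l} (ram₁ 2≤l l∣N) (ramanujan-periodic l 1 (1∣ l))) ⟩
        err dir φ (div l ∷ Ls)                        ∎
        where
        open ℕP.≤-Reasoning
        a b : ℕ → ℤ
        a e = k e * vals Ls e
        b e = k e * ramanujan l 1 e * vals Ls e
        lem : ∀ k x v → k * ((1ℤ + x) * v) ≡ k * v + k * x * v
        lem = solve-∀

    err₀-bound : ∀ Ls → Admissible N Ls → ∥ (λ e → vals Ls e - + leads Ls) ∥ ℕ.≤ err₀ Ls
    err₀-bound [] [] = ℕP.≤-reflexive (trans (cong (λ z → s ℕ.* ∣ z ∣) (∑-0 q)) (ℕP.*-zeroʳ s))
    err₀-bound (two ∷ Ls) (adm _ 4∣N cL A) = begin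
      ∥ (λ e → val two e * vals Ls e - + (1 ℕ.* leads Ls)) ∥
        ≡⟨ ∥∥-cong (λ e → trans (cong (λ z → val two e * vals Ls e - z) (pos-* 1 (leads Ls))) (lem (ramanujan 2 1 e) (ramanujan 4 2 e) (vals Ls e) (+ leads Ls))) ⟩
      ∥ (λ e → a e + (b e - d e)) ∥             ≤⟨ ∥+∥ a (λ e → b e - d e) ⟩
      ∥ a ∥ ℕ.+ ∥ (λ e → b e - d e) ∥           ≤⟨ ℕP.+-monoʳ-≤ ∥ a ∥ (∥-∥ b d) ⟩
      ∥ a ∥ ℕ.+ (∥ b ∥ ℕ.+ ∥ d ∥)
        ≤⟨ ℕP.+-mono-≤ (err₀-bound Ls A) (ℕP.+-mono-≤
             (err-bound Ls (ram₂ 4∣N) (dir₁ {2} (ramanujan-periodic 2 1 (1∣ 2))) cL A)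
             (err-bound Ls (ram₄ 4∣N) (dir₁ {4} (ramanujan-periodic 4 2 (divides 2 refl))) cL A)) ⟩
      err₀ (two ∷ Ls)                           ∎
      where
      open ℕP.≤-Reasoning
      a b d : ℕ → ℤ
      a e = vals Ls e - + leads Ls
      b e = ramanujan 2 1 e * vals Ls e
      d e = ramanujan 4 2 e * vals Ls e
      lem : ∀ x y v m → (1ℤ + (x - y)) * v - 1ℤ * m ≡ (v - m) + (x * v - y * v)
      lem = solve-∀
    err₀-bound (cop l ∷ Ls) (adm 2≤l l∣N cL A) = begin
      ∥ (λ e → val (cop l) e * vals Ls e - + ((l ℕ.∸ 1) ℕ.* leads Ls)) ∥
        ≡⟨ ∥∥-cong (λ e → trans (cong (λ z → val (cop l) e * vals Ls e - z) (pos-* (l ℕ.∸ 1) (leads Ls))) (lem (+ (l ℕ.∸ 1)) (ramanujan l 1 e) (vals Ls e) (+ leads Ls))) ⟩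
      ∥ (λ e → + (l ℕ.∸ 1) * a e - b e) ∥       ≤⟨ ∥-∥ (λ e → + (l ℕ.∸ 1) * a e) b ⟩
      ∥ (λ e → + (l ℕ.∸ 1) * a e) ∥ ℕ.+ ∥ b ∥   ≡⟨ cong (ℕ._+ ∥ b ∥) (∥*∥ (l ℕ.∸ 1) a) ⟩
      (l ℕ.∸ 1) ℕ.* ∥ a ∥ ℕ.+ ∥ b ∥
        ≤⟨ ℕP.+-mono-≤ (ℕP.*-monoʳ-≤ (l ℕ.∸ 1) (err₀-bound Ls A)) (err-bound Ls (ram₁ 2≤l l∣N) (dir₁ {l} (ramanujan-periodic l 1 (1∣ l))) cL A) ⟩
      err₀ (cop l ∷ Ls)                         ∎
      where
      open ℕP.≤-Reasoning
      a b : ℕ → ℤ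
      a e = vals Ls e - + leads Ls
      b e = ramanujan l 1 e * vals Ls e
      lem : ∀ l x v m → (l - x) * v - l * m ≡ l * (v - m) - x * v
      lem = solve-∀
    err₀-bound (div l ∷ Ls) (adm 2≤l l∣N cL A) = begin
      ∥ (λ e → val (div l) e * vals Ls e - + (1 ℕ.* leads Ls)) ∥
        ≡⟨ ∥∥-cong (λ e → trans (cong (λ z → val (div l) e * vals Ls e - z) (pos-* 1 (leads Ls))) (lem (ramanujan l 1 e) (vals Ls e) (+ leads Ls))) ⟩
      ∥ (λ e → a e + b e) ∥                     ≤⟨ ∥+∥ a b ⟩
      ∥ a ∥ ℕ.+ ∥ b ∥
        ≤⟨ ℕP.+-mono-≤ (err₀-bound Ls A) (err-bound Ls (ram₁ 2≤l l∣N) (dir₁ {l} (ramanujan-periodic l 1 (1∣ l))) cL A) ⟩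
      err₀ (div l ∷ Ls)                         ∎
      where
      open ℕP.≤-Reasoning
      a b : ℕ → ℤ
      a e = vals Ls e - + leads Ls
      b e = ramanujan l 1 e * vals Ls e
      lem : ∀ x v m → (1ℤ + x) * v - 1ℤ * m ≡ (v - m) + x * v
      lem = solve-∀

    ∑vals-≤ : ∀ Ls → Admissible N Ls → + s * ∑ q (vals Ls ∘ T) ≤ + (s ℕ.* q ℕ.* leads Ls ℕ.+ err₀ Ls)
    ∑vals-≥ : ∀ Ls → Admissible N Ls → + (s ℕ.* q ℕ.* leads Ls) - + err₀ Ls ≤ + s * ∑ q (vals Ls ∘ T)

    private
      deviation : ∀ Ls → + s * ∑ q (vals Ls ∘ T) ≡ + (s ℕ.* q ℕ.* leads Ls) + + s * ∑ q (λ i → vals Ls (T i) - + leads Ls)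
      deviation Ls = sym (begin
        + (s ℕ.* q ℕ.* leads Ls) + + s * ∑ q (λ i → vals Ls (T i) - + leads Ls)
          ≡⟨ cong₂ _+_ (trans (pos-* (s ℕ.* q) (leads Ls)) (cong (_* + leads Ls) (pos-* s q)))
                       (cong (+ s *_) (trans (∑-- q (vals Ls ∘ T) (λ _ → + leads Ls)) (cong (λ z → ∑ q (vals Ls ∘ T) - z) (∑-const q (+ leads Ls))))) ⟩
        + s * + q * + leads Ls + + s * (∑ q (vals Ls ∘ T) - + q * + leads Ls) ≡⟨ lem (+ s) (+ q) (+ leads Ls) (∑ q (vals Ls ∘ T)) ⟩
        + s * ∑ q (vals Ls ∘ T) ∎)
        where
        open ≡-Reasoning
        lem : ∀ s q m x → s * q * m + s * (x - q * m) ≡ s * x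
        lem = solve-∀
      abs≤ : ∀ x n → ∣ x ∣ ℕ.≤ n → x ≤ + n
      abs≤ (+ m)    n p = +≤+ p
      abs≤ -[1+ m ] n p = -≤+
      s*abs : ∀ Ls → Admissible N Ls → ∣ + s * ∑ q (λ i → vals Ls (T i) - + leads Ls) ∣ ℕ.≤ err₀ Ls
      s*abs Ls A = ℕP.≤-trans (ℕP.≤-reflexive (abs-* (+ s) (∑ q (λ i → vals Ls (T i) - + leads Ls)))) (err₀-bound Ls A)

    ∑vals-≤ Ls A = ≤-trans (≤-reflexive (deviation Ls))
      (≤-trans (+-monoʳ-≤ (+ (s ℕ.* q ℕ.* leads Ls)) (abs≤ (+ s * ∑ q (λ i → vals Ls (T i) - + leads Ls)) (err₀ Ls) (s*abs Ls A)))
               (≤-reflexive (sym (pos-+ (s ℕ.* q ℕ.* leads Ls) (err₀ Ls)))))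
    ∑vals-≥ Ls A = ≤-trans (+-monoʳ-≤ (+ (s ℕ.* q ℕ.* leads Ls))
        (subst (- + err₀ Ls ≤_) (neg-involutive (+ s * D)) (neg-mono-≤ (abs≤ (- (+ s * D)) (err₀ Ls) (subst (ℕ._≤ err₀ Ls) (sym (∣-i∣≡∣i∣ (+ s * D))) (s*abs Ls A))))))
      (≤-reflexive (sym (deviation Ls)))
      where D = ∑ q (λ i → vals Ls (T i) - + leads Ls)

-- The weighted sieve and three estimates for its sieved terms

module Sieve where

  open import Data.Nat as ℕ using (ℕ; zero; suc; s≤s; z≤n; NonZero)
  import Data.Nat.Properties as ℕP
  open import Data.Nat.Divisibility using (_∣_; _∣?_; ∣1⇒≡1)
  open import Data.Nat.Primality using (Prime; prime⇒irreducible; prime⇒nonTrivial)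
  open import Data.Nat.Coprimality using (Coprime) renaming (sym to coprime-sym)
  import Data.Nat.Tactic.RingSolver as ℕR
  open import Data.Integer hiding (suc; NonZero; ∣_∣)
  open import Data.Integer.Properties
  open import Data.Integer.Tactic.RingSolver using (solve-∀)
  open import Data.Bool using (true; false; if_then_else_)
  open import Data.List using (List; []; _∷_; map; _++_)
  open import Data.List.Relation.Unary.All as All using (All; []; _∷_)
  import Data.List.Relation.Unary.All.Properties as AllP
  open import Data.List.Relation.Unary.AllPairs using ([]; _∷_)
  open import Data.List.Relation.Unary.Unique.Propositional using (Unique)
  open import Data.Product using (_×_; _,_; proj₁; proj₂; ∃-syntax)
  open import Data.Sum using (inj₁; inj₂)
  open import Data.Unit using (tt)
  open import Data.Empty using (⊥-elim)
  open import Function using (_∘_)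
  open import Relation.Nullary using (yes; no; ¬_)
  open import Relation.Binary.PropositionalEquality
  open IntegerSums
  open Kernels
  open PointSums
  open SieveBounds

  prime≥2 : ∀ {p} → Prime p → 2 ℕ.≤ p
  prime≥2 pp = ℕ.nonTrivial⇒n>1 _ {{prime⇒nonTrivial pp}}

  primes-coprime : ∀ {p p′} → Prime p → Prime p′ → p ≢ p′ → Coprime p p′
  primes-coprime pp pp′ ne (d∣p , d∣p′) with prime⇒irreducible pp d∣p | prime⇒irreducible pp′ d∣p′
  ... | inj₁ e | _ = e
  ... | inj₂ _ | inj₁ e = e
  ... | inj₂ e | inj₂ e′ = ⊥-elim (ne (trans (sym e) e′))

  coprime-moduli : ∀ {a Ls} → All (λ L → Coprime a (modulus L)) Ls → Coprime a (moduli Ls)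
  coprime-moduli []       (_ , d∣1) = ∣1⇒≡1 d∣1
  coprime-moduli (c ∷ cs) = coprime-sym (coprime-*ˡ (coprime-sym c) (coprime-sym (coprime-moduli cs)))

  coprime-cops : ∀ {a M} → All (Coprime a) M → All (λ L → Coprime a (modulus L)) (map cop M)
  coprime-cops []       = []
  coprime-cops (c ∷ cs) = c ∷ coprime-cops cs

  coprime-4 : ∀ {l} → Coprime 2 l → Coprime 4 l
  coprime-4 c = coprime-*ˡ {2} {2} c c

  coprime-others : ∀ {p M} → Prime p → All Prime M → All (p ≢_) M → All (Coprime p) M
  coprime-others pp []         []         = []
  coprime-others pp (pp′ ∷ ps) (ne ∷ nes) = primes-coprime pp pp′ ne ∷ coprime-others pp ps nes

  admissible-cops : ∀ {n M} → All Prime M → All (_∣ n) M → Unique M → Admissible n (map cop M)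
  admissible-cops []         []         []        = []
  admissible-cops (pp ∷ pps) (p∣n ∷ d) (p∉ ∷ u) = adm (prime≥2 pp) p∣n
    (coprime-moduli (coprime-cops (coprime-others pp pps p∉)))
    (admissible-cops pps d u)

  sumOver : List ℕ → (ℕ → ℤ) → ℤ
  sumOver []       f = 0ℤ
  sumOver (x ∷ xs) f = f x + sumOver xs f

  ∑-sumOver : ∀ n P (f : ℕ → ℕ → ℤ) → ∑ n (λ i → sumOver P (f i)) ≡ sumOver P (λ l → ∑ n (λ i → f i l))
  ∑-sumOver n []      f = ∑-0 n
  ∑-sumOver n (l ∷ P) f = trans (∑-+ n (λ i → f i l) (λ i → sumOver P (f i))) (cong (λ z → ∑ n (λ i → f i l) + z) (∑-sumOver n P f))

  sumOver-*ˡ : ∀ P c (f : ℕ → ℤ) → sumOver P (λ l → c * f l) ≡ c * sumOver P f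
  sumOver-*ˡ []      c f = sym (*-zeroʳ c)
  sumOver-*ˡ (l ∷ P) c f = trans (cong (λ z → c * f l + z) (sumOver-*ˡ P c f)) (sym (*-distribˡ-+ c (f l) (sumOver P f)))

  sumℕ : List ℕ → (ℕ → ℕ) → ℕ
  sumℕ []       u = 0
  sumℕ (x ∷ xs) u = u x ℕ.+ sumℕ xs u

  sumOver-≤ : ∀ {P f u} → All (λ l → f l ≤ + u l) P → sumOver P f ≤ + sumℕ P u
  sumOver-≤ []       = ≤-refl
  sumOver-≤ (p ∷ ps) = +-mono-≤ p (sumOver-≤ ps)

  sumOver-𝟙 : ∀ P e → 0ℤ ≤ sumOver P (λ l → 𝟙 l e)
  sumOver-𝟙 []      e = ≤-refl
  sumOver-𝟙 (l ∷ P) e = +-mono-≤ (⟦⟧-≥0 (l ∣? e)) (sumOver-𝟙 P e)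

  sumOver-𝟙<1 : ∀ P e → sumOver P (λ l → 𝟙 l e) < 1ℤ → All (λ l → ¬ l ∣ e) P
  sumOver-𝟙<1 []      e lt = []
  sumOver-𝟙<1 (l ∷ P) e lt with l ∣? e
  ... | yes _ = ⊥-elim (<-irrefl {1ℤ} refl (≤-<-trans (+-monoʳ-≤ 1ℤ (sumOver-𝟙 P e)) lt))
  ... | no ¬d = ¬d ∷ sumOver-𝟙<1 P e (subst (_< 1ℤ) (+-identityˡ (sumOver P (λ l → 𝟙 l e))) lt)

  ∑-positive : ∀ n (f : ℕ → ℤ) → 0ℤ < ∑ n f → ∃[ i ] (i ℕ.< n × 0ℤ < f i)
  ∑-positive zero    f lt = ⊥-elim (<-irrefl refl lt)
  ∑-positive (suc n) f lt with 0ℤ <? f n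
  ... | yes p = n , ℕP.≤-refl , p
  ... | no ¬p with ∑-positive n f (<-≤-trans lt (subst (∑ n f + f n ≤_) (+-identityʳ (∑ n f)) (+-monoʳ-≤ (∑ n f) (≮⇒≥ ¬p))))
  ...   | i , i<n , p = i , ℕP.m≤n⇒m≤1+n i<n , p

  positive-factors : ∀ {a b} → 0ℤ ≤ a → 0ℤ < a * b → a ≢ 0ℤ × 0ℤ < b
  positive-factors {a} {b} 0≤a lt = (λ { refl → <-irrefl refl (subst (0ℤ <_) (*-zeroˡ b) lt) })
    , *-cancelˡ-<-nonNeg a {{nonNegative 0≤a}} (subst (_< a * b) (sym (*-zeroʳ a)) lt)

  -- Odd primes are divided into two sets: those in M are imposed exactly by weights, while the
  -- others are removed by a union bound. Weights multiply the number of characters, the union bound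
  -- loses about 1/l of the points.
  core : List ℕ → List Local
  core M = two ∷ map cop M

  core≥1 : ∀ {M} → All (1 ℕ.≤_) M → All Positive≥ (core M)
  core≥1 ps = tt ∷ go ps
    where go : ∀ {M} → All (1 ℕ.≤_) M → All Positive≥ (map cop M)
          go []       = []
          go (p ∷ ps) = p ∷ go ps

  vals-core≢0 : ∀ {M} e → All (1 ℕ.≤_) M → vals (core M) e ≢ 0ℤ → 2 ∣ e × ¬ 4 ∣ e × All (λ l → ¬ l ∣ e) M
  vals-core≢0 {M} e ps ne = two-part (proj₁ factors) .proj₁ , two-part (proj₁ factors) .proj₂ , go ps (proj₂ factors)
    where
    split : ∀ {a b} → a * b ≢ 0ℤ → a ≢ 0ℤ × b ≢ 0ℤ
    split {a} {b} ne = (λ { refl → ne (*-zeroˡ b) }) , (λ { refl → ne (*-zeroʳ a) })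
    factors = split {val two e} {vals (map cop M) e} ne
    two-part : val two e ≢ 0ℤ → 2 ∣ e × ¬ 4 ∣ e
    two-part ne′ = lem (ne′ ∘ trans (val-two e))
      where
      lem : + 4 * (𝟙 2 e - 𝟙 4 e) ≢ 0ℤ → 2 ∣ e × ¬ 4 ∣ e
      lem n with 2 ∣? e | 4 ∣? e
      ... | yes p | no ¬p = p , ¬p
      ... | yes _ | yes _ = ⊥-elim (n refl)
      ... | no ¬2 | yes p = ⊥-elim (¬2 (4∣⇒2∣ p))
      ... | no _  | no _  = ⊥-elim (n refl)
    go : ∀ {M} → All (1 ℕ.≤_) M → vals (map cop M) e ≢ 0ℤ → All (λ l → ¬ l ∣ e) M
    go []       _ = []
    go {l ∷ M} (p ∷ ps) n with split {val (cop l) e} {vals (map cop M) e} n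
    ... | n₁ , n₂ = (λ l∣e → n₁ (trans (val-cop l p e) (trans (cong (λ z → + l * (1ℤ - z)) (⟦⟧-yes (l ∣? e) l∣e)) (*-zeroʳ (+ l))))) ∷ go ps n₂

  productℕ : List ℕ → ℕ
  productℕ []       = 1
  productℕ (x ∷ xs) = x ℕ.* productℕ xs

  -- An upper bound for Σ_{u<n} Π_{p∈M} p[p∤u], divided by n, using only the p dividing n.
  avoid : ℕ → List ℕ → ℕ
  avoid n []      = 1
  avoid n (p ∷ M) = (if p ∣ᵇ n then p ℕ.∸ 1 else p) ℕ.* avoid n M

  -- If 4 does not divide n, classes modulo n cannot express t ≡ 2 (mod 4). The condition is then
  -- weakened to 2 ∣ t, and `two` is at most twice `div 2`.
  parity : ℕ → ℕ
  parity n = if 4 ∣ᵇ n then 1 else 2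

  module _ {r : ℕ} {T : ℕ → ℕ} .{{_ : NonZero r}} (L : LineLogs r T) where
    open LineLogs L

    HitsGood : List ℕ → Set
    HitsGood P = ∃[ i ] (i ℕ.< q × 2 ∣ T i × ¬ 4 ∣ T i × All (λ l → ¬ l ∣ T i) P)

    module _ (4∣N : 4 ∣ N) (2∣q+1 : 2 ∣ q+1) (2∣r : 2 ∣ r) {M : List ℕ}
             (primes : All Prime M) (odd : All (Coprime 2) M) (div-N : All (_∣ N) M) (unique : Unique M) where

      M≥1 : All (1 ℕ.≤_) M
      M≥1 = All.map (λ pp → ℕP.≤-trans (s≤s z≤n) (prime≥2 pp)) primes

      core-admissible : Admissible N (core M)
      core-admissible = adm tt 4∣N (coprime-moduli {4} {map cop M} (coprime-cops (All.map coprime-4 odd))) (admissible-cops primes div-N unique)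

      C : ℕ → ℤ
      C = vals (core M)

      C≥0 : ∀ e → 0ℤ ≤ C e
      C≥0 = vals≥0 (core≥1 M≥1)

      -- the weighted number of points divisible by l
      X : ℕ → ℤ
      X l = ∑ q (λ i → C (T i) * 𝟙 l (T i))

      -- The hypothesis makes the sum of C(t)(1 - number of l in P dividing t) over the logarithms t
      -- positive, so some term is positive. As C is nonnegative, there C(t) ≠ 0, and no l in P
      -- divides t.
      sieve : ∀ {P} → sumOver P X < ∑ q (C ∘ T) → HitsGood (M ++ P)
      sieve {P} lt = finish (∑-positive q unsieved (subst (0ℤ <_) (sym total) (positive-difference lt)))
        where
        unsieved : ℕ → ℤ
        unsieved i = C (T i) * (1ℤ - sumOver P (λ l → 𝟙 l (T i)))
        positive-difference : ∀ {a b} → a < b → 0ℤ < b - a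
        positive-difference {a} {b} a<b = subst (_< b - a) (+-inverseʳ a) (+-monoˡ-< (- a) a<b)
        open ≡-Reasoning
        lem : ∀ c x → c * (1ℤ - x) ≡ c - c * x
        lem = solve-∀
        total : ∑ q unsieved ≡ ∑ q (C ∘ T) - sumOver P X
        total = begin
          ∑ q unsieved
            ≡⟨ ∑-cong q (λ i → trans (lem (C (T i)) (sumOver P (λ l → 𝟙 l (T i)))) (cong (λ z → C (T i) - z) (sym (sumOver-*ˡ P (C (T i)) (λ l → 𝟙 l (T i)))))) ⟩
          ∑ q (λ i → C (T i) - sumOver P (λ l → C (T i) * 𝟙 l (T i))) ≡⟨ ∑-- q (C ∘ T) (λ i → sumOver P (λ l → C (T i) * 𝟙 l (T i))) ⟩
          ∑ q (C ∘ T) - ∑ q (λ i → sumOver P (λ l → C (T i) * 𝟙 l (T i))) ≡⟨ cong (λ z → ∑ q (C ∘ T) - z) (∑-sumOver q P (λ i l → C (T i) * 𝟙 l (T i))) ⟩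
          ∑ q (C ∘ T) - sumOver P X ∎
        drop : ∀ {x} → 0ℤ < 1ℤ - x → x < 1ℤ
        drop {x} p = subst₂ _<_ (+-identityˡ x) (cancel x) (+-monoˡ-< x p)
          where cancel : ∀ x → 1ℤ - x + x ≡ 1ℤ
                cancel = solve-∀
        good : ∀ i → C (T i) ≢ 0ℤ × 0ℤ < 1ℤ - sumOver P (λ l → 𝟙 l (T i)) → 2 ∣ T i × ¬ 4 ∣ T i × All (λ l → ¬ l ∣ T i) (M ++ P)
        good i (C≢0 , pos) = proj₁ c , proj₁ (proj₂ c) , AllP.++⁺ (proj₂ (proj₂ c)) (sumOver-𝟙<1 P (T i) (drop pos))
          where c = vals-core≢0 {M} (T i) M≥1 C≢0
        finish : ∃[ i ] (i ℕ.< q × 0ℤ < unsieved i) → HitsGood (M ++ P)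
        finish (i , i<q , pos) = i , i<q , good i (positive-factors (C≥0 (T i)) pos)

      module _ {s R : ℕ} .{{_ : NonZero s}} (s²q≤R² : s ℕ.* s ℕ.* q ℕ.≤ R ℕ.* R) where
        open Error q+1 s R

        sieve-criterion : ∀ {P} (u : ℕ → ℕ) → All (λ l → X l ≤ + u l) P →
          s ℕ.* sumℕ P u ℕ.+ err₀ (core M) ℕ.< s ℕ.* q ℕ.* leads (core M) → HitsGood (M ++ P)
        sieve-criterion {P} u le lt = sieve (≤-<-trans (sumOver-≤ le) (*-cancelˡ-<-nonNeg (+ s) (begin-strict
          + s * + sumℕ P u                                       ≡⟨ sym (pos-* s (sumℕ P u)) ⟩
          + (s ℕ.* sumℕ P u)                                     ≡⟨ lem (+ (s ℕ.* sumℕ P u)) (+ err₀ (core M)) ⟩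
          (+ (s ℕ.* sumℕ P u) + + err₀ (core M)) - + err₀ (core M) <⟨ +-monoˡ-< (- + err₀ (core M)) (+<+ lt) ⟩
          + (s ℕ.* q ℕ.* leads (core M)) - + err₀ (core M)       ≤⟨ ∑vals-≥ L {s} {R} s²q≤R² (core M) core-admissible ⟩
          + s * ∑ q (C ∘ T)                                      ∎)))
          where
          open ≤-Reasoning
          lem : ∀ a b → a ≡ (a + b) - b
          lem = solve-∀

        module _ {l : ℕ} (pl : Prime l) (2⊥l : Coprime 2 l) (l∣N : l ∣ N) where

          X-bound : All (l ≢_) M → + s * (+ l * X l) ≤ + (s ℕ.* q ℕ.* leads (core M) ℕ.+ err₀ (div l ∷ core M))
          X-bound l∉M = ≤-trans (≤-reflexive (cong (+ s *_) (trans (sym (∑-*ˡ q (+ l) (λ i → C (T i) * 𝟙 l (T i))))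
              (∑-cong q λ i → trans (lem (+ l) (C (T i)) (𝟙 l (T i))) (cong (_* C (T i)) (sym (val-div l (T i))))))))
            (≤-trans (∑vals-≤ L {s} {R} s²q≤R² (div l ∷ core M) (adm (prime≥2 pl) l∣N
              (coprime-moduli {l} {core M} (coprime-sym (coprime-4 2⊥l) ∷ coprime-cops (coprime-others pl primes l∉M))) core-admissible))
              (≤-reflexive (cong (λ z → + (s ℕ.* q ℕ.* z ℕ.+ err₀ (div l ∷ core M))) (ℕP.*-identityˡ (leads (core M))))))
            where lem : ∀ l c x → l * (c * x) ≡ l * x * c
                  lem = solve-∀

          cops≤ : ∀ {M} → All (1 ℕ.≤_) M → ∀ e → vals (map cop M) e ≤ + productℕ M
          cops≤ []                e = ≤-refl
          cops≤ {p ∷ M} (1≤ ∷ ps) e = ≤-trans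
            (*-mono {val (cop p) e} {+ p} {vals (map cop M) e} {+ productℕ M} (val≥0 (cop p) 1≤ e) (+≤+ z≤n) (≤-trans (≤-reflexive (val-cop p 1≤ e))
               (≤-trans (*-monoˡ-≤-nonNeg (+ p) (≤1 (⟦⟧-≥0 (p ∣? e)))) (≤-reflexive (*-identityʳ (+ p))))) (cops≤ ps e))
            (≤-reflexive (sym (pos-* p (productℕ M))))
            where ≤1 : ∀ {x} → 0ℤ ≤ x → 1ℤ - x ≤ 1ℤ
                  ≤1 {x} p = +-monoʳ-≤ 1ℤ (neg-mono-≤ p)

          -- Weights at primes of M are replaced by their maxima, so only characters of orders built
          -- from 4 and l remain. The main term grows by the factors p/(p - 1), but characters
          -- belonging to M no longer add to the error.
          X-bound₂ : + s * (+ l * X l) ≤ + (productℕ M ℕ.* (s ℕ.* q ℕ.+ err₀ (div l ∷ two ∷ [])))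
          X-bound₂ = begin
            + s * (+ l * X l) ≡⟨ cong (+ s *_) (sym (∑-*ˡ q (+ l) (λ i → C (T i) * 𝟙 l (T i)))) ⟩
            + s * ∑ q (λ i → + l * (C (T i) * 𝟙 l (T i))) ≤⟨ *-monoˡ-≤-nonNeg (+ s) (∑-mono q λ i _ → term (T i)) ⟩
            + s * ∑ q (λ i → + productℕ M * vals (div l ∷ two ∷ []) (T i)) ≡⟨ cong (+ s *_) (∑-*ˡ q (+ productℕ M) (vals (div l ∷ two ∷ []) ∘ T)) ⟩
            + s * (+ productℕ M * ∑ q (vals (div l ∷ two ∷ []) ∘ T)) ≡⟨ comm (+ s) (+ productℕ M) (∑ q (vals (div l ∷ two ∷ []) ∘ T)) ⟩
            + productℕ M * (+ s * ∑ q (vals (div l ∷ two ∷ []) ∘ T))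
              ≤⟨ *-monoˡ-≤-nonNeg (+ productℕ M) (∑vals-≤ L {s} {R} s²q≤R² (div l ∷ two ∷ []) (adm (prime≥2 pl) l∣N (coprime-moduli {l} {two ∷ []} (coprime-sym (coprime-4 2⊥l) ∷ [])) (adm tt 4∣N (coprime-moduli {4} {[]} []) []))) ⟩
            + productℕ M * + (s ℕ.* q ℕ.* 1 ℕ.+ err₀ (div l ∷ two ∷ [])) ≡⟨ sym (pos-* (productℕ M) (s ℕ.* q ℕ.* 1 ℕ.+ err₀ (div l ∷ two ∷ []))) ⟩
            + (productℕ M ℕ.* (s ℕ.* q ℕ.* 1 ℕ.+ err₀ (div l ∷ two ∷ []))) ≡⟨ cong (λ z → + (productℕ M ℕ.* (z ℕ.+ err₀ (div l ∷ two ∷ [])))) (ℕP.*-identityʳ (s ℕ.* q)) ⟩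
            + (productℕ M ℕ.* (s ℕ.* q ℕ.+ err₀ (div l ∷ two ∷ []))) ∎
            where
            open ≤-Reasoning
            comm : ∀ a b c → a * (b * c) ≡ b * (a * c)
            comm = solve-∀
            re : ∀ l t m x → l * (t * m * x) ≡ m * (l * x * t)
            re = solve-∀
            term : ∀ e → + l * (C e * 𝟙 l e) ≤ + productℕ M * vals (div l ∷ two ∷ []) e
            term e = begin
              + l * (val two e * vals (map cop M) e * 𝟙 l e) ≡⟨ re (+ l) (val two e) (vals (map cop M) e) (𝟙 l e) ⟩
              vals (map cop M) e * (+ l * 𝟙 l e * val two e)
                ≤⟨ *-monoʳ-≤-nonNeg (+ l * 𝟙 l e * val two e) {{nonNegative (0≤* {+ l * 𝟙 l e} {val two e} (0≤* {+ l} {𝟙 l e} (+≤+ z≤n) (⟦⟧-≥0 (l ∣? e))) (val≥0 two tt e))}} (cops≤ M≥1 e) ⟩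
              + productℕ M * (+ l * 𝟙 l e * val two e)       ≡⟨ cong₂ (λ a b → + productℕ M * (a * b)) (sym (val-div l e)) (sym (*-identityʳ (val two e))) ⟩
              + productℕ M * vals (div l ∷ two ∷ []) e       ∎

      module _ {l : ℕ} (pl : Prime l) (2⊥l : Coprime 2 l) (l∉M : All (l ≢_) M)
               (n mult : ℕ) .{{_ : NonZero n}} (2∣n : 2 ∣ n) (l∣n : l ∣ n)
               (hits : ∀ u → ∑ q (λ i → 𝟙 n (T i ℕ.+ u)) ≤ + mult) where

        private
          -- Modulo n only primes dividing n can be seen. `kept` retains these; for the other primes
          -- `factor` collects the maximum p of the weight.
          kept : List ℕ → List ℕ
          kept []      = []
          kept (p ∷ M) = if p ∣ᵇ n then p ∷ kept M else kept M

          factor : List ℕ → ℕ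
          factor []      = 1
          factor (p ∷ M) = (if p ∣ᵇ n then 1 else p) ℕ.* factor M

          kept-All : ∀ {Q : ℕ → Set} {M} → All Q M → All Q (kept M)
          kept-All []            = []
          kept-All {M = p ∷ M} (x ∷ xs) with p ∣ᵇ n
          ... | true  = x ∷ kept-All xs
          ... | false = kept-All xs

          kept-∣ : ∀ M → All (_∣ n) (kept M)
          kept-∣ []      = []
          kept-∣ (p ∷ M) with p ∣ᵇ n in eq
          ... | true  = ∣ᵇ⇒∣ p n eq ∷ kept-∣ M
          ... | false = kept-∣ M

          kept-unique : ∀ {M} → Unique M → Unique (kept M)
          kept-unique [] = []
          kept-unique {p ∷ M} (x ∷ u) with p ∣ᵇ n
          ... | true  = kept-All x ∷ kept-unique u
          ... | false = kept-unique u

          cops≤kept : ∀ {M} → All (1 ℕ.≤_) M → ∀ e → vals (map cop M) e ≤ + factor M * vals (map cop (kept M)) e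
          cops≤kept [] e = ≤-refl
          cops≤kept {p ∷ M} (1≤ ∷ ps) e with p ∣ᵇ n
          ... | true  = ≤-trans (*-monoˡ-≤-nonNeg (val (cop p) e) {{nonNegative (val≥0 (cop p) 1≤ e)}} (cops≤kept ps e))
            (≤-reflexive (trans (lem (val (cop p) e) (+ factor M) (vals (map cop (kept M)) e)) (cong (λ z → + z * (val (cop p) e * vals (map cop (kept M)) e)) (sym (ℕP.*-identityˡ (factor M))))))
            where lem : ∀ a b c → a * (b * c) ≡ b * (a * c)
                  lem = solve-∀
          ... | false = ≤-trans (*-mono {val (cop p) e} {+ p} {vals (map cop M) e} {+ factor M * V} (val≥0 (cop p) 1≤ e) nonneg val≤p (cops≤kept ps e))
              (≤-reflexive (trans (sym (*-assoc (+ p) (+ factor M) V)) (cong (_* V) (sym (pos-* p (factor M))))))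
            where
            V = vals (map cop (kept M)) e
            nonneg : 0ℤ ≤ + factor M * V
            nonneg = 0≤* {+ factor M} {V} (+≤+ z≤n) (vals≥0 (All.tail (core≥1 (kept-All ps))) e)
            val≤p : val (cop p) e ≤ + p
            val≤p = ≤-trans (≤-reflexive (val-cop p 1≤ e)) (≤-trans (*-monoˡ-≤-nonNeg (+ p) (+-monoʳ-≤ 1ℤ (neg-mono-≤ (⟦⟧-≥0 (p ∣? e))))) (≤-reflexive (*-identityʳ (+ p))))

          avoid≡ : ∀ M → factor M ℕ.* leads (map cop (kept M)) ≡ avoid n M
          avoid≡ [] = refl
          avoid≡ (p ∷ M) with p ∣ᵇ n
          ... | true  = trans (lem (factor M) (p ℕ.∸ 1) (leads (map cop (kept M)))) (cong ((p ℕ.∸ 1) ℕ.*_) (avoid≡ M))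
            where lem : ∀ a b c → 1 ℕ.* a ℕ.* (b ℕ.* c) ≡ b ℕ.* (a ℕ.* c)
                  lem = ℕR.solve-∀
          ... | false = trans (ℕP.*-assoc p (factor M) (leads (map cop (kept M)))) (cong (p ℕ.*_) (avoid≡ M))

          twoPart : Local
          twoPart = if 4 ∣ᵇ n then two else div 2

          twoPart-lead : lead twoPart ≡ 1
          twoPart-lead with 4 ∣ᵇ n
          ... | true  = refl
          ... | false = refl

          twoPart-⊥ : ∀ {l} → Coprime 2 l → Coprime (modulus twoPart) l
          twoPart-⊥ c with 4 ∣ᵇ n
          ... | true  = coprime-4 c
          ... | false = c

          twoPart-∣ : modulus twoPart ∣ n
          twoPart-∣ with 4 ∣ᵇ n in eq
          ... | true  = ∣ᵇ⇒∣ 4 n eq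
          ... | false = 2∣n

          twoPart-≥2 : ≥2 twoPart
          twoPart-≥2 with 4 ∣ᵇ n
          ... | true  = tt
          ... | false = ℕP.≤-refl

          twoPart-≥1 : Positive≥ twoPart
          twoPart-≥1 with 4 ∣ᵇ n
          ... | true  = tt
          ... | false = tt

          two≤twoPart : ∀ e → val two e ≤ + parity n * val twoPart e
          two≤twoPart e with 4 ∣ᵇ n
          ... | true  = ≤-reflexive (sym (*-identityˡ (val two e)))
          ... | false = ≤-trans (≤-reflexive (val-two e)) (≤-trans
            (*-monoˡ-≤-nonNeg (+ 4) (+-monoʳ-≤ (𝟙 2 e) (neg-mono-≤ (⟦⟧-≥0 (4 ∣? e)))))
            (≤-reflexive (trans (lem (𝟙 2 e)) (cong (+ 2 *_) (sym (val-div 2 e))))))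
            where lem : ∀ a → + 4 * (a - 0ℤ) ≡ + 2 * (+ 2 * a)
                  lem = solve-∀

          locals : List Local
          locals = div l ∷ twoPart ∷ map cop (kept M)

          locals-admissible : Admissible n locals
          locals-admissible = adm (prime≥2 pl) l∣n
            (coprime-moduli {l} {twoPart ∷ map cop (kept M)} (coprime-sym (twoPart-⊥ 2⊥l) ∷ coprime-cops (coprime-others pl (kept-All primes) (kept-All l∉M))))
            (adm twoPart-≥2 twoPart-∣ (coprime-moduli {modulus twoPart} {map cop (kept M)} (coprime-cops (All.map twoPart-⊥ (kept-All odd)))) (admissible-cops (kept-All primes) (kept-∣ M) (kept-unique unique)))

          locals≥0 : ∀ e → 0ℤ ≤ vals locals e
          locals≥0 = vals≥0 {locals} (tt ∷ twoPart-≥1 ∷ All.tail (core≥1 (kept-All M≥1)))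

        -- Once all remaining weights have periods dividing n, the sum over the line is at most
        -- `mult` times the sum over ℤ/n, and the latter is known exactly by coprimality. For small
        -- q this can beat an estimate containing √q.
        X-count : + l * X l ≤ + (mult ℕ.* n ℕ.* (parity n ℕ.* avoid n M))
        X-count = begin
          + l * X l ≡⟨ sym (∑-*ˡ q (+ l) (λ i → C (T i) * 𝟙 l (T i))) ⟩
          ∑ q (λ i → + l * (C (T i) * 𝟙 l (T i))) ≤⟨ ∑-mono q (λ i _ → term (T i)) ⟩
          ∑ q (λ i → + (parity n ℕ.* factor M) * vals locals (T i)) ≡⟨ ∑-*ˡ q (+ (parity n ℕ.* factor M)) (vals locals ∘ T) ⟩
          + (parity n ℕ.* factor M) * ∑ q (vals locals ∘ T)
            ≤⟨ *-monoˡ-≤-nonNeg (+ (parity n ℕ.* factor M)) (∑T-count L n mult hits (vals-periodic-adm locals-admissible) locals≥0) ⟩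
          + (parity n ℕ.* factor M) * (+ mult * ∑ n (vals locals)) ≡⟨ cong (λ z → + (parity n ℕ.* factor M) * (+ mult * z)) (∑-vals locals-admissible) ⟩
          + (parity n ℕ.* factor M) * (+ mult * (+ n * + leads locals))
            ≡⟨ cong (λ z → + (parity n ℕ.* factor M) * z) (trans (cong (+ mult *_) (sym (pos-* n (leads locals)))) (sym (pos-* mult (n ℕ.* leads locals)))) ⟩
          + (parity n ℕ.* factor M) * + (mult ℕ.* (n ℕ.* leads locals)) ≡⟨ sym (pos-* (parity n ℕ.* factor M) (mult ℕ.* (n ℕ.* leads locals))) ⟩
          + (parity n ℕ.* factor M ℕ.* (mult ℕ.* (n ℕ.* leads locals))) ≡⟨ cong +_ collect ⟩
          + (mult ℕ.* n ℕ.* (parity n ℕ.* avoid n M)) ∎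
          where
          open ≤-Reasoning
          collect : parity n ℕ.* factor M ℕ.* (mult ℕ.* (n ℕ.* leads locals)) ≡ mult ℕ.* n ℕ.* (parity n ℕ.* avoid n M)
          collect = trans (cong (λ z → parity n ℕ.* factor M ℕ.* (mult ℕ.* (n ℕ.* (1 ℕ.* (z ℕ.* leads (map cop (kept M))))))) twoPart-lead)
            (trans (lem (parity n) (factor M) mult n (leads (map cop (kept M)))) (cong (λ z → mult ℕ.* n ℕ.* (parity n ℕ.* z)) (avoid≡ M)))
            where lem : ∀ p f m n x → p ℕ.* f ℕ.* (m ℕ.* (n ℕ.* (1 ℕ.* (1 ℕ.* x)))) ≡ m ℕ.* n ℕ.* (p ℕ.* (f ℕ.* x))
                  lem = ℕR.solve-∀
          re : ∀ l t m x → l * (t * m * x) ≡ l * x * (t * m)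
          re = solve-∀
          re′ : ∀ p f d t k → d * (p * t * (f * k)) ≡ p * f * (d * (t * k))
          re′ = solve-∀
          term : ∀ e → + l * (C e * 𝟙 l e) ≤ + (parity n ℕ.* factor M) * vals locals e
          term e = begin
            + l * (val two e * vals (map cop M) e * 𝟙 l e) ≡⟨ re (+ l) (val two e) (vals (map cop M) e) (𝟙 l e) ⟩
            + l * 𝟙 l e * (val two e * vals (map cop M) e) ≡⟨ cong (_* (val two e * vals (map cop M) e)) (sym (val-div l e)) ⟩
            val (div l) e * (val two e * vals (map cop M) e)
              ≤⟨ *-monoˡ-≤-nonNeg (val (div l) e) {{nonNegative (val≥0 (div l) tt e)}}
                   (*-mono {val two e} {+ parity n * val twoPart e} {vals (map cop M) e} {+ factor M * vals (map cop (kept M)) e} (val≥0 two tt e) (0≤* {+ factor M} {vals (map cop (kept M)) e} (+≤+ z≤n) (vals≥0 (All.tail (core≥1 (kept-All M≥1))) e)) (two≤twoPart e) (cops≤kept M≥1 e)) ⟩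
            val (div l) e * (+ parity n * val twoPart e * (+ factor M * vals (map cop (kept M)) e))
              ≡⟨ re′ (+ parity n) (+ factor M) (val (div l) e) (val twoPart e) (vals (map cop (kept M)) e) ⟩
            + parity n * + factor M * vals locals e ≡⟨ cong (_* vals locals e) (sym (pos-* (parity n) (factor M))) ⟩
            + (parity n ℕ.* factor M) * vals locals e ∎

-- Ring identities with integer coefficients over an abstract commutative ring

module IntegerCoefficients where

  open import Level using (0ℓ)
  open import Algebra.Structures using (IsCommutativeRing)
  open import Algebra.Bundles using (CommutativeRing; RawRing)
  import Algebra.Properties.Ring as RingProperties
  import Algebra.Properties.AbelianGroup as AbelianGroupProperties
  open import Algebra.Solver.Ring.AlmostCommutativeRing using (AlmostCommutativeRing; fromCommutativeRing; _-Raw-AlmostCommutative⟶_)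
  import Algebra.Solver.Ring as RingSolver
  open import Data.Integer as ℤ using (ℤ; +_; -[1+_]; _⊖_)
  import Data.Integer.Properties as ℤP
  open import Data.Nat as ℕ using (ℕ; zero; suc)
  import Data.Nat.Properties as ℕP
  open import Data.Maybe using (Maybe; just; nothing)
  open import Relation.Nullary using (yes; no)
  open import Relation.Binary.PropositionalEquality

  -- Ring identities over an abstract ring involve cancellation, so the solver needs computing (integer) coefficients.
  module RingIdentities {A : Set} {plus times : A → A → A} {neg : A → A} {o e : A}
           (isCommutativeRing : IsCommutativeRing _≡_ plus times neg o e) where

    private
      R : CommutativeRing 0ℓ 0ℓ
      R = record { isCommutativeRing = isCommutativeRing }
      open CommutativeRing R using (_+_; _*_; -_; 0#; 1#; +-assoc; +-comm; +-identityˡ; +-identityʳ; *-identityˡ; zeroˡ; distribʳ; -‿inverseʳ)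
      open RingProperties (CommutativeRing.ring R) using (-‿distribˡ-*; -‿distribʳ-*; -‿involutive; -0#≈0#)
      open AbelianGroupProperties (CommutativeRing.+-abelianGroup R) using (⁻¹-∙-comm)

      ⟦_⟧ℕ : ℕ → A
      ⟦ zero ⟧ℕ  = 0#
      ⟦ suc n ⟧ℕ = 1# + ⟦ n ⟧ℕ

      ⟦_⟧ : ℤ → A
      ⟦ + n ⟧      = ⟦ n ⟧ℕ
      ⟦ -[1+ n ] ⟧ = - ⟦ suc n ⟧ℕ

      ℕ-+ : ∀ m n → ⟦ m ℕ.+ n ⟧ℕ ≡ ⟦ m ⟧ℕ + ⟦ n ⟧ℕ
      ℕ-+ zero    n = sym (+-identityˡ ⟦ n ⟧ℕ)
      ℕ-+ (suc m) n = trans (cong (λ z → 1# + z) (ℕ-+ m n)) (sym (+-assoc 1# ⟦ m ⟧ℕ ⟦ n ⟧ℕ))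

      ℕ-* : ∀ m n → ⟦ m ℕ.* n ⟧ℕ ≡ ⟦ m ⟧ℕ * ⟦ n ⟧ℕ
      ℕ-* zero    n = sym (zeroˡ ⟦ n ⟧ℕ)
      ℕ-* (suc m) n = trans (ℕ-+ n (m ℕ.* n)) (trans (cong₂ _+_ (sym (*-identityˡ ⟦ n ⟧ℕ)) (ℕ-* m n)) (sym (distribʳ ⟦ n ⟧ℕ 1# ⟦ m ⟧ℕ)))

      ⟦⊖⟧ : ∀ m n → ⟦ m ⊖ n ⟧ ≡ ⟦ m ⟧ℕ + - ⟦ n ⟧ℕ
      ⟦⊖⟧ m       zero    = trans (sym (+-identityʳ ⟦ m ⟧ℕ)) (cong (λ z → ⟦ m ⟧ℕ + z) (sym -0#≈0#))
      ⟦⊖⟧ zero    (suc n) = sym (+-identityˡ (- ⟦ suc n ⟧ℕ))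
      ⟦⊖⟧ (suc m) (suc n) = begin
        ⟦ suc m ⊖ suc n ⟧                       ≡⟨ cong ⟦_⟧ (ℤP.[1+m]⊖[1+n]≡m⊖n m n) ⟩
        ⟦ m ⊖ n ⟧                               ≡⟨ ⟦⊖⟧ m n ⟩
        a + - b                                 ≡⟨ cong (_+ (- b)) (sym (trans (cong (λ z → a + z) (-‿inverseʳ 1#)) (+-identityʳ a))) ⟩
        (a + (1# + - 1#)) + - b                 ≡⟨ cong (_+ (- b)) (trans (sym (+-assoc a 1# (- 1#))) (cong (_+ (- 1#)) (+-comm a 1#))) ⟩
        ((1# + a) + - 1#) + - b                 ≡⟨ +-assoc (1# + a) (- 1#) (- b) ⟩
        (1# + a) + (- 1# + - b)                 ≡⟨ cong (λ z → (1# + a) + z) (⁻¹-∙-comm 1# b) ⟩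
        (1# + a) + - (1# + b)                   ∎
        where open ≡-Reasoning
              a = ⟦ m ⟧ℕ
              b = ⟦ n ⟧ℕ

      ⟦+⟧ : ∀ i j → ⟦ i ℤ.+ j ⟧ ≡ ⟦ i ⟧ + ⟦ j ⟧
      ⟦+⟧ (+ m)    (+ n)    = ℕ-+ m n
      ⟦+⟧ (+ m)    -[1+ n ] = ⟦⊖⟧ m (suc n)
      ⟦+⟧ -[1+ m ] (+ n)    = trans (⟦⊖⟧ n (suc m)) (+-comm ⟦ n ⟧ℕ (- ⟦ suc m ⟧ℕ))
      ⟦+⟧ -[1+ m ] -[1+ n ] = trans (cong -_ (trans (cong ⟦_⟧ℕ (cong suc (sym (ℕP.+-suc m n)))) (ℕ-+ (suc m) (suc n))))
                                    (sym (⁻¹-∙-comm ⟦ suc m ⟧ℕ ⟦ suc n ⟧ℕ))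

      ⟦-⟧ : ∀ i → ⟦ ℤ.- i ⟧ ≡ - ⟦ i ⟧
      ⟦-⟧ (+ zero)  = sym -0#≈0#
      ⟦-⟧ (+ suc n) = refl
      ⟦-⟧ -[1+ n ]  = sym (-‿involutive ⟦ suc n ⟧ℕ)

      pos*⟦⟧ : ∀ m j → ⟦ + m ℤ.* j ⟧ ≡ ⟦ m ⟧ℕ * ⟦ j ⟧
      pos*⟦⟧ m (+ n)    = trans (cong ⟦_⟧ (sym (ℤP.pos-* m n))) (ℕ-* m n)
      pos*⟦⟧ m -[1+ n ] = begin
        ⟦ + m ℤ.* ℤ.- (+ suc n) ⟧   ≡⟨ cong ⟦_⟧ (sym (ℤP.neg-distribʳ-* (+ m) (+ suc n))) ⟩
        ⟦ ℤ.- (+ m ℤ.* + suc n) ⟧   ≡⟨ ⟦-⟧ (+ m ℤ.* + suc n) ⟩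
        - ⟦ + m ℤ.* + suc n ⟧       ≡⟨ cong -_ (trans (cong ⟦_⟧ (sym (ℤP.pos-* m (suc n)))) (ℕ-* m (suc n))) ⟩
        - (⟦ m ⟧ℕ * ⟦ suc n ⟧ℕ)     ≡⟨ -‿distribʳ-* ⟦ m ⟧ℕ ⟦ suc n ⟧ℕ ⟩
        ⟦ m ⟧ℕ * - ⟦ suc n ⟧ℕ       ∎
        where open ≡-Reasoning

      ⟦*⟧ : ∀ i j → ⟦ i ℤ.* j ⟧ ≡ ⟦ i ⟧ * ⟦ j ⟧
      ⟦*⟧ (+ m)    j = pos*⟦⟧ m j
      ⟦*⟧ -[1+ m ] j = begin
        ⟦ ℤ.- (+ suc m) ℤ.* j ⟧     ≡⟨ cong ⟦_⟧ (sym (ℤP.neg-distribˡ-* (+ suc m) j)) ⟩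
        ⟦ ℤ.- (+ suc m ℤ.* j) ⟧     ≡⟨ ⟦-⟧ (+ suc m ℤ.* j) ⟩
        - ⟦ + suc m ℤ.* j ⟧         ≡⟨ cong -_ (pos*⟦⟧ (suc m) j) ⟩
        - (⟦ suc m ⟧ℕ * ⟦ j ⟧)      ≡⟨ -‿distribˡ-* ⟦ suc m ⟧ℕ ⟦ j ⟧ ⟩
        (- ⟦ suc m ⟧ℕ) * ⟦ j ⟧      ∎
        where open ≡-Reasoning

      ring : AlmostCommutativeRing 0ℓ 0ℓ
      ring = fromCommutativeRing R

      coefficients : RawRing 0ℓ 0ℓ
      coefficients = record { Carrier = ℤ ; _≈_ = _≡_ ; _+_ = ℤ._+_ ; _*_ = ℤ._*_ ; -_ = ℤ.-_ ; 0# = + 0 ; 1# = + 1 }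

      morphism : coefficients -Raw-AlmostCommutative⟶ ring
      morphism = record { ⟦_⟧ = ⟦_⟧ ; +-homo = ⟦+⟧ ; *-homo = ⟦*⟧ ; -‿homo = ⟦-⟧ ; 0-homo = refl ; 1-homo = +-identityʳ 1# }

      coeff≟ : ∀ i j → Maybe (⟦ i ⟧ ≡ ⟦ j ⟧)
      coeff≟ i j with i ℤ.≟ j
      ... | yes e = just (cong ⟦_⟧ e)
      ... | no _  = nothing

    open RingSolver coefficients ring morphism coeff≟ public using (solve; con; _:=_; _:+_; _:*_; _:-_; :-_)

-- Finite fields: Fermat, roots of polynomials, primitive elements

module FiniteFields where

  open import Level using (0ℓ)
  open import Data.Nat as ℕ using (ℕ; zero; suc; s≤s; z≤n; NonZero)
  import Data.Nat.Properties as ℕP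
  open import Data.Nat.Divisibility using (_∣_; _∣?_; divides; ∣-trans; m∣m*n; n∣m*n; ∣-refl; ∣⇒≤)
  open import Data.Nat.GCD using (gcd; gcd-GCD; module Bézout; gcd[m,n]∣m; gcd[m,n]∣n)
  open import Data.Nat.Coprimality using (Coprime; coprime-divisor) renaming (sym to coprime-sym)
  open import Data.Nat.Primality using (Prime; prime⇒irreducible; prime⇒nonZero; prime⇒nonTrivial)
  open import Data.Nat.Primality.Factorisation using (factorise)
  open import Data.Nat.Induction using (<-rec)
  open import Data.Fin as Fin using (Fin)
  import Data.Fin.Properties as FinP
  open import Data.List using (List; []; _∷_; length; tabulate; applyUpTo)
  open import Data.Nat.ListAction using (product)
  open import Data.List.Properties using (length-tabulate; length-applyUpTo)
  open import Data.List.Relation.Unary.All as All using (All; []; _∷_)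
  import Data.List.Relation.Unary.All.Properties as AllP
  open import Data.List.Relation.Unary.AllPairs using ([]; _∷_)
  open import Data.List.Relation.Unary.Unique.Propositional using (Unique)
  import Data.List.Relation.Unary.Unique.Propositional.Properties as UniqueP
  open import Data.Vec using (Vec; []; _∷_; replicate)
  open import Data.Product using (_×_; _,_; proj₁; proj₂; ∃-syntax)
  open import Data.Sum using (_⊎_; inj₁; inj₂)
  open import Data.Empty using (⊥-elim)
  open import Function using (_∘_; Inverse; _↔_; mk↔ₛ′)
  open import Function.Construct.Composition using (_↔-∘_)
  open import Function.Construct.Symmetry using (↔-sym)
  open import Relation.Nullary using (yes; no; ¬_; Dec)
  open import Relation.Nullary.Decidable using (map′)
  open import Relation.Binary using (DecidableEquality)
  open import Relation.Binary.PropositionalEquality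
  open import Algebra.Bundles using (CommutativeRing; CommutativeMonoid)
  import Algebra.Properties.CommutativeMonoid.Sum as MonoidSum
  open IntegerCoefficients using (module RingIdentities)

  primeDivisor : ∀ n → n ≢ 1 → .{{_ : NonZero n}} → ∃[ p ] (Prime p × p ∣ n)
  primeDivisor n n≢1 with factorise n
  ... | record { factors = [] ; isFactorisation = e } = ⊥-elim (n≢1 e)
  ... | record { factors = p ∷ ps ; isFactorisation = e ; factorsPrime = pp ∷ _ } =
    p , pp , subst (p ∣_) (sym e) (m∣m*n (product ps))

  splitPrimePower : ∀ {p} → Prime p → ∀ n → .{{_ : NonZero n}} → ∃[ k ] ∃[ c ] (n ≡ p ℕ.^ k ℕ.* c × ¬ p ∣ c)
  splitPrimePower {p} pp n = <-rec (λ n → n ≢ 0 → ∃[ k ] ∃[ c ] (n ≡ p ℕ.^ k ℕ.* c × ¬ p ∣ c)) step n (ℕ.≢-nonZero⁻¹ n)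
    where
    step : ∀ n → (∀ {m} → m ℕ.< n → m ≢ 0 → ∃[ k ] ∃[ c ] (m ≡ p ℕ.^ k ℕ.* c × ¬ p ∣ c)) → n ≢ 0 → ∃[ k ] ∃[ c ] (n ≡ p ℕ.^ k ℕ.* c × ¬ p ∣ c)
    step n rec n≢0 with p ∣? n
    ... | no p∤n = 0 , n , sym (ℕP.*-identityˡ n) , p∤n
    ... | yes (divides zero e) = ⊥-elim (n≢0 e)
    ... | yes (divides m@(suc _) e) with rec (subst (m ℕ.<_) (sym e) (ℕP.m<m*n m p (ℕ.nonTrivial⇒n>1 p {{prime⇒nonTrivial pp}}))) (λ ())
    ...   | k , c , e′ , p∤c = suc k , c , trans e (trans (ℕP.*-comm m p) (trans (cong (p ℕ.*_) e′) (sym (ℕP.*-assoc p (p ℕ.^ k) c)))) , p∤c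

  prime∤⇒coprime : ∀ {p c} → Prime p → ¬ p ∣ c → Coprime p c
  prime∤⇒coprime pp p∤c (d∣p , d∣c) with prime⇒irreducible pp d∣p
  ... | inj₁ e = e
  ... | inj₂ refl = ⊥-elim (p∤c d∣c)

  coprime-^ˡ : ∀ {a c} k → Coprime a c → Coprime (a ℕ.^ k) c
  coprime-^ˡ zero c (d∣1 , _) = Data.Nat.Divisibility.∣1⇒≡1 d∣1
  coprime-^ˡ {a} (suc k) c {d} (d∣ , d∣c) = coprime-^ˡ k c
    (coprime-divisor (λ { (e∣d , e∣a) → c (e∣a , ∣-trans e∣d d∣c) }) d∣ , d∣c)

  -- Look at the cofactor e. If p ∣ e, cancel one p; otherwise e is coprime to the prime power that
  -- it divides, so e = 1.
  divisor-of-prime-power : ∀ {p} → Prime p → ∀ k {d} → d ∣ p ℕ.^ suc k → d ≡ p ℕ.^ suc k ⊎ d ∣ p ℕ.^ k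
  divisor-of-prime-power {p} pp k {d} (divides e eq) with p ∣? e
  ... | yes (divides e′ refl) = inj₂ (divides e′ (ℕP.*-cancelˡ-≡ (p ℕ.^ k) (e′ ℕ.* d) p {{prime⇒nonZero pp}} (trans eq lem)))
    where lem : e′ ℕ.* p ℕ.* d ≡ p ℕ.* (e′ ℕ.* d)
          lem = trans (cong (ℕ._* d) (ℕP.*-comm e′ p)) (ℕP.*-assoc p e′ d)
  ... | no p∤e = inj₁ (trans (sym (ℕP.*-identityˡ d)) (trans (cong (ℕ._* d) (sym e≡1)) (sym eq)))
    where e≡1 : e ≡ 1
          e≡1 = coprime-^ˡ (suc k) (prime∤⇒coprime pp p∤e) (divides d (trans eq (ℕP.*-comm e d)) , ∣-refl)

  module Powers {n : ℕ} (F : FiniteField n) where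
    open FiniteField F using (isCommutativeRing; _^_)
    private
      R : CommutativeRing 0ℓ 0ℓ
      R = record { isCommutativeRing = isCommutativeRing }
    open CommutativeRing R using (_*_; 1#; *-identityˡ; *-assoc)

    ^-+ : ∀ a j k → a ^ (j ℕ.+ k) ≡ a ^ j * a ^ k
    ^-+ a zero    k = sym (*-identityˡ (a ^ k))
    ^-+ a (suc j) k = trans (cong (a *_) (^-+ a j k)) (sym (*-assoc a (a ^ j) (a ^ k)))

    1^ : ∀ k → 1# ^ k ≡ 1#
    1^ zero    = refl
    1^ (suc k) = trans (*-identityˡ (1# ^ k)) (1^ k)

    ^-* : ∀ a j k → a ^ (j ℕ.* k) ≡ (a ^ k) ^ j
    ^-* a zero    k = refl
    ^-* a (suc j) k = trans (^-+ a k (j ℕ.* k)) (cong (a ^ k *_) (^-* a j k))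

    ^-*′ : ∀ a j k → a ^ (j ℕ.* k) ≡ (a ^ j) ^ k
    ^-*′ a j k = trans (cong (a ^_) (ℕP.*-comm j k)) (^-* a k j)

  module Field {m : ℕ} (F : FiniteField (suc m)) where
    open FiniteField F using (Carrier; isCommutativeRing; 0≢1; inverse; enum; _^_)

    commutativeRing : CommutativeRing 0ℓ 0ℓ
    commutativeRing = record { isCommutativeRing = isCommutativeRing }

    open RingIdentities isCommutativeRing using (solve; _:=_; _:+_; _:*_; _:-_)
    open CommutativeRing commutativeRing using (_+_; _*_; -_; _-_; 0#; 1#; +-identityˡ; *-comm; *-assoc; *-identityˡ; *-identityʳ;
      zeroˡ; zeroʳ; -‿inverseˡ; -‿inverseʳ; *-commutativeMonoid; +-commutativeMonoid)

    index : Carrier → Fin (suc m)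
    index = Inverse.to enum

    elem : Fin (suc m) → Carrier
    elem = Inverse.from enum

    elem-index : ∀ x → elem (index x) ≡ x
    elem-index x = Inverse.inverseʳ enum refl

    index-elem : ∀ i → index (elem i) ≡ i
    index-elem i = Inverse.inverseˡ enum refl

    elem-injective : ∀ {i j} → elem i ≡ elem j → i ≡ j
    elem-injective {i} {j} e = trans (sym (index-elem i)) (trans (cong index e) (index-elem j))

    infix 4 _≟_
    _≟_ : DecidableEquality Carrier
    x ≟ y = map′ (λ e → trans (sym (elem-index x)) (trans (cong elem e) (elem-index y))) (cong index) (index x Fin.≟ index y)

    x-y≡0⇒x≡y : ∀ {x y} → x - y ≡ 0# → x ≡ y
    x-y≡0⇒x≡y {x} {y} e = trans (lem x y) (trans (cong (_+ y) e) (+-identityˡ y))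
      where lem : ∀ x y → x ≡ (x - y) + y
            lem = solve 2 (λ x y → x := (x :- y) :+ y) refl

    x-x≡0 : ∀ x → x - x ≡ 0#
    x-x≡0 = -‿inverseʳ

    integral : ∀ {x y} → x * y ≡ 0# → x ≢ 0# → y ≡ 0#
    integral {x} {y} e x≢0 with inverse x x≢0
    ... | x⁻¹ , xx⁻¹ = begin
      y               ≡⟨ sym (*-identityˡ y) ⟩
      1# * y          ≡⟨ cong (_* y) (sym xx⁻¹) ⟩
      x * x⁻¹ * y     ≡⟨ lem x x⁻¹ y ⟩
      x⁻¹ * (x * y)   ≡⟨ cong (x⁻¹ *_) e ⟩
      x⁻¹ * 0#        ≡⟨ zeroʳ x⁻¹ ⟩
      0#              ∎
      where open ≡-Reasoning
            lem : ∀ a b c → a * b * c ≡ b * (a * c)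
            lem = solve 3 (λ a b c → a :* b :* c := b :* (a :* c)) refl

    *≢0 : ∀ {x y} → x ≢ 0# → y ≢ 0# → x * y ≢ 0#
    *≢0 x≢0 y≢0 e = y≢0 (integral e x≢0)

    *-cancelˡ : ∀ {a x y} → a ≢ 0# → a * x ≡ a * y → x ≡ y
    *-cancelˡ {a} {x} {y} a≢0 e = x-y≡0⇒x≡y (integral (trans (lem a x y) (trans (cong (_- a * y) e) (x-x≡0 (a * y)))) a≢0)
      where lem : ∀ a x y → a * (x - y) ≡ a * x - a * y
            lem = solve 3 (λ a x y → a :* (x :- y) := a :* x :- a :* y) refl

    unit≢0 : ∀ {x y} → x * y ≡ 1# → x ≢ 0#
    unit≢0 {x} {y} e refl = 0≢1 (trans (sym (zeroˡ y)) e)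

    open Powers F public

    *-^ : ∀ a b k → (a * b) ^ k ≡ a ^ k * b ^ k
    *-^ a b zero    = sym (*-identityˡ 1#)
    *-^ a b (suc k) = trans (cong (a * b *_) (*-^ a b k)) (lem a b (a ^ k) (b ^ k))
      where lem : ∀ a b c d → a * b * (c * d) ≡ a * c * (b * d)
            lem = solve 4 (λ a b c d → a :* b :* (c :* d) := a :* c :* (b :* d)) refl

    ^≢0 : ∀ {a} k → a ≢ 0# → a ^ k ≢ 0#
    ^≢0 zero    a≢0 = 0≢1 ∘ sym
    ^≢0 (suc k) a≢0 = *≢0 a≢0 (^≢0 k a≢0)

    private
      module ∏ = MonoidSum *-commutativeMonoid
      module ∑ = MonoidSum +-commutativeMonoid

    reindex : (f g : Carrier → Carrier) → (∀ x → f (g x) ≡ x) → (∀ x → g (f x) ≡ x) → Fin (suc m) ↔ Fin (suc m)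
    reindex f g fg gf = enum ↔-∘ (mk↔ₛ′ f g fg gf ↔-∘ ↔-sym enum)

    -- Lagrange's argument: multiplication by a permutes the nonzero elements, hence fixes their product.
    fermat : ∀ {a} → a ≢ 0# → a ^ m ≡ 1#
    fermat {a} a≢0 with inverse a a≢0
    ... | a⁻¹ , aa⁻¹ = sym (*-cancelˡ product≢0 (trans (*-identityʳ (∏.sum (h ∘ elem)))
        (trans ∏-permuted (trans (∏.sum-cong-≗ h-a*) (trans (∏.∑-distrib-+ (k ∘ elem) (h ∘ elem))
        (trans (*-comm (∏.sum (k ∘ elem)) (∏.sum (h ∘ elem))) (cong (∏.sum (h ∘ elem) *_) ∏k)))))))
      where
      h k : Carrier → Carrier
      h x with x ≟ 0#
      ... | yes _ = 1#
      ... | no _  = x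
      k x with x ≟ 0#
      ... | yes _ = 1#
      ... | no _  = a
      h≢0 : ∀ x → h x ≢ 0#
      h≢0 x with x ≟ 0#
      ... | yes _ = 0≢1 ∘ sym
      ... | no ne = ne
      h-a* : ∀ i → h (a * elem i) ≡ k (elem i) * h (elem i)
      h-a* i with elem i ≟ 0# | (a * elem i) ≟ 0#
      ... | yes _ | yes _  = sym (*-identityˡ 1#)
      ... | yes e | no ne  = ⊥-elim (ne (trans (cong (a *_) e) (zeroʳ a)))
      ... | no ne | yes e  = ⊥-elim (ne (integral e a≢0))
      ... | no _  | no _   = refl
      ∏≢0 : ∀ {n} (t : Fin n → Carrier) → (∀ i → t i ≢ 0#) → ∏.sum t ≢ 0#
      ∏≢0 {zero}  t ne = 0≢1 ∘ sym
      ∏≢0 {suc n} t ne = *≢0 (ne Fin.zero) (∏≢0 (t ∘ Fin.suc) (ne ∘ Fin.suc))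
      product≢0 : ∏.sum (h ∘ elem) ≢ 0#
      product≢0 = ∏≢0 (h ∘ elem) (h≢0 ∘ elem)
      ∏-const : ∀ n → ∏.sum {n} (λ _ → a) ≡ a ^ n
      ∏-const zero    = refl
      ∏-const (suc n) = cong (a *_) (∏-const n)
      π : Fin (suc m) ↔ Fin (suc m)
      π = reindex (a *_) (a⁻¹ *_) (λ x → trans (sym (*-assoc a a⁻¹ x)) (trans (cong (_* x) aa⁻¹) (*-identityˡ x)))
        (λ x → trans (sym (*-assoc a⁻¹ a x)) (trans (cong (_* x) (trans (*-comm a⁻¹ a) aa⁻¹)) (*-identityˡ x)))
      ∏-permuted : ∏.sum (h ∘ elem) ≡ ∏.sum (λ i → h (a * elem i))
      ∏-permuted = trans (∏.sum-permute (h ∘ elem) π) (∏.sum-cong-≗ λ i → cong h (elem-index (a * elem i)))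
      k-zero : ∀ x → x ≡ 0# → k x ≡ 1#
      k-zero x e with x ≟ 0#
      ... | yes _ = refl
      ... | no ne = ⊥-elim (ne e)
      k-nonzero : ∀ x → x ≢ 0# → k x ≡ a
      k-nonzero x ne with x ≟ 0#
      ... | yes e = ⊥-elim (ne e)
      ... | no _ = refl
      ∏k : ∏.sum (k ∘ elem) ≡ a ^ m
      ∏k = trans (∏.sum-remove {i = index 0#} (k ∘ elem))
        (trans (cong₂ _*_ (k-zero _ (elem-index 0#))
          (trans (∏.sum-cong-≗ {m} λ j → k-nonzero _ λ e → FinP.punchInᵢ≢i (index 0#) j (trans (sym (index-elem _)) (cong index e))) (∏-const m)))
        (*-identityˡ (a ^ m)))

    infixr 8 _·1
    _·1 : ℕ → Carrier
    zero  ·1 = 0#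
    suc n ·1 = 1# + n ·1

    -- Adding 1 permutes the field, so the sum S of all elements satisfies S = S + (size)·1.
    size·1≡0 : suc m ·1 ≡ 0#
    size·1≡0 = begin
      suc m ·1                          ≡⟨ lem (suc m ·1) S ⟩
      (S + suc m ·1) - S                ≡⟨ cong (_- S) (sym sum-shifted) ⟩
      S - S                             ≡⟨ x-x≡0 S ⟩
      0#                                ∎
      where
      open ≡-Reasoning
      S = ∑.sum elem
      lem : ∀ a s → a ≡ (s + a) - s
      lem = solve 2 (λ a s → a := (s :+ a) :- s) refl
      lem₁ : ∀ a x → (x - a) + a ≡ x
      lem₁ = solve 2 (λ a x → (x :- a) :+ a := x) refl
      lem₂ : ∀ a x → (x + a) - a ≡ x
      lem₂ = solve 2 (λ a x → (x :+ a) :- a := x) refl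
      π : Fin (suc m) ↔ Fin (suc m)
      π = reindex (_+ 1#) (_- 1#) (lem₁ 1#) (lem₂ 1#)
      ∑-const : ∀ n → ∑.sum {n} (λ _ → 1#) ≡ n ·1
      ∑-const zero    = refl
      ∑-const (suc n) = cong (1# +_) (∑-const n)
      sum-shifted : S ≡ S + suc m ·1
      sum-shifted = trans (∑.sum-permute elem π) (trans (∑.sum-cong-≗ λ i → elem-index (elem i + 1#))
        (trans (∑.∑-distrib-+ elem (λ _ → 1#)) (cong (S +_) (∑-const (suc m)))))

    -- the monic polynomial c₀ + c₁X + … + X^d
    monic : ∀ {d} → Vec Carrier d → Carrier → Carrier
    monic []       x = 1#
    monic (c ∷ cs) x = c + x * monic cs x

    private
      -- cs + r·ds with ds monic of degree one less, so that the result is again monic.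
      add : ∀ {d} → Vec Carrier (suc d) → Carrier → Vec Carrier d → Vec Carrier (suc d)
      add (c ∷ [])     r []       = c + r ∷ []
      add (c ∷ b ∷ cs) r (d ∷ ds) = c + r * d ∷ add (b ∷ cs) r ds

      monic-add : ∀ {d} (cs : Vec Carrier (suc d)) r ds x → monic (add cs r ds) x ≡ monic cs x + r * monic ds x
      monic-add (c ∷ [])     r []       x = trans (lem c r x 1#) (cong (λ z → (c + x * 1#) + z) (sym (*-identityʳ r)))
        where lem : ∀ c r x o → c + r + x * o ≡ c + x * o + r
              lem = solve 4 (λ c r x o → c :+ r :+ x :* o := c :+ x :* o :+ r) refl
      monic-add (c ∷ b ∷ cs) r (d ∷ ds) x rewrite monic-add (b ∷ cs) r ds x = lem c r d x (monic (b ∷ cs) x) (monic ds x)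
        where lem : ∀ c r d x u v → (c + r * d) + x * (u + r * v) ≡ (c + x * u) + r * (d + x * v)
              lem = solve 6 (λ c r d x u v → (c :+ r :* d) :+ x :* (u :+ r :* v) := (c :+ x :* u) :+ r :* (d :+ x :* v)) refl

      -- Synthetic division: the quotient of cs - cs(r) by X - r.
      deflate : ∀ {d} → Vec Carrier (suc d) → Carrier → Vec Carrier d
      deflate (c ∷ [])     r = []
      deflate (c ∷ b ∷ cs) r = add (b ∷ cs) r (deflate (b ∷ cs) r)

      monic-deflate : ∀ {d} (cs : Vec Carrier (suc d)) r x → monic cs x - monic cs r ≡ (x - r) * monic (deflate cs r) x
      monic-deflate (c ∷ [])     r x = lem c r x 1#
        where lem : ∀ c r x o → (c + x * o) - (c + r * o) ≡ (x - r) * o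
              lem = solve 4 (λ c r x o → (c :+ x :* o) :- (c :+ r :* o) := (x :- r) :* o) refl
      monic-deflate (c ∷ b ∷ cs) r x = begin
        (c + x * s x) - (c + r * s r)         ≡⟨ lem₁ c x r (s x) (s r) ⟩
        (x - r) * s x + r * (s x - s r)       ≡⟨ cong (λ z → (x - r) * s x + r * z) (monic-deflate (b ∷ cs) r x) ⟩
        (x - r) * s x + r * ((x - r) * t x)   ≡⟨ lem₂ (x - r) r (s x) (t x) ⟩
        (x - r) * (s x + r * t x)             ≡⟨ cong ((x - r) *_) (sym (monic-add (b ∷ cs) r (deflate (b ∷ cs) r) x)) ⟩
        (x - r) * monic (deflate (c ∷ b ∷ cs) r) x ∎
        where
        open ≡-Reasoning
        s = monic (b ∷ cs)
        t = monic (deflate (b ∷ cs) r)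
        lem₁ : ∀ c x r u v → (c + x * u) - (c + r * v) ≡ (x - r) * u + r * (u - v)
        lem₁ = solve 5 (λ c x r u v → (c :+ x :* u) :- (c :+ r :* v) := (x :- r) :* u :+ r :* (u :- v)) refl
        lem₂ : ∀ y r u v → y * u + r * (y * v) ≡ y * (u + r * v)
        lem₂ = solve 4 (λ y r u v → y :* u :+ r :* (y :* v) := y :* (u :+ r :* v)) refl

    roots≤degree : ∀ {d} (cs : Vec Carrier d) rs → Unique rs → All (λ r → monic cs r ≡ 0#) rs → length rs ℕ.≤ d
    roots≤degree cs []       u        z        = z≤n
    roots≤degree [] (r ∷ rs) u        (e ∷ _)  = ⊥-elim (0≢1 (sym e))
    roots≤degree cs@(_ ∷ _) (r ∷ rs) (r∉ ∷ u) (e ∷ es) = s≤s (roots≤degree (deflate cs r) rs u (others r∉ es))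
      where
      others : ∀ {rs} → All (r ≢_) rs → All (λ x → monic cs x ≡ 0#) rs → All (λ x → monic (deflate cs r) x ≡ 0#) rs
      others []        []        = []
      others {x ∷ _} (ne ∷ nes) (z ∷ zs) = integral
        (trans (sym (monic-deflate cs r x)) (trans (cong₂ _-_ z e) (x-x≡0 0#))) (λ d → ne (sym (x-y≡0⇒x≡y d))) ∷ others nes zs

    monic-power : ∀ d x → monic (replicate d 0#) x ≡ x ^ d
    monic-power zero    x = refl
    monic-power (suc d) x = trans (+-identityˡ (x * monic (replicate d 0#) x)) (cong (x *_) (monic-power d x))

    -- X^(d+2) - X vanishes exactly at 0 and at the roots of X^(d+1) = 1; a field with more than d +
    -- 2 elements has a point outside its zero set.
    ∃-nonroot : ∀ d → suc (suc d) ℕ.< suc m → ∃[ z ] (z ≢ 0# × z ^ suc d ≢ 1#)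
    ∃-nonroot d lt with FinP.¬∀⟶∃¬ (suc m) (λ i → elem i ≡ 0# ⊎ elem i ^ suc d ≡ 1#) dec? all-roots
      where
      dec? : ∀ i → Dec (elem i ≡ 0# ⊎ elem i ^ suc d ≡ 1#)
      dec? i with elem i ≟ 0# | elem i ^ suc d ≟ 1#
      ... | yes e | _     = yes (inj₁ e)
      ... | no _  | yes e = yes (inj₂ e)
      ... | no n₁ | no n₂ = no λ { (inj₁ e) → n₁ e ; (inj₂ e) → n₂ e }
      poly : Vec Carrier (suc (suc d))
      poly = 0# ∷ - 1# ∷ replicate d 0#
      root : ∀ {x} → x ≡ 0# ⊎ x ^ suc d ≡ 1# → monic poly x ≡ 0#
      root {x} (inj₁ refl) = trans (+-identityˡ _) (zeroˡ _)
      root {x} (inj₂ e) = trans (+-identityˡ _) (trans (cong (x *_) (trans (cong (λ z → - 1# + x * z) (monic-power d x)) (trans (cong (λ z → - 1# + z) e) (-‿inverseˡ 1#)))) (zeroʳ x))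
      all-roots : ¬ (∀ i → elem i ≡ 0# ⊎ elem i ^ suc d ≡ 1#)
      all-roots all = ℕP.<⇒≱ lt (subst (ℕ._≤ suc (suc d)) (length-tabulate elem)
        (roots≤degree poly (tabulate elem) (UniqueP.tabulate⁺ elem-injective) (AllP.tabulate⁺ (root ∘ all))))
    ... | i , ne = elem i , ne ∘ inj₁ , ne ∘ inj₂

    record Ord (z : Carrier) (k : ℕ) : Set where
      field
        power   : z ^ k ≡ 1#
        minimal : ∀ j → z ^ j ≡ 1# → k ∣ j
    open Ord

    ^-∣ : ∀ {z j k} → j ∣ k → z ^ j ≡ 1# → z ^ k ≡ 1#
    ^-∣ {z} {j} (divides c refl) e = trans (^-* z c j) (trans (cong (_^ c) e) (1^ c))

    ^≡1⇒≢0 : ∀ {z k} → .{{_ : NonZero k}} → z ^ k ≡ 1# → z ≢ 0#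
    ^≡1⇒≢0 {z} {suc k} e = unit≢0 e

    ^-gcd : ∀ {z} j k → .{{_ : NonZero k}} → z ^ j ≡ 1# → z ^ k ≡ 1# → z ^ gcd j k ≡ 1#
    ^-gcd {z} j k ej ek with Bézout.identity (gcd-GCD j k)
    ... | Bézout.+- x y eq = trans (sym (trans (^-+ z (gcd j k) (y ℕ.* k)) (trans (cong (z ^ gcd j k *_) (^-∣ (n∣m*n y) ek)) (*-identityʳ _))))
                              (trans (cong (z ^_) eq) (^-∣ (n∣m*n x) ej))
    ... | Bézout.-+ x y eq = trans (sym (trans (^-+ z (gcd j k) (x ℕ.* j)) (trans (cong (z ^ gcd j k *_) (^-∣ (n∣m*n x) ej)) (*-identityʳ _))))
                              (trans (cong (z ^_) eq) (^-∣ (n∣m*n y) ek))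

    -- If (ab)^i = 1, raising to the power k removes b and gives j ∣ ki, hence j ∣ i by coprimality;
    -- symmetrically k ∣ i.
    ord-* : ∀ {a b j k} → Coprime j k → .{{_ : NonZero j}} → .{{_ : NonZero k}} → Ord a j → Ord b k → Ord (a * b) (j ℕ.* k)
    ord-* {a} {b} {j} {k} cop oa ob = record
      { power   = trans (*-^ a b (j ℕ.* k)) (trans (cong₂ _*_ (^-∣ {a} {j} (m∣m*n k) (power oa)) (^-∣ {b} {k} (n∣m*n j) (power ob))) (*-identityˡ 1#))
      ; minimal = λ i e → both (side oa ob cop e) (side ob oa (coprime-sym cop) (trans (cong (_^ i) (*-comm b a)) e))
      }
      where
      side : ∀ {a b j k i} → Ord a j → Ord b k → Coprime j k → (a * b) ^ i ≡ 1# → j ∣ i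
      side {a} {b} {j} {k} {i} oa ob cop e = coprime-divisor cop (minimal oa (k ℕ.* i) (begin
        a ^ (k ℕ.* i)                   ≡⟨ sym (*-identityʳ _) ⟩
        a ^ (k ℕ.* i) * 1#              ≡⟨ cong (a ^ (k ℕ.* i) *_) (sym (^-∣ {b} {k} (m∣m*n i) (power ob))) ⟩
        a ^ (k ℕ.* i) * b ^ (k ℕ.* i)   ≡⟨ sym (*-^ a b (k ℕ.* i)) ⟩
        (a * b) ^ (k ℕ.* i)             ≡⟨ ^-∣ (n∣m*n k) e ⟩
        1#                              ∎))
        where open ≡-Reasoning
      both : ∀ {i} → j ∣ i → k ∣ i → j ℕ.* k ∣ i
      both (divides c refl) k∣ = subst (_∣ c ℕ.* j) (ℕP.*-comm k j)
        (Data.Nat.Divisibility.*-monoˡ-∣ j (coprime-divisor (coprime-sym cop) (subst (k ∣_) (ℕP.*-comm c j) k∣)))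

    -- Take w with w^(m/p) ≠ 1 and put c = m / p^(k+1). Then w^c is killed by p^(k+1), and if its
    -- order divided p^k, then w^(m/p) would be 1. In the proof e is m/p.
    ord-prime-power : ∀ {p} → Prime p → ∀ k → p ℕ.^ suc k ∣ m → .{{_ : NonZero m}} → ∃[ z ] Ord z (p ℕ.^ suc k)
    ord-prime-power {p} pp k (divides c eq) {{m≢0}} = w ^ c , record { power = pow ; minimal = min }
      where
      e = p ℕ.^ k ℕ.* c
      m≡pe : m ≡ p ℕ.* e
      m≡pe = trans eq (trans (ℕP.*-comm c (p ℕ.* p ℕ.^ k)) (ℕP.*-assoc p (p ℕ.^ k) c))
      e<m : e ≢ 0 × e ℕ.< m
      e<m = e≢0 , subst (e ℕ.<_) (sym (trans m≡pe (ℕP.*-comm p e))) (ℕP.m<m*n e p {{ℕ.≢-nonZero e≢0}} (ℕ.nonTrivial⇒n>1 p {{prime⇒nonTrivial pp}}))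
        where e≢0 : e ≢ 0
              e≢0 z = ℕ.≢-nonZero⁻¹ m {{m≢0}} (trans m≡pe (trans (cong (p ℕ.*_) z) (ℕP.*-zeroʳ p)))
      ∃-nonroot′ : ∀ e → e ≢ 0 × e ℕ.< m → ∃[ z ] (z ≢ 0# × z ^ e ≢ 1#)
      ∃-nonroot′ zero    (e≢0 , _) = ⊥-elim (e≢0 refl)
      ∃-nonroot′ (suc d) (_ , lt)  = ∃-nonroot d (s≤s lt)
      nonroot = ∃-nonroot′ e e<m
      w = proj₁ nonroot
      w≢0 = proj₁ (proj₂ nonroot)
      we≢1 = proj₂ (proj₂ nonroot)
      pow : (w ^ c) ^ (p ℕ.^ suc k) ≡ 1#
      pow = trans (sym (^-*′ w c (p ℕ.^ suc k))) (trans (cong (w ^_) (sym eq)) (fermat w≢0))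
      min : ∀ j → (w ^ c) ^ j ≡ 1# → p ℕ.^ suc k ∣ j
      min j ej with divisor-of-prime-power pp k (gcd[m,n]∣n j (p ℕ.^ suc k))
      ... | inj₁ g≡ = subst (_∣ j) g≡ (gcd[m,n]∣m j (p ℕ.^ suc k))
      ... | inj₂ g∣ = ⊥-elim (we≢1 (trans (cong (w ^_) (ℕP.*-comm (p ℕ.^ k) c))
        (trans (^-*′ w c (p ℕ.^ k)) (^-∣ g∣ (^-gcd j (p ℕ.^ suc k) {{ℕP.m^n≢0 p (suc k) {{prime⇒nonZero pp}}}} ej pow)))))

    ord-divisor : ∀ n → n ∣ m → .{{_ : NonZero m}} → ∃[ z ] Ord z n
    ord-divisor n n∣m {{m≢0}} = <-rec (λ n → n ∣ m → ∃[ z ] Ord z n) step n n∣m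
      where
      step : ∀ n → (∀ {c} → c ℕ.< n → c ∣ m → ∃[ z ] Ord z c) → n ∣ m → ∃[ z ] Ord z n
      step zero rec (divides c e) = ⊥-elim (ℕ.≢-nonZero⁻¹ m {{m≢0}} (trans e (ℕP.*-zeroʳ c)))
      step (suc zero) rec _ = 1# , record { power = *-identityˡ 1# ; minimal = λ j _ → Data.Nat.Divisibility.1∣ j }
      step n@(suc (suc _)) rec n∣m with primeDivisor n (λ ())
      ... | p , pp , p∣n with splitPrimePower pp n
      ...   | zero , c , e , p∤c = ⊥-elim (p∤c (subst (p ∣_) (trans e (ℕP.*-identityˡ c)) p∣n))
      ...   | suc k , c , e , p∤c = proj₁ a * proj₁ b , subst (Ord _) (sym e) (ord-* (coprime-^ˡ (suc k) (prime∤⇒coprime pp p∤c)) {{pk≢0}} {{c≢0}} (proj₂ a) (proj₂ b))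
        where
        pk≢0 : NonZero (p ℕ.^ suc k)
        pk≢0 = ℕP.m^n≢0 p (suc k) {{prime⇒nonZero pp}}
        c≢0 : NonZero c
        c≢0 = ℕ.≢-nonZero λ z → ⊥-elim (p∤c (subst (p ∣_) (sym z) (p Data.Nat.Divisibility.∣0)))
        c<n : c ℕ.< n
        c<n = subst (c ℕ.<_) (sym (trans e (ℕP.*-comm (p ℕ.^ suc k) c))) (ℕP.m<m*n c (p ℕ.^ suc k) {{c≢0}}
          (ℕP.<-≤-trans (ℕ.nonTrivial⇒n>1 p {{prime⇒nonTrivial pp}}) (ℕP.m≤m*n p (p ℕ.^ k) {{ℕP.m^n≢0 p k {{prime⇒nonZero pp}}}})))
        a = ord-prime-power pp k (∣-trans (subst (p ℕ.^ suc k ∣_) (sym e) (m∣m*n c)) n∣m) {{m≢0}}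
        b = rec c<n (∣-trans (subst (c ∣_) (sym e) (n∣m*n (p ℕ.^ suc k))) n∣m)

    record Generator : Set where
      field
        g     : Carrier
        g≢0   : g ≢ 0#
        order : ∀ j → g ^ j ≡ 1# → m ∣ j
        log   : ∀ a → a ≢ 0# → ∃[ i ] (i ℕ.< m × g ^ i ≡ a)

    ^-injective : ∀ {g} → g ≢ 0# → (∀ j → g ^ j ≡ 1# → m ∣ j) → ∀ {i j} → i ℕ.< j → j ℕ.< m → g ^ i ≢ g ^ j
    ^-injective {g} g≢0 ord {i} {j} i<j j<m e = ℕP.<⇒≱ (ℕP.≤-<-trans (ℕP.m∸n≤m j i) j<m)
      (∣⇒≤ {{ℕ.≢-nonZero (ℕP.m>n⇒m∸n≢0 i<j)}} (ord (j ℕ.∸ i) (sym (*-cancelˡ (^≢0 i g≢0) (trans (*-identityʳ (g ^ i))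
        (trans e (trans (cong (g ^_) (sym (ℕP.m+[n∸m]≡n (ℕP.<⇒≤ i<j)))) (^-+ g i (j ℕ.∸ i)))))))))

    -- An element missing from the m powers of g would be an additional root of X^m - 1, one more
    -- than its degree allows.
    exhaust : ∀ {g} → g ≢ 0# → (∀ j → g ^ j ≡ 1# → m ∣ j) → .{{_ : NonZero m}} → ∀ a → a ≢ 0# → ∃[ i ] (i ℕ.< m × g ^ i ≡ a)
    exhaust {g} g≢0 ord {{m≢0}} a a≢0 with ℕP.anyUpTo? (λ i → g ^ i ≟ a) m
    ... | yes (i , lt , e) = i , lt , e
    ... | no none = ⊥-elim (too-many m refl (ℕ.≢-nonZero⁻¹ m {{m≢0}}))
      where
      powers : List Carrier
      powers = applyUpTo (g ^_) m
      too-many : ∀ d → m ≡ d → ¬ d ≢ 0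
      too-many zero    _ n≢0 = n≢0 refl
      too-many (suc d) e _ = ℕP.<⇒≱ (s≤s (ℕP.≤-reflexive (trans (sym e) (sym (length-applyUpTo (g ^_) m)))))
        (roots≤degree (- 1# ∷ replicate d 0#) (a ∷ powers)
          (AllP.applyUpTo⁺₁ (g ^_) m (λ {i} i<m eq → none (i , i<m , sym eq)) ∷ UniqueP.applyUpTo⁺₁ (g ^_) m (^-injective g≢0 ord))
          (root a≢0 ∷ AllP.applyUpTo⁺₂ (g ^_) m (λ i → root (^≢0 i g≢0))))
        where
        root : ∀ {x} → x ≢ 0# → monic (- 1# ∷ replicate d 0#) x ≡ 0#
        root {x} x≢0 = trans (cong (λ z → - 1# + x * z) (monic-power d x)) (trans (cong (λ k → - 1# + x ^ k) (sym e)) (trans (cong (λ z → - 1# + z) (fermat x≢0)) (-‿inverseˡ 1#)))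

    abstract
     generator : .{{_ : NonZero m}} → Generator
     generator {{m≢0}} with ord-divisor m ∣-refl {{m≢0}}
     ... | g , o = record { g = g ; g≢0 = g≢0 ; order = minimal o ; log = exhaust g≢0 (minimal o) {{m≢0}} }
       where
       g≢0 : g ≢ 0#
       g≢0 = ^≡1⇒≢0 {g} {m} {{m≢0}} (power o)

-- The quadratic extension: coordinates, norm, and the geometry of a line

module Lines where

  open import Data.Nat as ℕ using (ℕ; zero; suc; s≤s; NonZero)
  import Data.Nat.Properties as ℕP
  import Data.Integer
  open import Data.Fin as Fin using (Fin; toℕ)
  import Data.Fin.Properties as FinP
  open import Data.List using (List; []; _∷_; applyUpTo)
  open import Data.List.Properties using (length-applyUpTo)
  open import Data.List.Relation.Unary.All using (All; []; _∷_)
  import Data.List.Relation.Unary.All.Properties as AllP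
  open import Data.List.Relation.Unary.AllPairs using ([]; _∷_)
  import Data.List.Relation.Unary.Unique.Propositional.Properties as UniqueP
  open import Data.Vec using (replicate; _∷_)
  open import Data.Product using (_×_; _,_; proj₁; proj₂; ∃-syntax)
  open import Data.Sum using (_⊎_; inj₁; inj₂)
  open import Data.Empty using (⊥-elim)
  open import Function using (_∘_)
  open import Relation.Nullary using (yes; no; ¬_; Dec)
  open import Relation.Binary.PropositionalEquality
  open import Algebra.Bundles using (CommutativeRing)
  open IntegerSums
  open PointSums
  open FiniteFields
  open IntegerCoefficients using (module RingIdentities)

  module Extension {r : ℕ} (E : QuadExt (suc r)) where
    open QuadExt E using (F; K; ι; ι-+; ι-*; ι-1)
    module EF = Field F
    module EK = Field K
    open CommutativeRing EF.commutativeRing using (Carrier; _+_; _*_; -_; _-_; 0#; 1#; *-identityˡ; *-identityʳ; *-assoc; +-comm; +-identityˡ; +-identityʳ; zeroˡ; zeroʳ; -‿inverseʳ)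
    open FiniteField F using (_^_; inverse)
    private module 𝕂 = CommutativeRing EK.commutativeRing
    private module KF = FiniteField K
    private module EI = RingIdentities (FiniteField.isCommutativeRing F)
    private module KI = RingIdentities (FiniteField.isCommutativeRing K)

    q q+1 N : ℕ
    q   = suc r
    q+1 = suc q
    N   = r ℕ.* q+1

    -- N = (q - 1)(q + 1) is the convenient form, whereas `r + r * q` is what the size q·q minus 1
    -- unfolds to in statements about the group order.
    N-size : N ≡ r ℕ.+ r ℕ.* q
    N-size = ℕP.*-suc r q

    ι-0 : ι 𝕂.0# ≡ 0#
    ι-0 = EF.x-y≡0⇒x≡y (begin
      ι 𝕂.0# - 0#                    ≡⟨ lem (ι 𝕂.0#) 0# ⟩
      (ι 𝕂.0# + ι 𝕂.0#) - (ι 𝕂.0# + 0#) ≡⟨ cong₂ _-_ (trans (sym (ι-+ 𝕂.0# 𝕂.0#)) (cong ι (𝕂.+-identityˡ 𝕂.0#))) (+-identityʳ (ι 𝕂.0#)) ⟩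
      ι 𝕂.0# - ι 𝕂.0#                ≡⟨ EF.x-x≡0 (ι 𝕂.0#) ⟩
      0#                             ∎)
      where open ≡-Reasoning
            open EI
            lem : ∀ a b → a - b ≡ (a + a) - (a + b)
            lem = solve 2 (λ a b → a :- b := (a :+ a) :- (a :+ b)) refl

    ι-neg : ∀ x → ι (𝕂.- x) ≡ - ι x
    ι-neg x = EF.x-y≡0⇒x≡y (trans (lem (ι (𝕂.- x)) (ι x)) (trans (sym (ι-+ (𝕂.- x) x)) (trans (cong ι (𝕂.-‿inverseˡ x)) ι-0)))
      where open EI
            lem : ∀ a b → a - (- b) ≡ a + b
            lem = solve 2 (λ a b → a :- (:- b) := a :+ b) refl

    ι-- : ∀ x y → ι (x 𝕂.- y) ≡ ι x - ι y
    ι-- x y = trans (ι-+ x (𝕂.- y)) (cong (ι x +_) (ι-neg y))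

    ι-≢0 : ∀ {x} → x ≢ 𝕂.0# → ι x ≢ 0#
    ι-≢0 {x} x≢0 with KF.inverse x x≢0
    ... | y , xy≡1 = EF.unit≢0 {ι x} {ι y} (trans (sym (ι-* x y)) (trans (cong ι xy≡1) ι-1))

    ι-injective : ∀ {x y} → ι x ≡ ι y → x ≡ y
    ι-injective {x} {y} e with (x 𝕂.- y) EK.≟ 𝕂.0#
    ... | yes z = EK.x-y≡0⇒x≡y z
    ... | no nz = ⊥-elim (ι-≢0 nz (trans (ι-- x y) (trans (cong (_- ι y) e) (EF.x-x≡0 (ι y)))))

    ι-^ : ∀ x k → ι (x KF.^ k) ≡ ι x ^ k
    ι-^ x zero    = ι-1
    ι-^ x (suc k) = trans (ι-* x (x KF.^ k)) (cong (ι x *_) (ι-^ x k))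

    instance
      size≢0 : .{{_ : NonZero r}} → NonZero (r ℕ.+ r ℕ.* q)
      size≢0 = ℕ.≢-nonZero λ e → ℕ.≢-nonZero⁻¹ r (ℕP.m+n≡0⇒m≡0 r e)

    -- the subfield consists of 0 and the roots of X^r − 1
    root⇒base : .{{_ : NonZero r}} → ∀ z → z ^ r ≡ 1# → ∃[ k ] ι k ≡ z
    root⇒base {{r≢0}} z e with ℕP.anyUpTo? (λ i → ι (EK.Generator.g γ KF.^ i) EF.≟ z) r
      where γ = EK.generator {{r≢0}}
    ... | yes (i , _ , eq) = EK.Generator.g (EK.generator {{r≢0}}) KF.^ i , eq
    ... | no none = ⊥-elim (too-many r refl (ℕ.≢-nonZero⁻¹ r {{r≢0}}))
      where
      open EK.Generator (EK.generator {{r≢0}})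
      power : ℕ → Carrier
      power i = ι (g KF.^ i)
      too-many : ∀ d → r ≡ d → ¬ d ≢ 0
      too-many zero    _  n≢0 = n≢0 refl
      too-many (suc d) eq _   = ℕP.<⇒≱ (s≤s (ℕP.≤-reflexive (trans (sym eq) (sym (length-applyUpTo power r)))))
        (EF.roots≤degree (- 1# ∷ replicate d 0#) (z ∷ applyUpTo power r)
          (AllP.applyUpTo⁺₁ power r (λ {i} i<r eq′ → none (i , i<r , sym eq′)) ∷ UniqueP.applyUpTo⁺₁ power r (λ i<j j<r → EK.^-injective g≢0 order i<j j<r ∘ ι-injective))
          (root e ∷ AllP.applyUpTo⁺₂ power r (λ i → root (trans (sym (ι-^ (g KF.^ i) r)) (trans (cong ι (EK.fermat (EK.^≢0 i g≢0))) ι-1)))))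
        where
        root : ∀ {x} → x ^ r ≡ 1# → EF.monic (- 1# ∷ replicate d 0#) x ≡ 0#
        root {x} e′ = trans (cong (λ z → - 1# + x * z) (EF.monic-power d x)) (trans (cong (λ k → - 1# + x ^ k) (sym eq))
          (trans (cong (λ z → - 1# + z) e′) (trans (+-comm (- 1#) 1#) (-‿inverseʳ 1#))))

    module Basis {θ : Carrier} (θ∉K : ∀ x → ι x ≢ θ) where

      -- If b ≠ d, then θ = (a - c)/(d - b) would lie in the base field.
      basis-unique : ∀ {a b c d} → ι a + ι b * θ ≡ ι c + ι d * θ → a ≡ c × b ≡ d
      basis-unique {a} {b} {c} {d} e = by-cases ((d 𝕂.- b) EK.≟ 𝕂.0#)
        where
        open EI
        e′ : ι (a 𝕂.- c) ≡ ι (d 𝕂.- b) * θ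
        e′ = EF.x-y≡0⇒x≡y (trans (cong₂ (λ u v → u - v * θ) (ι-- a c) (ι-- d b))
          (trans (lem (ι a) (ι b) (ι c) (ι d) θ) (trans (cong (_- (ι c + ι d * θ)) e) (EF.x-x≡0 _))))
          where lem : ∀ a b c d t → (a - c) - (d - b) * t ≡ (a + b * t) - (c + d * t)
                lem = solve 5 (λ a b c d t → (a :- c) :- (d :- b) :* t := (a :+ b :* t) :- (c :+ d :* t)) refl
        by-cases : Dec (d 𝕂.- b ≡ 𝕂.0#) → a ≡ c × b ≡ d
        by-cases (yes z) = EK.x-y≡0⇒x≡y (ι-injective (trans e′ (trans (cong (λ w → ι w * θ) z) (trans (cong (_* θ) ι-0) (trans (zeroˡ θ) (sym ι-0))))))
                         , sym (EK.x-y≡0⇒x≡y z)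
        by-cases (no nz) with KF.inverse (d 𝕂.- b) nz
        ... | w , dw≡1 = ⊥-elim (θ∉K ((a 𝕂.- c) 𝕂.* w) (trans (ι-* (a 𝕂.- c) w) (trans (cong (_* ι w) e′)
          (trans (lem (ι (d 𝕂.- b)) θ (ι w)) (trans (cong (_* θ) (trans (sym (ι-* (d 𝕂.- b) w)) (trans (cong ι dw≡1) ι-1))) (*-identityˡ θ))))))
          where lem : ∀ a b c → a * b * c ≡ a * c * b
                lem = solve 3 (λ a b c → a :* b :* c := a :* c :* b) refl

      -- K² → E, (a,b) ↦ a + bθ, is injective between sets of equal size
      coordinates : ∀ z → ∃[ a ] ∃[ b ] z ≡ ι a + ι b * θ
      coordinates z with FinP.any? (λ k → z EF.≟ point k)
        where
        point : Fin (q ℕ.* q) → Carrier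
        point k = ι (EK.elem (proj₁ (Fin.remQuot q k))) + ι (EK.elem (proj₂ (Fin.remQuot {q} q k))) * θ
      ... | yes (k , e) = _ , _ , e
      ... | no none with FinP.pigeonhole (ℕP.n<1+n (q ℕ.* q)) f
        where
        point : Fin (q ℕ.* q) → Carrier
        point k = ι (EK.elem (proj₁ (Fin.remQuot q k))) + ι (EK.elem (proj₂ (Fin.remQuot {q} q k))) * θ
        f : Fin (suc (q ℕ.* q)) → Fin (q ℕ.* q)
        f Fin.zero    = EF.index z
        f (Fin.suc k) = EF.index (point k)
      ...   | Fin.zero  , Fin.suc k , _   , e = ⊥-elim (none (k , index-injective e))
        where
        index-injective : ∀ {x y} → EF.index x ≡ EF.index y → x ≡ y
        index-injective {x} {y} e = trans (sym (EF.elem-index x)) (trans (cong EF.elem e) (EF.elem-index y))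
      ...   | Fin.suc j , Fin.suc k , j<k , e = ⊥-elim (ℕP.<⇒≢ (ℕ.s<s⁻¹ j<k) (cong toℕ (trans (sym (FinP.combine-remQuot {q} q j))
          (trans (cong₂ Fin.combine (EK.elem-injective (proj₁ ab)) (EK.elem-injective (proj₂ ab))) (FinP.combine-remQuot {q} q k)))))
        where
        index-injective : ∀ {x y} → EF.index x ≡ EF.index y → x ≡ y
        index-injective {x} {y} e = trans (sym (EF.elem-index x)) (trans (cong EF.elem e) (EF.elem-index y))
        ab = basis-unique (index-injective e)

      private
        A B : Carrier → 𝕂.Carrier
        A z = proj₁ (coordinates z)
        B z = proj₁ (proj₂ (coordinates z))
        AB : ∀ z → z ≡ ι (A z) + ι (B z) * θ
        AB z = proj₂ (proj₂ (coordinates z))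

        s n : 𝕂.Carrier
        n = A (θ * θ)
        s = B (θ * θ)

        -- With θ² = n + sθ, the conjugates of θ have sum s and product -n, so this is (a + bθ)(a +
        -- bθ′), the norm in coordinates. Multiplicativity is then a polynomial identity, and no
        -- conjugation map has to be constructed.
        form : 𝕂.Carrier → 𝕂.Carrier → 𝕂.Carrier
        form a b = (a 𝕂.* a 𝕂.+ a 𝕂.* b 𝕂.* s) 𝕂.- b 𝕂.* b 𝕂.* n

      norm : Carrier → 𝕂.Carrier
      norm z = form (A z) (B z)

      norm-coordinates : ∀ {z a b} → z ≡ ι a + ι b * θ → norm z ≡ form a b
      norm-coordinates {z} e with basis-unique (trans (sym (AB z)) e)
      ... | ea , eb = cong₂ form ea eb

      norm-* : ∀ x y → norm (x * y) ≡ norm x 𝕂.* norm y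
      norm-* x y = trans (norm-coordinates product) (multiplicative (A x) (B x) (A y) (B y) s n)
        where
        a = A x
        b = B x
        c = A y
        d = B y
        open ≡-Reasoning
        multiplicative : ∀ a b c d s n →
          ((a 𝕂.* c 𝕂.+ b 𝕂.* d 𝕂.* n) 𝕂.* (a 𝕂.* c 𝕂.+ b 𝕂.* d 𝕂.* n)
            𝕂.+ (a 𝕂.* c 𝕂.+ b 𝕂.* d 𝕂.* n) 𝕂.* (a 𝕂.* d 𝕂.+ b 𝕂.* c 𝕂.+ b 𝕂.* d 𝕂.* s) 𝕂.* s)
            𝕂.- (a 𝕂.* d 𝕂.+ b 𝕂.* c 𝕂.+ b 𝕂.* d 𝕂.* s) 𝕂.* (a 𝕂.* d 𝕂.+ b 𝕂.* c 𝕂.+ b 𝕂.* d 𝕂.* s) 𝕂.* n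
          ≡ ((a 𝕂.* a 𝕂.+ a 𝕂.* b 𝕂.* s) 𝕂.- b 𝕂.* b 𝕂.* n) 𝕂.* ((c 𝕂.* c 𝕂.+ c 𝕂.* d 𝕂.* s) 𝕂.- d 𝕂.* d 𝕂.* n)
        multiplicative = solve 6 (λ a b c d s n →
          ((a :* c :+ b :* d :* n) :* (a :* c :+ b :* d :* n)
            :+ (a :* c :+ b :* d :* n) :* (a :* d :+ b :* c :+ b :* d :* s) :* s)
            :- (a :* d :+ b :* c :+ b :* d :* s) :* (a :* d :+ b :* c :+ b :* d :* s) :* n
          := ((a :* a :+ a :* b :* s) :- b :* b :* n) :* ((c :* c :+ c :* d :* s) :- d :* d :* n)) refl
          where open KI
        expand : ∀ a b c d t → (a + b * t) * (c + d * t) ≡ (a * c + (a * d + b * c) * t) + b * d * (t * t)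
        expand = solve 5 (λ a b c d t → (a :+ b :* t) :* (c :+ d :* t) := (a :* c :+ (a :* d :+ b :* c) :* t) :+ b :* d :* (t :* t)) refl
          where open EI
        collect : ∀ a b c d t s n → (a * c + (a * d + b * c) * t) + b * d * (n + s * t) ≡ (a * c + b * d * n) + ((a * d + b * c) + b * d * s) * t
        collect = solve 7 (λ a b c d t s n → (a :* c :+ (a :* d :+ b :* c) :* t) :+ b :* d :* (n :+ s :* t) := (a :* c :+ b :* d :* n) :+ ((a :* d :+ b :* c) :+ b :* d :* s) :* t) refl
          where open EI
        product : x * y ≡ ι (a 𝕂.* c 𝕂.+ b 𝕂.* d 𝕂.* n) + ι (a 𝕂.* d 𝕂.+ b 𝕂.* c 𝕂.+ b 𝕂.* d 𝕂.* s) * θ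
        product = begin
          x * y                                                                    ≡⟨ cong₂ _*_ (AB x) (AB y) ⟩
          (ι a + ι b * θ) * (ι c + ι d * θ)                                        ≡⟨ expand (ι a) (ι b) (ι c) (ι d) θ ⟩
          (ι a * ι c + (ι a * ι d + ι b * ι c) * θ) + ι b * ι d * (θ * θ)          ≡⟨ cong (λ z → (ι a * ι c + (ι a * ι d + ι b * ι c) * θ) + ι b * ι d * z) (AB (θ * θ)) ⟩
          (ι a * ι c + (ι a * ι d + ι b * ι c) * θ) + ι b * ι d * (ι n + ι s * θ)  ≡⟨ collect (ι a) (ι b) (ι c) (ι d) θ (ι s) (ι n) ⟩
          (ι a * ι c + ι b * ι d * ι n) + ((ι a * ι d + ι b * ι c) + ι b * ι d * ι s) * θ
            ≡⟨ sym (cong₂ (λ u v → u + v * θ) (trans (ι-+ _ _) (cong₂ _+_ (ι-* a c) (trans (ι-* _ n) (cong (_* ι n) (ι-* b d)))))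
                 (trans (ι-+ _ _) (cong₂ _+_ (trans (ι-+ _ _) (cong₂ _+_ (ι-* a d) (ι-* b c))) (trans (ι-* _ s) (cong (_* ι s) (ι-* b d)))))) ⟩
          ι (a 𝕂.* c 𝕂.+ b 𝕂.* d 𝕂.* n) + ι (a 𝕂.* d 𝕂.+ b 𝕂.* c 𝕂.+ b 𝕂.* d 𝕂.* s) * θ ∎

      norm-1 : norm 1# ≡ 𝕂.1#
      norm-1 = trans (norm-coordinates {1#} {𝕂.1#} {𝕂.0#} (sym (trans (cong₂ (λ u v → u + v * θ) ι-1 ι-0) (trans (cong (1# +_) (zeroˡ θ)) (+-identityʳ 1#)))))
        (trans (cong₂ (λ u v → (𝕂.1# 𝕂.* 𝕂.1# 𝕂.+ u) 𝕂.- v) (trans (cong (𝕂._* s) (𝕂.zeroʳ 𝕂.1#)) (𝕂.zeroˡ s)) (trans (cong (𝕂._* n) (𝕂.zeroʳ 𝕂.0#)) (𝕂.zeroˡ n)))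
          (trans (cong (𝕂._- 𝕂.0#) (trans (𝕂.+-identityʳ _) (𝕂.*-identityˡ 𝕂.1#))) (sub0 𝕂.1#)))
        where sub0 : ∀ x → x 𝕂.- 𝕂.0# ≡ x
              sub0 x = trans (sym (𝕂.+-identityʳ _)) (lem x 𝕂.0#)
                where open KI
                      lem : ∀ x z → (x 𝕂.- z) 𝕂.+ z ≡ x
                      lem = solve 2 (λ x z → (x :- z) :+ z := x) refl

      norm-^ : ∀ z k → norm (z ^ k) ≡ norm z KF.^ k
      norm-^ z zero    = norm-1
      norm-^ z (suc k) = trans (norm-* z (z ^ k)) (cong (norm z 𝕂.*_) (norm-^ z k))

      norm-≢0 : ∀ {z} → z ≢ 0# → norm z ≢ 𝕂.0#
      norm-≢0 {z} z≢0 with inverse z z≢0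
      ... | w , zw≡1 = EK.unit≢0 {norm z} {norm w} (trans (sym (norm-* z w)) (trans (cong norm zw≡1) norm-1))

      θ+≢0 : ∀ x → θ + ι x ≢ 0#
      θ+≢0 x e = θ∉K (𝕂.- x) (trans (ι-neg x) (sym (EF.x-y≡0⇒x≡y (trans (lem θ (ι x)) e))))
        where open EI
              lem : ∀ a b → a - (- b) ≡ a + b
              lem = solve 2 (λ a b → a :- (:- b) := a :+ b) refl

      as-coordinates : ∀ x → θ + ι x ≡ ι x + ι 𝕂.1# * θ
      as-coordinates x = trans (+-comm θ (ι x)) (cong (ι x +_) (sym (trans (cong (_* θ) ι-1) (*-identityˡ θ))))

      -- On the line the norm is the quadratic x² + sx - n, and the difference of two values factors
      -- as (x - y)(x + y + s). Hence norms on a line are at most two-to-one.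
      norm-collision : ∀ {x y} → norm (θ + ι x) ≡ norm (θ + ι y) → x ≡ y ⊎ (x 𝕂.+ y) 𝕂.+ s ≡ 𝕂.0#
      norm-collision {x} {y} e with (x 𝕂.- y) EK.≟ 𝕂.0#
      ... | yes z = inj₁ (EK.x-y≡0⇒x≡y z)
      ... | no nz = inj₂ (EK.integral (trans (lem x y s n 𝕂.1#) (trans (cong₂ 𝕂._-_ (trans (cong (λ w → (x 𝕂.* x 𝕂.+ w) 𝕂.- 𝕂.1# 𝕂.* 𝕂.1# 𝕂.* n) (cong (𝕂._* s) (sym (𝕂.*-identityʳ x)))) (sym (norm-coordinates (as-coordinates x))))
          (trans (cong (λ w → (y 𝕂.* y 𝕂.+ w) 𝕂.- 𝕂.1# 𝕂.* 𝕂.1# 𝕂.* n) (cong (𝕂._* s) (sym (𝕂.*-identityʳ y)))) (sym (norm-coordinates (as-coordinates y)))))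
          (trans (cong (𝕂._- norm (θ + ι y)) e) (EK.x-x≡0 _)))) nz)
        where open KI
              lem : ∀ x y s n o → (x 𝕂.- y) 𝕂.* ((x 𝕂.+ y) 𝕂.+ s) ≡ ((x 𝕂.* x 𝕂.+ x 𝕂.* s) 𝕂.- o 𝕂.* o 𝕂.* n) 𝕂.- ((y 𝕂.* y 𝕂.+ y 𝕂.* s) 𝕂.- o 𝕂.* o 𝕂.* n)
              lem = solve 5 (λ x y s n o → (x :- y) :* ((x :+ y) :+ s) := ((x :* x :+ x :* s) :- o :* o :* n) :- ((y :* y :+ y :* s) :- o :* o :* n)) refl

      norm-fibres : ∀ {x y z} → norm (θ + ι x) ≡ norm (θ + ι y) → norm (θ + ι y) ≡ norm (θ + ι z) → x ≡ y ⊎ y ≡ z ⊎ x ≡ z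
      norm-fibres {x} {y} {z} exy eyz with norm-collision exy | norm-collision eyz
      ... | inj₁ e | _      = inj₁ e
      ... | inj₂ _ | inj₁ e = inj₂ (inj₁ e)
      ... | inj₂ u | inj₂ v = inj₂ (inj₂ (EK.x-y≡0⇒x≡y (trans (lem x y z s) (trans (cong₂ 𝕂._-_ u v) (EK.x-x≡0 𝕂.0#)))))
        where open KI
              lem : ∀ x y z s → x 𝕂.- z ≡ ((x 𝕂.+ y) 𝕂.+ s) 𝕂.- ((y 𝕂.+ z) 𝕂.+ s)
              lem = solve 4 (λ x y z s → x :- z := ((x :+ y) :+ s) :- ((y :+ z) :+ s)) refl

      -- Comparing the coefficients of θ gives k = 1: no two different points of the line are
      -- proportional over the base field.
      parallel : ∀ {k x y} → θ + ι x ≡ ι k * (θ + ι y) → x ≡ y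
      parallel {k} {x} {y} e with basis-unique {x} {𝕂.1#} {k 𝕂.* y} {k} (trans (sym (as-coordinates x)) (trans e
        (trans (lem (ι k) θ (ι y)) (cong (_+ ι k * θ) (sym (ι-* k y))))))
        where open EI
              lem : ∀ k t y → k * (t + y) ≡ k * y + k * t
              lem = solve 3 (λ k t y → k :* (t :+ y) := k :* y :+ k :* t) refl
      ... | x≡ky , 1≡k = trans x≡ky (trans (cong (𝕂._* y) (sym 1≡k)) (𝕂.*-identityˡ y))

      -- if w ∉ K then w(θ+y) = θ+x determines y and x
      secant : ∀ {w x y x′ y′} → (∀ k → ι k ≢ w) → θ + ι x ≡ w * (θ + ι y) → θ + ι x′ ≡ w * (θ + ι y′) → y ≡ y′
      secant {w} {x} {y} {x′} {y′} w∉K e e′ with (y 𝕂.- y′) EK.≟ 𝕂.0#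
      ... | yes z = EK.x-y≡0⇒x≡y z
      ... | no nz with KF.inverse (y 𝕂.- y′) nz
      ...   | v , uv≡1 = ⊥-elim (w∉K ((x 𝕂.- x′) 𝕂.* v) (begin
        ι ((x 𝕂.- x′) 𝕂.* v)                       ≡⟨ ι-* (x 𝕂.- x′) v ⟩
        ι (x 𝕂.- x′) * ι v                         ≡⟨ cong (_* ι v) (trans (ι-- x x′) (trans (lem₁ θ (ι x) (ι x′)) (trans (cong₂ _-_ e e′) (lem₂ w θ (ι y) (ι y′))))) ⟩
        w * (ι y - ι y′) * ι v                     ≡⟨ cong (λ z → w * z * ι v) (sym (ι-- y y′)) ⟩
        w * ι (y 𝕂.- y′) * ι v                     ≡⟨ *-assoc w _ _ ⟩
        w * (ι (y 𝕂.- y′) * ι v)                   ≡⟨ cong (w *_) (trans (sym (ι-* (y 𝕂.- y′) v)) (trans (cong ι uv≡1) ι-1)) ⟩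
        w * 1#                                     ≡⟨ *-identityʳ w ⟩
        w                                          ∎))
        where open EI
              open ≡-Reasoning
              lem₁ : ∀ t x x′ → x - x′ ≡ (t + x) - (t + x′)
              lem₁ = solve 3 (λ t x x′ → x :- x′ := (t :+ x) :- (t :+ x′)) refl
              lem₂ : ∀ w t y y′ → w * (t + y) - w * (t + y′) ≡ w * (y - y′)
              lem₂ = solve 4 (λ w t y y′ → w :* (t :+ y) :- w :* (t :+ y′) := w :* (y :- y′)) refl

-- Logarithms of the points of a line form a relative difference set

module LinePoints where

  open import Data.Nat as ℕ using (ℕ; zero; suc; s≤s; z≤n; NonZero)
  import Data.Nat.Properties as ℕP
  open import Data.Nat.Divisibility using (_∣_; _∣?_; divides; ∣-trans; m∣m*n; n∣m*n; ∣⇒≤; ∣m+n∣m⇒∣n; *-cancelˡ-∣; *-cancelʳ-∣; *-monoˡ-∣; 0∣⇒≡0; >⇒∤)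
  open import Data.Nat.DivMod using (m/n*n≡m; m%n<n; m≡m%n+[m/n]*n; _mod_; m<n⇒m%n≡m)
  open import Data.Nat.Coprimality using (Coprime; coprime-divisor)
  open import Data.Nat.Primality using (Prime)
  import Data.Nat.Tactic.RingSolver as ℕR
  open import Data.Integer as ℤ using (ℤ; 0ℤ; 1ℤ; +_; +≤+)
  import Data.Integer.Properties as ℤP
  import Data.Integer.Tactic.RingSolver as ℤR
  open import Data.Fin as Fin using (Fin; toℕ)
  import Data.Fin.Properties as FinP
  open import Data.Product using (_×_; _,_; proj₁; proj₂; ∃-syntax)
  open import Data.Sum using (_⊎_; inj₁; inj₂) renaming (map to map-⊎)
  open import Data.Empty using (⊥-elim)
  open import Relation.Nullary using (yes; no; ¬_; Dec)
  open import Relation.Nullary.Decidable using (decidable-stable)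
  open import Relation.Binary.Definitions using (Tri; tri<; tri≈; tri>)
  open import Relation.Binary.PropositionalEquality
  open import Algebra.Bundles using (CommutativeRing)
  open IntegerSums
  open PointSums
  open FiniteFields
  open IntegerCoefficients using (module RingIdentities)
  open Lines

  ∑-multiples : ∀ k m .{{_ : NonZero m}} (h : ℕ → ℤ) → ∑ (k ℕ.* m) (λ s → 𝟙 m s ℤ.* h s) ≡ ∑ k (λ j → h (j ℕ.* m))
  ∑-multiples zero    m         h = refl
  ∑-multiples (suc k) m@(suc m′) h = begin
    ∑ (m ℕ.+ k ℕ.* m) f                        ≡⟨ cong (λ n → ∑ n f) (ℕP.+-comm m (k ℕ.* m)) ⟩
    ∑ (k ℕ.* m ℕ.+ m) f                        ≡⟨ ∑-split (k ℕ.* m) m f ⟩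
    ∑ (k ℕ.* m) f ℤ.+ ∑ m (λ i → f (k ℕ.* m ℕ.+ i)) ≡⟨ cong₂ ℤ._+_ (∑-multiples k m h) block ⟩
    ∑ k (λ j → h (j ℕ.* m)) ℤ.+ h (k ℕ.* m)    ∎
    where
    open ≡-Reasoning
    f : ℕ → ℤ
    f s = 𝟙 m s ℤ.* h s
    first : f (k ℕ.* m ℕ.+ 0) ≡ h (k ℕ.* m)
    first = trans (cong f (ℕP.+-identityʳ (k ℕ.* m))) (trans (cong (ℤ._* h (k ℕ.* m)) (⟦⟧-yes (m ∣? (k ℕ.* m)) (n∣m*n k))) (ℤP.*-identityˡ (h (k ℕ.* m))))
    rest : ∀ i → i ℕ.< m′ → f (k ℕ.* m ℕ.+ suc i) ≡ 0ℤ
    rest i i<m′ = cong (ℤ._* h (k ℕ.* m ℕ.+ suc i)) (⟦⟧-no (m ∣? (k ℕ.* m ℕ.+ suc i)) λ d → >⇒∤ (s≤s i<m′) (∣m+n∣m⇒∣n d (n∣m*n k)))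
    block : ∑ m (λ i → f (k ℕ.* m ℕ.+ i)) ≡ h (k ℕ.* m)
    block = trans (∑-suc m′ (λ i → f (k ℕ.* m ℕ.+ i))) (trans (cong₂ ℤ._+_ first (∑-zero m′ rest)) (ℤP.+-identityʳ _))

  periodic-% : ∀ n .{{_ : NonZero n}} {h : ℕ → ℤ} → Periodic n h → ∀ t → h (t ℕ.% n) ≡ h t
  periodic-% n {h} per t = trans (sym (periodic-* (t ℕ./ n) per (t ℕ.% n))) (cong h (sym (m≡m%n+[m/n]*n t n)))

  common-shift : ∀ {d a b u} → d ∣ a ℕ.+ u → d ∣ b ℕ.+ u → b ℕ.≤ a → ∃[ c ] a ≡ b ℕ.+ c ℕ.* d
  common-shift {d} {a} {b} {u} da db b≤a with ∣m+n∣m⇒∣n (subst (d ∣_) (trans (cong (ℕ._+ u) (sym (ℕP.m+[n∸m]≡n b≤a))) (lem b (a ℕ.∸ b) u)) da) db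
    where lem : ∀ b x u → b ℕ.+ x ℕ.+ u ≡ b ℕ.+ u ℕ.+ x
          lem = ℕR.solve-∀
  ... | divides c e = c , trans (sym (ℕP.m+[n∸m]≡n b≤a)) (cong (b ℕ.+_) e)

  module Line {r : ℕ} .{{r≢0 : NonZero r}} (E : QuadExt (suc r)) where
    open Extension E
    open QuadExt E using (F; K; ι)
    open CommutativeRing EF.commutativeRing using (Carrier; _+_; _*_; -_; _-_; 0#; 1#; *-identityˡ; *-identityʳ; *-comm; *-assoc)
    open FiniteField F using (_^_)
    private module 𝕂 = CommutativeRing EK.commutativeRing
    private module KF = FiniteField K

    generator : EF.Generator
    generator = EF.generator
    open EF.Generator generator public

    private instance
      N≢0 : NonZero N
      N≢0 = ℕP.m*n≢0 r q+1

    g^N : g ^ N ≡ 1#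
    g^N = trans (cong (g ^_) N-size) (EF.fermat g≢0)

    -- The (q - 1)-st power of g^(c(q+1)) is 1, and such elements belong to the base field.
    g^-base : ∀ c → ∃[ k ] ι k ≡ g ^ (c ℕ.* q+1)
    g^-base c = root⇒base (g ^ (c ℕ.* q+1)) (trans (sym (EF.^-*′ g (c ℕ.* q+1) r))
      (trans (cong (g ^_) (lem c r q+1)) (trans (EF.^-* g c N) (trans (cong (_^ c) g^N) (EF.1^ c)))))
      where lem : ∀ c r m → c ℕ.* m ℕ.* r ≡ c ℕ.* (r ℕ.* m)
            lem = ℕR.solve-∀

    base⇒∣ : ∀ k {i} → ι k ≡ g ^ i → q+1 ∣ i
    base⇒∣ k {i} e = *-cancelʳ-∣ r (subst (_∣ i ℕ.* r) (ℕP.*-comm r q+1) (subst (_∣ i ℕ.* r) (sym N-size) (order (i ℕ.* r)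
      (trans (EF.^-*′ g i r) (trans (cong (_^ r) (sym e)) (trans (sym (ι-^ k r)) (trans (cong ι (EK.fermat k≢0)) (QuadExt.ι-1 E))))))))
      where k≢0 : k ≢ 𝕂.0#
            k≢0 refl = EF.^≢0 i g≢0 (trans (sym e) ι-0)

    -- The index is reduced modulo q to make the enumeration total on ℕ; it is injective below q.
    point : ℕ → 𝕂.Carrier
    point i = EK.elem (i mod q)

    point-injective : ∀ i j → i ℕ.< q → j ℕ.< q → point i ≡ point j → i ≡ j
    point-injective i j i<q j<q e = trans (sym (mod-< i<q)) (trans (cong toℕ (EK.elem-injective e)) (mod-< j<q))
      where mod-< : ∀ {i} → i ℕ.< q → toℕ (i mod q) ≡ i
            mod-< {i} i<q = trans (FinP.toℕ-fromℕ< (m%n<n i q)) (m<n⇒m%n≡m i<q)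

    module _ {α θ : Carrier} (α≢0 : α ≢ 0#) (θ∉K : ∀ x → ι x ≢ θ) where
      open Basis θ∉K

      Z : ℕ → Carrier
      Z i = α * (θ + ι (point i))

      Z≢0 : ∀ i → Z i ≢ 0#
      Z≢0 i = EF.*≢0 α≢0 (θ+≢0 (point i))

      T : ℕ → ℕ
      T i = proj₁ (log (Z i) (Z≢0 i))

      T<N : ∀ i → T i ℕ.< N
      T<N i = subst (T i ℕ.<_) (sym N-size) (proj₁ (proj₂ (log (Z i) (Z≢0 i))))

      g^T : ∀ i → g ^ T i ≡ Z i
      g^T i = proj₂ (proj₂ (log (Z i) (Z≢0 i)))

      ratio : ∀ {w i j} → Z i ≡ w * Z j → θ + ι (point i) ≡ w * (θ + ι (point j))
      ratio {w} {i} {j} e = EF.*-cancelˡ α≢0 (trans e (lem w α (θ + ι (point j))))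
        where open RingIdentities (FiniteField.isCommutativeRing F)
              lem : ∀ w a z → w * (a * z) ≡ a * (w * z)
              lem = solve 3 (λ w a z → w :* (a :* z) := a :* (w :* z)) refl

      Z-shift : ∀ i j c → T i ≡ T j ℕ.+ c → Z i ≡ g ^ c * Z j
      Z-shift i j c e = begin
        Z i               ≡⟨ sym (g^T i) ⟩
        g ^ T i           ≡⟨ cong (g ^_) (trans e (ℕP.+-comm (T j) c)) ⟩
        g ^ (c ℕ.+ T j)   ≡⟨ EF.^-+ g c (T j) ⟩
        g ^ c * g ^ T j   ≡⟨ cong (g ^ c *_) (g^T j) ⟩
        g ^ c * Z j       ∎
        where open ≡-Reasoning

      T-injective : ∀ {i j} → i ℕ.< q → j ℕ.< q → T i ≡ T j → i ≡ j
      T-injective {i} {j} i<q j<q e = point-injective i j i<q j<q (parallel {𝕂.1#}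
        (trans (ratio {1#} {i} {j} (trans (sym (g^T i)) (trans (cong (g ^_) e) (trans (g^T j) (sym (*-identityˡ (Z j)))))))
               (cong (_* (θ + ι (point j))) (sym (QuadExt.ι-1 E)))))

      -- reduces a symmetric statement about congruent T i, T j to the case T i = T j + c d
      align : ∀ d {R : ℕ → ℕ → Set} → (∀ {i j} → R i j → R j i) → (∀ i j c → T i ≡ T j ℕ.+ c ℕ.* d → R i j) →
        ∀ i j u → d ∣ T i ℕ.+ u → d ∣ T j ℕ.+ u → R i j
      align d {R} swap step i j u di dj = pick (ℕP.≤-total (T j) (T i))
        where
        pick : T j ℕ.≤ T i ⊎ T i ℕ.≤ T j → R i j
        pick (inj₁ le) = step i j (proj₁ c) (proj₂ c)
          where c = common-shift {d} {T i} {T j} {u} di dj le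
        pick (inj₂ le) = swap (step j i (proj₁ c) (proj₂ c))
          where c = common-shift {d} {T j} {T i} {u} dj di le

      -- Logarithms congruent modulo q + 1 belong to points whose ratio is in the base field, which
      -- `parallel` forbids for different points.
      direction-injective : ∀ i j u → q+1 ∣ T i ℕ.+ u → q+1 ∣ T j ℕ.+ u → point i ≡ point j
      direction-injective = align q+1 {λ i j → point i ≡ point j} sym λ i j c e → parallel {proj₁ (g^-base c)}
        (trans (ratio {g ^ (c ℕ.* q+1)} {i} {j} (Z-shift i j (c ℕ.* q+1) e)) (cong (_* (θ + ι (point j))) (sym (proj₂ (g^-base c)))))

      norm-power : ∀ c → norm (g ^ (c ℕ.* r)) ≡ 𝕂.1#
      norm-power c = trans (norm-^ g (c ℕ.* r)) (trans (EK.^-* (norm g) c r) (trans (cong (KF._^ c) (EK.fermat (norm-≢0 g≢0))) (EK.1^ c)))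

      -- Powers g^(c(q-1)) have norm 1, so logarithms congruent modulo q - 1 belong to points of
      -- equal norm; `norm-fibres` then limits each class to two points.
      norm-congruent : ∀ i j u → r ∣ T i ℕ.+ u → r ∣ T j ℕ.+ u → norm (θ + ι (point i)) ≡ norm (θ + ι (point j))
      norm-congruent = align r {λ i j → norm (θ + ι (point i)) ≡ norm (θ + ι (point j))} sym λ i j c e → EK.*-cancelˡ (norm-≢0 α≢0) (begin
          norm α 𝕂.* norm (θ + ι (point i))        ≡⟨ sym (norm-* α (θ + ι (point i))) ⟩
          norm (Z i)                               ≡⟨ cong norm (Z-shift i j (c ℕ.* r) e) ⟩
          norm (g ^ (c ℕ.* r) * Z j)               ≡⟨ norm-* (g ^ (c ℕ.* r)) (Z j) ⟩
          norm (g ^ (c ℕ.* r)) 𝕂.* norm (Z j)      ≡⟨ cong (𝕂._* norm (Z j)) (norm-power c) ⟩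
          𝕂.1# 𝕂.* norm (Z j)                      ≡⟨ 𝕂.*-identityˡ (norm (Z j)) ⟩
          norm (Z j)                               ≡⟨ norm-* α (θ + ι (point j)) ⟩
          norm α 𝕂.* norm (θ + ι (point j))        ∎)
        where open ≡-Reasoning

      hits₊ : ∀ u → ∑ q (λ i → 𝟙 q+1 (T i ℕ.+ u)) ℤ.≤ 1ℤ
      hits₊ u = ∑-atMostOne q (λ i → 𝟙 q+1 (T i ℕ.+ u)) (λ i _ → ⟦⟧-≤1 (q+1 ∣? (T i ℕ.+ u)))
        (λ i j i<q j<q ni nj → point-injective i j i<q j<q (direction-injective i j u (⟦⟧≢0 (q+1 ∣? (T i ℕ.+ u)) ni) (⟦⟧≢0 (q+1 ∣? (T j ℕ.+ u)) nj)))

      hits₋ : ∀ u → ∑ q (λ i → 𝟙 r (T i ℕ.+ u)) ℤ.≤ + 2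
      hits₋ u = ∑-atMostTwo q (λ i → 𝟙 r (T i ℕ.+ u)) (λ i _ → ⟦⟧-≤1 (r ∣? (T i ℕ.+ u)))
        (λ i j k i<q j<q k<q ni nj nk → map-⊎ (point-injective i j i<q j<q) (map-⊎ (point-injective j k j<q k<q) (point-injective i k i<q k<q))
          (norm-fibres {point i} {point j} {point k} (norm-congruent i j u (⟦⟧≢0 (r ∣? (T i ℕ.+ u)) ni) (⟦⟧≢0 (r ∣? (T j ℕ.+ u)) nj))
                       (norm-congruent j k u (⟦⟧≢0 (r ∣? (T j ℕ.+ u)) nj) (⟦⟧≢0 (r ∣? (T k ℕ.+ u)) nk))))

      private
        diff : ℕ → ℕ → ℕ
        diff i j = (T i ℕ.+ (N ℕ.∸ T j)) ℕ.% N

        diff<N : ∀ i j → diff i j ℕ.< N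
        diff<N i j = m%n<n (T i ℕ.+ (N ℕ.∸ T j)) N

        Z-diff : ∀ i j → Z i ≡ g ^ diff i j * Z j
        Z-diff i j = begin
          Z i                                   ≡⟨ sym (g^T i) ⟩
          g ^ T i                               ≡⟨ sym (trans (cong (g ^ T i *_) g^N) (*-identityʳ (g ^ T i))) ⟩
          g ^ T i * g ^ N                       ≡⟨ sym (EF.^-+ g (T i) N) ⟩
          g ^ (T i ℕ.+ N)                       ≡⟨ cong (g ^_) index ⟩
          g ^ (D ℕ./ N ℕ.* N ℕ.+ (D ℕ.% N ℕ.+ T j)) ≡⟨ EF.^-+ g (D ℕ./ N ℕ.* N) (D ℕ.% N ℕ.+ T j) ⟩
          g ^ (D ℕ./ N ℕ.* N) * g ^ (D ℕ.% N ℕ.+ T j)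
            ≡⟨ cong (_* g ^ (D ℕ.% N ℕ.+ T j)) (trans (EF.^-* g (D ℕ./ N) N) (trans (cong (_^ (D ℕ./ N)) g^N) (EF.1^ (D ℕ./ N)))) ⟩
          1# * g ^ (D ℕ.% N ℕ.+ T j)            ≡⟨ *-identityˡ _ ⟩
          g ^ (D ℕ.% N ℕ.+ T j)                 ≡⟨ trans (EF.^-+ g (D ℕ.% N) (T j)) (cong (g ^ diff i j *_) (g^T j)) ⟩
          g ^ diff i j * Z j                    ∎
          where
          open ≡-Reasoning
          D = T i ℕ.+ (N ℕ.∸ T j)
          re : ∀ a b c → a ℕ.+ b ℕ.+ c ≡ b ℕ.+ (a ℕ.+ c)
          re = ℕR.solve-∀
          index : T i ℕ.+ N ≡ D ℕ./ N ℕ.* N ℕ.+ (D ℕ.% N ℕ.+ T j)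
          index = trans (cong (T i ℕ.+_) (sym (ℕP.m∸n+n≡m (ℕP.<⇒≤ (T<N j)))))
            (trans (sym (ℕP.+-assoc (T i) (N ℕ.∸ T j) (T j))) (trans (cong (ℕ._+ T j) (m≡m%n+[m/n]*n D N)) (re (D ℕ.% N) (D ℕ./ N ℕ.* N) (T j))))

        diff-∉K : ∀ {i j} → i ℕ.< q → j ℕ.< q → i ≢ j → ∀ k → ι k ≢ g ^ diff i j
        diff-∉K {i} {j} i<q j<q i≢j k e = i≢j (point-injective i j i<q j<q (parallel {k} (trans (ratio {w = g ^ diff i j} {i} {j} (Z-diff i j)) (cong (_* (θ + ι (point j))) (sym e)))))

        off : ℕ → ℕ → ℤ
        off i j = 1ℤ ℤ.- δ i j

        hit : ℕ → ℕ → ℕ → ℤ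
        hit s i j = off i j ℤ.* δ s (diff i j)

        hit≢0 : ∀ s i j → hit s i j ≢ 0ℤ → i ≢ j × s ≡ diff i j
        hit≢0 s i j n = i≢j , ⟦⟧≢0 (s ℕ.≟ diff i j) (λ e → n (trans (cong (off i j ℤ.*_) e) (ℤP.*-zeroʳ (off i j))))
          where i≢j : i ≢ j
                i≢j i≡j = n (trans (cong (λ z → (1ℤ ℤ.- z) ℤ.* δ s (diff i j)) (⟦⟧-yes (i ℕ.≟ j) i≡j)) (ℤP.*-zeroˡ (δ s (diff i j))))

        hit≤1 : ∀ s i j → hit s i j ℤ.≤ 1ℤ
        hit≤1 s i j = bounded (i ℕ.≟ j) (s ℕ.≟ diff i j)
          where
          bounded : {P Q : Set} (d : Dec P) (e : Dec Q) → (1ℤ ℤ.- ⟦ d ⟧) ℤ.* ⟦ e ⟧ ℤ.≤ 1ℤ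
          bounded (yes _) (yes _) = +≤+ z≤n
          bounded (yes _) (no _)  = +≤+ z≤n
          bounded (no _)  (yes _) = ℤP.≤-refl
          bounded (no _)  (no _)  = +≤+ z≤n

        g^% : ∀ e → g ^ (e ℕ.% N) ≡ g ^ e
        g^% e = sym (trans (cong (g ^_) (m≡m%n+[m/n]*n e N)) (trans (EF.^-+ g (e ℕ.% N) (e ℕ./ N ℕ.* N))
          (trans (cong (g ^ (e ℕ.% N) *_) (trans (EF.^-* g (e ℕ./ N) N) (trans (cong (_^ (e ℕ./ N)) g^N) (EF.1^ (e ℕ./ N))))) (*-identityʳ _))))

        log-unique : ∀ a b → a ℕ.< N → b ℕ.< N → g ^ a ≡ g ^ b → a ≡ b
        log-unique a b a<N b<N e = compare (ℕP.<-cmp a b)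
          where
          compare : Tri (a ℕ.< b) (a ≡ b) (b ℕ.< a) → a ≡ b
          compare (tri≈ _ a≡b _) = a≡b
          compare (tri< a<b _ _) = ⊥-elim (EF.^-injective g≢0 order a<b (subst (b ℕ.<_) N-size b<N) e)
          compare (tri> _ _ b<a) = ⊥-elim (EF.^-injective g≢0 order b<a (subst (a ℕ.<_) N-size a<N) (sym e))

        recover : ∀ i j → T i ≡ (diff i j ℕ.+ T j) ℕ.% N
        recover i j = log-unique (T i) ((diff i j ℕ.+ T j) ℕ.% N) (T<N i) (m%n<n (diff i j ℕ.+ T j) N) (trans (g^T i) (trans (Z-diff i j) (trans (cong (g ^ diff i j *_) (sym (g^T j)))
          (trans (sym (EF.^-+ g (diff i j) (T j))) (sym (g^% (diff i j ℕ.+ T j)))))))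

        ρ : ℕ → ℤ
        ρ s = ∑ q (λ i → ∑ q (hit s i))

        -- The difference s fixes the ratio w = g^s, which is outside the base field because i ≠ j.
        -- By `secant`, w determines j, and then T i ≡ s + T j determines i.
        ρ≤1 : ∀ s → ρ s ℤ.≤ 1ℤ
        ρ≤1 s = ∑-atMostOne q (λ i → ∑ q (hit s i))
          (λ i i<q → ∑-atMostOne q (hit s i) (λ j _ → hit≤1 s i j) (λ j j′ j<q j′<q n n′ → same i i j j′ i<q i<q j<q j′<q (hit≢0 s i j n) (hit≢0 s i j′ n′)))
          (λ i i′ i<q i′<q n n′ → rows i i′ i<q i′<q (∑-nonzero q (hit s i) n) (∑-nonzero q (hit s i′) n′))
          where
          same : ∀ i i′ j j′ → i ℕ.< q → i′ ℕ.< q → j ℕ.< q → j′ ℕ.< q → i ≢ j × s ≡ diff i j → i′ ≢ j′ × s ≡ diff i′ j′ → j ≡ j′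
          same i i′ j j′ i<q i′<q j<q j′<q (i≢j , e) (_ , e′) = point-injective j j′ j<q j′<q
            (secant {g ^ diff i j} {point i} {point j} {point i′} {point j′} (diff-∉K i<q j<q i≢j) (ratio {w = g ^ diff i j} {i} {j} (Z-diff i j))
              (ratio {w = g ^ diff i j} {i′} {j′} (trans (Z-diff i′ j′) (cong (λ d → g ^ d * Z j′) (trans (sym e′) e)))))
          rows : ∀ i i′ → i ℕ.< q → i′ ℕ.< q → ∃[ j ] (j ℕ.< q × hit s i j ≢ 0ℤ) → ∃[ j ] (j ℕ.< q × hit s i′ j ≢ 0ℤ) → i ≡ i′
          rows i i′ i<q i′<q (j , j<q , n) (j′ , j′<q , n′) = T-injective i<q i′<q (begin
            T i                          ≡⟨ recover i j ⟩
            (diff i j ℕ.+ T j) ℕ.% N     ≡⟨ cong₂ (λ d k → (d ℕ.+ T k) ℕ.% N) (trans (sym (proj₂ (hit≢0 s i j n))) (proj₂ (hit≢0 s i′ j′ n′))) (same i i′ j j′ i<q i′<q j<q j′<q (hit≢0 s i j n) (hit≢0 s i′ j′ n′)) ⟩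
            (diff i′ j′ ℕ.+ T j′) ℕ.% N  ≡⟨ sym (recover i′ j′) ⟩
            T i′                         ∎)
            where open ≡-Reasoning

        ρ-forbidden : ∀ s → q+1 ∣ s → ρ s ≡ 0ℤ
        ρ-forbidden s (divides c e) = ∑-zero q λ i i<q → ∑-zero q λ j j<q → zero-hit i j i<q j<q
          where
          zero-hit : ∀ i j → i ℕ.< q → j ℕ.< q → hit s i j ≡ 0ℤ
          zero-hit i j i<q j<q = decidable-stable (hit s i j ℤ.≟ 0ℤ) λ n →
            diff-∉K i<q j<q (proj₁ (hit≢0 s i j n)) (proj₁ (g^-base c)) (trans (proj₂ (g^-base c)) (cong (g ^_) (trans (sym e) (proj₂ (hit≢0 s i j n)))))

        ρ≤ : ∀ s → ρ s ℤ.≤ 1ℤ ℤ.- 𝟙 q+1 s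
        ρ≤ s = cases (q+1 ∣? s)
          where cases : (d : Dec (q+1 ∣ s)) → ρ s ℤ.≤ 1ℤ ℤ.- ⟦ d ⟧
                cases (yes d) = ℤP.≤-reflexive (ρ-forbidden s d)
                cases (no _)  = ρ≤1 s

        collect : ∀ (h : ℕ → ℤ) → ∑ q (λ i → ∑ q λ j → off i j ℤ.* h (diff i j)) ≡ ∑ N (λ s → ρ s ℤ.* h s)
        collect h = begin
          ∑ q (λ i → ∑ q λ j → off i j ℤ.* h (diff i j))
            ≡⟨ ∑-cong q (λ i → ∑-cong q λ j → trans (cong (off i j ℤ.*_) (sym (∑-δ N (diff i j) h (diff<N i j))))
                 (trans (sym (∑-*ˡ N (off i j) (λ s → δ s (diff i j) ℤ.* h s))) (∑-cong N λ s → sym (ℤP.*-assoc (off i j) (δ s (diff i j)) (h s))))) ⟩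
          ∑ q (λ i → ∑ q λ j → ∑ N λ s → hit s i j ℤ.* h s) ≡⟨ ∑-cong q (λ i → ∑-swap q N (λ j s → hit s i j ℤ.* h s)) ⟩
          ∑ q (λ i → ∑ N λ s → ∑ q λ j → hit s i j ℤ.* h s) ≡⟨ ∑-swap q N (λ i s → ∑ q λ j → hit s i j ℤ.* h s) ⟩
          ∑ N (λ s → ∑ q λ i → ∑ q λ j → hit s i j ℤ.* h s)
            ≡⟨ ∑-cong N (λ s → trans (∑-cong q λ i → ∑-*ʳ q (h s) (hit s i)) (∑-*ʳ q (h s) (λ i → ∑ q (hit s i)))) ⟩
          ∑ N (λ s → ρ s ℤ.* h s) ∎
          where open ≡-Reasoning

        -- There are q(q - 1) ordered pairs of different points, and N - (q - 1) = q(q - 1) residues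
        -- outside the multiples of q + 1. Equality of the two numbers forces every such residue to
        -- occur exactly once.
        total : ∑ N ρ ≡ ∑ N (λ s → 1ℤ ℤ.- 𝟙 q+1 s)
        total = begin
          ∑ N ρ                           ≡⟨ ∑-cong N (λ s → sym (ℤP.*-identityʳ (ρ s))) ⟩
          ∑ N (λ s → ρ s ℤ.* 1ℤ)          ≡⟨ sym (collect (λ _ → 1ℤ)) ⟩
          ∑ q (λ i → ∑ q λ j → off i j ℤ.* 1ℤ) ≡⟨ ∑-cong< q (λ i i<q → trans (∑-cong q λ j → ℤP.*-identityʳ (off i j)) (row i i<q)) ⟩
          ∑ q (λ i → + q ℤ.- 1ℤ)          ≡⟨ ∑-const q (+ q ℤ.- 1ℤ) ⟩
          + q ℤ.* (+ q ℤ.- 1ℤ)            ≡⟨ arithmetic (+ r) ⟩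
          + r ℤ.* (+ q+1) ℤ.- + r         ≡⟨ cong (ℤ._- + r) (sym (ℤP.pos-* r q+1)) ⟩
          + N ℤ.- + r                     ≡⟨ sym (trans (∑-- N (λ _ → 1ℤ) (𝟙 q+1)) (cong₂ ℤ._-_ (trans (∑-const N 1ℤ) (ℤP.*-identityʳ (+ N))) (∑-𝟙 r q+1))) ⟩
          ∑ N (λ s → 1ℤ ℤ.- 𝟙 q+1 s)      ∎
          where
          open ≡-Reasoning
          arithmetic : ∀ r → (1ℤ ℤ.+ r) ℤ.* ((1ℤ ℤ.+ r) ℤ.- 1ℤ) ≡ r ℤ.* (1ℤ ℤ.+ (1ℤ ℤ.+ r)) ℤ.- r
          arithmetic = ℤR.solve-∀
          row : ∀ i → i ℕ.< q → ∑ q (off i) ≡ + q ℤ.- 1ℤ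
          row i i<q = trans (∑-- q (λ _ → 1ℤ) (δ i)) (cong₂ ℤ._-_ (trans (∑-const q 1ℤ) (ℤP.*-identityʳ (+ q)))
            (trans (∑-cong q λ j → trans (⟦⟧-cong (i ℕ.≟ j) (j ℕ.≟ i) sym sym) (sym (ℤP.*-identityʳ (δ j i)))) (∑-δ q i (λ _ → 1ℤ) i<q)))

      lineLogs : LineLogs r T
      lineLogs = record
        { T<N         = T<N
        ; differences = λ h per → begin
            ∑ q (λ i → ∑ q λ j → off i j ℤ.* h (T i ℕ.+ (N ℕ.∸ T j)))
              ≡⟨ ∑-cong q (λ i → ∑-cong q λ j → cong (off i j ℤ.*_) (sym (periodic-% N per (T i ℕ.+ (N ℕ.∸ T j))))) ⟩
            ∑ q (λ i → ∑ q λ j → off i j ℤ.* h (diff i j)) ≡⟨ collect h ⟩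
            ∑ N (λ s → ρ s ℤ.* h s)                       ≡⟨ ∑-cong< N (λ s s<N → cong (ℤ._* h s) (∑-squeeze N (λ s _ → ρ≤ s) total s s<N)) ⟩
            ∑ N (λ s → (1ℤ ℤ.- 𝟙 q+1 s) ℤ.* h s)          ≡⟨ ∑-cong N (λ s → lem (𝟙 q+1 s) (h s)) ⟩
            ∑ N (λ s → h s ℤ.- 𝟙 q+1 s ℤ.* h s)           ≡⟨ ∑-- N h (λ s → 𝟙 q+1 s ℤ.* h s) ⟩
            ∑ N h ℤ.- ∑ N (λ s → 𝟙 q+1 s ℤ.* h s)         ≡⟨ cong (λ z → ∑ N h ℤ.- z) (∑-multiples r q+1 h) ⟩
            ∑ N h ℤ.- ∑ r (λ j → h (j ℕ.* q+1))           ∎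
        ; hits₊       = hits₊
        ; hits₋       = hits₋
        }
        where
        open ≡-Reasoning
        lem : ∀ a b → (1ℤ ℤ.- a) ℤ.* b ≡ b ℤ.- a ℤ.* b
        lem = ℤR.solve-∀

  module _ {r : ℕ} .{{r≢0 : NonZero r}} (E : QuadExt (suc r)) where
    open Extension E
    open QuadExt E using (F; TwoPrimitive)
    open CommutativeRing EF.commutativeRing using (Carrier; 0#; 1#)
    open FiniteField F using (_^_)

    -- t ≡ 2 (mod 4) and no odd prime divisor of N divides t, i.e. gcd(t, N) = 2 when 4 ∣ N
    two-primitive : ∀ {g} → g ≢ 0# → (∀ j → g ^ j ≡ 1# → r ℕ.+ r ℕ.* q ∣ j) → 2 ∣ N →
      ∀ t {z} → g ^ t ≡ z → 2 ∣ t → ¬ 4 ∣ t → (∀ p → Prime p → p ≢ 2 → p ∣ N → ¬ p ∣ t) → TwoPrimitive z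
    two-primitive {g} g≢0 order 2∣N _ refl (divides t refl) 4∤ odd = EF.^≢0 (t ℕ.* 2) g≢0 , h>0 , power , minimal
      where
      m h : ℕ
      m = r ℕ.+ r ℕ.* q
      h = m ℕ./ 2
      m≡h2 : m ≡ h ℕ.* 2
      m≡h2 = sym (m/n*n≡m (subst (2 ∣_) N-size 2∣N))
      h>0 : 0 ℕ.< h
      h>0 = ℕP.n≢0⇒n>0 λ e → ℕ.≢-nonZero⁻¹ m (trans m≡h2 (cong (ℕ._* 2) e))
      power : (g ^ (t ℕ.* 2)) ^ h ≡ 1#
      power = trans (sym (EF.^-*′ g (t ℕ.* 2) h)) (EF.^-∣ {g} {m} {t ℕ.* 2 ℕ.* h} (divides t (trans (lem t h) (cong (t ℕ.*_) (sym m≡h2)))) (EF.fermat g≢0))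
        where lem : ∀ t h → t ℕ.* 2 ℕ.* h ≡ t ℕ.* (h ℕ.* 2)
              lem = ℕR.solve-∀
      -- Here the logarithm is 2t and the group order is 2h. A common prime factor of h and t is not
      -- 2, since otherwise 4 ∣ 2t; an odd one would divide both N and the logarithm.
      coprime : Coprime h t
      coprime {d} (d∣h , d∣t) with d ℕ.≟ 1
      ... | yes e = e
      ... | no d≢1 with primeDivisor d d≢1 {{ℕ.≢-nonZero λ { refl → ℕP.<⇒≢ h>0 (sym (0∣⇒≡0 d∣h)) }}}
      ...   | p , pp , p∣d with p ℕ.≟ 2
      ...     | yes refl = ⊥-elim (4∤ (*-monoˡ-∣ 2 (∣-trans p∣d d∣t)))
      ...     | no p≢2   = ⊥-elim (odd p pp p≢2 (subst (p ∣_) (sym (trans N-size m≡h2)) (∣-trans (∣-trans p∣d d∣h) (m∣m*n 2))) (∣-trans (∣-trans p∣d d∣t) (m∣m*n 2)))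
      -- 2h ∣ 2tj gives h ∣ tj, and coprimality gives h ∣ j.
      minimal : ∀ j → 0 ℕ.< j → j ℕ.< h → (g ^ (t ℕ.* 2)) ^ j ≢ 1#
      minimal j 0<j j<h e = ℕP.<⇒≱ j<h (∣⇒≤ {{ℕ.>-nonZero 0<j}} (coprime-divisor coprime (*-cancelˡ-∣ 2 (subst₂ _∣_ (trans m≡h2 (ℕP.*-comm h 2)) (lem t j) (order (t ℕ.* 2 ℕ.* j) (trans (EF.^-*′ g (t ℕ.* 2) j) e))))))
        where lem : ∀ t j → t ℕ.* 2 ℕ.* j ≡ 2 ℕ.* (t ℕ.* j)
              lem = ℕR.solve-∀

-- A sieve criterion depending on few data of q

module Crude where

  open import Data.Nat as ℕ using (ℕ; zero; suc; s≤s; z≤n; NonZero; _≤ᵇ_; _<ᵇ_)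
  import Data.Nat.Properties as ℕP
  open import Data.Nat.Divisibility using (_∣_; ∣-trans; m∣m*n; n∣m*n)
  open import Data.Nat.DivMod using (m/n*n≡m)
  open import Data.Nat.Primality using (Prime)
  open import Data.Nat.Coprimality using (Coprime)
  import Data.Nat.Tactic.RingSolver as ℕR
  open import Data.Integer hiding (suc; NonZero; ∣_∣; _≤ᵇ_)
  open import Data.Integer.Properties
  open import Data.Integer.Tactic.RingSolver using (solve-∀)
  open import Data.Bool using (Bool; true; _∧_)
  open import Data.List using (List; []; _∷_; map; _++_; length)
  open import Data.List.Relation.Unary.All as All using (All; []; _∷_)
  open import Data.List.Relation.Unary.AllPairs using ([]; _∷_)
  open import Data.List.Relation.Unary.Unique.Propositional using (Unique)
  open import Data.Product using (_×_; _,_; proj₁; proj₂)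
  open import Data.Sum using (inj₁; inj₂)
  open import Data.Unit using (tt)
  open import Data.Empty using (⊥-elim)
  open import Function using (_∘_)
  open import Relation.Binary.PropositionalEquality
  open IntegerSums
  open PointSums
  open SieveBounds
  open Sieve

  quot : ℕ → ℕ → ℕ
  quot n zero    = 0
  quot n (suc d) = n ℕ./ suc d

  quot-exact : ∀ {n} d → d ∣ n → quot n d ℕ.* d ≡ n
  quot-exact (suc d) d∣n = m/n*n≡m d∣n
  quot-exact zero    d∣n = sym (Data.Nat.Divisibility.0∣⇒≡0 d∣n)

  recips : ℕ → List ℕ → ℕ
  recips den []       = 0
  recips den (x ∷ xs) = quot den x ℕ.+ recips den xs

  -- den (1 − Σ_{l ∈ rest} 1/l − t/29)
  loss : List ℕ → ℕ → ℕ
  loss rest t = recips (29 ℕ.* productℕ rest) rest ℕ.+ t ℕ.* productℕ rest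

  gain : List ℕ → ℕ → ℕ
  gain rest t = 29 ℕ.* productℕ rest ℕ.∸ loss rest t

  cost : ℕ → List ℕ → ℕ → ℕ
  cost C rest t = 29 ℕ.* productℕ rest ℕ.* C ℕ.* (1 ℕ.+ (length rest ℕ.+ t))

  ≤ᵇ-true : ∀ {m n} → (m ≤ᵇ n) ≡ true → m ℕ.≤ n
  ≤ᵇ-true {m} {n} e = ℕP.≤ᵇ⇒≤ m n (subst Data.Bool.T (sym e) tt)

  <ᵇ-true : ∀ {m n} → (m <ᵇ n) ≡ true → m ℕ.< n
  <ᵇ-true {m} {n} e = ℕP.<ᵇ⇒< m n (subst Data.Bool.T (sym e) tt)

  -- For w = ρ - 1 with ρ the integer part of √q, this is (ρ - 1)(1 - Σ 1/l - t/29) ≥ C(1 + number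
  -- of sieved primes), cleared of denominators. The separate positivity test is needed because
  -- `gain` is a truncated difference.
  splitOK : ℕ → ℕ → ℕ → List ℕ → Bool
  splitOK w t C rest = (loss rest t <ᵇ 29 ℕ.* productℕ rest) ∧ (cost C rest t ≤ᵇ w ℕ.* gain rest t)

  ∣productℕ : ∀ {P} → All (λ l → l ∣ productℕ P) P
  ∣productℕ {[]}    = []
  ∣productℕ {x ∷ P} = m∣m*n (productℕ P) ∷ All.map (λ d → ∣-trans d (n∣m*n x)) ∣productℕ

  -- The sign of y is unknown. For y ≤ 0 the left side is at most 0 and only z ≥ 0 counts. It allows
  -- any prime l ≥ 29 to be replaced by 29.
  shrink : ∀ m l y z → + l * y ≤ z → 0ℤ ≤ z → m ℕ.≤ l → + m * y ≤ z
  shrink m l y z h 0≤z m≤l with ≤-total 0ℤ y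
  ... | inj₁ 0≤y = ≤-trans (*-monoʳ-≤-nonNeg y {{nonNegative 0≤y}} (+≤+ m≤l)) h
  ... | inj₂ y≤0 = ≤-trans (≤-trans (*-monoˡ-≤-nonNeg (+ m) y≤0) (≤-reflexive (*-zeroʳ (+ m)))) 0≤z

  module _ {r : ℕ} {T : ℕ → ℕ} .{{_ : NonZero r}} (L : LineLogs r T) where
    open LineLogs L

    module _ (4∣N : 4 ∣ N) (2∣q+1 : 2 ∣ q+1) (2∣r : 2 ∣ r) {M rest big : List ℕ}
             (primes : All Prime M) (odd : All (Coprime 2) M) (div-N : All (_∣ N) M) (unique : Unique M)
             (rest-ok : All (λ l → Prime l × Coprime 2 l × l ∣ N × All (l ≢_) M) rest)
             (big-ok : All (λ l → (Prime l × Coprime 2 l × l ∣ N × All (l ≢_) M) × 29 ℕ.≤ l) big) where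

      private
        φ K den : ℕ
        φ = leads (core M)
        K = Error.weights q+1 1 0 (core M)
        den = 29 ℕ.* productℕ rest

      -- With s = 1, R = ρ+1 and err₀ estimated by R C φ, the sieve needs q(1 − Σ1/l) > C R (1 + #P).
      crude-sieve : ∀ {ρ C} → K ≡ C ℕ.* φ → 1 ℕ.≤ φ → q ℕ.≤ suc ρ ℕ.* suc ρ → ρ ℕ.* ρ ℕ.≤ q → 1 ℕ.≤ ρ →
        splitOK (ρ ℕ.∸ 1) (length big) C rest ≡ true → HitsGood L (M ++ (rest ++ big))
      crude-sieve {ρ} {C} K≡ 1≤φ q≤R² ρ²≤q 1≤ρ ok = sieve L 4∣N 2∣q+1 2∣r primes odd div-N unique {rest ++ big}
        (*-cancelˡ-<-nonNeg (+ den) (begin-strict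
          + den * sumOver (rest ++ big) X′                        ≤⟨ upper ⟩
          + φ * (+ q * + loss rest t) + + ((len ℕ.* den) ℕ.* (φ ℕ.* (R ℕ.* C))) <⟨ main ⟩
          + den * (+ (φ ℕ.* q) - + (φ ℕ.* (R ℕ.* C)))              ≤⟨ *-monoˡ-≤-nonNeg (+ den) lower ⟩
          + den * ∑ q (vals (core M) ∘ T)                          ∎))
        where
        open ≤-Reasoning
        R = suc ρ
        t = length big
        len = length rest ℕ.+ t
        open Error q+1 1 R using (err₀; err₀≤; weights)
        X′ : ℕ → ℤ
        X′ = X L 4∣N 2∣q+1 2∣r primes odd div-N unique
        1²q≤R² : 1 ℕ.* 1 ℕ.* q ℕ.≤ R ℕ.* R
        1²q≤R² = subst (ℕ._≤ R ℕ.* R) (sym (ℕP.*-identityˡ q)) q≤R²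
        adm-core = core-admissible L 4∣N 2∣q+1 2∣r primes odd div-N unique
        weights≡ : ∀ Ls → weights Ls ≡ Error.weights q+1 1 0 Ls
        weights≡ []       = refl
        weights≡ (two ∷ Ls)   = cong (4 ℕ.*_) (weights≡ Ls)
        weights≡ (cop l ∷ Ls) = cong (2 ℕ.* (l ℕ.∸ 1) ℕ.*_) (weights≡ Ls)
        weights≡ (div l ∷ Ls) = cong (suc (l ℕ.∸ 1) ℕ.*_) (weights≡ Ls)
        err-core : err₀ (core M) ℕ.≤ φ ℕ.* (R ℕ.* C)
        err-core = ℕP.≤-trans (err₀≤ (s≤s z≤n) (core M)) (ℕP.≤-reflexive (trans (cong (R ℕ.*_) (trans (weights≡ (core M)) K≡)) (lem R C φ)))
          where lem : ∀ r c f → r ℕ.* (c ℕ.* f) ≡ f ℕ.* (r ℕ.* c)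
                lem = ℕR.solve-∀
        lower : + (φ ℕ.* q) - + (φ ℕ.* (R ℕ.* C)) ≤ ∑ q (vals (core M) ∘ T)
        lower = ≤-trans (+-mono-≤ (≤-reflexive (cong +_ (trans (ℕP.*-comm φ q) (cong (ℕ._* φ) (sym (ℕP.*-identityˡ q))))))
            (neg-mono-≤ (+≤+ err-core)))
          (≤-trans (∑vals-≥ L {1} {R} 1²q≤R² (core M) adm-core) (≤-reflexive (*-identityˡ (∑ q (vals (core M) ∘ T)))))
        lX : ∀ {l} → Prime l × Coprime 2 l × l ∣ N × All (l ≢_) M → + l * X′ l ≤ + φ * + q + + l * + (φ ℕ.* (R ℕ.* C))
        lX {zero} (pl , _ , _) = ⊥-elim (ℕP.<⇒≱ (prime≥2 pl) z≤n)
        lX {l@(suc l-1)} (pl , c , d , n) = begin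
          + l * X′ l ≡⟨ sym (*-identityˡ (+ l * X′ l)) ⟩
          1ℤ * (+ l * X′ l) ≤⟨ X-bound L 4∣N 2∣q+1 2∣r primes odd div-N unique {1} {R} 1²q≤R² pl c d n ⟩
          + (1 ℕ.* q ℕ.* φ ℕ.+ err₀ (div l ∷ core M)) ≤⟨ +≤+ (ℕP.+-mono-≤ (ℕP.≤-reflexive (trans (cong (ℕ._* φ) (ℕP.*-identityˡ q)) (ℕP.*-comm q φ))) (err₀≤ (s≤s z≤n) (div l ∷ core M))) ⟩
          + (φ ℕ.* q ℕ.+ R ℕ.* (l ℕ.* weights (core M))) ≡⟨ cong (λ z → + (φ ℕ.* q ℕ.+ R ℕ.* (l ℕ.* z))) (trans (weights≡ (core M)) K≡) ⟩
          + (φ ℕ.* q ℕ.+ R ℕ.* (l ℕ.* (C ℕ.* φ))) ≡⟨ cong (λ z → + (φ ℕ.* q ℕ.+ z)) (lem R l C φ) ⟩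
          + (φ ℕ.* q) + + (l ℕ.* (φ ℕ.* (R ℕ.* C))) ≡⟨ cong₂ _+_ (pos-* φ q) (pos-* l (φ ℕ.* (R ℕ.* C))) ⟩
          + φ * + q + + l * + (φ ℕ.* (R ℕ.* C)) ∎
          where lem : ∀ r l c f → r ℕ.* (l ℕ.* (c ℕ.* f)) ≡ l ℕ.* (f ℕ.* (r ℕ.* c))
                lem = ℕR.solve-∀
        -- Removing the error φRC first leaves l·Y l ≤ φq, which can be scaled by den/l. For listed
        -- primes this quotient is exact; for large ones 29 takes the place of l.
        Y : ℕ → ℤ
        Y l = X′ l - + (φ ℕ.* (R ℕ.* C))
        lY : ∀ {l} → Prime l × Coprime 2 l × l ∣ N × All (l ≢_) M → + l * Y l ≤ + φ * + q
        lY {l} h = ≤-trans (≤-reflexive (lem (+ l) (X′ l) (+ (φ ℕ.* (R ℕ.* C))))) (≤-trans (+-monoˡ-≤ (- (+ l * + (φ ℕ.* (R ℕ.* C)))) (lX h))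
            (≤-reflexive (lem′ (+ φ * + q) (+ l * + (φ ℕ.* (R ℕ.* C))))))
          where lem : ∀ l x e → l * (x - e) ≡ l * x - l * e
                lem = solve-∀
                lem′ : ∀ a b → (a + b) - b ≡ a
                lem′ = solve-∀
        scaled : ∀ d {l} → + l * Y l ≤ + φ * + q → l ℕ.* d ≡ den → + den * Y l ≤ + φ * (+ q * + d)
        scaled d {l} h e = begin
          + den * Y l         ≡⟨ cong (_* Y l) (trans (cong +_ (trans (sym e) (ℕP.*-comm l d))) (pos-* d l)) ⟩
          + d * + l * Y l     ≡⟨ *-assoc (+ d) (+ l) (Y l) ⟩
          + d * (+ l * Y l)   ≤⟨ *-monoˡ-≤-nonNeg (+ d) h ⟩
          + d * (+ φ * + q)   ≡⟨ lem (+ d) (+ φ) (+ q) ⟩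
          + φ * (+ q * + d)   ∎
          where lem : ∀ d f q → d * (f * q) ≡ f * (q * d)
                lem = solve-∀
        bigY : ∀ {l} → + l * Y l ≤ + φ * + q → 29 ℕ.≤ l → + 29 * Y l ≤ + φ * + q
        bigY {l} h 29≤l = shrink 29 l (Y l) (+ φ * + q) h (subst (0ℤ ≤_) (pos-* φ q) (+≤+ z≤n)) 29≤l
        term : ∀ d {l} → + den * Y l ≤ + φ * (+ q * + d) → + den * X′ l ≤ + φ * (+ q * + d) + + (den ℕ.* (φ ℕ.* (R ℕ.* C)))
        term d {l} h = ≤-trans (≤-reflexive (trans (lem (+ den) (X′ l) (+ (φ ℕ.* (R ℕ.* C)))) (cong (λ z → + den * Y l + z) (sym (pos-* den (φ ℕ.* (R ℕ.* C)))))))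
            (+-monoˡ-≤ (+ (den ℕ.* (φ ℕ.* (R ℕ.* C)))) h)
          where lem : ∀ d x e → d * x ≡ d * (x - e) + d * e
                lem = solve-∀
        E : ℕ
        E = den ℕ.* (φ ℕ.* (R ℕ.* C))
        sum-rest : ∀ {rs} → All (λ l → Prime l × Coprime 2 l × l ∣ N × All (l ≢_) M) rs → All (_∣ den) rs →
          + den * sumOver rs X′ ≤ + φ * (+ q * + recips den rs) + + (length rs ℕ.* E)
        sum-rest [] [] = ≤-reflexive (trans (*-zeroʳ (+ den)) (sym (trans (+-identityʳ (+ φ * (+ q * 0ℤ))) (trans (cong (+ φ *_) (*-zeroʳ (+ q))) (*-zeroʳ (+ φ))))))
        sum-rest {l ∷ rs} (h ∷ hs) (d ∷ ds) = ≤-trans (≤-reflexive (*-distribˡ-+ (+ den) (X′ l) (sumOver rs X′)))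
          (≤-trans (+-mono-≤ (term (quot den l) {l} (scaled (quot den l) {l} (lY h) (trans (ℕP.*-comm l (quot den l)) (quot-exact l d)))) (sum-rest hs ds))
            (≤-reflexive (lem (+ φ) (+ q) (+ quot den l) (+ recips den rs) (+ E) (+ (length rs ℕ.* E)))))
          where lem : ∀ f q a b e x → (f * (q * a) + e) + (f * (q * b) + x) ≡ f * (q * (a + b)) + (e + x)
                lem = solve-∀
        sum-big : ∀ {bs} → All (λ l → (Prime l × Coprime 2 l × l ∣ N × All (l ≢_) M) × 29 ℕ.≤ l) bs →
          + den * sumOver bs X′ ≤ + φ * (+ q * + (length bs ℕ.* productℕ rest)) + + (length bs ℕ.* E)
        sum-big [] = ≤-reflexive (trans (*-zeroʳ (+ den)) (sym (trans (+-identityʳ (+ φ * (+ q * 0ℤ))) (trans (cong (+ φ *_) (*-zeroʳ (+ q))) (*-zeroʳ (+ φ))))))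
        sum-big {l ∷ bs} ((h , 29≤l) ∷ hs) = ≤-trans (≤-reflexive (*-distribˡ-+ (+ den) (X′ l) (sumOver bs X′)))
          (≤-trans (+-mono-≤ (term (productℕ rest) {l} scaled29) (sum-big hs))
            (≤-reflexive (lem (+ φ) (+ q) (+ productℕ rest) (+ (length bs ℕ.* productℕ rest)) (+ E) (+ (length bs ℕ.* E)))))
          where
          lem : ∀ f q a b e x → (f * (q * a) + e) + (f * (q * b) + x) ≡ f * (q * (a + b)) + (e + x)
          lem = solve-∀
          scaled29 : + den * Y l ≤ + φ * (+ q * + productℕ rest)
          scaled29 = begin
            + den * Y l                       ≡⟨ cong (_* Y l) (trans (cong +_ (ℕP.*-comm 29 (productℕ rest))) (pos-* (productℕ rest) 29)) ⟩
            + productℕ rest * + 29 * Y l      ≡⟨ *-assoc (+ productℕ rest) (+ 29) (Y l) ⟩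
            + productℕ rest * (+ 29 * Y l)    ≤⟨ *-monoˡ-≤-nonNeg (+ productℕ rest) (bigY {l} (lY h) 29≤l) ⟩
            + productℕ rest * (+ φ * + q)     ≡⟨ lem″ (+ productℕ rest) (+ φ) (+ q) ⟩
            + φ * (+ q * + productℕ rest)     ∎
            where lem″ : ∀ d f q → d * (f * q) ≡ f * (q * d)
                  lem″ = solve-∀
        sumOver-++ : ∀ as bs → sumOver (as ++ bs) X′ ≡ sumOver as X′ + sumOver bs X′
        sumOver-++ []       bs = sym (+-identityˡ (sumOver bs X′))
        sumOver-++ (a ∷ as) bs = trans (cong (λ z → X′ a + z) (sumOver-++ as bs)) (sym (+-assoc (X′ a) (sumOver as X′) (sumOver bs X′)))
        upper : + den * sumOver (rest ++ big) X′ ≤ + φ * (+ q * + loss rest t) + + ((len ℕ.* den) ℕ.* (φ ℕ.* (R ℕ.* C)))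
        upper = begin
          + den * sumOver (rest ++ big) X′ ≡⟨ trans (cong (+ den *_) (sumOver-++ rest big)) (*-distribˡ-+ (+ den) (sumOver rest X′) (sumOver big X′)) ⟩
          + den * sumOver rest X′ + + den * sumOver big X′ ≤⟨ +-mono-≤ (sum-rest rest-ok (All.map (λ d → ∣-trans d (n∣m*n 29)) ∣productℕ)) (sum-big big-ok) ⟩
          (+ φ * (+ q * + recips den rest) + + (length rest ℕ.* E)) + (+ φ * (+ q * + (t ℕ.* productℕ rest)) + + (t ℕ.* E))
            ≡⟨ lem (+ φ) (+ q) (+ recips den rest) (+ (t ℕ.* productℕ rest)) (+ (length rest ℕ.* E)) (+ (t ℕ.* E)) ⟩
          + φ * (+ q * + loss rest t) + + (length rest ℕ.* E ℕ.+ t ℕ.* E)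
            ≡⟨ cong (λ z → + φ * (+ q * + loss rest t) + + z) (trans (sym (ℕP.*-distribʳ-+ E (length rest) t)) (sym (ℕP.*-assoc len den (φ ℕ.* (R ℕ.* C))))) ⟩
          + φ * (+ q * + loss rest t) + + ((len ℕ.* den) ℕ.* (φ ℕ.* (R ℕ.* C))) ∎
          where lem : ∀ f q a b x y → (f * (q * a) + x) + (f * (q * b) + y) ≡ f * (q * (a + b)) + (x + y)
                lem = solve-∀
        loss<den : loss rest t ℕ.< den
        loss<den = <ᵇ-true (proj₁ (∧-true {loss rest t <ᵇ den} ok))
        cost≤ : cost C rest t ℕ.≤ (ρ ℕ.∸ 1) ℕ.* gain rest t
        cost≤ = ≤ᵇ-true (proj₂ (∧-true {loss rest t <ᵇ den} ok))
        -- ρ² gain = (ρ+1)(ρ−1) gain + gain > R cost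
        enough : R ℕ.* cost C rest t ℕ.< q ℕ.* gain rest t
        enough = ℕP.<-≤-trans (ℕP.≤-<-trans (ℕP.*-monoʳ-≤ R cost≤) below) (ℕP.*-monoˡ-≤ (gain rest t) ρ²≤q)
          where
          gain>0 : 1 ℕ.≤ gain rest t
          gain>0 = ℕP.m<n⇒0<n∸m loss<den
          below : R ℕ.* ((ρ ℕ.∸ 1) ℕ.* gain rest t) ℕ.< ρ ℕ.* ρ ℕ.* gain rest t
          below = subst (ℕ._< ρ ℕ.* ρ ℕ.* gain rest t) (ℕP.*-assoc R (ρ ℕ.∸ 1) (gain rest t))
            (ℕP.*-monoˡ-< (gain rest t) {{ℕ.>-nonZero gain>0}} (lem ρ 1≤ρ))
            where lem : ∀ p → 1 ℕ.≤ p → suc p ℕ.* (p ℕ.∸ 1) ℕ.< p ℕ.* p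
                  lem (suc p) _ = ℕP.≤-reflexive (re p)
                    where re : ∀ p → suc (suc (suc p) ℕ.* p) ≡ suc p ℕ.* suc p
                          re = ℕR.solve-∀
        main : + φ * (+ q * + loss rest t) + + ((len ℕ.* den) ℕ.* (φ ℕ.* (R ℕ.* C))) < + den * (+ (φ ℕ.* q) - + (φ ℕ.* (R ℕ.* C)))
        main = begin-strict
          + φ * (+ q * + loss rest t) + + ((len ℕ.* den) ℕ.* (φ ℕ.* (R ℕ.* C)))
            ≡⟨ lem (+ φ * (+ q * + loss rest t)) (+ ((len ℕ.* den) ℕ.* (φ ℕ.* (R ℕ.* C)))) (+ (den ℕ.* (φ ℕ.* (R ℕ.* C)))) ⟩
          (+ φ * (+ q * + loss rest t) + (+ ((len ℕ.* den) ℕ.* (φ ℕ.* (R ℕ.* C))) + + (den ℕ.* (φ ℕ.* (R ℕ.* C))))) - + (den ℕ.* (φ ℕ.* (R ℕ.* C)))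
            ≡⟨ cong₂ (λ a b → (a + b) - + (den ℕ.* (φ ℕ.* (R ℕ.* C)))) (trans (cong (+ φ *_) (sym (pos-* q (loss rest t)))) (sym (pos-* φ (q ℕ.* loss rest t))))
                 (cong +_ (re den len φ R C)) ⟩
          + (φ ℕ.* (q ℕ.* loss rest t) ℕ.+ φ ℕ.* (R ℕ.* cost C rest t)) - + (den ℕ.* (φ ℕ.* (R ℕ.* C)))
            <⟨ +-monoˡ-< (- + (den ℕ.* (φ ℕ.* (R ℕ.* C)))) (+<+ (subst (ℕ._< φ ℕ.* (q ℕ.* den)) (ℕP.*-distribˡ-+ φ (q ℕ.* loss rest t) (R ℕ.* cost C rest t))
                 (ℕP.*-monoʳ-< φ {{ℕ.>-nonZero 1≤φ}} inner))) ⟩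
          + (φ ℕ.* (q ℕ.* den)) - + (den ℕ.* (φ ℕ.* (R ℕ.* C)))
            ≡⟨ cong₂ _-_ (trans (cong +_ (re′ φ q den)) (pos-* den (φ ℕ.* q))) (pos-* den (φ ℕ.* (R ℕ.* C))) ⟩
          + den * + (φ ℕ.* q) - + den * + (φ ℕ.* (R ℕ.* C)) ≡⟨ distr (+ den) (+ (φ ℕ.* q)) (+ (φ ℕ.* (R ℕ.* C))) ⟩
          + den * (+ (φ ℕ.* q) - + (φ ℕ.* (R ℕ.* C))) ∎
          where
          lem : ∀ a b c → a + b ≡ (a + (b + c)) - c
          lem = solve-∀
          distr : ∀ d a b → d * a - d * b ≡ d * (a - b)
          distr = solve-∀
          re : ∀ d n f r c → (n ℕ.* d) ℕ.* (f ℕ.* (r ℕ.* c)) ℕ.+ d ℕ.* (f ℕ.* (r ℕ.* c)) ≡ f ℕ.* (r ℕ.* (d ℕ.* c ℕ.* (1 ℕ.+ n)))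
          re = ℕR.solve-∀
          re′ : ∀ f q d → f ℕ.* (q ℕ.* d) ≡ d ℕ.* (f ℕ.* q)
          re′ = ℕR.solve-∀
          inner : q ℕ.* loss rest t ℕ.+ R ℕ.* cost C rest t ℕ.< q ℕ.* den
          inner = ℕP.<-≤-trans (ℕP.+-monoʳ-< (q ℕ.* loss rest t) enough)
            (ℕP.≤-reflexive (trans (sym (ℕP.*-distribˡ-+ q (loss rest t) (gain rest t))) (cong (q ℕ.*_) (ℕP.m+[n∸m]≡n (ℕP.<⇒≤ loss<den)))))

-- Complete sets of odd prime divisors; the range of large q

module Criteria where

  open import Data.Nat hiding (_≟_)
  open import Data.Nat.Properties
  open import Data.Nat.Divisibility
  open import Data.Nat.Primality using (Prime; prime?; prime⇒nonZero)
  open import Data.Nat.Coprimality using (Coprime; coprime-divisor) renaming (sym to coprime-sym)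
  open import Data.Nat.Tactic.RingSolver using (solve-∀)
  open import Data.Bool using (Bool; true; false; _∧_; _∨_)
  open import Data.List using (List; []; _∷_; map; _++_; length; filter; filterᵇ; upTo)
  open import Data.List.Properties using (++-assoc)
  open import Data.List.Relation.Unary.All as All using (All; []; _∷_)
  import Data.List.Relation.Unary.All.Properties as AllP
  open import Data.List.Relation.Unary.Any using (here; there)
  open import Data.List.Relation.Unary.AllPairs using ([]; _∷_)
  open import Data.List.Relation.Unary.Unique.Propositional using (Unique)
  import Data.List.Relation.Unary.Unique.Propositional.Properties as UniqueP
  open import Data.List.Membership.Propositional using (_∈_)
  open import Data.List.Membership.Propositional.Properties using (∈-filter⁺; ∈-++⁺ˡ; ∈-++⁺ʳ; ∈-upTo⁺)
  open import Data.Product using (_×_; _,_; proj₁; proj₂; ∃-syntax)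
  open import Data.Sum using (_⊎_; inj₁; inj₂)
  open import Data.Unit using (tt)
  open import Data.Empty using (⊥-elim)
  open import Function using (_∘_)
  open import Relation.Nullary using (yes; no; ¬_; Dec)
  open import Relation.Nullary.Decidable using (_×-dec_; _⊎-dec_; ¬?; toWitness)
  open import Relation.Binary.PropositionalEquality
  open PointSums
  open SieveBounds
  open Sieve hiding (C; X)
  open Crude

  odd-prime : ∀ {p} → Prime p → p ≢ 2 → Coprime 2 p
  odd-prime pp p≢2 = coprime-sym (primes-coprime pp (toWitness {a? = prime? 2} tt) p≢2)

  odd-primes : ∀ {P} → All (λ p → Prime p × p ≢ 2) P → All (Coprime 2) P
  odd-primes []              = []
  odd-primes ((pp , ne) ∷ h) = odd-prime pp ne ∷ odd-primes h

  ∨-true : ∀ {a b} → a ∨ b ≡ true → a ≡ true ⊎ b ≡ true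
  ∨-true {true}  e = inj₁ refl
  ∨-true {false} e = inj₂ e

  unique-++ : ∀ M {P : List ℕ} → Unique (M ++ P) → Unique M × All (λ l → All (l ≢_) M) P
  unique-++ []      u       = [] , All.universal (λ _ → []) _
  unique-++ (x ∷ M) (n ∷ u) with unique-++ M u | AllP.++⁻ʳ M n
  ... | uM , ls | ns = (AllP.++⁻ˡ M n ∷ uM) , All.zipWith (λ { (ne , all) → (λ e → ne (sym e)) ∷ all }) (ns , ls)

  coprime-lcm : ∀ {a b n} → Coprime a b → a ∣ n → b ∣ n → a * b ∣ n
  coprime-lcm {a} {b} a⊥b (divides c refl) b∣ = subst (_∣ c * a) (*-comm b a) (*-monoˡ-∣ a (coprime-divisor (coprime-sym a⊥b) (subst (b ∣_) (*-comm c a) b∣)))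

  coprime-productℕ : ∀ {a P} → All (Coprime a) P → Coprime a (productℕ P)
  coprime-productℕ []       (_ , d∣1) = ∣1⇒≡1 d∣1
  coprime-productℕ (c ∷ cs) = coprime-sym (coprime-*ˡ (coprime-sym c) (coprime-sym (coprime-productℕ cs)))

  record OddPrimeDivisors (N : ℕ) (P : List ℕ) : Set where
    field
      primes   : All Prime P
      odd      : All (Coprime 2) P
      dividing : All (_∣ N) P
      unique   : Unique P
      complete : ∀ p → Prime p → p ≢ 2 → p ∣ N → p ∈ P

    product∣ : productℕ P ∣ N
    product∣ = go primes dividing unique
      where
      go : ∀ {P} → All Prime P → All (_∣ N) P → Unique P → productℕ P ∣ N
      go []         []       []       = 1∣ N
      go (pp ∷ pps) (d ∷ ds) (ne ∷ u) = coprime-lcm (coprime-productℕ (coprime-others pp pps ne)) d (go pps ds u)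

  -- Every line has a point whose logarithm t satisfies t ≡ 2 (mod 4) and p ∤ t for the odd primes p ∣ q² − 1.
  Hit : ℕ → Set
  Hit r = ∀ {T} → (L : LineLogs r T) → ∃[ i ] (i < suc r × 2 ∣ T i × ¬ 4 ∣ T i × (∀ p → Prime p → p ≢ 2 → p ∣ r * suc (suc r) → ¬ p ∣ T i))

  -- Tries every cut of the list of small divisors: primes before the cut belong to the core and
  -- double C, those after it are sieved.
  anyCore : ℕ → ℕ → ℕ → List ℕ → Bool
  anyCore w t C []       = splitOK w t C []
  anyCore w t C (x ∷ xs) = splitOK w t C (x ∷ xs) ∨ anyCore w t (2 * C) xs

  -- `cop l` has weight 2(l - 1) against lead l - 1, and `two` has 4 against 1. This is the origin
  -- of C = 4·2^|M| in the criterion.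
  weights-core : ∀ {q+1 s R} M → Error.weights q+1 s R (core M) ≡ 4 * 2 ^ length M * leads (core M)
  weights-core {q+1} {s} {R} M = trans (cong (4 *_) (go M)) (lem (2 ^ length M) (leads (map cop M)))
    where
    lem : ∀ a b → 4 * (a * b) ≡ 4 * a * (1 * b)
    lem = solve-∀
    re : ∀ a b c → 2 * a * (b * c) ≡ 2 * b * (a * c)
    re = solve-∀
    go : ∀ M → Error.weights q+1 s R (map cop M) ≡ 2 ^ length M * leads (map cop M)
    go []      = refl
    go (l ∷ M) = trans (cong (2 * (l ∸ 1) *_) (go M)) (re (l ∸ 1) (2 ^ length M) (leads (map cop M)))

  leads-core≥1 : ∀ {M} → All Prime M → 1 ≤ leads (core M)
  leads-core≥1 pps = ≤-trans (go pps) (≤-reflexive (sym (*-identityˡ _)))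
    where go : ∀ {M} → All Prime M → 1 ≤ leads (map cop M)
          go []         = ≤-refl
          go (pp ∷ pps) = *-mono-≤ (∸-monoˡ-≤ 1 (prime≥2 pp)) (go pps)

  even-divisors : ∀ {r} → 2 ∣ r → 2 ∣ suc (suc r) × 4 ∣ r * suc (suc r)
  even-divisors 2∣r = 2∣r+2 , *-pres-∣ 2∣r 2∣r+2
    where 2∣r+2 = ∣m∣n⇒∣m+n (∣-refl {2}) 2∣r

  module _ {r : ℕ} .{{_ : NonZero r}} (2∣r : 2 ∣ r) where

    private
      q N : ℕ
      q = suc r
      N = r * suc q
      2∣q+1 = proj₁ (even-divisors 2∣r)
      4∣N   = proj₂ (even-divisors 2∣r)

    hit-from : ∀ {T P} (L : LineLogs r T) → OddPrimeDivisors N P → HitsGood L P →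
      ∃[ i ] (i < q × 2 ∣ T i × ¬ 4 ∣ T i × (∀ p → Prime p → p ≢ 2 → p ∣ N → ¬ p ∣ T i))
    hit-from L O (i , i<q , 2∣ , 4∤ , all) = i , i<q , 2∣ , 4∤ , λ p pp p≢2 p∣N → All.lookup all (OddPrimeDivisors.complete O p pp p≢2 p∣N)

    split-primes : ∀ M {P} → OddPrimeDivisors N (M ++ P) →
      (All Prime M × All (Coprime 2) M × All (_∣ N) M × Unique M) × All (λ l → Prime l × Coprime 2 l × l ∣ N × All (l ≢_) M) P
    split-primes M O = (AllP.++⁻ˡ M primes , AllP.++⁻ˡ M odd , AllP.++⁻ˡ M dividing , proj₁ (unique-++ M unique))
      , All.zip (AllP.++⁻ʳ M primes , All.zip (AllP.++⁻ʳ M odd , All.zip (AllP.++⁻ʳ M dividing , proj₂ (unique-++ M unique))))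
      where open OddPrimeDivisors O

    module _ {ρ : ℕ} (ρ²≤q : ρ * ρ ≤ q) (q≤R² : q ≤ suc ρ * suc ρ) (1≤ρ : 1 ≤ ρ) where

      split-hit : ∀ M rest big → OddPrimeDivisors N (M ++ (rest ++ big)) → All (29 ≤_) big →
        splitOK (ρ ∸ 1) (length big) (4 * 2 ^ length M) rest ≡ true → Hit r
      split-hit M rest big O big≥ ok L with split-primes M O
      ... | (pM , oM , dM , uM) , all = hit-from L O (crude-sieve L 4∣N 2∣q+1 2∣r pM oM dM uM (AllP.++⁻ˡ rest all) (All.zip (AllP.++⁻ʳ rest all , big≥))
        {ρ} {4 * 2 ^ length M} (weights-core {suc q} {1} {0} M) (leads-core≥1 pM) q≤R² ρ²≤q 1≤ρ ok)

      core-hit : ∀ M D big → OddPrimeDivisors N (M ++ (D ++ big)) → All (29 ≤_) big →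
        anyCore (ρ ∸ 1) (length big) (4 * 2 ^ length M) D ≡ true → Hit r
      core-hit M []      big O big≥ ok = split-hit M [] big O big≥ ok
      core-hit M (x ∷ D) big O big≥ ok with ∨-true {splitOK (ρ ∸ 1) (length big) (4 * 2 ^ length M) (x ∷ D)} ok
      ... | inj₁ e = split-hit M (x ∷ D) big O big≥ e
      ... | inj₂ e = core-hit (M ++ x ∷ []) D big (subst (OddPrimeDivisors N) (sym (++-assoc M (x ∷ []) (D ++ big))) O) big≥
          (subst (λ c → anyCore (ρ ∸ 1) (length big) c D ≡ true) (trans (re (2 ^ length M)) (cong (λ k → 4 * 2 ^ k) (sym (len M)))) e)
        where
        re : ∀ a → 2 * (4 * a) ≡ 4 * (2 * a)
        re = solve-∀
        len : ∀ M → length (M ++ x ∷ []) ≡ suc (length M)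
        len []      = refl
        len (_ ∷ M) = cong suc (len M)

  -- Each odd prime below 29 that divides N enters the criterion with its exact size; the larger ones only by their number.
  smallPrimes : List ℕ
  smallPrimes = 3 ∷ 5 ∷ 7 ∷ 11 ∷ 13 ∷ 17 ∷ 19 ∷ 23 ∷ []

  module _ (N : ℕ) .{{_ : NonZero N}} where

    smallDivisors : List ℕ
    smallDivisors = filterᵇ (_∣ᵇ N) smallPrimes

    private
      Big : ℕ → Set
      Big p = 29 ≤ p × Prime p × p ∣ N
      big? : ∀ p → Dec (Big p)
      big? p = (29 ≤? p) ×-dec (prime? p ×-dec (p ∣? N))

    bigDivisors : List ℕ
    bigDivisors = filter big? (upTo (suc N))

    bigDivisors-All : All Big bigDivisors
    bigDivisors-All = AllP.all-filter big? (upTo (suc N))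

    private
      small-All : ∀ {Q : ℕ → Set} {xs} → All Q xs → All (λ p → Q p × p ∣ N) (filterᵇ (_∣ᵇ N) xs)
      small-All []                    = []
      small-All {xs = x ∷ _} (q ∷ qs) with x ∣ᵇ N in e
      ... | true  = (q , ∣ᵇ⇒∣ x N e) ∷ small-All qs
      ... | false = small-All qs

      small-complete : ∀ {p} xs → .{{_ : NonZero p}} → p ∈ xs → p ∣ N → p ∈ filterᵇ (_∣ᵇ N) xs
      small-complete (x ∷ xs) (here refl) p∣N rewrite ∣⇒∣ᵇ x N p∣N = here refl
      small-complete (x ∷ xs) (there p∈) p∣N with x ∣ᵇ N
      ... | true  = there (small-complete xs p∈ p∣N)
      ... | false = small-complete xs p∈ p∣N

      small-unique : ∀ {xs} → Unique xs → Unique (filterᵇ (_∣ᵇ N) xs)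
      small-unique []             = []
      small-unique {x ∷ xs} (n ∷ u) with x ∣ᵇ N
      ... | true  = All.map proj₁ (small-All n) ∷ small-unique u
      ... | false = small-unique u

      small-facts : All (λ p → (Prime p × p ≢ 2) × p < 29) smallPrimes
      small-facts = toWitness {a? = All.all? (λ p → (prime? p ×-dec ¬? (p Data.Nat.≟ 2)) ×-dec (p <? 29)) smallPrimes} tt

      small-list : ∀ {p} → p < 29 → p ∈ smallPrimes ⊎ (p ≡ 2 ⊎ ¬ Prime p)
      small-list = toWitness {a? = allUpTo? (λ p → member p ⊎-dec ((p Data.Nat.≟ 2) ⊎-dec ¬? (prime? p))) 29} tt
        where open import Data.List.Membership.DecPropositional Data.Nat._≟_ using (_∈?_)
              member : ∀ p → Dec (p ∈ smallPrimes)
              member p = p ∈? smallPrimes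

      smallPrimes-unique : Unique smallPrimes
      smallPrimes-unique = toWitness {a? = unique? smallPrimes} tt
        where open import Data.List.Relation.Unary.Unique.DecPropositional Data.Nat._≟_ using (unique?)

    smallDivisors-All : All (λ p → ((Prime p × p ≢ 2) × p < 29) × p ∣ N) smallDivisors
    smallDivisors-All = small-All small-facts

    oddPrimeDivisors : OddPrimeDivisors N (smallDivisors ++ bigDivisors)
    oddPrimeDivisors = record
      { primes   = AllP.++⁺ (All.map (proj₁ ∘ proj₁ ∘ proj₁) smallDivisors-All) (All.map (proj₁ ∘ proj₂) bigDivisors-All)
      ; odd      = AllP.++⁺ (odd-primes (All.map (proj₁ ∘ proj₁) smallDivisors-All))
                            (odd-primes (All.map (λ { (29≤ , pp , _) → pp , λ { refl → <⇒≱ (s≤s (s≤s (s≤s z≤n))) 29≤ } }) bigDivisors-All))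
      ; dividing = AllP.++⁺ (All.map proj₂ smallDivisors-All) (All.map (proj₂ ∘ proj₂) bigDivisors-All)
      ; unique   = UniqueP.++⁺ (small-unique smallPrimes-unique) (UniqueP.filter⁺ big? (UniqueP.upTo⁺ (suc N)))
          (λ { (x∈ , y∈) → <⇒≱ (proj₂ (proj₁ (All.lookup smallDivisors-All x∈))) (proj₁ (All.lookup bigDivisors-All y∈)) })
      ; complete = complete
      }
      where
      complete : ∀ p → Prime p → p ≢ 2 → p ∣ N → p ∈ smallDivisors ++ bigDivisors
      complete p pp p≢2 p∣N = place (p <? 29)
        where
        known : p ∈ smallPrimes ⊎ (p ≡ 2 ⊎ ¬ Prime p) → p ∈ smallDivisors ++ bigDivisors
        known (inj₁ p∈)       = ∈-++⁺ˡ (small-complete smallPrimes {{prime⇒nonZero pp}} p∈ p∣N)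
        known (inj₂ (inj₁ e)) = ⊥-elim (p≢2 e)
        known (inj₂ (inj₂ n)) = ⊥-elim (n pp)
        place : Dec (p < 29) → p ∈ smallDivisors ++ bigDivisors
        place (no p≮29)  = ∈-++⁺ʳ smallDivisors (∈-filter⁺ big? (∈-upTo⁺ (s≤s (∣⇒≤ p∣N))) (≮⇒≥ p≮29 , pp , p∣N))
        place (yes p<29) = known (small-list p<29)

    -- 4 ΠD 29^t ≤ N, where t is the number of large prime divisors
    size-bound : 4 ∣ N → 4 * productℕ smallDivisors * 29 ^ length bigDivisors ≤ N
    size-bound 4∣N = ≤-trans (≤-trans (*-monoʳ-≤ (4 * productℕ smallDivisors) (large (All.map proj₁ bigDivisors-All)))
        (≤-reflexive (trans (*-assoc 4 (productℕ smallDivisors) (productℕ bigDivisors)) (cong (4 *_) (sym (productℕ-++ smallDivisors bigDivisors))))))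
      (∣⇒≤ (coprime-lcm (coprime-productℕ (All.map coprime-4 (OddPrimeDivisors.odd oddPrimeDivisors))) 4∣N (OddPrimeDivisors.product∣ oddPrimeDivisors)))
      where
      large : ∀ {P} → All (29 ≤_) P → 29 ^ length P ≤ productℕ P
      large []       = ≤-refl
      large (p ∷ ps) = *-mono-≤ p (large ps)
      productℕ-++ : ∀ as bs → productℕ (as ++ bs) ≡ productℕ as * productℕ bs
      productℕ-++ []       bs = sym (+-identityʳ (productℕ bs))
      productℕ-++ (a ∷ as) bs = trans (cong (a *_) (productℕ-++ as bs)) (sym (*-assoc a (productℕ as) (productℕ bs)))

  -- The number t of large divisors is not computed; all t are tested until P = 4·∏D·29^t exceeds N,
  -- which `size-bound` excludes. When the fuel is spent, the answer is true only if this has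
  -- happened.
  allCounts : ℕ → ℕ → ℕ → List ℕ → ℕ → ℕ → Bool
  allCounts zero    N w D t P = N <ᵇ P
  allCounts (suc f) N w D t P = (N <ᵇ P) ∨ (anyCore w t 4 D ∧ allCounts f N w D (suc t) (P * 29))

  allCounts-sound : ∀ f {N w D} t u P → allCounts f N w D t P ≡ true → P * 29 ^ u ≤ N → anyCore w (t + u) 4 D ≡ true
  allCounts-sound zero {N} t u P ok le = ⊥-elim (<⇒≱ (<ᵇ-true {N} {P} ok) (≤-trans (m≤m*n P (29 ^ u) {{m^n≢0 29 u}}) le))
  allCounts-sound (suc f) {N} {w} {D} t u P ok le with ∨-true {N <ᵇ P} ok
  ... | inj₁ e = ⊥-elim (<⇒≱ (<ᵇ-true {N} {P} e) (≤-trans (m≤m*n P (29 ^ u) {{m^n≢0 29 u}}) le))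
  ... | inj₂ e with u
  ...   | zero   = subst (λ z → anyCore w z 4 D ≡ true) (sym (+-identityʳ t)) (proj₁ (∧-true {anyCore w t 4 D} e))
  ...   | suc u′ = subst (λ z → anyCore w z 4 D ≡ true) (sym (+-suc t u′))
          (allCounts-sound f (suc t) u′ (P * 29) (proj₂ (∧-true {anyCore w t 4 D} e)) (≤-trans (≤-reflexive (*-assoc P 29 (29 ^ u′))) le))

  crudeᵇ : ℕ → ℕ → Bool
  -- Twelve rounds are ample: 4·29⁶ already exceeds 37249².
  crudeᵇ q ρ = allCounts 12 n (ρ ∸ 1) D 0 (4 * productℕ D)
    where n = (q ∸ 1) * suc q
          D = filterᵇ (_∣ᵇ n) smallPrimes

  isFloorRoot : ℕ → ℕ → Bool
  isFloorRoot q ρ = (ρ * ρ ≤ᵇ q) ∧ ((q <ᵇ suc ρ * suc ρ) ∧ (1 ≤ᵇ ρ))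

  crude-sound : ∀ {r ρ} .{{_ : NonZero r}} → 2 ∣ r → isFloorRoot (suc r) ρ ≡ true → crudeᵇ (suc r) ρ ≡ true → Hit r
  crude-sound {r} {ρ} 2∣r root ok = core-hit 2∣r {ρ} (≤ᵇ-true (proj₁ root₁)) (<⇒≤ (<ᵇ-true (proj₁ root₂))) (≤ᵇ-true (proj₂ root₂))
      [] (smallDivisors N) (bigDivisors N) (oddPrimeDivisors N) (All.map proj₁ (bigDivisors-All N))
      (allCounts-sound 12 {N} {ρ ∸ 1} {smallDivisors N} 0 (length (bigDivisors N)) (4 * productℕ (smallDivisors N)) ok (size-bound N (proj₂ (even-divisors 2∣r))))
    where
    N = r * suc (suc r)
    instance N≢0 : NonZero N
             N≢0 = m*n≢0 r (suc (suc r))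
    root₁ = ∧-true {ρ * ρ ≤ᵇ suc r} root
    root₂ = ∧-true {suc r <ᵇ suc ρ * suc ρ} (proj₂ root₁)

  -- A bound t = w+1 such that the criterion holds once √q ≥ t; it does if t² ≤ 37249 ≤ q or t⁴ ≤ 4 ΠD 29^t′ < q².
  splitLarge : List ℕ → ℕ → ℕ → List ℕ → Bool
  splitLarge D t C rest = (loss rest t <ᵇ 29 * productℕ rest) ∧ ((cost C rest t ≤ᵇ w * gain rest t) ∧
      ((suc w * suc w ≤ᵇ 37249) ∨ (suc w * suc w * (suc w * suc w) ≤ᵇ 4 * productℕ D * 29 ^ t)))
    where w = quot (cost C rest t + gain rest t ∸ 1) (gain rest t)

  anyLarge : List ℕ → ℕ → ℕ → List ℕ → Bool
  anyLarge D t C []       = splitLarge D t C []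
  anyLarge D t C (x ∷ xs) = splitLarge D t C (x ∷ xs) ∨ anyLarge D t (2 * C) xs

  upToCount : ℕ → List ℕ → Bool
  upToCount zero    D = true
  upToCount (suc t) D = anyLarge D t 4 D ∧ upToCount t D

  -- With 20 or more large divisors all primes are put into the core, and (C + 1)⁴ ≤ 4·∏D·29^t is
  -- what is required. It suffices to test t = 20, because another prime multiplies the bound (2C)⁴
  -- by 16 and the right side by 29.
  manyPrimes : List ℕ → Bool
  manyPrimes D = 4096 * 16 ^ (length D + 20) ≤ᵇ 4 * productℕ D * 29 ^ 20

  allSub : (List ℕ → Bool) → List ℕ → Bool
  allSub f []       = f []
  allSub f (x ∷ xs) = allSub f xs ∧ allSub (f ∘ (x ∷_)) xs

  -- The set of small divisors of an unknown N is one of the sublists, so a check over all sublists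
  -- covers every N.
  allSub-sound : ∀ f xs (p : ℕ → Bool) → allSub f xs ≡ true → f (filterᵇ p xs) ≡ true
  allSub-sound f []       p ok = ok
  allSub-sound f (x ∷ xs) p ok with p x
  ... | true  = allSub-sound (f ∘ (x ∷_)) xs p (proj₂ (∧-true {allSub f xs} ok))
  ... | false = allSub-sound f xs p (proj₁ (∧-true {allSub f xs} ok))

  module _ {q ρ : ℕ} {D : List ℕ} {t : ℕ} (X≤q : 37249 ≤ q) (size : 4 * productℕ D * 29 ^ t < q * q) (q<R² : q < suc ρ * suc ρ) where

    square≤ : ∀ {a b} → a * a ≤ b * b → a ≤ b
    square≤ {a} {b} le = ≮⇒≥ λ b<a → <⇒≱ (*-mono-< b<a b<a) le

    splitLarge-sound : ∀ {C rest} → splitLarge D t C rest ≡ true → splitOK (ρ ∸ 1) t C rest ≡ true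
    splitLarge-sound {C} {rest} ok = cong₂ _∧_ (proj₁ ok₁) (≤⇒≤ᵇ-true (≤-trans (≤ᵇ-true {cost C rest t} (proj₁ ok₂)) (*-monoˡ-≤ (gain rest t) w≤)))
      where
      w = quot (cost C rest t + gain rest t ∸ 1) (gain rest t)
      ok₁ = ∧-true {loss rest t <ᵇ 29 * productℕ rest} ok
      ok₂ = ∧-true {cost C rest t ≤ᵇ w * gain rest t} (proj₂ ok₁)
      ≤⇒≤ᵇ-true : ∀ {m n} → m ≤ n → (m ≤ᵇ n) ≡ true
      ≤⇒≤ᵇ-true {m} {n} le with m ≤ᵇ n | ≤⇒≤ᵇ {m} {n} le
      ... | true | _ = refl
      t²≤q : suc w * suc w ≤ q
      t²≤q with ∨-true {suc w * suc w ≤ᵇ 37249} (proj₂ ok₂)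
      ... | inj₁ e = ≤-trans (≤ᵇ-true {suc w * suc w} e) X≤q
      ... | inj₂ e = square≤ (<⇒≤ (≤-<-trans (≤ᵇ-true {suc w * suc w * (suc w * suc w)} e) size))
      w≤ : w ≤ ρ ∸ 1
      w≤ = ∸-monoˡ-≤ 1 (≮⇒≥ {ρ} {suc w} λ lt → <⇒≱ q<R² (≤-trans (*-mono-≤ lt lt) t²≤q))

    anyLarge-sound : ∀ C xs → anyLarge D t C xs ≡ true → anyCore (ρ ∸ 1) t C xs ≡ true
    anyLarge-sound C []       ok = splitLarge-sound {C} {[]} ok
    anyLarge-sound C (x ∷ xs) ok with ∨-true {splitLarge D t C (x ∷ xs)} ok
    ... | inj₁ e rewrite splitLarge-sound {C} {x ∷ xs} e = refl
    ... | inj₂ e rewrite anyLarge-sound (2 * C) xs e with splitOK (ρ ∸ 1) t C (x ∷ xs)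
    ...   | true  = refl
    ...   | false = refl

  upToCount-sound : ∀ n {D t} → upToCount n D ≡ true → t < n → anyLarge D t 4 D ≡ true
  upToCount-sound (suc n) {D} {t} ok t<1+n with t Data.Nat.≟ n
  ... | yes refl = proj₁ (∧-true {anyLarge D n 4 D} ok)
  ... | no t≢n   = upToCount-sound n (proj₂ (∧-true {anyLarge D n 4 D} ok)) (≤∧≢⇒< (≤-pred t<1+n) t≢n)

  -- An evaluation over the 2⁸ sets of primes below 29, each with all t < 20 and the condition for
  -- the tail.
  allLarge : allSub (λ D → upToCount 20 D ∧ manyPrimes D) smallPrimes ≡ true
  allLarge = refl

  floorRoot : ∀ q → ∃[ ρ ] (ρ * ρ ≤ q × q < suc ρ * suc ρ)
  floorRoot zero = 0 , z≤n , s≤s z≤n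
  floorRoot (suc q) with floorRoot q
  ... | ρ , le , lt with suc ρ * suc ρ ≤? suc q
  ...   | yes le′ = suc ρ , le′ , ≤-<-trans lt (*-mono-< (n<1+n (suc ρ)) (n<1+n (suc ρ)))
  ...   | no ¬le  = ρ , m≤n⇒m≤1+n le , ≰⇒> ¬le

  -- (C+1)⁴ ≤ (2C)⁴ = 4096 · 16^L for C = 4 · 2^L
  manyPrimes-bound : ∀ d m u P L → L ≡ d + (m + u) → 4096 * 16 ^ (d + m) ≤ P * 29 ^ m →
    suc (4 * 2 ^ L) * suc (4 * 2 ^ L) * (suc (4 * 2 ^ L) * suc (4 * 2 ^ L)) ≤ P * 29 ^ (m + u)
  manyPrimes-bound d m u P L L≡ le = begin
    suc C * suc C * (suc C * suc C)                ≤⟨ sq (sq (+-monoˡ-≤ C C≥1)) ⟩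
    (C + C) * (C + C) * ((C + C) * (C + C))        ≡⟨ lem (2 ^ L) ⟩
    4096 * (2 ^ L * 2 ^ L * (2 ^ L * 2 ^ L))       ≡⟨ cong (4096 *_) (trans (16^ L) (cong (16 ^_) (trans L≡ (sym (+-assoc d m u))))) ⟩
    4096 * 16 ^ (d + m + u)                        ≡⟨ cong (4096 *_) (^-distribˡ-+-* 16 (d + m) u) ⟩
    4096 * (16 ^ (d + m) * 16 ^ u)                 ≡⟨ sym (*-assoc 4096 (16 ^ (d + m)) (16 ^ u)) ⟩
    4096 * 16 ^ (d + m) * 16 ^ u                   ≤⟨ *-mono-≤ le (^-monoˡ-≤ u (≤ᵇ-true {16} {29} refl)) ⟩
    P * 29 ^ m * 29 ^ u                            ≡⟨ *-assoc P (29 ^ m) (29 ^ u) ⟩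
    P * (29 ^ m * 29 ^ u)                          ≡⟨ cong (P *_) (sym (^-distribˡ-+-* 29 m u)) ⟩
    P * 29 ^ (m + u)                               ∎
    where
    open ≤-Reasoning
    C = 4 * 2 ^ L
    C≥1 : 1 ≤ C
    C≥1 = *-mono-≤ (s≤s {n = 3} z≤n) (m^n>0 2 L)
    sq : ∀ {a b} → a ≤ b → a * a ≤ b * b
    sq p = *-mono-≤ p p
    16^ : ∀ k → 2 ^ k * 2 ^ k * (2 ^ k * 2 ^ k) ≡ 16 ^ k
    16^ zero    = refl
    16^ (suc k) = trans (lem₁₆ (2 ^ k)) (cong (16 *_) (16^ k))
      where lem₁₆ : ∀ a → 2 * a * (2 * a) * (2 * a * (2 * a)) ≡ 16 * (a * a * (a * a))
            lem₁₆ = solve-∀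
    lem : ∀ a → (4 * a + 4 * a) * (4 * a + 4 * a) * ((4 * a + 4 * a) * (4 * a + 4 * a)) ≡ 4096 * (a * a * (a * a))
    lem = solve-∀

  large-hit : ∀ {r} .{{_ : NonZero r}} D big → 2 ∣ r → 37249 ≤ suc r → OddPrimeDivisors (r * suc (suc r)) (D ++ big) → All (29 ≤_) big →
    4 * productℕ D * 29 ^ length big ≤ r * suc (suc r) → upToCount 20 D ∧ manyPrimes D ≡ true → Hit r
  large-hit {r} D big 2∣r X≤q O big≥ size≤N ok = cases (t <? 20)
    where
    q = suc r
    N = r * suc q
    ρ = proj₁ (floorRoot q)
    ρ²≤q = proj₁ (proj₂ (floorRoot q))
    q<R² = proj₂ (proj₂ (floorRoot q))
    t = length big
    size : 4 * productℕ D * 29 ^ t < q * q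
    size = ≤-<-trans size≤N (≤-reflexive (lem r))
      where lem : ∀ r → suc (r * suc (suc r)) ≡ suc r * suc r
            lem = solve-∀
    1≤ρ : 1 ≤ ρ
    1≤ρ = ≮⇒≥ λ ρ<1 → <⇒≱ (<-≤-trans q<R² (*-mono-≤ ρ<1 ρ<1)) (≤-trans (s≤s z≤n) X≤q)
    checked = ∧-true {upToCount 20 D} ok
    cases : Dec (t < 20) → Hit r
    cases (yes t<20) = core-hit 2∣r {ρ} ρ²≤q (<⇒≤ q<R²) 1≤ρ [] D big O big≥
      (anyLarge-sound {q} {ρ} {D} {t} X≤q size q<R² 4 D (upToCount-sound 20 {D} (proj₁ checked) t<20))
    -- Every prime is in the core and nothing is left to sieve, so the criterion is just C ≤ ρ - 1.
    cases (no t≮20) = split-hit 2∣r {ρ} ρ²≤q (<⇒≤ q<R²) 1≤ρ (D ++ big) [] []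
        (subst (OddPrimeDivisors N) (sym (Data.List.Properties.++-identityʳ (D ++ big))) O) [] full
      where
      C = 4 * 2 ^ length (D ++ big)
      u = t ∸ 20
      t≡ : 20 + u ≡ t
      t≡ = m+[n∸m]≡n (≮⇒≥ t≮20)
      length≡ : length (D ++ big) ≡ length D + (20 + u)
      length≡ = trans (Data.List.Properties.length-++ D) (cong (length D +_) (sym t≡))
      fourth : suc C * suc C * (suc C * suc C) ≤ 4 * productℕ D * 29 ^ t
      fourth = subst (λ z → suc C * suc C * (suc C * suc C) ≤ 4 * productℕ D * 29 ^ z) t≡
        (manyPrimes-bound (length D) 20 u (4 * productℕ D) (length (D ++ big)) length≡ (≤ᵇ-true {4096 * 16 ^ (length D + 20)} {4 * productℕ D * 29 ^ 20} (proj₂ checked)))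
      C<ρ : C ≤ ρ ∸ 1
      C<ρ = ∸-monoˡ-≤ 1 (≮⇒≥ {ρ} {suc C} λ lt → <⇒≱ q<R² (≤-trans (*-mono-≤ lt lt)
        (square≤ {q} {ρ} {D} {t} X≤q size q<R² (<⇒≤ (≤-<-trans fourth size)))))
      full : splitOK (ρ ∸ 1) 0 C [] ≡ true
      full = ≤⇒true (≤-trans (≤-reflexive (lem C)) (*-monoˡ-≤ 29 C<ρ))
        where
        lem : ∀ c → 29 * 1 * c * 1 ≡ c * 29
        lem = solve-∀
        ≤⇒true : ∀ {m n} → m ≤ n → (m ≤ᵇ n) ≡ true
        ≤⇒true {m} {n} le with m ≤ᵇ n | ≤⇒≤ᵇ {m} {n} le
        ... | true | _ = refl

  large-sound : ∀ {r} .{{_ : NonZero r}} → 2 ∣ r → 37249 ≤ suc r → Hit r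
  large-sound {r} 2∣r X≤q = large-hit (smallDivisors N) (bigDivisors N) 2∣r X≤q (oddPrimeDivisors N) (All.map proj₁ (bigDivisors-All N))
      (size-bound N (proj₂ (even-divisors 2∣r))) (allSub-sound (λ D → upToCount 20 D ∧ manyPrimes D) smallPrimes (_∣ᵇ N) allLarge)
    where
    N = r * suc (suc r)
    instance N≢0 : NonZero N
             N≢0 = m*n≢0 r (suc (suc r))

-- The criterion with the actual prime divisors, and recognising non-prime-powers

module Refined where

  open import Defs using (IsPrimePower)
  open import Data.Nat hiding (_≟_; parity)
  open import Data.Nat.Properties
  open import Data.Nat.Divisibility
  open import Data.Nat.DivMod using (/-monoˡ-≤; m*n/n≡m)
  open import Data.Nat.Primality using (Prime; euclidsLemma; prime⇒irreducible; prime⇒nonZero; _Rough_; 2-rough; ∤⇒rough-suc; rough∧square>⇒prime)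
  open import Data.Nat.Coprimality using (Coprime)
  import Data.Integer as ℤ
  import Data.Integer.Properties as ℤP
  open import Data.Bool using (Bool; true; false; _∧_; _∨_; if_then_else_; not)
  open import Data.List using (List; []; _∷_; _++_; take; drop)
  open import Data.List.Properties using (take++drop≡id)
  open import Data.List.Relation.Unary.All as All using (All; []; _∷_)
  open import Data.List.Relation.Unary.Any using (here; there)
  open import Data.List.Relation.Unary.AllPairs using ([]; _∷_)
  open import Data.List.Relation.Unary.Unique.Propositional using (Unique)
  open import Data.List.Membership.Propositional using (_∈_)
  open import Data.Product using (_×_; _,_; proj₁; proj₂; ∃-syntax)
  open import Data.Sum using (_⊎_; inj₁; inj₂)
  open import Data.Unit using (tt)
  open import Data.Empty using (⊥-elim)
  open import Relation.Nullary using (¬_)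
  open import Relation.Binary.PropositionalEquality
  open PointSums
  open SieveBounds
  open Sieve
  open Crude
  open Criteria
  open FiniteFields using (primeDivisor)

  not-true : ∀ {b} → not b ≡ true → b ≢ true
  not-true {false} _ ()

  noDivisor : ℕ → ℕ → ℕ → Bool
  noDivisor zero    d n = false
  noDivisor (suc f) d n = (n <ᵇ d * d) ∨ (not (d ∣ᵇ n) ∧ noDivisor f (suc d) n)

  isPrimeᵇ : ℕ → Bool
  isPrimeᵇ n = (2 ≤ᵇ n) ∧ noDivisor n 2 n

  noDivisor-sound : ∀ f d {n} .{{_ : NonTrivial n}} .{{_ : NonZero d}} → d Rough n → noDivisor f d n ≡ true → Prime n
  noDivisor-sound (suc f) d {n} rough ok with ∨-true {n <ᵇ d * d} ok
  ... | inj₁ e = rough∧square>⇒prime rough (<ᵇ-true {n} e)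
  ... | inj₂ e = noDivisor-sound f (suc d) (∤⇒rough-suc (λ d∣n → not-true (proj₁ (∧-true {not (d ∣ᵇ n)} e)) (∣⇒∣ᵇ d n d∣n)) rough)
                   (proj₂ (∧-true {not (d ∣ᵇ n)} e))

  isPrimeᵇ-sound : ∀ n → isPrimeᵇ n ≡ true → Prime n
  isPrimeᵇ-sound n ok = noDivisor-sound n 2 {{n>1⇒nonTrivial (≤ᵇ-true {2} (proj₁ (∧-true {2 ≤ᵇ n} ok)))}} 2-rough (proj₂ (∧-true {2 ≤ᵇ n} ok))

  -- Removes the factor l repeatedly; its callers allow 40 divisions, enough for l ≥ 2 and every n
  -- below 2⁴⁰.
  strip : ℕ → ℕ → ℕ → ℕ
  strip zero    l n = n
  strip (suc f) l n = if l ∣ᵇ n then strip f l (quot n l) else n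

  strip-sound : ∀ f {p l n} → Prime p → p ∣ n → p ∣ l ⊎ p ∣ strip f l n
  strip-sound zero    pp p∣n = inj₂ p∣n
  strip-sound (suc f) {p} {l} {n} pp p∣n with l ∣ᵇ n in e
  ... | false = inj₂ p∣n
  ... | true  with euclidsLemma (quot n l) l pp (subst (p ∣_) (sym (quot-exact l (∣ᵇ⇒∣ l n e))) p∣n)
  ...   | inj₁ d = strip-sound f pp d
  ...   | inj₂ d = inj₁ d

  stripAll : List ℕ → ℕ → ℕ
  stripAll []       n = n
  stripAll (l ∷ ls) n = stripAll ls (strip 40 l n)

  allᵇ : (ℕ → Bool) → List ℕ → Bool
  allᵇ f []       = true
  allᵇ f (x ∷ xs) = f x ∧ allᵇ f xs

  allᵇ-sound : ∀ {f} {Q : ℕ → Set} → (∀ x → f x ≡ true → Q x) → ∀ xs → allᵇ f xs ≡ true → All Q xs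
  allᵇ-sound h []       ok = []
  allᵇ-sound {f} h (x ∷ xs) ok = h x (proj₁ (∧-true {f x} ok)) ∷ allᵇ-sound h xs (proj₂ (∧-true {f x} ok))

  ascending : ℕ → List ℕ → Bool
  ascending a []       = true
  ascending a (x ∷ xs) = (a <ᵇ x) ∧ ascending x xs

  ascending-sound : ∀ a xs → ascending a xs ≡ true → All (a <_) xs × Unique xs
  ascending-sound a []       ok = [] , []
  ascending-sound a (x ∷ xs) ok with ascending-sound x xs (proj₂ (∧-true {a <ᵇ x} ok))
  ... | x< , u = a<x ∷ All.map (<-trans a<x) x< , All.map <⇒≢ x< ∷ u
    where a<x = <ᵇ-true {a} (proj₁ (∧-true {a <ᵇ x} ok))

  stripAll-sound : ∀ {p n} ls → Prime p → All Prime ls → p ∣ n → stripAll ls n ≡ 1 → p ∈ ls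
  stripAll-sound {p} [] pp [] p∣n refl = ⊥-elim (<⇒≢ (prime≥2 pp) (sym (∣1⇒≡1 p∣n)))
  stripAll-sound {p} (l ∷ ls) pp (pl ∷ pls) p∣n e with strip-sound 40 {p} {l} pp p∣n
  ... | inj₂ d = there (stripAll-sound ls pp pls d e)
  ... | inj₁ p∣l with prime⇒irreducible pl p∣l
  ...   | inj₁ refl = ⊥-elim (<⇒≱ (prime≥2 pp) ≤-refl)
  ...   | inj₂ e′   = here e′

  -- Trial division by odd numbers. The output is only a proposal: `valid` certifies it afterwards.
  factors : ℕ → ℕ → ℕ → List ℕ
  factors zero    d n = []
  factors (suc f) d n = if n <ᵇ d * d then (if 1 <ᵇ n then n ∷ [] else [])
                        else (if d ∣ᵇ n then d ∷ factors f (2 + d) (strip 40 d n) else factors f (2 + d) n)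

  merge : ℕ → List ℕ → List ℕ → List ℕ
  merge zero    xs       ys       = xs
  merge (suc f) []       ys       = ys
  merge (suc f) (x ∷ xs) []       = x ∷ xs
  merge (suc f) (x ∷ xs) (y ∷ ys) = if x <ᵇ y then x ∷ merge f xs (y ∷ ys) else y ∷ merge f (x ∷ xs) ys

  -- q - 1 and q + 1 share no odd prime, so two much smaller numbers than N are factored. Increasing
  -- order matters, because initial segments of the list serve as cores.
  oddPrimes : ℕ → List ℕ
  oddPrimes q = merge 40 (factors q 3 (strip 40 2 (q ∸ 1))) (factors q 3 (strip 40 2 (suc q)))

  -- Completeness is seen from the cofactors: after dividing q - 1 and q + 1 by the powers of 2 and
  -- of the listed primes, 1 remains, so no other prime divides N.
  valid : ℕ → List ℕ → Bool
  valid r P = (allᵇ isPrimeᵇ P ∧ ascending 2 P) ∧ (allᵇ (λ l → (l ∣ᵇ r) ∨ (l ∣ᵇ suc (suc r))) P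
    ∧ ((stripAll (2 ∷ P) r ≡ᵇ 1) ∧ (stripAll (2 ∷ P) (suc (suc r)) ≡ᵇ 1)))

  ≡ᵇ-true : ∀ {m n} → (m ≡ᵇ n) ≡ true → m ≡ n
  ≡ᵇ-true {m} {n} e = ≡ᵇ⇒≡ m n (subst Data.Bool.T (sym e) tt)

  valid-sound : ∀ r P → valid r P ≡ true → OddPrimeDivisors (r * suc (suc r)) P
  valid-sound r P ok = record
    { primes   = primes
    ; odd      = odd-primes (All.zip (primes , All.map (λ { 2<p refl → <⇒≱ 2<p ≤-refl }) (proj₁ asc)))
    ; dividing = allᵇ-sound divides-N P (proj₁ ok₃)
    ; unique   = proj₂ asc
    ; complete = complete
    }
    where
    ok₁ = ∧-true {allᵇ isPrimeᵇ P ∧ ascending 2 P} ok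
    ok₂ = ∧-true {allᵇ isPrimeᵇ P} (proj₁ ok₁)
    ok₃ = ∧-true {allᵇ (λ l → (l ∣ᵇ r) ∨ (l ∣ᵇ suc (suc r))) P} (proj₂ ok₁)
    ok₄ = ∧-true {stripAll (2 ∷ P) r ≡ᵇ 1} (proj₂ ok₃)
    primes : All Prime P
    primes = allᵇ-sound isPrimeᵇ-sound P (proj₁ ok₂)
    asc = ascending-sound 2 P (proj₂ ok₂)
    divides-N : ∀ l → (l ∣ᵇ r) ∨ (l ∣ᵇ suc (suc r)) ≡ true → l ∣ r * suc (suc r)
    divides-N l e with ∨-true {l ∣ᵇ r} e
    ... | inj₁ e′ = ∣m⇒∣m*n (suc (suc r)) (∣ᵇ⇒∣ l r e′)
    ... | inj₂ e′ = ∣n⇒∣m*n r (∣ᵇ⇒∣ l (suc (suc r)) e′)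
    prime2 = isPrimeᵇ-sound 2 refl
    odd-member : ∀ {p} → p ≢ 2 → p ∈ 2 ∷ P → p ∈ P
    odd-member p≢2 (here e)   = ⊥-elim (p≢2 e)
    odd-member p≢2 (there p∈) = p∈
    complete : ∀ p → Prime p → p ≢ 2 → p ∣ r * suc (suc r) → p ∈ P
    complete p pp p≢2 p∣N with euclidsLemma r (suc (suc r)) pp p∣N
    ... | inj₁ d = odd-member p≢2 (stripAll-sound (2 ∷ P) pp (prime2 ∷ primes) d (≡ᵇ-true (proj₁ ok₄)))
    ... | inj₂ d = odd-member p≢2 (stripAll-sound (2 ∷ P) pp (prime2 ∷ primes) d (≡ᵇ-true (proj₂ ok₄)))

  -- upper bounds for the weighted number of points divisible by l: from the character sums, and from
  -- the number of residues modulo q+1 or q−1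
  analyticBound countBound shareBound : ℕ → ℕ → List ℕ → ℕ → ℕ
  analyticBound r R M l = quot (productℕ M * (4 * suc r + Error.err₀ (suc (suc r)) 4 R (div l ∷ two ∷ []))) (4 * l)
  countBound r R M l = if l ∣ᵇ suc (suc r)
    then quot (1 * suc (suc r) * (parity (suc (suc r)) * avoid (suc (suc r)) M)) l
    else quot (2 * r * (parity r * avoid r M)) l
  shareBound r R M l = if analyticBound r R M l <ᵇ countBound r R M l then analyticBound r R M l else countBound r R M l

  -- Scale s = 4: √q is bounded by R/4 with R² ≥ 16q, finer than rounding to a whole number, and
  -- kernels of period q + 1 are charged without any √q.
  criterion : ℕ → ℕ → List ℕ → List ℕ → Bool
  criterion r R M P = 4 * sumℕ P (shareBound r R M) + Error.err₀ (suc (suc r)) 4 R (core M) <ᵇ 4 * suc r * leads (core M)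

  rootAbove : ℕ → ℕ → ℕ → ℕ
  rootAbove zero    n k = k
  rootAbove (suc f) n k = if n ≤ᵇ k * k then k else rootAbove f n (suc k)

  refinedWith : ℕ → ℕ → List ℕ → Bool
  refinedWith r R P = (16 * suc r ≤ᵇ R * R) ∧ (valid r P ∧ (criterion r R (take 1 P) (drop 1 P) ∨ criterion r R (take 2 P) (drop 2 P)))

  refinedᵇ : ℕ → Bool
  refinedᵇ q = refinedWith (q ∸ 1) (rootAbove q (16 * q) 1) (oddPrimes q)

  quot-bound : ∀ {x} B a → 1 ≤ a → ℤ.+ a ℤ.* x ℤ.≤ ℤ.+ B → x ℤ.≤ ℤ.+ quot B a
  quot-bound {ℤ.+ n}      B (suc a) _ le = ℤ.+≤+ (≤-trans (≤-reflexive (sym (m*n/n≡m n (suc a)))) (/-monoˡ-≤ (suc a)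
    (≤-trans (≤-reflexive (*-comm n (suc a))) (ℤP.drop‿+≤+ (subst (ℤ._≤ ℤ.+ B) (sym (ℤP.pos-* (suc a) n)) le)))))
  quot-bound {ℤ.-[1+ n ]} B (suc a) _ le = ℤ.-≤+

  min-bound : ∀ {x : ℤ.ℤ} a b → x ℤ.≤ ℤ.+ a → x ℤ.≤ ℤ.+ b → x ℤ.≤ ℤ.+ (if a <ᵇ b then a else b)
  min-bound a b xa xb with a <ᵇ b
  ... | true  = xa
  ... | false = xb

  module _ {r : ℕ} .{{_ : NonZero r}} (2∣r : 2 ∣ r) {R : ℕ} (R-ok : 4 * 4 * suc r ≤ R * R) where
    private
      2∣q+1 = proj₁ (even-divisors 2∣r)
      4∣N   = proj₂ (even-divisors 2∣r)
      q+1 = suc (suc r)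

    criterion-sound : ∀ M P → OddPrimeDivisors (r * suc (suc r)) (M ++ P) → criterion r R M P ≡ true → Hit r
    criterion-sound M P O ok {T} L = from-split (split-primes 2∣r M O)
      where
      from-split : (All Prime M × All (Coprime 2) M × All (_∣ r * suc (suc r)) M × Unique M) ×
        All (λ l → Prime l × Coprime 2 l × l ∣ r * suc (suc r) × All (l ≢_) M) P →
        ∃[ i ] (i < suc r × 2 ∣ T i × ¬ 4 ∣ T i × (∀ p → Prime p → p ≢ 2 → p ∣ r * suc (suc r) → ¬ p ∣ T i))
      from-split ((pM , oM , dM , uM) , all) = hit-from 2∣r L O
        (sieve-criterion L 4∣N 2∣q+1 2∣r pM oM dM uM {4} {R} R-ok {P} (shareBound r R M) (All.map (λ {l} h → bound l h) all) (<ᵇ-true ok))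
        where
        X′ : ℕ → ℤ.ℤ
        X′ = X L 4∣N 2∣q+1 2∣r pM oM dM uM
        analytic : ∀ l → Prime l → Coprime 2 l → l ∣ r * suc (suc r) → X′ l ℤ.≤ ℤ.+ analyticBound r R M l
        analytic l pl ol dl = quot-bound {X′ l} (productℕ M * (4 * suc r + Error.err₀ q+1 4 R (div l ∷ two ∷ []))) (4 * l)
          (*-mono-≤ {1} {4} (s≤s z≤n) (≤-trans (s≤s z≤n) (prime≥2 pl)))
          (subst (ℤ._≤ ℤ.+ (productℕ M * (4 * suc r + Error.err₀ q+1 4 R (div l ∷ two ∷ []))))
            (trans (sym (ℤP.*-assoc (ℤ.+ 4) (ℤ.+ l) (X′ l))) (cong (ℤ._* X′ l) (sym (ℤP.pos-* 4 l))))
            (X-bound₂ L 4∣N 2∣q+1 2∣r pM oM dM uM {4} {R} R-ok pl ol dl))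
        count : ∀ l → Prime l → Coprime 2 l → l ∣ r * suc (suc r) → All (l ≢_) M → X′ l ℤ.≤ ℤ.+ countBound r R M l
        count l pl ol dl nM = choose (l ∣ᵇ q+1) refl
          where
          l≥1 = ≤-trans (s≤s z≤n) (prime≥2 pl)
          upper = quot (1 * q+1 * (parity q+1 * avoid q+1 M)) l
          lower = quot (2 * r * (parity r * avoid r M)) l
          l∣r : (l ∣ᵇ q+1) ≡ false → l ∣ r
          l∣r e = pick (euclidsLemma r q+1 pl dl)
            where pick : l ∣ r ⊎ l ∣ q+1 → l ∣ r
                  pick (inj₁ d) = d
                  pick (inj₂ d) = ⊥-elim (false≢true (trans (sym e) (∣⇒∣ᵇ l q+1 {{prime⇒nonZero pl}} d)))
                    where false≢true : false ≢ true
                          false≢true ()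
          choose : ∀ b → (l ∣ᵇ q+1) ≡ b → X′ l ℤ.≤ ℤ.+ (if b then upper else lower)
          choose true  e = quot-bound {X′ l} (1 * q+1 * (parity q+1 * avoid q+1 M)) l l≥1
            (X-count L 4∣N 2∣q+1 2∣r pM oM dM uM pl ol nM q+1 1 2∣q+1 (∣ᵇ⇒∣ l q+1 e) (LineLogs.hits₊ L))
          choose false e = quot-bound {X′ l} (2 * r * (parity r * avoid r M)) l l≥1
            (X-count L 4∣N 2∣q+1 2∣r pM oM dM uM pl ol nM r 2 2∣r (l∣r e) (LineLogs.hits₋ L))
        bound : ∀ l → Prime l × Coprime 2 l × l ∣ r * suc (suc r) × All (l ≢_) M → X′ l ℤ.≤ ℤ.+ shareBound r R M l
        bound l (pl , ol , dl , nM) = min-bound {X′ l} (analyticBound r R M l) (countBound r R M l) (analytic l pl ol dl) (count l pl ol dl nM)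

  refined-sound : ∀ {r} .{{_ : NonZero r}} R P → 2 ∣ r → refinedWith r R P ≡ true → Hit r
  refined-sound {r} R P 2∣r ok = cases (∨-true {criterion r R (take 1 P) (drop 1 P)} (proj₂ ok₂))
    where
    ok₁ = ∧-true {16 * suc r ≤ᵇ R * R} ok
    ok₂ = ∧-true {valid r P} (proj₂ ok₁)
    R-ok : 4 * 4 * suc r ≤ R * R
    R-ok = ≤ᵇ-true {16 * suc r} {R * R} (proj₁ ok₁)
    O : ∀ k → OddPrimeDivisors (r * suc (suc r)) (take k P ++ drop k P)
    O k = subst (OddPrimeDivisors (r * suc (suc r))) (sym (take++drop≡id k P)) (valid-sound r P (proj₁ ok₂))
    cases : criterion r R (take 1 P) (drop 1 P) ≡ true ⊎ criterion r R (take 2 P) (drop 2 P) ≡ true → Hit r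
    cases (inj₁ e) = criterion-sound 2∣r R-ok (take 1 P) (drop 1 P) (O 1) e
    cases (inj₂ e) = criterion-sound 2∣r R-ok (take 2 P) (drop 2 P) (O 2) e

  leastDivisor : ℕ → ℕ → ℕ → ℕ
  leastDivisor zero    d n = d
  leastDivisor (suc f) d n = if d ∣ᵇ n then d else leastDivisor f (suc d) n

  twoPrimes : ℕ → ℕ → ℕ → Bool
  twoPrimes n d m = (isPrimeᵇ d ∧ (1 <ᵇ m)) ∧ ((d ∣ᵇ n) ∧ ((m ∣ᵇ n) ∧ not (d ∣ᵇ m)))

  -- The least divisor d is prime. If something larger than 1 remains after removing all factors d,
  -- then n has a second prime divisor.
  notPrimePowerᵇ : ℕ → Bool
  notPrimePowerᵇ n = twoPrimes n (leastDivisor n 2 n) (strip 40 (leastDivisor n 2 n) n)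

  prime∣^ : ∀ {p d} k → Prime p → Prime d → d ∣ p ^ k → d ≡ p
  prime∣^ zero    pp pd d∣ = ⊥-elim (<⇒≢ (prime≥2 pd) (sym (∣1⇒≡1 d∣)))
  prime∣^ {p} (suc k) pp pd d∣ with euclidsLemma p (p ^ k) pd d∣
  ... | inj₂ d∣′ = prime∣^ k pp pd d∣′
  ... | inj₁ d∣p with prime⇒irreducible pp d∣p
  ...   | inj₁ refl = ⊥-elim (<⇒≱ (prime≥2 pd) ≤-refl)
  ...   | inj₂ e    = e

  twoPrimes-sound : ∀ {n d m} → twoPrimes n d m ≡ true → ¬ IsPrimePower n
  twoPrimes-sound {n} {d} {m} ok (p , k , pp , _ , refl) with primeDivisor m m≢1 {{m≢0}}
    where
    ok₁ = ∧-true {isPrimeᵇ d ∧ (1 <ᵇ m)} ok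
    1<m = <ᵇ-true {1} {m} (proj₂ (∧-true {isPrimeᵇ d} (proj₁ ok₁)))
    m≢1 : m ≢ 1
    m≢1 refl = <⇒≱ 1<m ≤-refl
    m≢0 : NonZero m
    m≢0 = >-nonZero (<-trans (s≤s z≤n) 1<m)
  ... | e , pe , e∣m = not-true (proj₂ ok₃) (∣⇒∣ᵇ d m {{prime⇒nonZero pd}} (subst (_∣ m) (trans (prime∣^ k pp pe (∣-trans e∣m (∣ᵇ⇒∣ m n (proj₁ ok₃)))) (sym (prime∣^ k pp pd (∣ᵇ⇒∣ d n (proj₁ ok₂))))) e∣m))
    where
    ok₁ = ∧-true {isPrimeᵇ d ∧ (1 <ᵇ m)} ok
    ok₂ = ∧-true {d ∣ᵇ n} (proj₂ ok₁)
    ok₃ = ∧-true {m ∣ᵇ n} (proj₂ ok₂)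
    pd = isPrimeᵇ-sound d (proj₁ (∧-true {isPrimeᵇ d} (proj₁ ok₁)))

-- Evaluation of the criteria for all odd q below 37249

module SmallOrders where

  open import Defs using (IsPrimePower)
  open import Data.Nat hiding (_≟_; parity)
  open import Data.Nat.Properties
  open import Data.Nat.Divisibility
  open import Data.Nat.Tactic.RingSolver using (solve-∀)
  open import Data.Bool using (Bool; true; false; _∧_; _∨_; if_then_else_)
  open import Data.List using (List; []; _∷_)
  open import Data.List.Relation.Unary.Any using (here; there)
  open import Data.List.Membership.Propositional using (_∈_)
  open import Data.Product using (_,_; proj₁; proj₂; ∃-syntax)
  open import Data.Sum using (_⊎_; inj₁; inj₂)
  open import Data.Empty using (⊥-elim)
  open import Relation.Nullary using (Dec; yes; no)
  open import Relation.Binary.PropositionalEquality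
  open SieveBounds using (∧-true)
  open Criteria
  open Refined

  excluded exceptional : List ℕ
  excluded    = 3 ∷ 5 ∷ 7 ∷ 9 ∷ 11 ∷ 13 ∷ 31 ∷ 41 ∷ []
  exceptional = 17 ∷ 19 ∷ 25 ∷ 29 ∷ 37 ∷ 43 ∷ 49 ∷ 61 ∷ 71 ∷ 79 ∷ 89 ∷ 97 ∷ 101 ∷ 109 ∷ 121 ∷ 131 ∷ 139 ∷ 151 ∷ 169 ∷ 181 ∷ 211 ∷
    229 ∷ 239 ∷ 241 ∷ 281 ∷ 331 ∷ 349 ∷ 379 ∷ 419 ∷ 461 ∷ 571 ∷ 601 ∷ 631 ∷ 701 ∷ 769 ∷ 859 ∷ 881 ∷ 911 ∷ 1301 ∷ 1429 ∷ 2311 ∷ 2729 ∷ []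

  member : ℕ → List ℕ → Bool
  member q []       = false
  member q (x ∷ xs) = (q ≡ᵇ x) ∨ member q xs

  member-sound : ∀ q xs → member q xs ≡ true → q ∈ xs
  member-sound q (x ∷ xs) ok with ∨-true {q ≡ᵇ x} ok
  ... | inj₁ e = here (≡ᵇ-true e)
  ... | inj₂ e = there (member-sound q xs e)

  decided : ℕ → ℕ → Bool
  decided q ρ = (isFloorRoot q ρ ∧ crudeᵇ q ρ) ∨ (refinedᵇ q ∨ (notPrimePowerᵇ q ∨ (member q exceptional ∨ member q excluded)))

  -- ρ follows the integer part of √q from one odd q to the next. `isFloorRoot` tests it again at
  -- each q, so nothing has to be proved about this update.
  allDecided : ℕ → ℕ → ℕ → Bool
  allDecided zero    q ρ = true
  allDecided (suc f) q ρ = decided q ρ ∧ allDecided f (2 + q) (if suc ρ * suc ρ ≤ᵇ 2 + q then suc ρ else ρ)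

  allDecided-sound : ∀ f q ρ → allDecided f q ρ ≡ true → ∀ i → i < f → ∃[ ρ′ ] decided (q + i * 2) ρ′ ≡ true
  allDecided-sound (suc f) q ρ ok zero    _ = ρ , subst (λ z → decided z ρ ≡ true) (sym (+-identityʳ q)) (proj₁ (∧-true {decided q ρ} ok))
  allDecided-sound (suc f) q ρ ok (suc i) (s≤s i<f) = proj₁ rest , subst (λ z → decided z (proj₁ rest) ≡ true) (lem q i) (proj₂ rest)
    where
    lem : ∀ q i → 2 + q + i * 2 ≡ q + suc i * 2
    lem = solve-∀
    rest : ∃[ ρ′ ] decided (2 + q + i * 2) ρ′ ≡ true
    rest = allDecided-sound f (2 + q) _ (proj₂ (∧-true {decided q ρ} ok)) i i<f

  abstract
    -- The 18623 odd numbers 3, 5, ..., 37247.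
    decidedBelow : allDecided 18623 3 1 ≡ true
    decidedBelow = refl

  ∨-elim : ∀ a {b} {A : Set} → (a ≡ true → A) → (b ≡ true → A) → a ∨ b ≡ true → A
  ∨-elim true  f g e = f refl
  ∨-elim false f g e = g e

  decided-sound : ∀ r .{{_ : NonZero r}} ρ → 2 ∣ r → IsPrimePower (suc r) → decided (suc r) ρ ≡ true →
    Hit r ⊎ suc r ∈ exceptional ⊎ suc r ∈ excluded
  decided-sound r ρ 2∣r pp =
    ∨-elim (isFloorRoot (suc r) ρ ∧ crudeᵇ (suc r) ρ)
      (λ e → inj₁ (crude-sound {r} {ρ} 2∣r (proj₁ (∧-true {isFloorRoot (suc r) ρ} e)) (proj₂ (∧-true {isFloorRoot (suc r) ρ} e))))
    (∨-elim (refinedᵇ (suc r))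
      (λ e → inj₁ (refined-sound {r} (rootAbove (suc r) (16 * suc r) 1) (oddPrimes (suc r)) 2∣r e))
    (∨-elim (notPrimePowerᵇ (suc r))
      (λ e → ⊥-elim (twoPrimes-sound {suc r} {leastDivisor (suc r) 2 (suc r)} {strip 40 (leastDivisor (suc r) 2 (suc r)) (suc r)} e pp))
    (∨-elim (member (suc r) exceptional)
      (λ e → inj₂ (inj₁ (member-sound (suc r) exceptional e)))
      (λ e → inj₂ (inj₂ (member-sound (suc r) excluded e))))))

  trichotomy : ∀ r → 0 < r → 2 ∣ r → IsPrimePower (suc r) → Hit r ⊎ suc r ∈ exceptional ⊎ suc r ∈ excluded
  trichotomy r 0<r 2∣r pp = cases (37249 ≤? suc r)
    where
    instance r≢0 : NonZero r
             r≢0 = >-nonZero 0<r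
    cases : Dec (37249 ≤ suc r) → Hit r ⊎ suc r ∈ exceptional ⊎ suc r ∈ excluded
    cases (yes le) = inj₁ (large-sound 2∣r le)
    cases (no ¬le) = small 2∣r
      where
      small : 2 ∣ r → Hit r ⊎ suc r ∈ exceptional ⊎ suc r ∈ excluded
      small (divides zero e) = ⊥-elim (<⇒≢ 0<r (sym e))
      small (divides (suc i) e) = decided-sound r (proj₁ found) 2∣r pp (subst (λ z → decided z (proj₁ found) ≡ true) (cong suc (sym e)) (proj₂ found))
        where
        i<18623 : i < 18623
        i<18623 = *-cancelʳ-< 2 i 18623 (≤-pred (≤-pred (subst (_< 37248) e (≤-pred (≰⇒> ¬le)))))
        found = allDecided-sound 18623 3 1 decidedBelow i i<18623

-- The executable search for a single q

module ConcreteCheck where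

  open import Data.Nat hiding (_≟_; parity)
  open import Data.Bool using (Bool; true; _∧_; _∨_; if_then_else_; not)
  open import Data.List using (List; []; _∷_; length)
  open import Data.Product using (_×_; _,_)
  open SieveBounds using (_∣ᵇ_)
  open Crude using (quot)
  open Refined using (valid; oddPrimes; allᵇ; isPrimeᵇ)

  _rem_ : ℕ → ℕ → ℕ
  n rem zero  = n
  n rem suc p = n % suc p

  -- (a , b) stands for a + bδ in the field of size p or p², where δ² = n₀
  Code : Set
  Code = ℕ × ℕ

  _==_ : Code → Code → Bool
  (a , b) == (c , d) = (a ≡ᵇ c) ∧ (b ≡ᵇ d)

  one : Code
  one = 1 , 0

  -- The certificates with q = p have second components 0 and n₀ = 1, so that a δ exists trivially;
  -- those with q = p² take a nonsquare n₀ modulo p.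
  module Codes (p n₀ : ℕ) where

    add mul : Code → Code → Code
    add (a , b) (c , d) = (a + c) rem p , (b + d) rem p
    mul (a , b) (c , d) = (a * c + n₀ * (b * d)) rem p , (a * d + b * c) rem p

    neg : Code → Code
    neg (a , b) = (p ∸ a rem p) rem p , (p ∸ b rem p) rem p

    pow : ℕ → Code → ℕ → Code
    pow fuel    x zero        = one
    pow zero    x (suc n)     = mul x (pow zero x n)
    pow (suc f) x n@(suc n-1) = if 2 ∣ᵇ n then pow f (mul x x) (quot n 2) else mul x (pow f (mul x x) (quot n-1 2))

    -- The equation x·x^(q-2) = 1 between codes remains true after evaluation in any model. It shows
    -- that the value of x is nonzero, without knowing that different codes have different values.
    isUnit : ℕ → Code → Bool
    isUnit q x = mul x (pow 30 x (q ∸ 2)) == one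

  -- Indexed by binary digits, lowest first. Twelve levels hold all keys below 4096, more than the
  -- largest q searched. What a lookup returns is tested by `isLog`.
  data Trie : Set where
    empty : Trie
    leaf  : ℕ → Trie
    node  : Trie → Trie → Trie

  left right : Trie → Trie
  left (node a b)  = a
  left _           = empty
  right (node a b) = b
  right _          = empty

  insert : ℕ → ℕ → ℕ → Trie → Trie
  insert zero    k v t = leaf v
  insert (suc f) k v t = if 2 ∣ᵇ k then node (insert f (quot k 2) v (left t)) (right t)
                                   else node (left t) (insert f (quot k 2) v (right t))

  lookup : ℕ → ℕ → Trie → ℕ
  lookup zero    k (leaf v)   = v
  lookup (suc f) k (node a b) = if 2 ∣ᵇ k then lookup f (quot k 2) a else lookup f (quot k 2) b
  lookup _       k _          = 0

  avoiding : ℕ → ℕ → List ℕ → List ℕ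
  avoiding l c []       = []
  avoiding l c (t ∷ ts) = if l ∣ᵇ (t + c) then avoiding l c ts else t ∷ avoiding l c ts

  count : ℕ → ℕ → List ℕ → ℕ
  count l c []       = 0
  count l c (t ∷ ts) = if l ∣ᵇ (t + c) then suc (count l c ts) else count l c ts

  maximum : ℕ → ℕ → ℕ
  maximum a b = if a <ᵇ b then b else a

  maxBelow : ℕ → (ℕ → ℕ) → ℕ
  maxBelow zero    f = 0
  maxBelow (suc n) f = maximum (maxBelow n f) (f n)

  -- The cap of l is the size of the largest residue class of S modulo l. It bounds the number of
  -- elements that excluding one class can remove, from S and from any sublist of it.
  withCaps : List ℕ → List ℕ → List (ℕ × ℕ)
  withCaps []       S = []
  withCaps (l ∷ ls) S = (l , maxBelow l (λ c → count l c S)) ∷ withCaps ls S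

  totalCap : List (ℕ × ℕ) → ℕ
  totalCap []             = 0
  totalCap ((l , m) ∷ ls) = m + totalCap ls

  allBelow : ℕ → (ℕ → Bool) → Bool
  allBelow zero    f = true
  allBelow (suc n) f = f n ∧ allBelow n f

  -- for all residues c_l modulo the listed primes some t ∈ S has l ∤ t + c_l for all of them: true if S is larger
  -- than the sum of the caps on the sizes of its residue classes, otherwise branch on the residue for the first prime
  covers : List (ℕ × ℕ) → List ℕ → Bool
  covers []             S = 0 <ᵇ length S
  covers ((l , m) ∷ ls) S = (totalCap ((l , m) ∷ ls) <ᵇ length S) ∨ allBelow l (λ c → covers ls (avoiding l c S))

  twoModFour : ℕ → List ℕ → List ℕ
  twoModFour b []       = []
  twoModFour b (t ∷ ts) = if (t + b) rem 4 ≡ᵇ 2 then t ∷ twoModFour b ts else twoModFour b ts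

  -- Only the residues of the unknown shift modulo 4 and modulo the primes in P matter, and they
  -- vary independently by the Chinese remainder theorem.
  coversAll : List ℕ → List ℕ → Bool
  coversAll P ts = allBelow 4 (λ b → covers (withCaps P (twoModFour b ts)) (twoModFour b ts))

  -- γ² = tr γ + c, and −c = γ^(q+1) generates the multiplicative group of the base field
  module Check (q p n₀ : ℕ) (tr c : Code) where
    open Codes p n₀

    nm : Code
    nm = neg c

    key : Code → ℕ
    key (a , b) = a + p * b

    table : ℕ → ℕ → Code → Trie → Trie
    table zero    i x t = t
    table (suc f) i x t = table f (suc i) (mul x nm) (insert 12 (key x) i t)

    logTable : Trie
    logTable = table (q ∸ 1) 0 one empty

    isLog : ℕ → Code → Bool
    isLog d v = (d ≤ᵇ q ∸ 1) ∧ (pow 30 nm d == v)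

    -- u, v are the coordinates v_{a−1}, v_a in γ^a = v_a γ + c v_{a−1}
    verify : Trie → ℕ → Code → Code → Bool
    verify t zero    u v = (v == (0 , 0)) ∧ (u == neg one)
    verify t (suc f) u v = isLog (lookup 12 (key v) t) v ∧ verify t f v (add (mul tr v) (mul c u))

    -- γ^a = v_a(γ + c·v_(a-1)/v_a), and v_a = γ^((q+1)d) with d its logarithm to base γ^(q+1). So
    -- the point γ + c·v_(a-1)/v_a has logarithm a - (q + 1)d, made nonnegative by adding (q + 1)(q
    -- - 1).
    logs : Trie → ℕ → ℕ → Code → Code → List ℕ
    logs t zero    a u v = []
    logs t (suc f) a u v = a + suc q * (q ∸ 1 ∸ lookup 12 (key v) t) ∷ logs t f (suc a) v (add (mul tr v) (mul c u))

    discriminant : Code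
    discriminant = add (mul tr tr) (mul (mul (2 , 0) (2 , 0)) c)

    generatorᵇ : List ℕ → Bool
    generatorᵇ P = allᵇ (λ l → not (l ∣ᵇ (q ∸ 1)) ∨ isUnit q (add (pow 30 nm (quot (q ∸ 1) l)) (neg one))) P

    fieldᵇ : Bool
    fieldᵇ = (isPrimeᵇ p ∧ ((q ≡ᵇ p) ∨ (q ≡ᵇ p * p))) ∧ ((Codes.pow p 0 30 (n₀ , 0) (quot (q ∸ 1) 2) == one)
      ∧ (isUnit q discriminant ∧ (isUnit q c ∧ isUnit q (2 , 0))))

    lineWith : List ℕ → Trie → Bool
    lineWith P t = (valid (q ∸ 1) P ∧ fieldᵇ) ∧ (generatorᵇ (2 ∷ P) ∧ (verify t q (0 , 0) one ∧ coversAll P (logs t q 1 (0 , 0) one)))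

  lineᵇ : ℕ → ℕ → ℕ → Code → Code → Bool
  lineᵇ q p n₀ tr c = Check.lineWith q p n₀ tr c (oddPrimes q) (Check.logTable q p n₀ tr c)

-- Soundness of the search over residues, and evaluation of codes

module Concrete where

  open import Data.Nat as ℕ using (ℕ; zero; suc; s≤s; z≤n; NonZero; _<ᵇ_; _≡ᵇ_)
  import Data.Nat.Properties as ℕP
  open import Data.Nat.Divisibility
  open import Data.Nat.DivMod using (m≡m%n+[m/n]*n; m%n<n; m%n≤n)
  import Data.Nat.Tactic.RingSolver as ℕR
  open import Data.Bool using (Bool; true; false; if_then_else_)
  open import Data.List using (List; []; _∷_; length)
  open import Data.List.Relation.Unary.All as All using (All; []; _∷_)
  open import Data.List.Relation.Unary.Any using (here; there)
  open import Data.List.Membership.Propositional using (_∈_)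
  open import Data.Product using (_×_; _,_; proj₁; proj₂; ∃-syntax)
  open import Data.Empty using (⊥-elim)
  open import Relation.Nullary using (yes; no; ¬_)
  open import Relation.Binary.PropositionalEquality
  open import Algebra.Bundles using (CommutativeRing)
  open FiniteFields
  open IntegerCoefficients using (module RingIdentities)
  open Lines
  open LinePoints
  open SieveBounds using (_∣ᵇ_; ∣ᵇ⇒∣; ∣⇒∣ᵇ; ∧-true)
  open Crude using (quot; quot-exact; <ᵇ-true)
  open Refined using (≡ᵇ-true)
  open SmallOrders using (∨-elim)
  open ConcreteCheck

  avoiding-count : ∀ l c ts → count l c ts ℕ.+ length (avoiding l c ts) ≡ length ts
  avoiding-count l c []       = refl
  avoiding-count l c (t ∷ ts) with l ∣ᵇ (t ℕ.+ c)
  ... | true  = cong suc (avoiding-count l c ts)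
  ... | false = trans (ℕP.+-suc (count l c ts) (length (avoiding l c ts))) (cong suc (avoiding-count l c ts))

  avoiding-∈ : ∀ l c {t} ts → t ∈ avoiding l c ts → t ∈ ts × (l ∣ᵇ (t ℕ.+ c)) ≢ true
  avoiding-∈ l c (t ∷ ts) t∈ with l ∣ᵇ (t ℕ.+ c) in e
  avoiding-∈ l c (t ∷ ts) t∈          | true with avoiding-∈ l c ts t∈
  ... | t∈′ , n = there t∈′ , n
  avoiding-∈ l c (t ∷ ts) (here refl) | false = here refl , λ e′ → ≢-true (trans (sym e) e′)
    where ≢-true : false ≢ true
          ≢-true ()
  avoiding-∈ l c (t ∷ ts) (there t∈)  | false with avoiding-∈ l c ts t∈
  ... | t∈′ , n = there t∈′ , n

  count-avoiding : ∀ l c l′ c′ ts → count l c (avoiding l′ c′ ts) ℕ.≤ count l c ts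
  count-avoiding l c l′ c′ []       = z≤n
  count-avoiding l c l′ c′ (t ∷ ts) with l′ ∣ᵇ (t ℕ.+ c′)
  ... | true  with l ∣ᵇ (t ℕ.+ c)
  ...   | true  = ℕP.m≤n⇒m≤1+n (count-avoiding l c l′ c′ ts)
  ...   | false = count-avoiding l c l′ c′ ts
  count-avoiding l c l′ c′ (t ∷ ts) | false with l ∣ᵇ (t ℕ.+ c)
  ...   | true  = s≤s (count-avoiding l c l′ c′ ts)
  ...   | false = count-avoiding l c l′ c′ ts

  maximum-≥ : ∀ a b → a ℕ.≤ maximum a b × b ℕ.≤ maximum a b
  maximum-≥ a b with a <ᵇ b in e
  ... | true  = ℕP.<⇒≤ (<ᵇ-true {a} e) , ℕP.≤-refl
  ... | false = ℕP.≤-refl , ℕP.≮⇒≥ λ a<b → subst Data.Bool.T e (ℕP.<⇒<ᵇ a<b)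

  maxBelow-≥ : ∀ n f {c} → c ℕ.< n → f c ℕ.≤ maxBelow n f
  maxBelow-≥ (suc n) f {c} c<1+n with c ℕ.≟ n
  ... | yes refl = proj₂ (maximum-≥ (maxBelow n f) (f n))
  ... | no c≢n   = ℕP.≤-trans (maxBelow-≥ n f (ℕP.≤∧≢⇒< (ℕP.≤-pred c<1+n) c≢n)) (proj₁ (maximum-≥ (maxBelow n f) (f n)))

  allBelow-sound : ∀ n f → allBelow n f ≡ true → ∀ {c} → c ℕ.< n → f c ≡ true
  allBelow-sound (suc n) f ok {c} c<1+n with c ℕ.≟ n
  ... | yes refl = proj₁ (∧-true {f n} ok)
  ... | no c≢n   = allBelow-sound n f (proj₂ (∧-true {f n} ok)) (ℕP.≤∧≢⇒< (ℕP.≤-pred c<1+n) c≢n)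

  Capped : List ℕ → ℕ × ℕ → Set
  Capped S (l , m) = NonZero l × (∀ c → c ℕ.< l → count l c S ℕ.≤ m)

  capped-avoiding : ∀ S {ls} l c → All (Capped S) ls → All (Capped (avoiding l c S)) ls
  capped-avoiding S l c []                               = []
  capped-avoiding S {(l′ , _) ∷ _} l c ((nz , h) ∷ hs) =
    (nz , λ c′ c′<l → ℕP.≤-trans (count-avoiding l′ c′ l c S) (h c′ c′<l)) ∷ capped-avoiding S l c hs

  ∣-residue : ∀ l .{{_ : NonZero l}} t b → l ∣ t ℕ.+ b → l ∣ t ℕ.+ b ℕ.% l
  ∣-residue l t b d = ∣m+n∣m⇒∣n (subst (l ∣_) index d) (n∣m*n (b ℕ./ l))
    where
    lem : ∀ t a b → t ℕ.+ (a ℕ.+ b) ≡ b ℕ.+ (t ℕ.+ a)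
    lem = ℕR.solve-∀
    index : t ℕ.+ b ≡ b ℕ./ l ℕ.* l ℕ.+ (t ℕ.+ b ℕ.% l)
    index = trans (cong (t ℕ.+_) (m≡m%n+[m/n]*n b l)) (lem t (b ℕ.% l) (b ℕ./ l ℕ.* l))

  Escapes : ℕ → List (ℕ × ℕ) → List ℕ → Set
  Escapes b ls S = ∃[ t ] (t ∈ S × All (λ lm → ¬ proj₁ lm ∣ t ℕ.+ b) ls)

  extend : ∀ {b l m ls S} .{{_ : NonZero l}} → Escapes b ls (avoiding l (b ℕ.% l) S) → Escapes b ((l , m) ∷ ls) S
  extend {b} {l} {S = S} (t , t∈ , h) = t , proj₁ av , (λ d → proj₂ av (∣⇒∣ᵇ l (t ℕ.+ b ℕ.% l) (∣-residue l t b d))) ∷ h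
    where av = avoiding-∈ l (b ℕ.% l) S t∈

  -- Each prime in turn removes at most its cap, whichever class is forbidden; a list longer than
  -- the sum of the caps is not exhausted.
  surplus : ∀ b ls S → All (Capped S) ls → totalCap ls ℕ.< length S → Escapes b ls S
  surplus b []             (t ∷ S) []               lt = t , here refl , []
  surplus b ((l , m) ∷ ls) S       ((nz , h) ∷ hs) lt = extend {m = m} {{nz}} (surplus b ls S′ (capped-avoiding S l c hs)
    (ℕP.+-cancelˡ-< m (totalCap ls) (length S′) (ℕP.<-≤-trans lt (ℕP.≤-trans (ℕP.≤-reflexive (sym (avoiding-count l c S))) (ℕP.+-monoˡ-≤ (length S′) (h c (m%n<n b l {{nz}})))))))
    where
    c = ℕ._%_ b l {{nz}}
    S′ = avoiding l c S

  covers-sound : ∀ b ls S → All (Capped S) ls → covers ls S ≡ true → Escapes b ls S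
  covers-sound b []             (t ∷ S) []              ok = t , here refl , []
  covers-sound b ((l , m) ∷ ls) S       ((nz , h) ∷ hs) ok = ∨-elim (totalCap ((l , m) ∷ ls) <ᵇ length S)
    (λ e → surplus b ((l , m) ∷ ls) S ((nz , h) ∷ hs) (<ᵇ-true {totalCap ((l , m) ∷ ls)} e))
    (λ e → extend {m = m} {{nz}} (covers-sound b ls (avoiding l c S) (capped-avoiding S l c hs)
       (allBelow-sound l (λ c → covers ls (avoiding l c S)) e (m%n<n b l {{nz}})))) ok
    where c = ℕ._%_ b l {{nz}}

  withCaps-capped : ∀ P S → All NonZero P → All (Capped S) (withCaps P S)
  withCaps-capped []      S []        = []
  withCaps-capped (l ∷ P) S (nz ∷ ns) = (nz , λ c c<l → maxBelow-≥ l (λ c → count l c S) c<l) ∷ withCaps-capped P S ns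

  withCaps-All : ∀ {Q : ℕ → Set} P S → All (λ lm → Q (proj₁ lm)) (withCaps P S) → All Q P
  withCaps-All []      S []       = []
  withCaps-All (l ∷ P) S (h ∷ hs) = h ∷ withCaps-All P S hs

  twoModFour-∈ : ∀ b {t} ts → t ∈ twoModFour b ts → t ∈ ts × (t ℕ.+ b) ℕ.% 4 ≡ 2
  twoModFour-∈ b (t ∷ ts) t∈ with (t ℕ.+ b) rem 4 ≡ᵇ 2 in e
  twoModFour-∈ b (t ∷ ts) (here refl) | true  = here refl , ≡ᵇ-true e
  twoModFour-∈ b (t ∷ ts) (there t∈)  | true  = there (proj₁ (twoModFour-∈ b ts t∈)) , proj₂ (twoModFour-∈ b ts t∈)
  twoModFour-∈ b (t ∷ ts) t∈          | false = there (proj₁ (twoModFour-∈ b ts t∈)) , proj₂ (twoModFour-∈ b ts t∈)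

  two-mod-four : ∀ t b → (t ℕ.+ b ℕ.% 4) ℕ.% 4 ≡ 2 → 2 ∣ t ℕ.+ b × ¬ 4 ∣ t ℕ.+ b
  two-mod-four t b e = 2∣ , λ 4∣ → 4∤2 (subst (4 ∣_) e (%-presˡ-∣ (∣-residue 4 t b 4∣) ∣-refl))
    where
    4∤2 : ¬ 4 ∣ 2
    4∤2 = >⇒∤ (s≤s (s≤s (s≤s z≤n)))
    2∣4 : 2 ∣ 4
    2∣4 = divides 2 refl
    2∣t+b%4 : 2 ∣ t ℕ.+ b ℕ.% 4
    2∣t+b%4 = ∣n∣m%n⇒∣m {n = 4} 2∣4 (subst (2 ∣_) (sym e) ∣-refl)
    lem : ∀ t a b → b ℕ.+ (t ℕ.+ a) ≡ t ℕ.+ (a ℕ.+ b)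
    lem = ℕR.solve-∀
    2∣ : 2 ∣ t ℕ.+ b
    2∣ = subst (2 ∣_) (trans (lem t (b ℕ.% 4) (b ℕ./ 4 ℕ.* 4)) (cong (t ℕ.+_) (sym (m≡m%n+[m/n]*n b 4)))) (∣m∣n⇒∣m+n (∣-trans 2∣4 (n∣m*n (b ℕ./ 4))) 2∣t+b%4)

  coversAll-sound : ∀ P ts → All NonZero P → coversAll P ts ≡ true → ∀ b →
    ∃[ t ] (t ∈ ts × 2 ∣ t ℕ.+ b × ¬ 4 ∣ t ℕ.+ b × All (λ l → ¬ l ∣ t ℕ.+ b) P)
  coversAll-sound P ts nz ok b = t , proj₁ t∈ , proj₁ tb , proj₂ tb , withCaps-All P S (proj₂ (proj₂ escape))
    where
    S = twoModFour (b ℕ.% 4) ts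
    escape = covers-sound b (withCaps P S) S (withCaps-capped P S nz)
      (allBelow-sound 4 (λ b → covers (withCaps P (twoModFour b ts)) (twoModFour b ts)) ok (m%n<n b 4))
    t = proj₁ escape
    t∈ = twoModFour-∈ (b ℕ.% 4) ts (proj₁ (proj₂ escape))
    tb = two-mod-four t b (proj₂ t∈)

  ==-sound : ∀ x y → (x == y) ≡ true → x ≡ y
  ==-sound (a , b) (c , d) ok = cong₂ _,_ (≡ᵇ-true (proj₁ (∧-true {a ≡ᵇ c} ok))) (≡ᵇ-true (proj₂ (∧-true {a ≡ᵇ c} ok)))

  module Embedding {m : ℕ} (K : FiniteField (suc m)) where
    open Field K
    open FiniteField K using (Carrier; _^_)
    open CommutativeRing commutativeRing using (_+_; _*_; -_; _-_; 0#; 1#; +-identityˡ; +-identityʳ; +-assoc; *-identityˡ; *-identityʳ; zeroˡ; zeroʳ; distribʳ)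
    open RingIdentities (FiniteField.isCommutativeRing K)

    ·1-+ : ∀ a b → (a ℕ.+ b) ·1 ≡ a ·1 + b ·1
    ·1-+ zero    b = sym (+-identityˡ (b ·1))
    ·1-+ (suc a) b = trans (cong (1# +_) (·1-+ a b)) (sym (+-assoc 1# (a ·1) (b ·1)))

    ·1-* : ∀ a b → (a ℕ.* b) ·1 ≡ a ·1 * b ·1
    ·1-* zero    b = sym (zeroˡ (b ·1))
    ·1-* (suc a) b = trans (·1-+ b (a ℕ.* b)) (trans (cong₂ _+_ (sym (*-identityˡ (b ·1))) (·1-* a b)) (sym (distribʳ (b ·1) 1# (a ·1))))

    -- Evaluation respects all operations, which transfers equalities between codes to the model.
    -- Inequalities are transferred by way of units.
    module Value (p n₀ : ℕ) .{{_ : NonZero p}} (p≡0 : p ·1 ≡ 0#) {δ : Carrier} (δ² : δ * δ ≡ n₀ ·1) where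
      open Codes p n₀

      rem-·1 : ∀ n → (n rem p) ·1 ≡ n ·1
      rem-·1 n = go p p≡0
        where
        go : ∀ p → p ·1 ≡ 0# → (n rem p) ·1 ≡ n ·1
        go zero    _ = refl
        go (suc p) e = sym (begin
          n ·1                                    ≡⟨ cong _·1 (m≡m%n+[m/n]*n n (suc p)) ⟩
          (n ℕ.% suc p ℕ.+ n ℕ./ suc p ℕ.* suc p) ·1 ≡⟨ ·1-+ (n ℕ.% suc p) (n ℕ./ suc p ℕ.* suc p) ⟩
          (n ℕ.% suc p) ·1 + (n ℕ./ suc p ℕ.* suc p) ·1 ≡⟨ cong ((n ℕ.% suc p) ·1 +_) (trans (·1-* (n ℕ./ suc p) (suc p)) (trans (cong ((n ℕ./ suc p) ·1 *_) e) (zeroʳ _))) ⟩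
          (n ℕ.% suc p) ·1 + 0#                   ≡⟨ +-identityʳ _ ⟩
          (n ℕ.% suc p) ·1                        ∎)
          where open ≡-Reasoning

      ⟪_⟫ : Code → Carrier
      ⟪ a , b ⟫ = a ·1 + b ·1 * δ

      ⟪add⟫ : ∀ x y → ⟪ add x y ⟫ ≡ ⟪ x ⟫ + ⟪ y ⟫
      ⟪add⟫ (a , b) (c , d) = trans (cong₂ (λ u v → u + v * δ) (trans (rem-·1 (a ℕ.+ c)) (·1-+ a c)) (trans (rem-·1 (b ℕ.+ d)) (·1-+ b d)))
        (lem (a ·1) (b ·1) (c ·1) (d ·1) δ)
        where lem : ∀ a b c d t → (a + c) + (b + d) * t ≡ (a + b * t) + (c + d * t)
              lem = solve 5 (λ a b c d t → (a :+ c) :+ (b :+ d) :* t := (a :+ b :* t) :+ (c :+ d :* t)) refl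

      ⟪mul⟫ : ∀ x y → ⟪ mul x y ⟫ ≡ ⟪ x ⟫ * ⟪ y ⟫
      ⟪mul⟫ (a , b) (c , d) = begin
        ⟪ mul (a , b) (c , d) ⟫
          ≡⟨ cong₂ (λ u v → u + v * δ)
               (trans (rem-·1 (a ℕ.* c ℕ.+ n₀ ℕ.* (b ℕ.* d))) (trans (·1-+ (a ℕ.* c) _) (cong₂ _+_ (·1-* a c) (trans (·1-* n₀ (b ℕ.* d)) (cong₂ _*_ (sym δ²) (·1-* b d))))))
               (trans (rem-·1 (a ℕ.* d ℕ.+ b ℕ.* c)) (trans (·1-+ (a ℕ.* d) (b ℕ.* c)) (cong₂ _+_ (·1-* a d) (·1-* b c)))) ⟩
        (a ·1 * c ·1 + δ * δ * (b ·1 * d ·1)) + (a ·1 * d ·1 + b ·1 * c ·1) * δ ≡⟨ lem (a ·1) (b ·1) (c ·1) (d ·1) δ ⟩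
        ⟪ a , b ⟫ * ⟪ c , d ⟫ ∎
        where open ≡-Reasoning
              lem : ∀ a b c d t → (a * c + t * t * (b * d)) + (a * d + b * c) * t ≡ (a + b * t) * (c + d * t)
              lem = solve 5 (λ a b c d t → (a :* c :+ t :* t :* (b :* d)) :+ (a :* d :+ b :* c) :* t := (a :+ b :* t) :* (c :+ d :* t)) refl

      ⟪1⟫ : ⟪ one ⟫ ≡ 1#
      ⟪1⟫ = trans (cong₂ _+_ (+-identityʳ 1#) (zeroˡ δ)) (+-identityʳ 1#)

      ⟪0⟫ : ⟪ 0 , 0 ⟫ ≡ 0#
      ⟪0⟫ = trans (cong (0# +_) (zeroˡ δ)) (+-identityʳ 0#)

      neg-·1 : ∀ a → ((p ℕ.∸ a rem p) rem p) ·1 ≡ - (a ·1)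
      neg-·1 a = x-y≡0⇒x≡y (trans (cong (_- (- (a ·1))) (rem-·1 (p ℕ.∸ a rem p))) (trans (lem ((p ℕ.∸ a rem p) ·1) (a ·1))
        (trans (cong ((p ℕ.∸ a rem p) ·1 +_) (sym (rem-·1 a))) (trans (sym (·1-+ (p ℕ.∸ a rem p) (a rem p))) (trans (cong _·1 (ℕP.m∸n+n≡m (rem≤ p))) p≡0)))))
        where
        lem : ∀ x y → x - (- y) ≡ x + y
        lem = solve 2 (λ x y → x :- (:- y) := x :+ y) refl
        rem≤ : ∀ p .{{_ : NonZero p}} → a rem p ℕ.≤ p
        rem≤ (suc p) = m%n≤n a (suc p)

      ⟪neg⟫ : ∀ x → ⟪ neg x ⟫ ≡ - ⟪ x ⟫
      ⟪neg⟫ (a , b) = trans (cong₂ (λ u v → u + v * δ) (neg-·1 a) (neg-·1 b)) (lem (a ·1) (b ·1) δ)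
        where lem : ∀ a b t → - a + (- b) * t ≡ - (a + b * t)
              lem = solve 3 (λ a b t → :- a :+ (:- b) :* t := :- (a :+ b :* t)) refl

      ⟪pow⟫ : ∀ f x n → ⟪ pow f x n ⟫ ≡ ⟪ x ⟫ ^ n
      ⟪pow⟫ zero    x zero    = ⟪1⟫
      ⟪pow⟫ (suc f) x zero    = ⟪1⟫
      ⟪pow⟫ zero    x (suc n) = trans (⟪mul⟫ x (pow zero x n)) (cong (⟪ x ⟫ *_) (⟪pow⟫ zero x n))
      ⟪pow⟫ (suc f) x (suc n) = go (2 ∣ᵇ suc n) refl
        where
        square : ∀ k → ⟪ pow f (mul x x) k ⟫ ≡ ⟪ x ⟫ ^ (k ℕ.* 2)
        square k = trans (⟪pow⟫ f (mul x x) k) (trans (cong (_^ k) (trans (⟪mul⟫ x x) (cong (⟪ x ⟫ *_) (sym (*-identityʳ ⟪ x ⟫))))) (sym (^-* ⟪ x ⟫ k 2)))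
        odd : (2 ∣ᵇ suc n) ≡ false → 2 ∣ n
        odd e = m%n≡0⇒n∣m n 2 (parity (n ℕ.% 2) refl)
          where
          parity : ∀ k → n ℕ.% 2 ≡ k → k ≡ 0
          parity zero          _  = refl
          parity (suc zero)    e₁ = ⊥-elim (f≢t (trans (sym e) (∣⇒∣ᵇ 2 (suc n) (subst (2 ∣_) (cong suc (sym (trans (m≡m%n+[m/n]*n n 2) (cong (ℕ._+ n ℕ./ 2 ℕ.* 2) e₁)))) (n∣m*n (suc (n ℕ./ 2)))))))
            where f≢t : false ≢ true
                  f≢t ()
          parity (suc (suc k)) e₁ = ⊥-elim (ℕP.<⇒≱ (m%n<n n 2) (subst (2 ℕ.≤_) (sym e₁) (s≤s (s≤s z≤n))))
        go : ∀ b → (2 ∣ᵇ suc n) ≡ b → ⟪ if b then pow f (mul x x) (quot (suc n) 2) else mul x (pow f (mul x x) (quot n 2)) ⟫ ≡ ⟪ x ⟫ ^ suc n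
        go true  e = trans (square (quot (suc n) 2)) (cong (⟪ x ⟫ ^_) (quot-exact 2 (∣ᵇ⇒∣ 2 (suc n) e)))
        go false e = trans (⟪mul⟫ x (pow f (mul x x) (quot n 2))) (cong (⟪ x ⟫ *_) (trans (square (quot n 2)) (cong (⟪ x ⟫ ^_) (quot-exact 2 (odd e)))))

      isUnit-≢0 : ∀ {q} x → isUnit q x ≡ true → ⟪ x ⟫ ≢ 0#
      isUnit-≢0 {q} x ok = unit≢0 {⟪ x ⟫} {⟪ pow 30 x (q ℕ.∸ 2) ⟫} (trans (sym (⟪mul⟫ x (pow 30 x (q ℕ.∸ 2)))) (trans (cong ⟪_⟫ (==-sound (mul x (pow 30 x (q ℕ.∸ 2))) one ok)) ⟪1⟫))

-- From a successful search to the line property in every model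

module ConcreteLine where

  open import Data.Nat as ℕ using (ℕ; zero; suc; s≤s; NonZero; _≤ᵇ_; _≡ᵇ_)
  import Data.Nat.Properties as ℕP
  open import Data.Nat.Divisibility
  open import Data.Nat.DivMod using (m≡m%n+[m/n]*n; m%n<n)
  open import Data.Nat.GCD using (gcd; gcd[m,n]∣m; gcd[m,n]∣n)
  open import Data.Nat.Primality using (Prime; prime⇒nonZero)
  import Data.Nat.Tactic.RingSolver as ℕR
  open import Data.Bool using (true; _∧_; _∨_; not)
  open import Data.List using (List; []; _∷_)
  open import Data.List.Relation.Unary.All as All using (All; []; _∷_)
  open import Data.List.Relation.Unary.Any using (here; there)
  open import Data.List.Membership.Propositional using (_∈_)
  open import Data.Product using (_×_; _,_; proj₁; proj₂; ∃-syntax)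
  open import Data.Empty using (⊥-elim)
  open import Relation.Nullary using (yes; no; ¬_; Dec)
  open import Relation.Binary.PropositionalEquality
  open import Algebra.Bundles using (CommutativeRing)
  open FiniteFields
  open IntegerCoefficients using (module RingIdentities)
  open Lines
  open LinePoints
  open SieveBounds using (_∣ᵇ_; ∣⇒∣ᵇ; ∧-true)
  open Crude using (quot; quot-exact; ≤ᵇ-true)
  open Criteria using (OddPrimeDivisors; even-divisors)
  open Refined using (valid; valid-sound; allᵇ-sound; isPrimeᵇ; isPrimeᵇ-sound; ≡ᵇ-true; not-true; oddPrimes)
  open SmallOrders using (∨-elim)
  open ConcreteCheck
  open Concrete

  module SquareRoots {m : ℕ} .{{_ : NonZero m}} (K : FiniteField (suc m)) where
    open Field K
    open FiniteField K using (Carrier; _*_; 0#; 1#; _^_)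
    open Generator generator

    double : ∀ {x i} → 2 ∣ i → g ^ i ≡ x → ∃[ y ] y * y ≡ x
    double (divides d refl) e = g ^ d , trans (sym (^-+ g d d)) (trans (cong (g ^_) (lem d)) e)
      where lem : ∀ d → d ℕ.+ d ≡ d ℕ.* 2
            lem = ℕR.solve-∀

    -- Write x = g^i; then 2h divides ih, so i is even.
    euler : ∀ {x} h → h ℕ.* 2 ≡ m → x ^ h ≡ 1# → ∃[ y ] y * y ≡ x
    euler {x} h h2≡m e = double (*-cancelˡ-∣ h {{h≢0}} (subst₂ _∣_ (sym h2≡m) (ℕP.*-comm (proj₁ l) h)
        (order (proj₁ l ℕ.* h) (trans (^-*′ g (proj₁ l) h) (trans (cong (_^ h) (proj₂ (proj₂ l))) e))))) (proj₂ (proj₂ l))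
      where
      h≢0 : NonZero h
      h≢0 = ℕ.≢-nonZero λ { refl → ℕ.≢-nonZero⁻¹ m (sym h2≡m) }
      l = log x (^≡1⇒≢0 {x} {h} {{h≢0}} e)

  module _ {r : ℕ} .{{r≢0 : NonZero r}} (2∣r : 2 ∣ r) (E : QuadExt (suc r)) (p n₀ : ℕ) (tr c : Code) (ok : lineᵇ (suc r) p n₀ tr c ≡ true) where
    open Extension E
    open QuadExt E using (F; K; ι; ι-+; ι-*; ι-1)
    open CommutativeRing EF.commutativeRing using (Carrier; _+_; _*_; -_; _-_; 0#; 1#; +-identityˡ; +-identityʳ; +-comm; *-identityˡ; *-identityʳ; *-comm; *-assoc; zeroˡ; zeroʳ)
    open FiniteField F using (_^_)
    private
      module 𝕂 = CommutativeRing EK.commutativeRing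
      module KF = FiniteField K
      module Em = Embedding K
      P : List ℕ
      P = oddPrimes q
    open Check q p n₀ tr c
    open Codes p n₀

    private
      ok₁ = ∧-true {valid r P ∧ fieldᵇ} ok
      ok₂ = ∧-true {valid r P} (proj₁ ok₁)
      ok₃ = ∧-true {generatorᵇ (2 ∷ P)} (proj₂ ok₁)
      ok₄ = ∧-true {verify logTable q (0 , 0) one} (proj₂ ok₃)
      f₁ = ∧-true {isPrimeᵇ p ∧ ((q ≡ᵇ p) ∨ (q ≡ᵇ p ℕ.* p))} (proj₂ ok₂)
      f₂ = ∧-true {isPrimeᵇ p} (proj₁ f₁)
      f₃ = ∧-true {Codes.pow p 0 30 (n₀ , 0) (quot r 2) == one} (proj₂ f₁)
      f₄ = ∧-true {isUnit q discriminant} (proj₂ f₃)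
      f₅ = ∧-true {isUnit q c} (proj₂ f₄)

      O : OddPrimeDivisors N P
      O = valid-sound r P (proj₁ ok₂)

      instance
        p≢0 : NonZero p
        p≢0 = prime⇒nonZero (isPrimeᵇ-sound p (proj₁ f₂))

      -- The size of the field annihilates 1. For q = p² this says (p·1)² = 0, and a field has no
      -- zero divisors.
      p≡0 : p EK.·1 ≡ 𝕂.0#
      p≡0 = ∨-elim (q ≡ᵇ p)
        (λ e → trans (cong EK._·1 (sym (≡ᵇ-true {q} {p} e))) EK.size·1≡0)
        (λ e → square (trans (sym (Em.·1-* p p)) (trans (cong EK._·1 (sym (≡ᵇ-true {q} {p ℕ.* p} e))) EK.size·1≡0))) (proj₂ f₂)
        where
        square : p EK.·1 𝕂.* p EK.·1 ≡ 𝕂.0# → p EK.·1 ≡ 𝕂.0#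
        square e = decide (p EK.·1 EK.≟ 𝕂.0#)
          where decide : Dec (p EK.·1 ≡ 𝕂.0#) → p EK.·1 ≡ 𝕂.0#
                decide (yes z) = z
                decide (no nz) = EK.integral e nz

      root : ∃[ δ ] δ 𝕂.* δ ≡ n₀ EK.·1
      root = SquareRoots.euler K (quot r 2) (quot-exact 2 2∣r) (trans (cong (KF._^ quot r 2) (sym base)) (trans (sym (V₀.⟪pow⟫ 30 (n₀ , 0) (quot r 2)))
          (trans (cong V₀.⟪_⟫ (==-sound (Codes.pow p 0 30 (n₀ , 0) (quot r 2)) one (proj₁ f₃))) V₀.⟪1⟫)))
        where
        module V₀ = Em.Value p 0 p≡0 {𝕂.0#} (𝕂.zeroˡ 𝕂.0#)
        base : V₀.⟪ n₀ , 0 ⟫ ≡ n₀ EK.·1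
        base = trans (cong (n₀ EK.·1 𝕂.+_) (𝕂.zeroˡ 𝕂.0#)) (𝕂.+-identityʳ _)

    open Em.Value p n₀ p≡0 (proj₂ root)

    private
      t ĉ : 𝕂.Carrier
      t = ⟪ tr ⟫
      ĉ = ⟪ c ⟫

      ĉ≢0 : ĉ ≢ 𝕂.0#
      ĉ≢0 = isUnit-≢0 {q} c (proj₁ f₅)

      2̂ : 𝕂.Carrier
      2̂ = ⟪ 2 , 0 ⟫

      2̂-double : ∀ x → 2̂ 𝕂.* x ≡ x 𝕂.+ x
      2̂-double x = trans (cong (𝕂._* x) (trans (cong₂ 𝕂._+_ (cong (𝕂.1# 𝕂.+_) (𝕂.+-identityʳ 𝕂.1#)) (𝕂.zeroˡ (proj₁ root))) (𝕂.+-identityʳ _)))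
        (trans (𝕂.distribʳ x 𝕂.1# 𝕂.1#) (cong₂ 𝕂._+_ (𝕂.*-identityˡ x) (𝕂.*-identityˡ x)))

      half : ∃[ w ] w 𝕂.+ w ≡ 𝕂.1#
      half = proj₁ inv , trans (sym (2̂-double (proj₁ inv))) (proj₂ inv)
        where inv = KF.inverse 2̂ (isUnit-≢0 {q} (2 , 0) (proj₂ f₅))

      D : 𝕂.Carrier
      D = ⟪ discriminant ⟫

      D≢0 : D ≢ 𝕂.0#
      D≢0 = isUnit-≢0 {q} discriminant (proj₁ f₄)

      D≡ : D ≡ t 𝕂.* t 𝕂.+ ((ĉ 𝕂.+ ĉ) 𝕂.+ (ĉ 𝕂.+ ĉ))
      D≡ = trans (⟪add⟫ (mul tr tr) (mul (mul (2 , 0) (2 , 0)) c)) (cong₂ 𝕂._+_ (⟪mul⟫ tr tr)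
        (trans (⟪mul⟫ (mul (2 , 0) (2 , 0)) c) (trans (cong (𝕂._* ĉ) (⟪mul⟫ (2 , 0) (2 , 0))) (trans (𝕂.*-assoc 2̂ 2̂ ĉ) (trans (2̂-double (2̂ 𝕂.* ĉ)) (cong₂ 𝕂._+_ (2̂-double ĉ) (2̂-double ĉ)))))))

      -- The logarithm of a nonzero base element is a multiple of q + 1, which is even; so every
      -- base element is a square in the extension.
      rootD : ∃[ y ] y * y ≡ ι D
      rootD = SquareRoots.double F {i = i} (∣-trans (proj₁ (even-divisors 2∣r)) (Line.base⇒∣ E D (sym gi))) gi
        where
        lD = EF.Generator.log (EF.generator {{size≢0}}) (ι D) (ι-≢0 D≢0)
        i = proj₁ lD
        gi = proj₂ (proj₂ lD)

      y w : Carrier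
      y = proj₁ rootD
      w = ι (proj₁ half)

    -- The quadratic formula for X² - tr X - c, with w = 1/2; either square root y of the
    -- discriminant serves.
    γ : Carrier
    γ = (ι t + y) * w

    private
      module EI = RingIdentities (FiniteField.isCommutativeRing F)

      w+w : w + w ≡ 1#
      w+w = trans (sym (ι-+ _ _)) (trans (cong ι (proj₂ half)) ι-1)

      ιD≡ : ι D ≡ ι t * ι t + ((ι ĉ + ι ĉ) + (ι ĉ + ι ĉ))
      ιD≡ = trans (cong ι D≡) (trans (ι-+ _ _) (cong₂ _+_ (ι-* t t) (trans (ι-+ _ _) (cong₂ _+_ (ι-+ ĉ ĉ) (ι-+ ĉ ĉ)))))

      γ² : γ * γ ≡ ι t * γ + ι ĉ
      γ² = begin
        γ * γ ≡⟨ lem (ι t) y w (ι ĉ) ⟩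
        ((w + w) * (ι t * γ) + (w + w) * (w + w) * ι ĉ) + w * w * (y * y - (ι t * ι t + ((ι ĉ + ι ĉ) + (ι ĉ + ι ĉ))))
          ≡⟨ cong₂ (λ e z → (e * (ι t * γ) + e * e * ι ĉ) + w * w * z) w+w (trans (cong₂ _-_ (proj₂ rootD) (sym ιD≡)) (EF.x-x≡0 (ι D))) ⟩
        (1# * (ι t * γ) + 1# * 1# * ι ĉ) + w * w * 0#
          ≡⟨ trans (cong₂ _+_ (cong₂ _+_ (*-identityˡ _) (trans (cong (_* ι ĉ) (*-identityˡ 1#)) (*-identityˡ _))) (zeroʳ _)) (+-identityʳ _) ⟩
        ι t * γ + ι ĉ ∎
        where
        open ≡-Reasoning
        open EI
        lem : ∀ t y w c → ((t + y) * w) * ((t + y) * w) ≡ ((w + w) * (t * ((t + y) * w)) + (w + w) * (w + w) * c) + w * w * (y * y - (t * t + ((c + c) + (c + c))))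
        lem = solve 4 (λ t y w c → ((t :+ y) :* w) :* ((t :+ y) :* w) := ((w :+ w) :* (t :* ((t :+ y) :* w)) :+ (w :+ w) :* (w :+ w) :* c) :+ w :* w :* (y :* y :- (t :* t :+ ((c :+ c) :+ (c :+ c))))) refl

      γ≢0 : γ ≢ 0#
      γ≢0 e = ι-≢0 ĉ≢0 (begin
        ι ĉ                     ≡⟨ lem (ι ĉ) (ι t * γ) ⟩
        (ι t * γ + ι ĉ) - ι t * γ ≡⟨ cong₂ _-_ (sym γ²) refl ⟩
        γ * γ - ι t * γ         ≡⟨ cong₂ _-_ (trans (cong (_* γ) e) (zeroˡ γ)) (trans (cong (ι t *_) e) (zeroʳ (ι t))) ⟩
        0# - 0#                 ≡⟨ EF.x-x≡0 0# ⟩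
        0#                      ∎)
        where open ≡-Reasoning
              open EI
              lem : ∀ c x → c ≡ (x + c) - x
              lem = solve 2 (λ c x → c := (x :+ c) :- x) refl

      -- γ^a = c u + v γ
      Coordinates : ℕ → Code → Code → Set
      Coordinates a u v = γ ^ a ≡ ι (ĉ 𝕂.* ⟪ u ⟫) + ι ⟪ v ⟫ * γ

      step : ∀ {a u v} → Coordinates a u v → Coordinates (suc a) v (add (mul tr v) (mul c u))
      step {a} {u} {v} W = begin
        γ * γ ^ a                                          ≡⟨ cong (γ *_) (trans W (cong (_+ ι ⟪ v ⟫ * γ) (ι-* ĉ ⟪ u ⟫))) ⟩
        γ * (ι ĉ * ι ⟪ u ⟫ + ι ⟪ v ⟫ * γ)                   ≡⟨ lem₁ γ (ι ĉ) (ι ⟪ u ⟫) (ι ⟪ v ⟫) ⟩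
        ι ĉ * ι ⟪ u ⟫ * γ + ι ⟪ v ⟫ * (γ * γ)               ≡⟨ cong (λ z → ι ĉ * ι ⟪ u ⟫ * γ + ι ⟪ v ⟫ * z) γ² ⟩
        ι ĉ * ι ⟪ u ⟫ * γ + ι ⟪ v ⟫ * (ι t * γ + ι ĉ)        ≡⟨ lem₂ γ (ι ĉ) (ι ⟪ u ⟫) (ι ⟪ v ⟫) (ι t) ⟩
        ι ĉ * ι ⟪ v ⟫ + (ι t * ι ⟪ v ⟫ + ι ĉ * ι ⟪ u ⟫) * γ
          ≡⟨ sym (cong₂ (λ x y → x + y * γ) (ι-* ĉ ⟪ v ⟫) (trans (cong ι (trans (⟪add⟫ (mul tr v) (mul c u)) (cong₂ 𝕂._+_ (⟪mul⟫ tr v) (⟪mul⟫ c u)))) (trans (ι-+ _ _) (cong₂ _+_ (ι-* t ⟪ v ⟫) (ι-* ĉ ⟪ u ⟫))))) ⟩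
        ι (ĉ 𝕂.* ⟪ v ⟫) + ι ⟪ add (mul tr v) (mul c u) ⟫ * γ ∎
        where
        open ≡-Reasoning
        open EI
        lem₁ : ∀ g c u v → g * (c * u + v * g) ≡ c * u * g + v * (g * g)
        lem₁ = solve 4 (λ g c u v → g :* (c :* u :+ v :* g) := c :* u :* g :+ v :* (g :* g)) refl
        lem₂ : ∀ g c u v t → c * u * g + v * (t * g + c) ≡ c * v + (t * v + c * u) * g
        lem₂ = solve 5 (λ g c u v t → c :* u :* g :+ v :* (t :* g :+ c) := c :* v :+ (t :* v :+ c :* u) :* g) refl

      start : Coordinates 1 (0 , 0) one
      start = trans (*-identityʳ γ) (sym (trans (cong₂ _+_ (trans (cong ι (trans (cong (ĉ 𝕂.*_) ⟪0⟫) (𝕂.zeroʳ ĉ))) ι-0)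
        (trans (cong (_* γ) (trans (cong ι ⟪1⟫) ι-1)) (*-identityˡ γ))) (+-identityˡ γ)))

      n̂ : 𝕂.Carrier
      n̂ = ⟪ nm ⟫

      n̂≡ : n̂ ≡ 𝕂.- ĉ
      n̂≡ = ⟪neg⟫ c

      -- Followed up to a = q + 1, the recurrence ends with v = 0 and u = -1, that is, γ^(q+1) = -c.
      final : ∀ f a u v → Coordinates a u v → verify logTable f u v ≡ true → γ ^ (f ℕ.+ a) ≡ ι n̂
      final zero a u v W e = begin
        γ ^ a                          ≡⟨ W ⟩
        ι (ĉ 𝕂.* ⟪ u ⟫) + ι ⟪ v ⟫ * γ   ≡⟨ cong₂ (λ x y → ι (ĉ 𝕂.* ⟪ x ⟫) + ι ⟪ y ⟫ * γ) (==-sound u (neg one) (proj₂ e′)) (==-sound v (0 , 0) (proj₁ e′)) ⟩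
        ι (ĉ 𝕂.* ⟪ neg one ⟫) + ι ⟪ 0 , 0 ⟫ * γ
          ≡⟨ cong₂ _+_ (cong ι (trans (cong (ĉ 𝕂.*_) (trans (⟪neg⟫ one) (cong 𝕂.-_ ⟪1⟫))) (trans (lem ĉ 𝕂.1#) (trans (cong 𝕂.-_ (𝕂.*-identityʳ ĉ)) (sym n̂≡)))))
                       (trans (cong (_* γ) (trans (cong ι ⟪0⟫) ι-0)) (zeroˡ γ)) ⟩
        ι n̂ + 0#                       ≡⟨ +-identityʳ _ ⟩
        ι n̂                            ∎
        where
        open ≡-Reasoning
        e′ = ∧-true {v == (0 , 0)} e
        lem : ∀ a b → a 𝕂.* (𝕂.- b) ≡ 𝕂.- (a 𝕂.* b)
        lem = solve 2 (λ a b → a :* (:- b) := :- (a :* b)) refl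
          where open RingIdentities (FiniteField.isCommutativeRing K)
      final (suc f) a u v W e = trans (cong (γ ^_) (sym (ℕP.+-suc f a))) (final f (suc a) v (add (mul tr v) (mul c u)) (step {a} {u} {v} W) (proj₂ (∧-true {isLog (lookup 12 (key v) logTable) v} e)))

      γ^q+1 : γ ^ q+1 ≡ ι n̂
      γ^q+1 = trans (cong (γ ^_) (ℕP.+-comm 1 q)) (final q 1 (0 , 0) one start (proj₁ ok₄))

      -- If γ were in the base field, then γ^(q-1) = 1 and γ² = γ^(q+1) = -c. With γ² = tγ + c this
      -- gives t = 2γ, so the discriminant t² + 4c would vanish.
      γ∉K : ∀ k → ι k ≢ γ
      γ∉K k e = ι-≢0 D≢0 (trans ιD≡ (trans (lem₁ γ (ι t) (ι ĉ)) (trans (cong₂ _-_ (cong₂ _*_ zero₁ zero₁) (cong₂ _+_ (cong₂ _+_ γ²′ γ²′) (cong₂ _+_ γ²′ γ²′)))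
          (trans (cong₂ _-_ (zeroˡ 0#) (trans (cong₂ _+_ (+-identityʳ 0#) (+-identityʳ 0#)) (+-identityʳ 0#))) (EF.x-x≡0 0#)))))
        where
        open EI
        k≢0 : k ≢ 𝕂.0#
        k≢0 refl = γ≢0 (trans (sym e) ι-0)
        γ^r : γ ^ r ≡ 1#
        γ^r = trans (cong (_^ r) (sym e)) (trans (sym (ι-^ k r)) (trans (cong ι (EK.fermat k≢0)) ι-1))
        γγ : γ * γ ≡ - ι ĉ
        γγ = trans (sym (trans (cong (λ z → γ * (γ * z)) γ^r) (cong (γ *_) (*-identityʳ γ)))) (trans γ^q+1 (trans (cong ι n̂≡) (ι-neg ĉ)))
        γ²′ : γ * γ - (ι t * γ + ι ĉ) ≡ 0#
        γ²′ = trans (cong (_- (ι t * γ + ι ĉ)) γ²) (EF.x-x≡0 _)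
        zero₁ : ι t - (γ + γ) ≡ 0#
        zero₁ = EF.integral (trans (lem₂ γ (ι t) (ι ĉ)) (trans (cong₂ _-_ (cong₂ _-_ (sym γ²) refl) (cong₂ _+_ γγ refl)) (lem₃ (γ * γ) (ι ĉ)))) γ≢0
          where
          lem₂ : ∀ g t c → g * (t - (g + g)) ≡ ((t * g + c) - c) - (g * g + g * g)
          lem₂ = solve 3 (λ g t c → g :* (t :- (g :+ g)) := ((t :* g :+ c) :- c) :- (g :* g :+ g :* g)) refl
          lem₃ : ∀ s c → (s - c) - (- c + s) ≡ 0#
          lem₃ s c = trans (re s c) (EF.x-x≡0 (- c))
            where re : ∀ s c → (s - c) - (- c + s) ≡ (- c) - (- c)
                  re = solve 2 (λ s c → (s :- c) :- (:- c :+ s) := (:- c) :- (:- c)) refl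
        lem₁ : ∀ g t c → t * t + ((c + c) + (c + c)) ≡ (t - (g + g)) * (t - (g + g)) - (((g * g - (t * g + c)) + (g * g - (t * g + c))) + ((g * g - (t * g + c)) + (g * g - (t * g + c))))
        lem₁ = solve 3 (λ g t c → t :* t :+ ((c :+ c) :+ (c :+ c)) := (t :- (g :+ g)) :* (t :- (g :+ g)) :- (((g :* g :- (t :* g :+ c)) :+ (g :* g :- (t :* g :+ c))) :+ ((g :* g :- (t :* g :+ c)) :+ (g :* g :- (t :* g :+ c))))) refl

      open Basis γ∉K

      n̂≢0 : n̂ ≢ 𝕂.0#
      n̂≢0 e = ĉ≢0 (trans (sym (lem ĉ)) (trans (cong 𝕂.-_ (trans (sym n̂≡) e)) (trans (sym (𝕂.+-identityˡ _)) (𝕂.-‿inverseʳ 𝕂.0#))))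
        where open RingIdentities (FiniteField.isCommutativeRing K)
              lem : ∀ a → 𝕂.- (𝕂.- a) ≡ a
              lem = solve 1 (λ a → :- (:- a) := a) refl

      isLog-sound : ∀ d v → isLog d v ≡ true → d ℕ.≤ r × n̂ KF.^ d ≡ ⟪ v ⟫
      isLog-sound d v e = ≤ᵇ-true {d} {r} (proj₁ e′) , trans (sym (⟪pow⟫ 30 nm d)) (cong ⟪_⟫ (==-sound (pow 30 nm d) v (proj₂ e′)))
        where e′ = ∧-true {d ≤ᵇ r} e

      off-base : ∀ f a u v → Coordinates a u v → verify logTable f u v ≡ true → ∀ i → i ℕ.< f →
        ∃[ x ] ∃[ y ] (γ ^ (i ℕ.+ a) ≡ ι x + ι y * γ × y ≢ 𝕂.0#)
      off-base (suc f) a u v W e zero    _         = ĉ 𝕂.* ⟪ u ⟫ , ⟪ v ⟫ , W , λ z → EK.^≢0 d n̂≢0 (trans (proj₂ (isLog-sound d v (proj₁ (∧-true {isLog d v} e)))) z)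
        where d = lookup 12 (key v) logTable
      off-base (suc f) a u v W e (suc i) (s≤s i<f) = proj₁ rest , proj₁ (proj₂ rest) , trans (cong (γ ^_) (sym (ℕP.+-suc i a))) (proj₁ (proj₂ (proj₂ rest))) , proj₂ (proj₂ (proj₂ rest))
        where rest = off-base f (suc a) v (add (mul tr v) (mul c u)) (step {a} {u} {v} W) (proj₂ (∧-true {isLog (lookup 12 (key v) logTable) v} e)) i i<f

      nonresidues : All (λ l → l ∣ r → n̂ KF.^ quot r l ≢ 𝕂.1#) (2 ∷ P)
      nonresidues = allᵇ-sound sound (2 ∷ P) (proj₁ ok₃)
        where
        sound : ∀ l → not (l ∣ᵇ r) ∨ isUnit q (add (pow 30 nm (quot r l)) (neg one)) ≡ true → l ∣ r → n̂ KF.^ quot r l ≢ 𝕂.1#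
        sound l e l∣r eq = ∨-elim (not (l ∣ᵇ r))
          (λ e′ → not-true e′ (∣⇒∣ᵇ l r {{ℕ.≢-nonZero λ { refl → ℕ.≢-nonZero⁻¹ r (0∣⇒≡0 l∣r) }}} l∣r))
          (λ e′ → isUnit-≢0 {q} (add (pow 30 nm (quot r l)) (neg one)) e′ (trans (⟪add⟫ (pow 30 nm (quot r l)) (neg one))
             (trans (cong₂ 𝕂._+_ (trans (⟪pow⟫ 30 nm (quot r l)) eq) (trans (⟪neg⟫ one) (cong 𝕂.-_ ⟪1⟫))) (𝕂.-‿inverseʳ 𝕂.1#)))) e

      -- Let d = gcd(j, r). If d ≠ r, choose a prime l dividing r/d; the power r/l of n̂ would then
      -- be 1, against the certificate for l.
      order-n̂ : ∀ j → n̂ KF.^ j ≡ 𝕂.1# → r ∣ j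
      order-n̂ j e = decide (d ℕ.≟ r)
        where
        d = gcd j r
        power-d : n̂ KF.^ d ≡ 𝕂.1#
        power-d = EK.^-gcd j r e (EK.fermat n̂≢0)
        decide : Dec (d ≡ r) → r ∣ j
        decide (yes d≡r) = subst (_∣ j) d≡r (gcd[m,n]∣m j r)
        decide (no d≢r)  = ⊥-elim (contradict (gcd[m,n]∣n j r))
          where
          contradict : ¬ d ∣ r
          contradict (divides k r≡kd) = smaller (primeDivisor k k≢1 {{ℕ.≢-nonZero λ { refl → ℕ.≢-nonZero⁻¹ r r≡kd }}})
            where
            k≢1 : k ≢ 1
            k≢1 refl = d≢r (sym (trans r≡kd (ℕP.*-identityˡ d)))
            smaller : ¬ (∃[ l ] (Prime l × l ∣ k))
            smaller (l , pl , divides k′ k≡k′l) = All.lookup nonresidues (place (l ℕ.≟ 2)) l∣r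
                (trans (cong (n̂ KF.^_) quotient≡) (trans (EK.^-* n̂ k′ d) (trans (cong (KF._^ k′) power-d) (EK.1^ k′))))
              where
              l∣r : l ∣ r
              l∣r = subst (l ∣_) (sym r≡kd) (∣m⇒∣m*n d (divides k′ k≡k′l))
              place : Dec (l ≡ 2) → l ∈ 2 ∷ P
              place (yes e₂) = here e₂
              place (no l≢2) = there (OddPrimeDivisors.complete O l pl l≢2 (∣m⇒∣m*n q+1 l∣r))
              re : ∀ a l d → a ℕ.* l ℕ.* d ≡ a ℕ.* d ℕ.* l
              re = ℕR.solve-∀
              quotient≡ : quot r l ≡ k′ ℕ.* d
              quotient≡ = ℕP.*-cancelʳ-≡ (quot r l) (k′ ℕ.* d) l {{prime⇒nonZero pl}}
                (trans (quot-exact l l∣r) (trans r≡kd (trans (cong (ℕ._* d) k≡k′l) (re k′ l d))))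

      γ^-split : ∀ a j → γ ^ (a ℕ.+ j ℕ.* q+1) ≡ γ ^ a * ι (n̂ KF.^ j)
      γ^-split a j = trans (EF.^-+ γ a (j ℕ.* q+1)) (cong (γ ^ a *_) (trans (EF.^-* γ j q+1) (trans (cong (_^ j) γ^q+1) (sym (ι-^ n̂ j)))))

      -- Split i = a + j(q + 1) with 0 ≤ a ≤ q. For a > 0 the power γ^a has a nonzero γ-coordinate
      -- and multiplication by a base element cannot remove it; for a = 0 the claim is about the
      -- order of γ^(q+1).
      order-γ : ∀ i → γ ^ i ≡ 1# → r ℕ.+ r ℕ.* q ∣ i
      order-γ i e = subst (_∣ i) N-size (cases (i ℕ.% q+1) refl)
        where
        j = i ℕ./ q+1
        split : ∀ a → i ℕ.% q+1 ≡ a → γ ^ a * ι (n̂ KF.^ j) ≡ 1#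
        split a e₁ = trans (sym (γ^-split a j)) (trans (cong (γ ^_) (sym (trans (m≡m%n+[m/n]*n i q+1) (cong (ℕ._+ j ℕ.* q+1) e₁)))) e)
        cases : ∀ a → i ℕ.% q+1 ≡ a → N ∣ i
        cases zero e₁ = subst (N ∣_) (sym (trans (m≡m%n+[m/n]*n i q+1) (cong (ℕ._+ j ℕ.* q+1) e₁))) (*-monoˡ-∣ q+1 (order-n̂ j
          (ι-injective (trans (sym (*-identityˡ _)) (trans (split 0 e₁) (sym ι-1))))))
        cases (suc a) e₁ = ⊥-elim (contradict (off-base q 1 (0 , 0) one start (proj₁ ok₄) a (ℕP.≤-pred (subst (ℕ._< q+1) e₁ (m%n<n i q+1)))))
          where
          contradict : ¬ (∃[ x ] ∃[ y ] (γ ^ (a ℕ.+ 1) ≡ ι x + ι y * γ × y ≢ 𝕂.0#))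
          contradict (x , y , eq , y≢0) = EK.*≢0 y≢0 (EK.^≢0 j n̂≢0) (proj₂ (basis-unique {x 𝕂.* n̂ KF.^ j} {y 𝕂.* n̂ KF.^ j} {𝕂.1#} {𝕂.0#} (begin
            ι (x 𝕂.* n̂ KF.^ j) + ι (y 𝕂.* n̂ KF.^ j) * γ   ≡⟨ cong₂ (λ u v → u + v * γ) (ι-* x _) (ι-* y _) ⟩
            ι x * ι (n̂ KF.^ j) + ι y * ι (n̂ KF.^ j) * γ   ≡⟨ lem (ι x) (ι y) (ι (n̂ KF.^ j)) γ ⟩
            (ι x + ι y * γ) * ι (n̂ KF.^ j)                ≡⟨ cong (_* ι (n̂ KF.^ j)) (trans (sym eq) (cong (γ ^_) (ℕP.+-comm a 1))) ⟩
            γ ^ suc a * ι (n̂ KF.^ j)                      ≡⟨ split (suc a) e₁ ⟩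
            1#                                            ≡⟨ sym (trans (cong₂ _+_ ι-1 (trans (cong (_* γ) ι-0) (zeroˡ γ))) (+-identityʳ 1#)) ⟩
            ι 𝕂.1# + ι 𝕂.0# * γ                           ∎)))
            where open ≡-Reasoning
                  open EI
                  lem : ∀ x y n g → x * n + y * n * g ≡ (x + y * g) * n
                  lem = solve 4 (λ x y n g → x :* n :+ y :* n :* g := (x :+ y :* g) :* n) refl

      OnLine : ℕ → Set
      OnLine e = ∃[ k ] γ + ι k ≡ γ ^ e

      logs-onLine : ∀ f a u v → Coordinates a u v → verify logTable f u v ≡ true → All OnLine (logs logTable f a u v)
      logs-onLine zero    a u v W e = []
      logs-onLine (suc f) a u v W e = (ĉ 𝕂.* ⟪ u ⟫ 𝕂.* z , sym point) ∷
          logs-onLine f (suc a) v (add (mul tr v) (mul c u)) (step {a} {u} {v} W) (proj₂ e′)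
        where
        open ≡-Reasoning
        open EI
        d = lookup 12 (key v) logTable
        e′ = ∧-true {isLog d v} e
        d≤r = proj₁ (isLog-sound d v (proj₁ e′))
        z = n̂ KF.^ (r ℕ.∸ d)
        vz≡1 : ⟪ v ⟫ 𝕂.* z ≡ 𝕂.1#
        vz≡1 = trans (cong (𝕂._* z) (sym (proj₂ (isLog-sound d v (proj₁ e′))))) (trans (sym (EK.^-+ n̂ d (r ℕ.∸ d))) (trans (cong (n̂ KF.^_) (ℕP.m+[n∸m]≡n d≤r)) (EK.fermat n̂≢0)))
        lem : ∀ x v g z → (x + v * g) * z ≡ v * z * g + x * z
        lem = solve 4 (λ x v g z → (x :+ v :* g) :* z := v :* z :* g :+ x :* z) refl
        point : γ ^ (a ℕ.+ q+1 ℕ.* (r ℕ.∸ d)) ≡ γ + ι (ĉ 𝕂.* ⟪ u ⟫ 𝕂.* z)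
        point = begin
          γ ^ (a ℕ.+ q+1 ℕ.* (r ℕ.∸ d))           ≡⟨ cong (λ k → γ ^ (a ℕ.+ k)) (ℕP.*-comm q+1 (r ℕ.∸ d)) ⟩
          γ ^ (a ℕ.+ (r ℕ.∸ d) ℕ.* q+1)           ≡⟨ γ^-split a (r ℕ.∸ d) ⟩
          γ ^ a * ι z                             ≡⟨ cong (_* ι z) W ⟩
          (ι (ĉ 𝕂.* ⟪ u ⟫) + ι ⟪ v ⟫ * γ) * ι z    ≡⟨ lem (ι (ĉ 𝕂.* ⟪ u ⟫)) (ι ⟪ v ⟫) γ (ι z) ⟩
          ι ⟪ v ⟫ * ι z * γ + ι (ĉ 𝕂.* ⟪ u ⟫) * ι z ≡⟨ cong₂ (λ x y → x * γ + y) (trans (sym (ι-* ⟪ v ⟫ z)) (trans (cong ι vz≡1) ι-1)) (sym (ι-* (ĉ 𝕂.* ⟪ u ⟫) z)) ⟩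
          1# * γ + ι (ĉ 𝕂.* ⟪ u ⟫ 𝕂.* z)           ≡⟨ cong (_+ ι (ĉ 𝕂.* ⟪ u ⟫ 𝕂.* z)) (*-identityˡ γ) ⟩
          γ + ι (ĉ 𝕂.* ⟪ u ⟫ 𝕂.* z)                ∎

      logList : List ℕ
      logList = logs logTable q 1 (0 , 0) one

    -- every affine line not through 0 is β(γ + K) for some β = γ^b
    line-from-check : LineProperty2 E
    line-from-check α θ α≢0 θ∉K = x , two-primitive E γ≢0 order-γ (∣-trans (divides 2 refl) (proj₂ (even-divisors 2∣r))) (e ℕ.+ b) product
        (proj₁ (proj₂ (proj₂ covered))) (proj₁ (proj₂ (proj₂ (proj₂ covered))))
        (λ l pl l≢2 l∣N → All.lookup (proj₂ (proj₂ (proj₂ (proj₂ covered)))) (OddPrimeDivisors.complete O l pl l≢2 l∣N))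
      where
      open ≡-Reasoning
      open EI
      coords = coordinates θ
      a₀ = proj₁ coords
      b₀ = proj₁ (proj₂ coords)
      θ≡ = proj₂ (proj₂ coords)
      b₀≢0 : b₀ ≢ 𝕂.0#
      b₀≢0 z = θ∉K a₀ (sym (trans θ≡ (trans (cong (ι a₀ +_) (trans (cong (_* γ) (trans (cong ι z) ι-0)) (zeroˡ γ))) (+-identityʳ _))))
      β≢0 : α * ι b₀ ≢ 0#
      β≢0 = EF.*≢0 α≢0 (ι-≢0 b₀≢0)
      logβ = EF.exhaust γ≢0 order-γ {{size≢0}} (α * ι b₀) β≢0
      b = proj₁ logβ
      covered = coversAll-sound P logList (All.map prime⇒nonZero (OddPrimeDivisors.primes O)) (proj₂ ok₄) b
      e = proj₁ covered
      onLine : OnLine e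
      onLine = All.lookup (logs-onLine q 1 (0 , 0) one start (proj₁ ok₄)) (proj₁ (proj₂ covered))
      k = proj₁ onLine
      x : 𝕂.Carrier
      -- Since θ = a₀ + b₀γ, this x makes θ + x equal to b₀(γ + k).
      x = (b₀ 𝕂.* k) 𝕂.- a₀
      lem₁ : ∀ a b g k → (a + b * g) + (b * k - a) ≡ b * (g + k)
      lem₁ = solve 4 (λ a b g k → (a :+ b :* g) :+ (b :* k :- a) := b :* (g :+ k)) refl
      product : γ ^ (e ℕ.+ b) ≡ α * (θ + ι x)
      product = sym (begin
        α * (θ + ι x)                              ≡⟨ cong₂ (λ u v → α * (u + v)) θ≡ (trans (ι-- _ a₀) (cong (_- ι a₀) (ι-* b₀ k))) ⟩
        α * ((ι a₀ + ι b₀ * γ) + (ι b₀ * ι k - ι a₀)) ≡⟨ cong (α *_) (lem₁ (ι a₀) (ι b₀) γ (ι k)) ⟩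
        α * (ι b₀ * (γ + ι k))                     ≡⟨ sym (*-assoc α (ι b₀) (γ + ι k)) ⟩
        α * ι b₀ * (γ + ι k)                       ≡⟨ cong₂ _*_ (sym (proj₂ (proj₂ logβ))) (proj₂ onLine) ⟩
        γ ^ b * γ ^ e                              ≡⟨ sym (EF.^-+ γ b e) ⟩
        γ ^ (b ℕ.+ e)                              ≡⟨ cong (γ ^_) (ℕP.+-comm b e) ⟩
        γ ^ (e ℕ.+ b)                              ∎)

-- An explicit model for q = 41 in which a line fails

module Order41 where

  open import Level using (0ℓ)
  open import Data.Nat as ℕ using (ℕ; zero; suc; _%_)
  import Data.Nat.Properties as ℕP
  open import Data.Nat.DivMod using (m%n<n; %-distribˡ-+; %-distribˡ-*; m<n⇒m%n≡m; n%n≡0)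
  open import Data.Bool using (true)
  open import Data.List using (List; []; _∷_)
  open import Data.List.Relation.Unary.All as All using (All; []; _∷_)
  open import Data.List.Relation.Unary.Any as Any using (Any; here; there)
  open import Data.Fin as Fin using (Fin; toℕ; fromℕ<)
  import Data.Fin.Properties as FinP
  open import Data.Product using (_×_; _,_; proj₁; proj₂; ∃-syntax)
  import Data.Product.Properties as ProductP
  open import Data.Sum using (_⊎_; inj₁; inj₂)
  open import Data.Unit using (tt)
  open import Data.Empty using (⊥-elim)
  import Function
  open import Function.Construct.Identity using (↔-id)
  open import Function.Construct.Symmetry using (↔-sym)
  open import Relation.Nullary using (¬_; Dec; does; yes)
  open import Relation.Binary.Definitions using (DecidableEquality)
  open import Relation.Nullary.Decidable using (_⊎-dec_; _×-dec_; ¬?; toWitness)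
  open import Relation.Binary.PropositionalEquality
  open import Algebra.Structures using (IsCommutativeRing)
  open import Algebra.Bundles using (CommutativeRing)
  open IntegerCoefficients using (module RingIdentities)
  open FiniteFields using (module Powers)

  module Residues (m : ℕ) where
    n : ℕ
    n = suc m

    red : ℕ → Fin n
    red k = fromℕ< (m%n<n k n)

    toℕ-red : ∀ k → toℕ (red k) ≡ k % n
    toℕ-red k = FinP.toℕ-fromℕ< (m%n<n k n)

    red-cong : ∀ k l → k % n ≡ l % n → red k ≡ red l
    red-cong k l e = FinP.toℕ-injective (trans (toℕ-red k) (trans e (sym (toℕ-red l))))

    red-toℕ : ∀ x → red (toℕ x) ≡ x
    red-toℕ x = FinP.toℕ-injective (trans (toℕ-red (toℕ x)) (m<n⇒m%n≡m (FinP.toℕ<n x)))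

    infixl 6 _⊕_
    infixl 7 _⊗_
    _⊕_ _⊗_ : Fin n → Fin n → Fin n
    x ⊕ y = red (toℕ x ℕ.+ toℕ y)
    x ⊗ y = red (toℕ x ℕ.* toℕ y)

    ⊖_ : Fin n → Fin n
    ⊖ x = red (n ℕ.∸ toℕ x)

    red-+ : ∀ k l → red k ⊕ red l ≡ red (k ℕ.+ l)
    red-+ k l = red-cong (toℕ (red k) ℕ.+ toℕ (red l)) (k ℕ.+ l) (trans (cong₂ (λ a b → (a ℕ.+ b) % n) (toℕ-red k) (toℕ-red l)) (sym (%-distribˡ-+ k l n)))

    red-* : ∀ k l → red k ⊗ red l ≡ red (k ℕ.* l)
    red-* k l = red-cong (toℕ (red k) ℕ.* toℕ (red l)) (k ℕ.* l) (trans (cong₂ (λ a b → (a ℕ.* b) % n) (toℕ-red k) (toℕ-red l)) (sym (%-distribˡ-* k l n)))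

    private
      -- A reduction in the right argument can be postponed; with this and its multiplicative
      -- analogue the ring laws are inherited from ℕ.
      _⊕′_ : ∀ x l → x ⊕ red l ≡ red (toℕ x ℕ.+ l)
      x ⊕′ l = trans (cong (_⊕ red l) (sym (red-toℕ x))) (red-+ (toℕ x) l)
      _⊗′_ : ∀ x l → x ⊗ red l ≡ red (toℕ x ℕ.* l)
      x ⊗′ l = trans (cong (_⊗ red l) (sym (red-toℕ x))) (red-* (toℕ x) l)

    ⊕-comm : ∀ x y → x ⊕ y ≡ y ⊕ x
    ⊕-comm x y = cong red (ℕP.+-comm (toℕ x) (toℕ y))

    ⊗-comm : ∀ x y → x ⊗ y ≡ y ⊗ x
    ⊗-comm x y = cong red (ℕP.*-comm (toℕ x) (toℕ y))

    ⊕-assoc : ∀ x y z → (x ⊕ y) ⊕ z ≡ x ⊕ (y ⊕ z)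
    ⊕-assoc x y z = trans (⊕-comm (x ⊕ y) z) (trans (z ⊕′ (toℕ x ℕ.+ toℕ y)) (trans
      (cong red (trans (ℕP.+-comm (toℕ z) _) (ℕP.+-assoc (toℕ x) (toℕ y) (toℕ z)))) (sym (x ⊕′ (toℕ y ℕ.+ toℕ z)))))

    ⊗-assoc : ∀ x y z → (x ⊗ y) ⊗ z ≡ x ⊗ (y ⊗ z)
    ⊗-assoc x y z = trans (⊗-comm (x ⊗ y) z) (trans (z ⊗′ (toℕ x ℕ.* toℕ y)) (trans
      (cong red (trans (ℕP.*-comm (toℕ z) _) (ℕP.*-assoc (toℕ x) (toℕ y) (toℕ z)))) (sym (x ⊗′ (toℕ y ℕ.* toℕ z)))))

    ⊗-distribˡ : ∀ x y z → x ⊗ (y ⊕ z) ≡ x ⊗ y ⊕ x ⊗ z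
    ⊗-distribˡ x y z = trans (x ⊗′ (toℕ y ℕ.+ toℕ z)) (trans (cong red (ℕP.*-distribˡ-+ (toℕ x) (toℕ y) (toℕ z))) (sym (red-+ (toℕ x ℕ.* toℕ y) (toℕ x ℕ.* toℕ z))))

    ⊕-identityˡ : ∀ x → red 0 ⊕ x ≡ x
    ⊕-identityˡ x = trans (⊕-comm (red 0) x) (trans (x ⊕′ 0) (trans (cong red (ℕP.+-identityʳ (toℕ x))) (red-toℕ x)))

    ⊗-identityˡ : ∀ x → red 1 ⊗ x ≡ x
    ⊗-identityˡ x = trans (⊗-comm (red 1) x) (trans (x ⊗′ 1) (trans (cong red (ℕP.*-identityʳ (toℕ x))) (red-toℕ x)))

    ⊖-inverseʳ : ∀ x → x ⊕ ⊖ x ≡ red 0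
    ⊖-inverseʳ x = trans (x ⊕′ (n ℕ.∸ toℕ x)) (red-cong (toℕ x ℕ.+ (n ℕ.∸ toℕ x)) 0 (trans (cong (_% n) (ℕP.m+[n∸m]≡n (ℕP.<⇒≤ (FinP.toℕ<n x)))) (n%n≡0 n)))

  commutativeRing : ∀ {A : Set} {_+_ _*_ : A → A → A} {neg : A → A} {0# 1# : A} →
    (∀ x y z → (x + y) + z ≡ x + (y + z)) → (∀ x y → x + y ≡ y + x) → (∀ x → 0# + x ≡ x) → (∀ x → x + neg x ≡ 0#) →
    (∀ x y z → (x * y) * z ≡ x * (y * z)) → (∀ x y → x * y ≡ y * x) → (∀ x → 1# * x ≡ x) →
    (∀ x y z → x * (y + z) ≡ (x * y) + (x * z)) → IsCommutativeRing _≡_ _+_ _*_ neg 0# 1#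
  commutativeRing {_} {_+_} {_*_} {neg} {0#} {1#} +-assoc +-comm +-idˡ -‿invʳ *-assoc *-comm *-idˡ distribˡ = record
    { isRing = record
      { +-isAbelianGroup = record
        { isGroup = record
          { isMonoid = record
            { isSemigroup = record { isMagma = record { isEquivalence = isEquivalence ; ∙-cong = cong₂ _+_ } ; assoc = +-assoc }
            ; identity = +-idˡ , λ x → trans (+-comm x 0#) (+-idˡ x) }
          ; inverse = (λ x → trans (+-comm (neg x) x) (-‿invʳ x)) , -‿invʳ
          ; ⁻¹-cong = cong neg }
        ; comm = +-comm }
      ; *-cong = cong₂ _*_
      ; *-assoc = *-assoc
      ; *-identity = *-idˡ , λ x → trans (*-comm x 1#) (*-idˡ x)
      ; distrib = distribˡ , λ x y z → trans (*-comm (y + z) x) (trans (distribˡ x y z) (cong₂ _+_ (*-comm x y) (*-comm x z))) }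
    ; *-comm = *-comm }

  residueRing : ∀ m → let open Residues m in IsCommutativeRing _≡_ _⊕_ _⊗_ ⊖_ (red 0) (red 1)
  residueRing m = commutativeRing ⊕-assoc ⊕-comm ⊕-identityˡ ⊖-inverseʳ ⊗-assoc ⊗-comm ⊗-identityˡ ⊗-distribˡ
    where open Residues m

  module AdjoinRoot {A : Set} {_⊕_ _⊗_ : A → A → A} {⊖_ : A → A} {o e : A}
                    (ringA : IsCommutativeRing _≡_ _⊕_ _⊗_ ⊖_ o e) (d : A) where
    private
      R : CommutativeRing 0ℓ 0ℓ
      R = record { isCommutativeRing = ringA }
    open CommutativeRing R using (_+_; _*_; -_; 0#; 1#; +-assoc; +-comm; +-identityˡ; +-identityʳ; -‿inverseʳ; *-identityˡ; zeroˡ; zeroʳ)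
    open RingIdentities ringA

    infixl 6 _⊞_
    infixl 7 _⊠_
    _⊞_ _⊠_ : A × A → A × A → A × A
    (a , b) ⊞ (c , f) = a + c , b + f
    (a , b) ⊠ (c , f) = a * c + d * (b * f) , a * f + b * c

    ⊟_ : A × A → A × A
    ⊟ (a , b) = - a , - b

    isCommutativeRing : IsCommutativeRing _≡_ _⊞_ _⊠_ ⊟_ (0# , 0#) (1# , 0#)
    isCommutativeRing = commutativeRing
      (λ { (a , b) (c , f) (g , h) → cong₂ _,_ (+-assoc a c g) (+-assoc b f h) })
      (λ { (a , b) (c , f) → cong₂ _,_ (+-comm a c) (+-comm b f) })
      (λ { (a , b) → cong₂ _,_ (+-identityˡ a) (+-identityˡ b) })
      (λ { (a , b) → cong₂ _,_ (-‿inverseʳ a) (-‿inverseʳ b) })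
      (λ { (a , b) (c , f) (g , h) → cong₂ _,_
        (solve 7 (λ a b c f g h d → (a :* c :+ d :* (b :* f)) :* g :+ d :* ((a :* f :+ b :* c) :* h) := a :* (c :* g :+ d :* (f :* h)) :+ d :* (b :* (c :* h :+ f :* g))) refl a b c f g h d)
        (solve 7 (λ a b c f g h d → (a :* c :+ d :* (b :* f)) :* h :+ (a :* f :+ b :* c) :* g := a :* (c :* h :+ f :* g) :+ b :* (c :* g :+ d :* (f :* h))) refl a b c f g h d) })
      (λ { (a , b) (c , f) → cong₂ _,_
        (solve 5 (λ a b c f d → a :* c :+ d :* (b :* f) := c :* a :+ d :* (f :* b)) refl a b c f d)
        (solve 4 (λ a b c f → a :* f :+ b :* c := c :* b :+ f :* a) refl a b c f) })
      (λ { (a , b) → cong₂ _,_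
        (trans (cong₂ _+_ (*-identityˡ a) (trans (cong (d *_) (zeroˡ b)) (zeroʳ d))) (+-identityʳ a))
        (trans (cong₂ _+_ (*-identityˡ b) (zeroˡ a)) (+-identityʳ b)) })
      (λ { (a , b) (c , f) (g , h) → cong₂ _,_
        (solve 7 (λ a b c f g h d → a :* (c :+ g) :+ d :* (b :* (f :+ h)) := (a :* c :+ d :* (b :* f)) :+ (a :* g :+ d :* (b :* h))) refl a b c f g h d)
        (solve 6 (λ a b c f g h → a :* (f :+ h) :+ b :* (c :+ g) := (a :* f :+ b :* c) :+ (a :* h :+ b :* g)) refl a b c f g h) })

  module FailureTest {q : ℕ} (E : QuadExt q) where
    open QuadExt E
    open Powers F using (^-*)

    -- an element of order a * b satisfies none of these, if 0 < j * k < a * b for each of the listed pairs (j , k)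
    LowerOrder : ℕ → ℕ → List (ℕ × ℕ) → Carrier → Set
    LowerOrder a b pairs z = (z ^ b) ^ a ≢ 1# ⊎ Any (λ (j , k) → (z ^ k) ^ j ≡ 1#) pairs

    lowerOrder? : DecidableEquality Carrier → ∀ a b pairs z → Dec (LowerOrder a b pairs z)
    lowerOrder? _≟_ a b pairs z = ¬? (((z ^ b) ^ a) ≟ 1#) ⊎-dec Any.any? (λ (j , k) → ((z ^ k) ^ j) ≟ 1#) pairs

    lowerOrder⇒¬order : ∀ {z n} a b pairs → a ℕ.* b ≡ n → All (λ (j , k) → 0 ℕ.< j ℕ.* k × j ℕ.* k ℕ.< n) pairs →
      LowerOrder a b pairs z → ¬ HasOrder z n
    lowerOrder⇒¬order {z} {n} a b _ ab≡n _ (inj₁ ne) (_ , e , _) = ne (trans (sym (^-* z a b)) (trans (cong (z ^_) ab≡n) e))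
    lowerOrder⇒¬order {z} {n} _ _ _ _ bounds (inj₂ any) (_ , _ , minimal) = go bounds any
      where
      go : ∀ {pairs} → All (λ (j , k) → 0 ℕ.< j ℕ.* k × j ℕ.* k ℕ.< n) pairs → ¬ Any (λ (j , k) → (z ^ k) ^ j ≡ 1#) pairs
      go {(j , k) ∷ _} ((pos , small) ∷ _) (here e)  = minimal (j ℕ.* k) pos small (trans (^-* z j k) e)
      go (_ ∷ bounds) (there any) = go bounds any

    LowerOrders : ℕ → ℕ → List (ℕ × ℕ) → Carrier → Carrier → Set
    LowerOrders a b pairs α θ = ∀ x → LowerOrder a b pairs (α * (θ + ι x))

    lowerOrders? : DecidableEquality Carrier → (∀ {P : Kcar → Set} → (∀ x → Dec (P x)) → Dec (∀ x → P x)) →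
      ∀ a b pairs α θ → Dec (LowerOrders a b pairs α θ)
    lowerOrders? _≟_ all? a b pairs α θ = all? λ x → lowerOrder? _≟_ a b pairs (α * (θ + ι x))

    -- The search enters only through its Boolean outcome, so that powers of a generic point are never compared.
    search⇒¬lineProperty : ∀ _≟_ (all? : ∀ {P : Kcar → Set} → (∀ x → Dec (P x)) → Dec (∀ x → P x)) a b pairs {α θ} →
      a ℕ.* b ≡ (q ℕ.* q ℕ.∸ 1) ℕ./ 2 → All (λ (j , k) → 0 ℕ.< j ℕ.* k × j ℕ.* k ℕ.< (q ℕ.* q ℕ.∸ 1) ℕ./ 2) pairs →
      α ≢ 0# → NotInBase θ → does (lowerOrders? _≟_ all? a b pairs α θ) ≡ true → ¬ LineProperty2 E
    search⇒¬lineProperty _≟_ all? a b pairs {α} {θ} ab bounds α≢0 θ∉K found property =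
      lowerOrder⇒¬order a b pairs ab bounds (lower (lowerOrders? _≟_ all? a b pairs α θ) found) (proj₂ (proj₂ line))
      where
      line = property α θ α≢0 θ∉K
      lower : (d : Dec (LowerOrders a b pairs α θ)) → does d ≡ true → LowerOrder a b pairs (α * (θ + ι (proj₁ line)))
      lower (yes p) _ = p (proj₁ line)

  open Residues 40

  F₄₁ : Set
  F₄₁ = Fin 41

  ring₄₁ : CommutativeRing 0ℓ 0ℓ
  ring₄₁ = record { isCommutativeRing = residueRing 40 }

  power : ℕ → F₄₁ → F₄₁
  power zero    x = red 1
  power (suc k) x = x ⊗ power k x

  K₄₁ : FiniteField 41
  K₄₁ = record
    { Carrier = F₄₁ ; _+_ = _⊕_ ; _*_ = _⊗_ ; -_ = ⊖_ ; 0# = red 0 ; 1# = red 1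
    ; isCommutativeRing = residueRing 40
    ; 0≢1 = λ ()
    ; inverse = λ x x≢0 → power 39 x , [ (λ e → ⊥-elim (x≢0 e)) , (λ e → e) ]′ (units x)
    ; enum = ↔-id F₄₁ }
    where
    open Data.Sum using ([_,_]′)
    units : ∀ x → x ≡ red 0 ⊎ x ⊗ power 39 x ≡ red 1
    units = toWitness {a? = FinP.all? λ x → (x FinP.≟ red 0) ⊎-dec ((x ⊗ power 39 x) FinP.≟ red 1)} tt

  -- 3 is not a square modulo 41
  open AdjoinRoot (residueRing 40) (red 3)

  _≟₂_ : (x y : F₄₁ × F₄₁) → Dec (x ≡ y)
  _≟₂_ = ProductP.≡-dec FinP._≟_ FinP._≟_

  normForm : F₄₁ → F₄₁ → F₄₁
  normForm a b = a ⊗ a ⊕ ⊖ (red 3 ⊗ (b ⊗ b))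

  anisotropic : ∀ a b → (a , b) ≡ (red 0 , red 0) ⊎ normForm a b ≢ red 0
  anisotropic = toWitness {a? = FinP.all? λ a → FinP.all? λ b → ((a , b) ≟₂ (red 0 , red 0)) ⊎-dec ¬? (normForm a b FinP.≟ red 0)} tt

  -- The conjugate (a, -b) divided by the norm form a² - 3b².
  reciprocal : ∀ {a b} → normForm a b ≢ red 0 → ∃[ y ] (a , b) ⊠ y ≡ (red 1 , red 0)
  reciprocal {a} {b} n≢0 = (a ⊗ w , ⊖ b ⊗ w) , cong₂ _,_
    (trans (solve 4 (λ a b w d → a :* (a :* w) :+ d :* (b :* (:- b :* w)) := (a :* a :+ :- (d :* (b :* b))) :* w) refl a b w (red 3)) (proj₂ inv))
    (trans (solve 3 (λ a b w → a :* (:- b :* w) :+ b :* (a :* w) := (a :+ :- a) :* (b :* w)) refl a b w) (trans (cong (_⊗ (b ⊗ w)) (⊖-inverseʳ a)) (CommutativeRing.zeroˡ ring₄₁ (b ⊗ w))))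
    where
    open RingIdentities (residueRing 40)
    inv = FiniteField.inverse K₄₁ (normForm a b) n≢0
    w = proj₁ inv

  F₁₆₈₁ : FiniteField (41 ℕ.* 41)
  F₁₆₈₁ = record
    { Carrier = F₄₁ × F₄₁ ; _+_ = _⊞_ ; _*_ = _⊠_ ; -_ = ⊟_ ; 0# = red 0 , red 0 ; 1# = red 1 , red 0
    ; isCommutativeRing = isCommutativeRing
    ; 0≢1 = λ ()
    ; inverse = λ { (a , b) x≢0 → reciprocal {a} {b} ([ (λ e → ⊥-elim (x≢0 e)) , (λ e → e) ]′ (anisotropic a b)) }
    ; enum = ↔-sym (FinP.*↔× {41} {41}) }
    where open Data.Sum using ([_,_]′)

  E₄₁ : QuadExt 41
  E₄₁ = record
    { F = F₁₆₈₁ ; K = K₄₁ ; ι = λ a → a , red 0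
    ; ι-+ = λ x y → refl
    ; ι-* = λ x y → cong₂ _,_ (sym (trans (⊕-comm (x ⊗ y) _) (⊕-identityˡ (x ⊗ y)))) (sym (trans (cong₂ _⊕_ (⊗-comm x (red 0)) refl) refl))
    ; ι-1 = refl }

  -- The products are 840/7, 840/5, 840/3 and 840/2, the maximal proper divisors of 840. They are
  -- factored because powers are computed by repeated multiplication, and a power of a power is
  -- shorter.
  pairs : List (ℕ × ℕ)
  pairs = (10 , 12) ∷ (12 , 14) ∷ (14 , 20) ∷ (20 , 21) ∷ []

  small : All (λ (j , k) → 0 ℕ.< j ℕ.* k × j ℕ.* k ℕ.< 840) pairs
  small = toWitness {a? = All.all? (λ (j , k) → (0 ℕ.<? j ℕ.* k) ×-dec (j ℕ.* k ℕ.<? 840)) pairs} tt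

  -- The property is asserted of all models, so one line in one model refutes it. Here 28·30 = 840 =
  -- (41² - 1)/2, and θ = (0, 1) is a square root of 3.
  ¬lineProperty41 : ¬ HasLineProperty2 41
  ¬lineProperty41 property = FailureTest.search⇒¬lineProperty E₄₁ _≟₂_ FinP.all? 28 30 pairs {red 3 , red 0} {red 0 , red 1}
    refl small (λ ()) (λ x ()) refl (property E₄₁)

-- Assembly: criteria, certificates and the exceptional orders

module Main where

  open import Data.Nat as ℕ using (ℕ; zero; suc; NonZero; _<_; _≤_; s≤s; z≤n; >-nonZero)
  import Data.Nat.Properties as ℕP
  open import Data.Nat.Properties using (≮⇒≥)
  open import Data.Nat.Divisibility using (_∣_; divides; ∣-trans; m∣m*n)
  open import Data.Nat.DivMod using (m≡m%n+[m/n]*n)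
  open import Data.Nat.Primality using (Prime; prime?; prime⇒nonTrivial)
  open import Data.Bool using (true)
  open import Data.List using (List; []; _∷_)
  open import Data.List.Relation.Unary.All as All using (All; []; _∷_)
  open import Data.List.Membership.Propositional using (_∈_)
  open import Data.Product using (_×_; _,_; ∃-syntax)
  open import Data.Sum using (_⊎_; inj₁; inj₂)
  open import Data.Empty using (⊥-elim)
  open import Data.Unit using (tt)
  open import Relation.Nullary using (¬_)
  open import Relation.Nullary.Decidable using (toWitness)
  open import Relation.Binary.PropositionalEquality
  open Lines
  open LinePoints
  open Criteria using (Hit)
  open SmallOrders using (exceptional; excluded; trichotomy)
  open ConcreteCheck using (lineᵇ)
  open ConcreteLine using (line-from-check)
  open Order41 using (¬lineProperty41)

  hit⇒lineProperty : ∀ {r} .{{_ : NonZero r}} → 2 ∣ r → Hit r → (E : QuadExt (suc r)) → LineProperty2 E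
  hit⇒lineProperty {r} 2∣r hit E α θ α≢0 θ∉K = conclude (hit (lineLogs α≢0 θ∉K))
    where
    open Line E
    open QuadExt E using (TwoPrimitive; ι; _+_; _*_)
    conclude : ∃[ i ] (i < suc r × 2 ∣ T α≢0 θ∉K i × ¬ 4 ∣ T α≢0 θ∉K i × (∀ p → Prime p → p ≢ 2 → p ∣ r ℕ.* suc (suc r) → ¬ p ∣ T α≢0 θ∉K i)) →
      ∃[ x ] TwoPrimitive (α * (θ + ι x))
    conclude (i , _ , even , 4∤ , odd) = point i , two-primitive E g≢0 order (∣-trans 2∣r (m∣m*n (suc (suc r)))) (T α≢0 θ∉K i) (g^T α≢0 θ∉K i) even 4∤ odd

  Certified : ℕ → Set
  Certified q = ∃[ p ] ∃[ n₀ ] ∃[ tr ] ∃[ c ] lineᵇ q p n₀ tr c ≡ true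

  abstract
    -- Each entry lists p, n₀ and the coefficients tr, c of X² - tr X - c, a primitive polynomial
    -- over the field of size q. Only for q = 25, 49, 121 and 169 is δ present, in c.
    certificates : All Certified exceptional
    certificates =
      (17 , 1 , (4 , 0) , (3 , 0) , refl) ∷
      (19 , 1 , (4 , 0) , (4 , 0) , refl) ∷
      (5 , 2 , (2 , 0) , (2 , 1) , refl) ∷
      (29 , 1 , (2 , 0) , (2 , 0) , refl) ∷
      (37 , 1 , (3 , 0) , (2 , 0) , refl) ∷
      (43 , 1 , (1 , 0) , (9 , 0) , refl) ∷
      (7 , 3 , (1 , 0) , (1 , 1) , refl) ∷
      (61 , 1 , (3 , 0) , (2 , 0) , refl) ∷
      (71 , 1 , (3 , 0) , (2 , 0) , refl) ∷
      (79 , 1 , (2 , 0) , (2 , 0) , refl) ∷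
      (89 , 1 , (5 , 0) , (3 , 0) , refl) ∷
      (97 , 1 , (3 , 0) , (5 , 0) , refl) ∷
      (101 , 1 , (6 , 0) , (2 , 0) , refl) ∷
      (109 , 1 , (3 , 0) , (6 , 0) , refl) ∷
      (11 , 2 , (2 , 0) , (2 , 1) , refl) ∷
      (131 , 1 , (5 , 0) , (3 , 0) , refl) ∷
      (139 , 1 , (4 , 0) , (4 , 0) , refl) ∷
      (151 , 1 , (2 , 0) , (5 , 0) , refl) ∷
      (13 , 2 , (2 , 0) , (2 , 1) , refl) ∷
      (181 , 1 , (3 , 0) , (2 , 0) , refl) ∷
      (211 , 1 , (1 , 0) , (4 , 0) , refl) ∷
      (229 , 1 , (7 , 0) , (6 , 0) , refl) ∷
      (239 , 1 , (7 , 0) , (2 , 0) , refl) ∷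
      (241 , 1 , (3 , 0) , (7 , 0) , refl) ∷
      (281 , 1 , (3 , 0) , (3 , 0) , refl) ∷
      (331 , 1 , (3 , 0) , (5 , 0) , refl) ∷
      (349 , 1 , (4 , 0) , (2 , 0) , refl) ∷
      (379 , 1 , (1 , 0) , (4 , 0) , refl) ∷
      (419 , 1 , (7 , 0) , (3 , 0) , refl) ∷
      (461 , 1 , (8 , 0) , (2 , 0) , refl) ∷
      (571 , 1 , (7 , 0) , (5 , 0) , refl) ∷
      (601 , 1 , (4 , 0) , (7 , 0) , refl) ∷
      (631 , 1 , (1 , 0) , (9 , 0) , refl) ∷
      (701 , 1 , (2 , 0) , (2 , 0) , refl) ∷
      (769 , 1 , (5 , 0) , (11 , 0) , refl) ∷
      (859 , 1 , (4 , 0) , (4 , 0) , refl) ∷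
      (881 , 1 , (4 , 0) , (3 , 0) , refl) ∷
      (911 , 1 , (11 , 0) , (3 , 0) , refl) ∷
      (1301 , 1 , (2 , 0) , (2 , 0) , refl) ∷
      (1429 , 1 , (10 , 0) , (6 , 0) , refl) ∷
      (2311 , 1 , (2 , 0) , (2 , 0) , refl) ∷
      (2729 , 1 , (4 , 0) , (3 , 0) , refl) ∷
      []

  certified⇒lineProperty : ∀ {r} .{{_ : NonZero r}} → 2 ∣ r → Certified (suc r) → (E : QuadExt (suc r)) → LineProperty2 E
  certified⇒lineProperty 2∣r (p , n₀ , tr , c , ok) E = line-from-check 2∣r E p n₀ tr c ok

  1<primePower : ∀ {q} → IsPrimePower q → 1 < q
  1<primePower (p , suc k , pp , _ , refl) = ℕP.<-≤-trans (ℕ.nonTrivial⇒n>1 p {{prime⇒nonTrivial pp}}) (ℕP.m≤m*n p (p ℕ.^ k) {{ℕP.m^n≢0 p k {{ℕ.nonTrivial⇒nonZero p {{prime⇒nonTrivial pp}}}}}})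

  lineProperty : ∀ {q} → IsOddPrimePower q → All (q ≢_) excluded → HasLineProperty2 q
  lineProperty {zero} (pp , _) _ = ⊥-elim (ℕP.n≮0 (1<primePower pp))
  lineProperty {suc r} (pp , odd) ∉excluded = conclude (trichotomy r 0<r 2∣r pp)
    where
    0<r : 0 < r
    0<r = ℕP.≤-pred (1<primePower pp)
    instance r≢0 : NonZero r
             r≢0 = >-nonZero 0<r
    2∣r : 2 ∣ r
    2∣r = divides (suc r ℕ./ 2) (ℕP.suc-injective (trans (m≡m%n+[m/n]*n (suc r) 2) (cong (ℕ._+ suc r ℕ./ 2 ℕ.* 2) odd)))
    conclude : Hit r ⊎ suc r ∈ exceptional ⊎ suc r ∈ excluded → HasLineProperty2 (suc r)
    conclude (inj₁ hit)           = hit⇒lineProperty 2∣r hit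
    conclude (inj₂ (inj₁ member)) = certified⇒lineProperty 2∣r (All.lookup certificates member)
    conclude (inj₂ (inj₂ member)) = ⊥-elim (All.lookup {P = suc r ≢_} ∉excluded member refl)

  lineProperty-beyond : ∀ {q} → IsOddPrimePower q → 41 < q → HasLineProperty2 q
  lineProperty-beyond odd 41<q = lineProperty odd (All.map (λ ≤41 e → ℕP.<⇒≱ 41<q (subst (_≤ 41) (sym e) ≤41)) excluded≤41)
    where
    excluded≤41 : All (_≤ 41) excluded
    excluded≤41 = toWitness {a? = All.all? (ℕP._≤? 41) excluded} tt

  41-oddPrimePower : IsOddPrimePower 41
  41-oddPrimePower = (41 , 1 , toWitness {a? = prime? 41} tt , s≤s z≤n , refl) , refl

open import Data.Nat using (ℕ; _<_; _≤_)
open import Data.Product using (_×_; ∃-syntax)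
open import Relation.Nullary using (¬_)
open import Relation.Binary.PropositionalEquality using (_≢_)
open import Data.Nat.Properties using (≮⇒≥)
open import Data.Product using (_,_)
open import Data.List.Relation.Unary.All using ([]; _∷_)
open Order41 using (¬lineProperty41)
open Main

theorem5 : ((q : ℕ) → IsOddPrimePower q
             → q ≢ 3 → q ≢ 5 → q ≢ 7 → q ≢ 9 → q ≢ 11 → q ≢ 13 → q ≢ 31 → q ≢ 41
             → (E : QuadExt q) → LineProperty2 E)
           × ((∀ q → IsOddPrimePower q → 41 < q → HasLineProperty2 q)
             × (∀ L → (∀ q → IsOddPrimePower q → L < q → HasLineProperty2 q) → 41 ≤ L))
theorem5 = (λ q odd ≢3 ≢5 ≢7 ≢9 ≢11 ≢13 ≢31 ≢41 → lineProperty odd (≢3 ∷ ≢5 ∷ ≢7 ∷ ≢9 ∷ ≢11 ∷ ≢13 ∷ ≢31 ∷ ≢41 ∷ []))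
         , (λ q → lineProperty-beyond)
         , (λ L property → ≮⇒≥ λ L<41 → ¬lineProperty41 (property 41 41-oddPrimePower L<41))
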